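{- There is an absolute constant $C$ such that for every prime $p$ and every multiplicative subgroup $\Gamma\subseteq\mathbb{F}_p^\times$ with $p^{1/2}\leq|\Gamma|\leq p^{2/3}$, $$\mathsf{E}(\Gamma)\leq C\log^{1/4}|\Gamma|\cdot\max\left\{\left(\frac{|\Gamma|^{104}}{p^3}\right)^{1/40},\ \left(\frac{|\Gamma|^{68}}{p^5}\right)^{1/24}\right\}.$$
   Context: $\mathsf{E}(\Gamma)$ is the additive energy: the number of $(x_1,x_2,x_3,x_4)\in\Gamma^4$ with $x_1+x_2=x_3+x_4$ in $\mathbb{F}_p$. Logarithms base $2$. -}

module Defs where

open import Data.Nat using (ℕ; zero; suc; _+_; _*_; _^_; _≤_; _<_; NonZero; _⊔_)
open import Data.Nat.DivMod using (_%_; m%n<n)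
open import Data.Fin using (Fin; toℕ; fromℕ<)
open import Data.Fin.Subset using (Subset; _∈_; _∉_)
open import Data.Fin.Subset.Properties using (_∈?_)
open import Data.Fin.Properties using () renaming (_≟_ to _≟F_)
open import Data.List using (List; allFin; filter; length; concatMap; map)
open import Data.Product using (∃; _×_; _,_)
open import Data.Empty using (⊥)
open import Relation.Binary.PropositionalEquality using (_≡_)

_+ₚ_ : ∀ {p} .{{_ : NonZero p}} → Fin p → Fin p → Fin p
_+ₚ_ {p} x y = fromℕ< (m%n<n (toℕ x + toℕ y) p)

_*ₚ_ : ∀ {p} .{{_ : NonZero p}} → Fin p → Fin p → Fin p
_*ₚ_ {p} x y = fromℕ< (m%n<n (toℕ x * toℕ y) p)

record IsMulSubgroup (p : ℕ) .{{_ : NonZero p}} (Γ : Subset p) : Set where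
  field
    zero∉  : ∀ x → x ∈ Γ → toℕ x ≡ 0 → ⊥
    one∈   : ∃ λ e → e ∈ Γ × toℕ e ≡ 1
    mul∈   : ∀ x y → x ∈ Γ → y ∈ Γ → (x *ₚ y) ∈ Γ
    inv∈   : ∀ x → x ∈ Γ → ∃ λ y → y ∈ Γ × toℕ (x *ₚ y) ≡ 1

elems : ∀ {p} → Subset p → List (Fin p)
elems {p} Γ = filter (_∈? Γ) (allFin p)

card : ∀ {p} → Subset p → ℕ
card Γ = length (elems Γ)

energy : ∀ {p} .{{_ : NonZero p}} → Subset p → ℕ
energy Γ = length (filter (λ q → sumPair (Data.Product.proj₁ q) ≟F sumPair (Data.Product.proj₂ q)) pairsOfPairs)
  where
  pairs = concatMap (λ x → map (λ y → (x , y)) (elems Γ)) (elems Γ)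
  pairsOfPairs = concatMap (λ a → map (λ b → (a , b)) pairs) pairs
  sumPair = λ (q : _ × _) → Data.Product.proj₁ q +ₚ Data.Product.proj₂ q

{-# OPTIONS --safe #-}
-- Write f_λ(c) for the number of (a,b) ∈ Γ² with a - λb = c, E_λ = Σ_c f_λ(c)² and n = |Γ|, so that E = E_1.
-- Stepanov's method bounds the number of pairs (λ,c) with f_λ(c) ≥ ν by O(n⁴/ν³), as long as ν exceeds a multiple of the
-- mean value n²/p, and the number of c for a fixed λ by O(n³/ν³); all quantities are cut into dyadic levels.
-- Let D be the set of c with f_h(c) ≈ τ. Counting triangles in Γ with two sides in D (Cauchy-Schwarz twice) gives
-- (|D|τ)⁴ E² ≪ n⁶ (Σ_c f_1(c)³) Σ_{α,β∈D} f_1(α-β)².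
-- By invariance under Γ the last sum is an incidence sum Σ_{λ,c} w(λ,c) f_λ(c), and Hölder together with the level bounds reduces it
-- to Σ w² = Σ_κ ρ_D(κ)² ρ_Q(κ), where ρ_D(κ) = |D ∩ κ⁻¹D| ≪ E_κ/τ². This yields E_h^14 E^6 ≪ n^37 (n²/p)² (Σ_c f_h(c)³)⁴ for every
-- dilate h. Feeding this bound for large E_κ back into the argument for h = 1, and estimating the part with small E_κ trivially,
-- gives E^910 p^48 ≪ n^2325 (up to logarithms) or a stronger bound. This beats the required exponent by a power of n, so that all
-- logarithmic losses, including the factor log^{1/4}|Γ| of the statement, are absorbed into the constant.
module Submission where

open import Defs
open import Data.Nat using (ℕ; _+_; _*_; _^_; _≤_; _<_; _⊔_; NonZero)
open import Data.Nat.Primality using (Prime)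
open import Data.Fin.Subset using (Subset)
open import Data.Product using (∃)

-- The margin is thinnest at p = n², where E^910 p^48 ≪ n^2325 means E ≪ n^(2229/910) against the
-- required n^(49/20), a gain of n^(1/1820). This is why as large a power as the 20124th of the
-- logarithmic factor Λ has to be absorbed by n. Stepanov's method is silent below the mean level
-- n²/p. When such levels carry the incidence sum, trivial bounds give E³p ≪ n⁹, and it is there
-- that the second term of the maximum is used. The obstacle is that a single E_κ may be as large as
-- E, so Σ_κ ρ_D² ρ_Q admits no good pointwise bound. The moment inequality for dilates helps
-- because, for E_κ above a suitable threshold, it becomes E_κ² ≪ T_κ with T_κ = Σ_c f_κ(c)³ and a
-- factor independent of κ. This relation is linear and can be summed, and Σ_κ T_κ ≪ n⁶/p follows
-- from the level bounds. Everything is carried out with integer powers in ℕ: each estimate is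
-- raised to a power that makes all exponents integral, and positive monomials are cancelled.

-- Arithmetic modulo a prime as a field.

module PrimeFields where

  open import Defs
  open import Data.Nat as ℕ using (ℕ; suc; _∸_; _<_; z≤n; s≤s; NonZero)
  import Data.Nat.Properties as ℕₚ
  open import Data.Nat.DivMod using (_%_; m%n<n; %-distribˡ-+; %-distribˡ-*; m<n⇒m%n≡m; n%n≡0; [m+kn]%n≡m%n)
  open import Data.Nat.Primality using (Prime; prime⇒nonTrivial)
  open import Data.Nat.Coprimality using (coprime-Bézout; prime⇒coprime)
  open import Data.Nat.GCD using (module Bézout)
  open import Data.Fin using (Fin; toℕ; fromℕ<)
  open import Data.Fin.Properties using (toℕ-fromℕ<; toℕ-injective; toℕ<n)
  open import Data.Product using (∃; _,_; proj₁; proj₂)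
  open import Data.Empty using (⊥-elim)
  open import Relation.Nullary using (yes; no)
  open import Relation.Binary.PropositionalEquality
  open import Algebra.Structures using (IsCommutativeRing)

  -- The interface through which all later arguments see 𝔽ₚ. The characteristic enters through
  -- `ι-nonzero`: factors `ι j` with 0 < j < p that come from differentiation can be cancelled. The
  -- convention `inv-zero` makes `inv` an involution of the whole field, so sums can be reindexed by
  -- it without excluding 0.
  record PrimeField (p : ℕ) : Set where
    infixl 6 _⊞_
    infixl 7 _⊠_
    field
      _⊞_ _⊠_ : Fin p → Fin p → Fin p
      ⊟_ inv : Fin p → Fin p
      0# 1# : Fin p
      isCommutativeRing : IsCommutativeRing _≡_ _⊞_ _⊠_ ⊟_ 0# 1#
      1≢0 : 1# ≢ 0#
      ⊠-inverse : ∀ {x} → x ≢ 0# → x ⊠ inv x ≡ 1#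
      inv-zero : inv 0# ≡ 0#
      ι : ℕ → Fin p
      ι-zero : ι 0 ≡ 0#
      ι-suc : ∀ k → ι (suc k) ≡ 1# ⊞ ι k
      ι-nonzero : ∀ {k} → 0 < k → k < p → ι k ≢ 0#

  module IntegersMod (p : ℕ) .{{nz : NonZero p}} (prime : Prime p) where

    private
      F = Fin p

    ι : ℕ → F
    ι k = fromℕ< (m%n<n k p)

    toℕ-ι : ∀ k → toℕ (ι k) ≡ k % p
    toℕ-ι k = toℕ-fromℕ< (m%n<n k p)

    ι-cong : ∀ {a b} → a % p ≡ b % p → ι a ≡ ι b
    ι-cong {a} {b} e = toℕ-injective (trans (toℕ-ι a) (trans e (sym (toℕ-ι b))))

    ι-toℕ : ∀ x → ι (toℕ x) ≡ x
    ι-toℕ x = toℕ-injective (trans (toℕ-ι (toℕ x)) (m<n⇒m%n≡m (toℕ<n x)))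

    ι-+ : ∀ a b → ι a +ₚ ι b ≡ ι (a ℕ.+ b)
    ι-+ a b = ι-cong (trans (cong₂ (λ u v → (u ℕ.+ v) % p) (toℕ-ι a) (toℕ-ι b)) (sym (%-distribˡ-+ a b p)))

    ι-* : ∀ a b → ι a *ₚ ι b ≡ ι (a ℕ.* b)
    ι-* a b = ι-cong (trans (cong₂ (λ u v → (u ℕ.* v) % p) (toℕ-ι a) (toℕ-ι b)) (sym (%-distribˡ-* a b p)))

    private
      -- Reduces the ring laws to those of ℕ: every residue is some `ι k`, and `ι` respects both
      -- operations.
      via : ∀ {P : F → Set} → (∀ k → P (ι k)) → ∀ x → P x
      via {P} h x = subst P (ι-toℕ x) (h (toℕ x))

    neg : F → F
    neg x = ι (p ∸ toℕ x)

    +-assoc : ∀ x y z → (x +ₚ y) +ₚ z ≡ x +ₚ (y +ₚ z)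
    +-assoc = via λ a → via λ b → via λ c → begin
      (ι a +ₚ ι b) +ₚ ι c ≡⟨ cong (_+ₚ ι c) (ι-+ a b) ⟩
      ι (a ℕ.+ b) +ₚ ι c  ≡⟨ ι-+ (a ℕ.+ b) c ⟩
      ι (a ℕ.+ b ℕ.+ c)   ≡⟨ cong ι (ℕₚ.+-assoc a b c) ⟩
      ι (a ℕ.+ (b ℕ.+ c)) ≡⟨ ι-+ a (b ℕ.+ c) ⟨
      ι a +ₚ ι (b ℕ.+ c)  ≡⟨ cong (ι a +ₚ_) (ι-+ b c) ⟨
      ι a +ₚ (ι b +ₚ ι c) ∎
      where open ≡-Reasoning

    *-assoc : ∀ x y z → (x *ₚ y) *ₚ z ≡ x *ₚ (y *ₚ z)
    *-assoc = via λ a → via λ b → via λ c → begin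
      (ι a *ₚ ι b) *ₚ ι c ≡⟨ cong (_*ₚ ι c) (ι-* a b) ⟩
      ι (a ℕ.* b) *ₚ ι c  ≡⟨ ι-* (a ℕ.* b) c ⟩
      ι (a ℕ.* b ℕ.* c)   ≡⟨ cong ι (ℕₚ.*-assoc a b c) ⟩
      ι (a ℕ.* (b ℕ.* c)) ≡⟨ ι-* a (b ℕ.* c) ⟨
      ι a *ₚ ι (b ℕ.* c)  ≡⟨ cong (ι a *ₚ_) (ι-* b c) ⟨
      ι a *ₚ (ι b *ₚ ι c) ∎
      where open ≡-Reasoning

    +-comm : ∀ x y → x +ₚ y ≡ y +ₚ x
    +-comm x y = cong ι (ℕₚ.+-comm (toℕ x) (toℕ y))

    *-comm : ∀ x y → x *ₚ y ≡ y *ₚ x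
    *-comm x y = cong ι (ℕₚ.*-comm (toℕ x) (toℕ y))

    *-distribˡ-+ : ∀ x y z → x *ₚ (y +ₚ z) ≡ (x *ₚ y) +ₚ (x *ₚ z)
    *-distribˡ-+ = via λ a → via λ b → via λ c → begin
      ι a *ₚ (ι b +ₚ ι c) ≡⟨ cong (ι a *ₚ_) (ι-+ b c) ⟩
      ι a *ₚ ι (b ℕ.+ c)  ≡⟨ ι-* a (b ℕ.+ c) ⟩
      ι (a ℕ.* (b ℕ.+ c)) ≡⟨ cong ι (ℕₚ.*-distribˡ-+ a b c) ⟩
      ι (a ℕ.* b ℕ.+ a ℕ.* c) ≡⟨ ι-+ (a ℕ.* b) (a ℕ.* c) ⟨
      ι (a ℕ.* b) +ₚ ι (a ℕ.* c) ≡⟨ cong₂ _+ₚ_ (ι-* a b) (ι-* a c) ⟨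
      (ι a *ₚ ι b) +ₚ (ι a *ₚ ι c) ∎
      where open ≡-Reasoning

    +-identityˡ : ∀ x → ι 0 +ₚ x ≡ x
    +-identityˡ = via λ a → ι-+ 0 a

    +-identityʳ : ∀ x → x +ₚ ι 0 ≡ x
    +-identityʳ x = trans (+-comm x (ι 0)) (+-identityˡ x)

    *-identityˡ : ∀ x → ι 1 *ₚ x ≡ x
    *-identityˡ = via λ a → trans (ι-* 1 a) (cong ι (ℕₚ.*-identityˡ a))

    ι-p : ι p ≡ ι 0
    ι-p = ι-cong (trans (n%n≡0 p) (sym (m<n⇒m%n≡m (ℕ.>-nonZero⁻¹ p))))

    -‿inverseʳ : ∀ x → x +ₚ neg x ≡ ι 0
    -‿inverseʳ x = begin
      x +ₚ ι (p ∸ toℕ x) ≡⟨ cong (_+ₚ neg x) (ι-toℕ x) ⟨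
      ι (toℕ x) +ₚ ι (p ∸ toℕ x) ≡⟨ ι-+ (toℕ x) (p ∸ toℕ x) ⟩
      ι (toℕ x ℕ.+ (p ∸ toℕ x)) ≡⟨ cong ι (ℕₚ.m+[n∸m]≡n (ℕₚ.<⇒≤ (toℕ<n x))) ⟩
      ι p ≡⟨ ι-p ⟩
      ι 0 ∎
      where open ≡-Reasoning

    -‿inverseˡ : ∀ x → neg x +ₚ x ≡ ι 0
    -‿inverseˡ x = trans (+-comm (neg x) x) (-‿inverseʳ x)

    1<p : 1 < p
    1<p = ℕ.nonTrivial⇒n>1 p {{prime⇒nonTrivial prime}}

    ι-nonzero : ∀ {k} → 0 < k → k < p → ι k ≢ ι 0
    ι-nonzero {k} 0<k k<p e = ℕₚ.<⇒≢ 0<k (sym (begin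
      k         ≡⟨ m<n⇒m%n≡m k<p ⟨
      k % p     ≡⟨ toℕ-ι k ⟨
      toℕ (ι k) ≡⟨ cong toℕ e ⟩
      toℕ (ι 0) ≡⟨ toℕ-ι 0 ⟩
      0 % p     ≡⟨ m<n⇒m%n≡m (ℕₚ.<-trans (s≤s z≤n) 1<p) ⟩
      0         ∎))
      where open ≡-Reasoning

    ι-multiple : ∀ k → ι (k ℕ.* p) ≡ ι 0
    ι-multiple k = ι-cong ([m+kn]%n≡m%n 0 k p)

    private
      -- Bézout for p and x gives either 1 + vx = up, where -v is the inverse, or 1 + up = vx, where
      -- v is.
      invertible : ∀ x → x ≢ ι 0 → ∃ λ y → x *ₚ y ≡ ι 1
      invertible x x≢0 with coprime-Bézout (prime⇒coprime prime {{ℕ.≢-nonZero x≢0ℕ}} (toℕ<n x))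
        where
        x≢0ℕ : toℕ x ≢ 0
        x≢0ℕ e = x≢0 (trans (sym (ι-toℕ x)) (cong ι e))
      ... | Bézout.+- u v eq = neg (ι v) , sum-zero
        where
        open ≡-Reasoning
        xv : (x *ₚ ι v) +ₚ ι 1 ≡ ι 0
        xv = begin
          (x *ₚ ι v) +ₚ ι 1 ≡⟨ cong (λ w → (w *ₚ ι v) +ₚ ι 1) (ι-toℕ x) ⟨
          (ι (toℕ x) *ₚ ι v) +ₚ ι 1 ≡⟨ cong (_+ₚ ι 1) (ι-* (toℕ x) v) ⟩
          ι (toℕ x ℕ.* v) +ₚ ι 1 ≡⟨ ι-+ (toℕ x ℕ.* v) 1 ⟩
          ι (toℕ x ℕ.* v ℕ.+ 1) ≡⟨ cong ι (trans (ℕₚ.+-comm _ 1) (cong suc (ℕₚ.*-comm (toℕ x) v))) ⟩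
          ι (1 ℕ.+ v ℕ.* toℕ x) ≡⟨ cong ι eq ⟩
          ι (u ℕ.* p) ≡⟨ ι-multiple u ⟩
          ι 0 ∎
        sum-zero : x *ₚ neg (ι v) ≡ ι 1
        sum-zero = begin
          x *ₚ neg (ι v) ≡⟨ +-identityʳ (x *ₚ neg (ι v)) ⟨
          (x *ₚ neg (ι v)) +ₚ ι 0 ≡⟨ cong ((x *ₚ neg (ι v)) +ₚ_) xv ⟨
          (x *ₚ neg (ι v)) +ₚ ((x *ₚ ι v) +ₚ ι 1) ≡⟨ +-assoc _ _ _ ⟨
          ((x *ₚ neg (ι v)) +ₚ (x *ₚ ι v)) +ₚ ι 1 ≡⟨ cong (_+ₚ ι 1) (*-distribˡ-+ x (neg (ι v)) (ι v)) ⟨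
          (x *ₚ (neg (ι v) +ₚ ι v)) +ₚ ι 1 ≡⟨ cong (λ w → (x *ₚ w) +ₚ ι 1) (-‿inverseˡ (ι v)) ⟩
          (x *ₚ ι 0) +ₚ ι 1 ≡⟨ cong (λ w → (w *ₚ ι 0) +ₚ ι 1) (ι-toℕ x) ⟨
          (ι (toℕ x) *ₚ ι 0) +ₚ ι 1 ≡⟨ cong (_+ₚ ι 1) (trans (ι-* (toℕ x) 0) (cong ι (ℕₚ.*-zeroʳ (toℕ x)))) ⟩
          ι 0 +ₚ ι 1 ≡⟨ +-identityˡ _ ⟩
          ι 1 ∎
      ... | Bézout.-+ u v eq = ι v , (begin
          x *ₚ ι v ≡⟨ cong (_*ₚ ι v) (ι-toℕ x) ⟨
          ι (toℕ x) *ₚ ι v ≡⟨ ι-* (toℕ x) v ⟩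
          ι (toℕ x ℕ.* v) ≡⟨ cong ι (trans (ℕₚ.*-comm (toℕ x) v) (sym eq)) ⟩
          ι (1 ℕ.+ u ℕ.* p) ≡⟨ ι-+ 1 (u ℕ.* p) ⟨
          ι 1 +ₚ ι (u ℕ.* p) ≡⟨ cong (ι 1 +ₚ_) (ι-multiple u) ⟩
          ι 1 +ₚ ι 0 ≡⟨ ι-+ 1 0 ⟩
          ι 1 ∎)
        where open ≡-Reasoning

      inverse : F → F
      inverse x with x Data.Fin.≟ ι 0
      ... | yes _ = ι 0
      ... | no x≢0 = proj₁ (invertible x x≢0)

      *-inverse : ∀ {x} → x ≢ ι 0 → x *ₚ inverse x ≡ ι 1
      *-inverse {x} x≢0 with x Data.Fin.≟ ι 0
      ... | yes e = ⊥-elim (x≢0 e)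
      ... | no x≢0′ = proj₂ (invertible x x≢0′)

      inverse-zero : inverse (ι 0) ≡ ι 0
      inverse-zero with ι 0 Data.Fin.≟ ι 0
      ... | yes _ = refl
      ... | no ne = ⊥-elim (ne refl)

    field-mod-p : PrimeField p
    field-mod-p = record
      { _⊞_ = _+ₚ_
      ; _⊠_ = _*ₚ_
      ; ⊟_ = neg
      ; inv = inverse
      ; 0# = ι 0
      ; 1# = ι 1
      ; isCommutativeRing = record
        { isRing = record
          { +-isAbelianGroup = record
            { isGroup = record
              { isMonoid = record
                { isSemigroup = record
                  { isMagma = record { isEquivalence = isEquivalence ; ∙-cong = cong₂ _+ₚ_ }
                  ; assoc = +-assoc }
                ; identity = +-identityˡ , +-identityʳ }
              ; inverse = -‿inverseˡ , -‿inverseʳ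
              ; ⁻¹-cong = cong neg }
            ; comm = +-comm }
          ; *-cong = cong₂ _*ₚ_
          ; *-assoc = *-assoc
          ; *-identity = *-identityˡ , λ x → trans (*-comm x _) (*-identityˡ x)
          ; distrib = *-distribˡ-+ , λ x y z → trans (*-comm (y +ₚ z) x) (trans (*-distribˡ-+ x y z) (cong₂ _+ₚ_ (*-comm x y) (*-comm x z))) }
        ; *-comm = *-comm }
      ; 1≢0 = ι-nonzero (s≤s z≤n) 1<p
      ; ⊠-inverse = *-inverse
      ; inv-zero = inverse-zero
      ; ι = ι
      ; ι-zero = refl
      ; ι-suc = λ k → sym (ι-+ 1 k)
      ; ι-nonzero = ι-nonzero
      }

-- Consequences of the field axioms.

module FieldArithmetic where

  open import Data.Nat as ℕ using (ℕ; zero; suc; _∸_; _<_)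
  import Data.Nat.Properties as ℕₚ
  open import Data.Fin using (Fin)
  open import Relation.Binary using (tri<; tri≈; tri>)
  open import Relation.Binary.PropositionalEquality
  open import Algebra.Bundles using (CommutativeRing)
  open PrimeFields

  module FieldLemmas {p : ℕ} (𝔽 : PrimeField p) where
    open PrimeField 𝔽 public

    F : Set
    F = Fin p

    ring : CommutativeRing _ _
    ring = record { isCommutativeRing = isCommutativeRing }

    open CommutativeRing ring public
      using (+-assoc; +-comm; +-identityˡ; +-identityʳ; *-assoc; *-comm; *-identityˡ; *-identityʳ; zeroˡ; zeroʳ; distribˡ; distribʳ; -‿inverseˡ; -‿inverseʳ; commutativeSemiring)
    module Solver where
      open import Algebra.Solver.Ring.NaturalCoefficients.Default commutativeSemiring public
    open Solver using (solve; _:+_; _:*_; _:=_; con) public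

    -- Differences are written `x ⊞ -1# ⊠ y` throughout: the semiring solver then treats `-1#` as
    -- one more variable, and the cancellations it cannot see are supplied by `x+-1x`.
    -1# : F
    -1# = ⊟ 1#

    1+-1 : 1# ⊞ -1# ≡ 0#
    1+-1 = -‿inverseʳ 1#

    x+-1x : ∀ x → x ⊞ -1# ⊠ x ≡ 0#
    x+-1x x = begin
      x ⊞ -1# ⊠ x        ≡⟨ cong (_⊞ -1# ⊠ x) (*-identityˡ x) ⟨
      1# ⊠ x ⊞ -1# ⊠ x   ≡⟨ distribʳ x 1# -1# ⟨
      (1# ⊞ -1#) ⊠ x     ≡⟨ cong (_⊠ x) 1+-1 ⟩
      0# ⊠ x             ≡⟨ zeroˡ x ⟩
      0#                 ∎
      where open ≡-Reasoning

    cancelʳ : ∀ a b → (a ⊞ b) ⊞ -1# ⊠ a ≡ b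
    cancelʳ a b = begin
      (a ⊞ b) ⊞ -1# ⊠ a ≡⟨ solve 3 (λ a b m → (a :+ b) :+ m :* a := (a :+ m :* a) :+ b) refl a b -1# ⟩
      (a ⊞ -1# ⊠ a) ⊞ b ≡⟨ cong (_⊞ b) (x+-1x a) ⟩
      0# ⊞ b            ≡⟨ +-identityˡ b ⟩
      b                 ∎
      where open ≡-Reasoning

    x-y≡0⇒x≡y : ∀ {x y} → x ⊞ -1# ⊠ y ≡ 0# → x ≡ y
    x-y≡0⇒x≡y {x} {y} e = begin
      x ≡⟨ +-identityʳ x ⟨
      x ⊞ 0# ≡⟨ cong (x ⊞_) (x+-1x y) ⟨
      x ⊞ (y ⊞ -1# ⊠ y) ≡⟨ solve 3 (λ x y m → x :+ (y :+ m :* y) := (x :+ m :* y) :+ y) refl x y -1# ⟩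
      (x ⊞ -1# ⊠ y) ⊞ y ≡⟨ cong (_⊞ y) e ⟩
      0# ⊞ y ≡⟨ +-identityˡ y ⟩
      y ∎
      where open ≡-Reasoning

    -1*-1 : -1# ⊠ -1# ≡ 1#
    -1*-1 = begin
      -1# ⊠ -1#                 ≡⟨ +-identityˡ _ ⟨
      0# ⊞ -1# ⊠ -1#            ≡⟨ cong (_⊞ -1# ⊠ -1#) 1+-1 ⟨
      (1# ⊞ -1#) ⊞ -1# ⊠ -1#    ≡⟨ +-assoc _ _ _ ⟩
      1# ⊞ (-1# ⊞ -1# ⊠ -1#)    ≡⟨ cong (1# ⊞_) (x+-1x -1#) ⟩
      1# ⊞ 0#                   ≡⟨ +-identityʳ 1# ⟩
      1#                        ∎
      where open ≡-Reasoning

    ⊠≡0 : ∀ {x y} → x ≢ 0# → x ⊠ y ≡ 0# → y ≡ 0#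
    ⊠≡0 {x} {y} x≢0 e = begin
      y ≡⟨ *-identityˡ y ⟨
      1# ⊠ y ≡⟨ cong (_⊠ y) (⊠-inverse x≢0) ⟨
      (x ⊠ inv x) ⊠ y ≡⟨ solve 3 (λ x i y → (x :* i) :* y := i :* (x :* y)) refl x (inv x) y ⟩
      inv x ⊠ (x ⊠ y) ≡⟨ cong (inv x ⊠_) e ⟩
      inv x ⊠ 0# ≡⟨ zeroʳ (inv x) ⟩
      0# ∎
      where open ≡-Reasoning

    ⊠≢0 : ∀ {x y} → x ≢ 0# → y ≢ 0# → x ⊠ y ≢ 0#
    ⊠≢0 x≢0 y≢0 e = y≢0 (⊠≡0 x≢0 e)

    inv≢0 : ∀ {x} → x ≢ 0# → inv x ≢ 0#
    inv≢0 {x} x≢0 e = 1≢0 (trans (sym (⊠-inverse x≢0)) (trans (cong (x ⊠_) e) (zeroʳ x)))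

    ⊠-cancelˡ : ∀ {a x y} → a ≢ 0# → a ⊠ x ≡ a ⊠ y → x ≡ y
    ⊠-cancelˡ {a} {x} {y} a≢0 e = x-y≡0⇒x≡y (⊠≡0 a≢0 (begin
      a ⊠ (x ⊞ -1# ⊠ y) ≡⟨ solve 4 (λ a x y m → a :* (x :+ m :* y) := a :* x :+ m :* (a :* y)) refl a x y -1# ⟩
      a ⊠ x ⊞ -1# ⊠ (a ⊠ y) ≡⟨ cong (_⊞ -1# ⊠ (a ⊠ y)) e ⟩
      a ⊠ y ⊞ -1# ⊠ (a ⊠ y) ≡⟨ x+-1x _ ⟩
      0# ∎))
      where open ≡-Reasoning

    ι-+ : ∀ a b → ι (a ℕ.+ b) ≡ ι a ⊞ ι b
    ι-+ zero b = sym (trans (cong (_⊞ ι b) ι-zero) (+-identityˡ (ι b)))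
    ι-+ (suc a) b = begin
      ι (suc (a ℕ.+ b)) ≡⟨ ι-suc _ ⟩
      1# ⊞ ι (a ℕ.+ b) ≡⟨ cong (1# ⊞_) (ι-+ a b) ⟩
      1# ⊞ (ι a ⊞ ι b) ≡⟨ +-assoc 1# (ι a) (ι b) ⟨
      (1# ⊞ ι a) ⊞ ι b ≡⟨ cong (_⊞ ι b) (ι-suc a) ⟨
      ι (suc a) ⊞ ι b ∎
      where open ≡-Reasoning

    -- The difference of the two numbers lies strictly between 0 and p. This separates the exponents
    -- of a polynomial of degree below p under x d/dx, as `sparse` requires.
    ι-injective : ∀ {a b} → a < p → b < p → a ≢ b → ι a ⊞ -1# ⊠ ι b ≢ 0#
    ι-injective {a} {b} a<p b<p a≢b e with ℕₚ.<-cmp a b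
    ... | tri≈ _ a≡b _ = a≢b a≡b
    ... | tri< a<b _ _ = ι-nonzero (ℕₚ.m<n⇒0<n∸m a<b) (ℕₚ.≤-<-trans (ℕₚ.m∸n≤m b a) b<p) (begin
        ι (b ∸ a) ≡⟨ cancelʳ (ι a) (ι (b ∸ a)) ⟨
        (ι a ⊞ ι (b ∸ a)) ⊞ -1# ⊠ ι a ≡⟨ cong (_⊞ -1# ⊠ ι a) (trans (sym (ι-+ a (b ∸ a))) (cong ι (ℕₚ.m+[n∸m]≡n (ℕₚ.<⇒≤ a<b)))) ⟩
        ι b ⊞ -1# ⊠ ι a ≡⟨ cong (λ w → ι b ⊞ -1# ⊠ w) (x-y≡0⇒x≡y e) ⟩
        ι b ⊞ -1# ⊠ ι b ≡⟨ x+-1x (ι b) ⟩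
        0# ∎)
      where open ≡-Reasoning
    ... | tri> _ _ b<a = ι-nonzero (ℕₚ.m<n⇒0<n∸m b<a) (ℕₚ.≤-<-trans (ℕₚ.m∸n≤m a b) a<p) (begin
        ι (a ∸ b) ≡⟨ cancelʳ (ι b) (ι (a ∸ b)) ⟨
        (ι b ⊞ ι (a ∸ b)) ⊞ -1# ⊠ ι b ≡⟨ cong (_⊞ -1# ⊠ ι b) (trans (sym (ι-+ b (a ∸ b))) (cong ι (ℕₚ.m+[n∸m]≡n (ℕₚ.<⇒≤ b<a)))) ⟩
        ι a ⊞ -1# ⊠ ι b ≡⟨ e ⟩
        0# ∎)
      where open ≡-Reasoning

    infixr 8 _↑_
    _↑_ : F → ℕ → F
    x ↑ zero = 1#
    x ↑ suc k = x ⊠ x ↑ k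

    ↑-+ : ∀ x a b → x ↑ (a ℕ.+ b) ≡ x ↑ a ⊠ x ↑ b
    ↑-+ x zero b = sym (*-identityˡ _)
    ↑-+ x (suc a) b = trans (cong (x ⊠_) (↑-+ x a b)) (sym (*-assoc x (x ↑ a) (x ↑ b)))

    ↑-* : ∀ x a b → x ↑ (a ℕ.* b) ≡ (x ↑ a) ↑ b
    ↑-* x a zero = cong (x ↑_) (ℕₚ.*-zeroʳ a)
    ↑-* x a (suc b) = begin
      x ↑ (a ℕ.* suc b) ≡⟨ cong (x ↑_) (ℕₚ.*-suc a b) ⟩
      x ↑ (a ℕ.+ a ℕ.* b) ≡⟨ ↑-+ x a (a ℕ.* b) ⟩
      x ↑ a ⊠ x ↑ (a ℕ.* b) ≡⟨ cong (x ↑ a ⊠_) (↑-* x a b) ⟩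
      x ↑ a ⊠ (x ↑ a) ↑ b ∎
      where open ≡-Reasoning

    ⊠-↑ : ∀ x y k → (x ⊠ y) ↑ k ≡ x ↑ k ⊠ y ↑ k
    ⊠-↑ x y zero = sym (*-identityˡ 1#)
    ⊠-↑ x y (suc k) = trans (cong (x ⊠ y ⊠_) (⊠-↑ x y k))
      (solve 4 (λ x y a b → (x :* y) :* (a :* b) := (x :* a) :* (y :* b)) refl x y (x ↑ k) (y ↑ k))

    1↑ : ∀ k → 1# ↑ k ≡ 1#
    1↑ zero = refl
    1↑ (suc k) = trans (*-identityˡ _) (1↑ k)

    ↑≢0 : ∀ {x} → x ≢ 0# → ∀ k → x ↑ k ≢ 0#
    ↑≢0 x≢0 zero = 1≢0
    ↑≢0 x≢0 (suc k) = ⊠≢0 x≢0 (↑≢0 x≢0 k)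

-- Polynomials, with multiplicities measured by derivations.

module PolynomialVanishing where

  open import Data.Nat as ℕ using (ℕ; zero; suc; _≤_; _<_; z≤n; s≤s)
  import Data.Nat.Properties as ℕₚ
  open import Data.Product using (∃; _×_; _,_; proj₂)
  open import Data.Unit using (⊤; tt)
  open import Relation.Binary.PropositionalEquality
  open PrimeFields
  open FieldArithmetic

  module Polynomials {p : ℕ} (𝔽 : PrimeField p) where
    open FieldLemmas 𝔽

    Ser : Set
    Ser = ℕ → F

    -- The bound on the support is not the exact degree, which spares a zero test for leading
    -- coefficients; sharper degrees are tracked separately by `Deg≤`.
    record Pol : Set where
      no-eta-equality
      constructor pol
      field
        at : Ser
        bound : ℕ
        vanish : ∀ k → bound ≤ k → at k ≡ 0#
    open Pol public

    infix 4 _≋_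
    record _≋_ (P Q : Pol) : Set where
      constructor ⟪_⟫
      field at-≡ : ∀ k → at P k ≡ at Q k
    open _≋_ public

    ≋-refl : ∀ {P} → P ≋ P
    ≋-refl = ⟪ (λ _ → refl) ⟫

    ≋-sym : ∀ {P Q} → P ≋ Q → Q ≋ P
    ≋-sym e = ⟪ (λ k → sym (at-≡ e k)) ⟫

    ≋-trans : ∀ {P Q R} → P ≋ Q → Q ≋ R → P ≋ R
    ≋-trans e e′ = ⟪ (λ k → trans (at-≡ e k) (at-≡ e′ k)) ⟫

    -- The degree is strictly below d, so that d counts coefficients and d = 0 characterises the
    -- zero polynomial.
    record Deg≤ (d : ℕ) (P : Pol) : Set where
      constructor deg≤
      field above : ∀ k → d ≤ k → at P k ≡ 0#
    open Deg≤ public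

    Deg≤-bound : ∀ P → Deg≤ (bound P) P
    Deg≤-bound P = deg≤ (vanish P)

    𝟘 : Pol
    𝟘 = pol (λ _ → 0#) 0 (λ _ _ → refl)

    infixl 6 _⊕_
    infixr 7 _·_
    _⊕_ : Pol → Pol → Pol
    at (P ⊕ Q) k = at P k ⊞ at Q k
    bound (P ⊕ Q) = bound P ℕ.+ bound Q
    vanish (P ⊕ Q) k le = begin
      at P k ⊞ at Q k ≡⟨ cong₂ _⊞_ (vanish P k (ℕₚ.≤-trans (ℕₚ.m≤m+n _ _) le)) (vanish Q k (ℕₚ.≤-trans (ℕₚ.m≤n+m _ _) le)) ⟩
      0# ⊞ 0# ≡⟨ +-identityˡ 0# ⟩
      0# ∎
      where open ≡-Reasoning

    _·_ : F → Pol → Pol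
    at (c · P) k = c ⊠ at P k
    bound (c · P) = bound P
    vanish (c · P) k le = trans (cong (c ⊠_) (vanish P k le)) (zeroʳ c)

    shift : Ser → Ser
    shift f zero = 0#
    shift f (suc k) = f k

    X : Pol → Pol
    at (X P) k = shift (at P) k
    bound (X P) = suc (bound P)
    vanish (X P) (suc k) (s≤s le) = vanish P k le

    -- Multiplication by x + w. A root z is divided out in the form `V (-1# ⊠ z)`.
    V : F → Pol → Pol
    V w P = X P ⊕ w · P

    -- The Euler derivation x d/dx, which is diagonal on monomials.
    δ : Pol → Pol
    at (δ P) k = ι k ⊠ at P k
    bound (δ P) = bound P
    vanish (δ P) k le = trans (cong (ι k ⊠_) (vanish P k le)) (zeroʳ _)

    U : Pol → Pol
    U = V -1#

    -- The derivation x(x-1)d/dx; unlike d/dx it maps x^i (x-1)^j g to a polynomial multiple of x^i (x-1)^j.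
    θ : Pol → Pol
    θ P = U (δ P)

    ⊕-cong : ∀ {P P′ Q Q′} → P ≋ P′ → Q ≋ Q′ → P ⊕ Q ≋ P′ ⊕ Q′
    ⊕-cong e e′ = ⟪ (λ k → cong₂ _⊞_ (at-≡ e k) (at-≡ e′ k)) ⟫

    ·-cong : ∀ c {P P′} → P ≋ P′ → c · P ≋ c · P′
    ·-cong c e = ⟪ (λ k → cong (c ⊠_) (at-≡ e k)) ⟫

    X-cong : ∀ {P P′} → P ≋ P′ → X P ≋ X P′
    X-cong e = ⟪ (λ { zero → refl ; (suc k) → at-≡ e k }) ⟫

    V-cong : ∀ w {P P′} → P ≋ P′ → V w P ≋ V w P′
    V-cong w e = ⊕-cong (X-cong e) (·-cong w e)

    δ-cong : ∀ {P P′} → P ≋ P′ → δ P ≋ δ P′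
    δ-cong e = ⟪ (λ k → cong (ι k ⊠_) (at-≡ e k)) ⟫

    θ-cong : ∀ {P P′} → P ≋ P′ → θ P ≋ θ P′
    θ-cong e = V-cong -1# (δ-cong e)

    X-⊕ : ∀ P Q → X (P ⊕ Q) ≋ X P ⊕ X Q
    X-⊕ P Q = ⟪ (λ { zero → sym (+-identityˡ 0#) ; (suc k) → refl }) ⟫

    X-· : ∀ c P → X (c · P) ≋ c · X P
    X-· c P = ⟪ (λ { zero → sym (zeroʳ c) ; (suc k) → refl }) ⟫

    V-⊕ : ∀ w P Q → V w (P ⊕ Q) ≋ V w P ⊕ V w Q
    V-⊕ w P Q = ⟪ (λ k → trans (cong (_⊞ w ⊠ (at P k ⊞ at Q k)) (at-≡ (X-⊕ P Q) k))
      (solve 5 (λ w a b c d → (a :+ b) :+ w :* (c :+ d) := (a :+ w :* c) :+ (b :+ w :* d)) refl w (shift (at P) k) (shift (at Q) k) (at P k) (at Q k))) ⟫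

    V-· : ∀ w c P → V w (c · P) ≋ c · V w P
    V-· w c P = ⟪ (λ k → trans (cong (_⊞ w ⊠ (c ⊠ at P k)) (at-≡ (X-· c P) k))
      (solve 4 (λ w c a b → (c :* a) :+ w :* (c :* b) := c :* (a :+ w :* b)) refl w c (shift (at P) k) (at P k))) ⟫

    δ-⊕ : ∀ P Q → δ (P ⊕ Q) ≋ δ P ⊕ δ Q
    δ-⊕ P Q = ⟪ (λ k → distribˡ (ι k) (at P k) (at Q k)) ⟫

    δ-· : ∀ c P → δ (c · P) ≋ c · δ P
    δ-· c P = ⟪ (λ k → solve 3 (λ i c a → i :* (c :* a) := c :* (i :* a)) refl (ι k) c (at P k)) ⟫

    θ-⊕ : ∀ P Q → θ (P ⊕ Q) ≋ θ P ⊕ θ Q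
    θ-⊕ P Q = ≋-trans (V-cong -1# (δ-⊕ P Q)) (V-⊕ -1# (δ P) (δ Q))

    θ-· : ∀ c P → θ (c · P) ≋ c · θ P
    θ-· c P = ≋-trans (V-cong -1# (δ-· c P)) (V-· -1# c (δ P))

    X-V : ∀ w P → X (V w P) ≋ V w (X P)
    X-V w P = ≋-trans (X-⊕ (X P) (w · P)) (⊕-cong ≋-refl (X-· w P))

    V-V : ∀ w v P → V w (V v P) ≋ V v (V w P)
    V-V w v P = ⟪ (λ k → begin
      shift (at (V v P)) k ⊞ w ⊠ at (V v P) k ≡⟨ cong (_⊞ w ⊠ at (V v P) k) (at-≡ (X-V v P) k) ⟩
      (shift (shift (at P)) k ⊞ v ⊠ shift (at P) k) ⊞ w ⊠ (shift (at P) k ⊞ v ⊠ at P k)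
        ≡⟨ solve 5 (λ w v a b c → (a :+ v :* b) :+ w :* (b :+ v :* c) := (a :+ w :* b) :+ v :* (b :+ w :* c)) refl w v (shift (shift (at P)) k) (shift (at P) k) (at P k) ⟩
      (shift (shift (at P)) k ⊞ w ⊠ shift (at P) k) ⊞ v ⊠ (shift (at P) k ⊞ w ⊠ at P k) ≡⟨ cong (_⊞ v ⊠ at (V w P) k) (at-≡ (X-V w P) k) ⟨
      shift (at (V w P)) k ⊞ v ⊠ at (V w P) k ∎) ⟫
      where open ≡-Reasoning

    δ-X : ∀ P → δ (X P) ≋ X P ⊕ X (δ P)
    δ-X P = ⟪ (λ { zero → trans (zeroʳ _) (sym (+-identityˡ 0#))
                ; (suc k) → trans (cong (_⊠ at P k) (ι-suc k)) (trans (distribʳ (at P k) 1# (ι k)) (cong (_⊞ ι k ⊠ at P k) (*-identityˡ _))) }) ⟫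

    δ-V : ∀ w P → δ (V w P) ≋ X P ⊕ V w (δ P)
    δ-V w P = ≋-trans (δ-⊕ (X P) (w · P)) (≋-trans (⊕-cong (δ-X P) (δ-· w P))
      ⟪ (λ k → +-assoc _ _ _) ⟫)

    -- Leibniz rule, with θ(x + w) = x(x - 1).
    θ-V : ∀ w P → θ (V w P) ≋ V w (θ P) ⊕ X (U P)
    θ-V w P = ≋-trans (V-cong -1# (δ-V w P)) (≋-trans (V-⊕ -1# (X P) (V w (δ P)))
      (≋-trans ⟪ (λ k → +-comm _ _) ⟫ (⊕-cong (V-V -1# w (δ P)) (≋-sym (X-V -1# P)))))

    θ-X : ∀ P → θ (X P) ≋ X (θ P) ⊕ X (U P)
    θ-X P = ≋-trans (V-cong -1# (δ-X P)) (≋-trans (V-⊕ -1# (X P) (X (δ P)))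
      (≋-trans ⟪ (λ k → +-comm _ _) ⟫ (⊕-cong (≋-sym (X-V -1# (δ P))) (≋-sym (X-V -1# P)))))

    -- Horner evaluation of the first d coefficients. With the length as an argument, values
    -- computed from different bounds can be compared by `ev-stable`.
    ev : ℕ → Ser → F → F
    ev zero f z = 0#
    ev (suc d) f z = f 0 ⊞ z ⊠ ev d (λ k → f (suc k)) z

    ev-cong : ∀ d {f g : Ser} z → (∀ k → f k ≡ g k) → ev d f z ≡ ev d g z
    ev-cong zero z e = refl
    ev-cong (suc d) z e = cong₂ (λ a b → a ⊞ z ⊠ b) (e 0) (ev-cong d z (λ k → e (suc k)))

    ev-zero : ∀ d {f : Ser} z → (∀ k → f k ≡ 0#) → ev d f z ≡ 0#
    ev-zero zero z e = refl
    ev-zero (suc d) z e = trans (cong₂ (λ a b → a ⊞ z ⊠ b) (e 0) (ev-zero d z (λ k → e (suc k)))) (trans (+-identityˡ _) (zeroʳ z))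

    ev-stable : ∀ {d e} {f : Ser} z → (∀ k → d ≤ k → f k ≡ 0#) → d ≤ e → ev e f z ≡ ev d f z
    ev-stable {zero} {e} z v le = ev-zero e z (λ k → v k z≤n)
    ev-stable {suc d} {suc e} {f} z v (s≤s le) = cong (λ b → f 0 ⊞ z ⊠ b) (ev-stable z (λ k le′ → v (suc k) (s≤s le′)) le)

    ev-⊞ : ∀ d (f g : Ser) z → ev d (λ k → f k ⊞ g k) z ≡ ev d f z ⊞ ev d g z
    ev-⊞ zero f g z = sym (+-identityˡ 0#)
    ev-⊞ (suc d) f g z = trans (cong (λ b → (f 0 ⊞ g 0) ⊞ z ⊠ b) (ev-⊞ d _ _ z))
      (solve 5 (λ z a b c d → (a :+ b) :+ z :* (c :+ d) := (a :+ z :* c) :+ (b :+ z :* d)) refl z (f 0) (g 0) (ev d (λ k → f (suc k)) z) (ev d (λ k → g (suc k)) z))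

    ev-⊠ : ∀ d c (f : Ser) z → ev d (λ k → c ⊠ f k) z ≡ c ⊠ ev d f z
    ev-⊠ zero c f z = sym (zeroʳ c)
    ev-⊠ (suc d) c f z = trans (cong (λ b → c ⊠ f 0 ⊞ z ⊠ b) (ev-⊠ d c _ z))
      (solve 4 (λ c z a b → c :* a :+ z :* (c :* b) := c :* (a :+ z :* b)) refl c z (f 0) (ev d (λ k → f (suc k)) z))

    ev-snoc : ∀ d (f : Ser) z → ev (suc d) f z ≡ ev d f z ⊞ f d ⊠ z ↑ d
    ev-snoc zero f z = solve 3 (λ a z i → a :+ z :* con 0 := con 0 :+ a :* con 1) refl (f 0) z 1#
    ev-snoc (suc d) f z = begin
      f 0 ⊞ z ⊠ ev (suc d) (λ k → f (suc k)) z ≡⟨ cong (λ b → f 0 ⊞ z ⊠ b) (ev-snoc d (λ k → f (suc k)) z) ⟩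
      f 0 ⊞ z ⊠ (ev d (λ k → f (suc k)) z ⊞ f (suc d) ⊠ z ↑ d)
        ≡⟨ solve 5 (λ a z e b y → a :+ z :* (e :+ b :* y) := (a :+ z :* e) :+ b :* (z :* y)) refl (f 0) z (ev d (λ k → f (suc k)) z) (f (suc d)) (z ↑ d) ⟩
      (f 0 ⊞ z ⊠ ev d (λ k → f (suc k)) z) ⊞ f (suc d) ⊠ (z ⊠ z ↑ d) ∎
      where open ≡-Reasoning

    abstract
      eval : Pol → F → F
      eval P z = ev (bound P) (at P) z

      eval≡ev : ∀ P z {d} → Deg≤ d P → eval P z ≡ ev d (at P) z
      eval≡ev P z {d} v = trans (sym (ev-stable z (vanish P) (ℕₚ.m≤m+n (bound P) d))) (ev-stable z (above v) (ℕₚ.m≤n+m d (bound P)))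

      eval-⊕ : ∀ P Q z → eval (P ⊕ Q) z ≡ eval P z ⊞ eval Q z
      eval-⊕ P Q z = trans (ev-⊞ (bound P ℕ.+ bound Q) (at P) (at Q) z)
        (cong₂ _⊞_ (ev-stable z (vanish P) (ℕₚ.m≤m+n (bound P) (bound Q))) (ev-stable z (vanish Q) (ℕₚ.m≤n+m (bound Q) (bound P))))

      eval-· : ∀ c P z → eval (c · P) z ≡ c ⊠ eval P z
      eval-· c P z = ev-⊠ (bound P) c (at P) z

      eval-X : ∀ P z → eval (X P) z ≡ z ⊠ eval P z
      eval-X P z = +-identityˡ _

      eval-𝟘 : ∀ z → eval 𝟘 z ≡ 0#
      eval-𝟘 z = refl

    eval-cong : ∀ {P Q} z → P ≋ Q → eval P z ≡ eval Q z
    eval-cong {P} {Q} z e = trans (eval≡ev P z {bound Q} (deg≤ λ k le → trans (at-≡ e k) (vanish Q k le))) (trans (ev-cong (bound Q) z (at-≡ e)) (sym (eval≡ev Q z (Deg≤-bound Q))))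

    eval-V : ∀ w P z → eval (V w P) z ≡ (z ⊞ w) ⊠ eval P z
    eval-V w P z = trans (eval-⊕ (X P) (w · P) z) (trans (cong₂ _⊞_ (eval-X P z) (eval-· w P z)) (sym (distribʳ (eval P z) z w)))

    -- For fixed z and M the polynomials with Vanish z M form an ideal; this replaces divisibility by (x-z)^M.
    module Vanishing (∂ : Pol → Pol)
      (∂-cong : ∀ {P Q} → P ≋ Q → ∂ P ≋ ∂ Q)
      (∂-⊕ : ∀ P Q → ∂ (P ⊕ Q) ≋ ∂ P ⊕ ∂ Q)
      (∂-· : ∀ c P → ∂ (c · P) ≋ c · ∂ P)
      where

      Vanish : F → ℕ → Pol → Set
      Vanish z zero P = ⊤
      Vanish z (suc M) P = eval P z ≡ 0# × Vanish z M (∂ P)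

      v-cong : ∀ {z} M {P Q} → P ≋ Q → Vanish z M P → Vanish z M Q
      v-cong zero e _ = tt
      v-cong {z} (suc M) e (v , vs) = trans (sym (eval-cong z e)) v , v-cong M (∂-cong e) vs

      v-weaken : ∀ {z} M {P} → Vanish z (suc M) P → Vanish z M P
      v-weaken zero _ = tt
      v-weaken (suc M) (v , vs) = v , v-weaken M vs

      v-⊕ : ∀ {z} M {P Q} → Vanish z M P → Vanish z M Q → Vanish z M (P ⊕ Q)
      v-⊕ zero _ _ = tt
      v-⊕ {z} (suc M) {P} {Q} (v , vs) (u , us) =
        trans (eval-⊕ P Q z) (trans (cong₂ _⊞_ v u) (+-identityˡ 0#)) , v-cong M (≋-sym (∂-⊕ P Q)) (v-⊕ M vs us)

      v-· : ∀ {z} M c {P} → Vanish z M P → Vanish z M (c · P)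
      v-· zero c _ = tt
      v-· {z} (suc M) c {P} (v , vs) = trans (eval-· c P z) (trans (cong (c ⊠_) v) (zeroʳ c)) , v-cong M (≋-sym (∂-· c P)) (v-· M c vs)

      v-cancel : ∀ {z} M {P Q} → Vanish z M (P ⊕ Q) → Vanish z M P → Vanish z M Q
      v-cancel M {P} {Q} s v = v-cong M ⟪ (λ k → cancelʳ (at P k) (at Q k)) ⟫ (v-⊕ M s (v-· M -1# v))

    -- Two derivations are in use. `θ` measures multiplicities away from 0 and 1, where x(x - 1) is
    -- invertible. At 1 every `θ P` vanishes, so the multiplicities at 1 behind the independence of
    -- the auxiliary polynomials are measured by `δ`.
    module Θ = Vanishing θ θ-cong θ-⊕ θ-·
    module Δ = Vanishing δ δ-cong δ-⊕ δ-·

    θv-X : ∀ {z} M {P} → Θ.Vanish z M P → Θ.Vanish z M (X P)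
    θv-X zero _ = tt
    θv-X {z} (suc M) {P} w@(v , vs) = trans (eval-X P z) (trans (cong (z ⊠_) v) (zeroʳ z)) ,
      Θ.v-cong M (≋-sym (θ-X P)) (Θ.v-⊕ M (θv-X M vs) (θv-X M (Θ.v-⊕ M (θv-X M w′) (Θ.v-· M -1# w′))))
      where w′ = Θ.v-weaken M w

    θv-V : ∀ {z} w M {P} → Θ.Vanish z M P → Θ.Vanish z M (V w P)
    θv-V w M v = Θ.v-⊕ M (θv-X M v) (Θ.v-· M w v)

    δv-X : ∀ {z} M {P} → Δ.Vanish z M P → Δ.Vanish z M (X P)
    δv-X zero _ = tt
    δv-X {z} (suc M) {P} w@(v , vs) = trans (eval-X P z) (trans (cong (z ⊠_) v) (zeroʳ z)) ,
      Δ.v-cong M (≋-sym (δ-X P)) (Δ.v-⊕ M (δv-X M (Δ.v-weaken M w)) (δv-X M vs))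

    -- δ((x - 1)P) = xP + (x - 1)δP: the first term has the order of P at 1, and the second regains
    -- by induction the order that δ loses.
    δv-U : ∀ M {P} → Δ.Vanish 1# M P → Δ.Vanish 1# (suc M) (U P)
    δv-U M {P} v = trans (eval-V -1# P 1#) (trans (cong (_⊠ eval P 1#) 1+-1) (zeroˡ _)) , rest M v
      where
      rest : ∀ M → Δ.Vanish 1# M P → Δ.Vanish 1# M (δ (U P))
      rest zero _ = tt
      rest (suc M) w = Δ.v-cong (suc M) (≋-sym (δ-V -1# P)) (Δ.v-⊕ (suc M) (δv-X (suc M) w) (δv-U M (proj₂ w)))

    module Root (z : F) (z≢0 : z ≢ 0#) where
      private
        y = inv z
        w = -1# ⊠ z

      z+w : z ⊞ w ≡ 0#
      z+w = x+-1x z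

      -- The power series of f/(x - z) at 0: its k-th coefficient is minus z^-(k+1) times the
      -- partial sum of f(z) up to degree k. It breaks off because the full sum is f(z) = 0. Since z
      -- ≠ 0, this closed formula replaces long division.
      quotient : Ser → Ser
      quotient f k = -1# ⊠ (y ↑ suc k ⊠ ev (suc k) f z)

      quotient-vanish : ∀ d f → (∀ k → suc d ≤ k → f k ≡ 0#) → ev (suc d) f z ≡ 0# → ∀ k → d ≤ k → quotient f k ≡ 0#
      quotient-vanish d f v root k le = begin
        -1# ⊠ (y ↑ suc k ⊠ ev (suc k) f z) ≡⟨ cong (λ e → -1# ⊠ (y ↑ suc k ⊠ e)) (trans (ev-stable z v (s≤s le)) root) ⟩
        -1# ⊠ (y ↑ suc k ⊠ 0#) ≡⟨ solve 2 (λ m a → m :* (a :* con 0) := con 0) refl -1# (y ↑ suc k) ⟩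
        0# ∎
        where open ≡-Reasoning

      private
        zy : z ⊠ y ≡ 1#
        zy = ⊠-inverse z≢0

        zyk : ∀ k → z ↑ k ⊠ y ↑ k ≡ 1#
        zyk k = trans (sym (⊠-↑ z y k)) (trans (cong (_↑ k) zy) (1↑ k))

        w*quotient : ∀ f k → w ⊠ quotient f k ≡ y ↑ k ⊠ ev (suc k) f z
        w*quotient f k = begin
          (-1# ⊠ z) ⊠ (-1# ⊠ ((y ⊠ y ↑ k) ⊠ ev (suc k) f z))
            ≡⟨ solve 5 (λ m z y t e → (m :* z) :* (m :* ((y :* t) :* e)) := (m :* m) :* ((z :* y) :* (t :* e))) refl -1# z y (y ↑ k) (ev (suc k) f z) ⟩
          (-1# ⊠ -1#) ⊠ ((z ⊠ y) ⊠ (y ↑ k ⊠ ev (suc k) f z)) ≡⟨ cong₂ (λ a b → a ⊠ (b ⊠ (y ↑ k ⊠ ev (suc k) f z))) -1*-1 zy ⟩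
          1# ⊠ (1# ⊠ (y ↑ k ⊠ ev (suc k) f z)) ≡⟨ trans (*-identityˡ _) (*-identityˡ _) ⟩
          y ↑ k ⊠ ev (suc k) f z ∎
          where open ≡-Reasoning

      quotient-factor : ∀ f k → shift (quotient f) k ⊞ w ⊠ quotient f k ≡ f k
      quotient-factor f zero = begin
        0# ⊞ w ⊠ quotient f 0 ≡⟨ +-identityˡ _ ⟩
        w ⊠ quotient f 0 ≡⟨ w*quotient f 0 ⟩
        1# ⊠ (f 0 ⊞ z ⊠ 0#) ≡⟨ solve 2 (λ a z → con 1 :* (a :+ z :* con 0) := a) refl (f 0) z ⟩
        f 0 ∎
        where open ≡-Reasoning
      quotient-factor f (suc k) = begin
        -1# ⊠ (y ↑ suc k ⊠ e) ⊞ w ⊠ quotient f (suc k) ≡⟨ cong (-1# ⊠ (y ↑ suc k ⊠ e) ⊞_) (w*quotient f (suc k)) ⟩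
        -1# ⊠ (y ↑ suc k ⊠ e) ⊞ y ↑ suc k ⊠ ev (suc (suc k)) f z ≡⟨ cong (λ b → -1# ⊠ (y ↑ suc k ⊠ e) ⊞ y ↑ suc k ⊠ b) (ev-snoc (suc k) f z) ⟩
        -1# ⊠ (y ↑ suc k ⊠ e) ⊞ y ↑ suc k ⊠ (e ⊞ f (suc k) ⊠ z ↑ suc k)
          ≡⟨ solve 5 (λ m t e a s → m :* (t :* e) :+ t :* (e :+ a :* s) := (t :* e :+ a :* (s :* t)) :+ m :* (t :* e)) refl -1# (y ↑ suc k) e (f (suc k)) (z ↑ suc k) ⟩
        (y ↑ suc k ⊠ e ⊞ f (suc k) ⊠ (z ↑ suc k ⊠ y ↑ suc k)) ⊞ -1# ⊠ (y ↑ suc k ⊠ e) ≡⟨ cancelʳ _ _ ⟩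
        f (suc k) ⊠ (z ↑ suc k ⊠ y ↑ suc k) ≡⟨ cong (f (suc k) ⊠_) (zyk (suc k)) ⟩
        f (suc k) ⊠ 1# ≡⟨ *-identityʳ _ ⟩
        f (suc k) ∎
        where
        open ≡-Reasoning
        e = ev (suc k) f z

      divide : ∀ d P → Deg≤ (suc d) P → eval P z ≡ 0# → ∃ λ Q → Deg≤ d Q × V w Q ≋ P
      divide d P v root = pol (quotient (at P)) d vq , deg≤ vq , ⟪ quotient-factor (at P) ⟫
        where vq = quotient-vanish d (at P) (above v) (trans (sym (eval≡ev P z v)) root)

      module _ (z-1≢0 : z ⊞ -1# ≢ 0#) where

        -- For j = 1 the polynomial in the hypothesis is θ((x-z)·G); applying θ once more turns (j , G) into (j+1 , θ G), up to multiples of G.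
        drop-factor : ∀ M j G → j ℕ.+ M ≤ p → 0 < j → Θ.Vanish z M (ι j · X (U G) ⊕ V w (θ G)) → Θ.Vanish z M G
        drop-factor zero j G _ _ _ = tt
        drop-factor (suc M) j G j+M≤p 0<j h@(v , vs) = G-root , drop-factor M (suc j) (θ G) (subst (_≤ p) (ℕₚ.+-suc j M) j+M≤p) (s≤s z≤n) tail
          where
          open ≡-Reasoning
          j<p : j < p
          j<p = ℕₚ.<-≤-trans (ℕₚ.m<m+n j (s≤s z≤n)) j+M≤p
          G-root : eval G z ≡ 0#
          -- At z the summand with `V w` drops out because z + w = 0. What remains is j z (z - 1)
          -- G(z), whose scalar factor is nonzero since 0 < j < p.
          G-root = ⊠≡0 (⊠≢0 (ι-nonzero 0<j j<p) (⊠≢0 z≢0 z-1≢0)) (begin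
            (ι j ⊠ (z ⊠ (z ⊞ -1#))) ⊠ eval G z ≡⟨ solve 4 (λ j z m g → (j :* (z :* (z :+ m))) :* g := j :* (z :* ((z :+ m) :* g)) :+ con 0) refl (ι j) z -1# (eval G z) ⟩
            ι j ⊠ (z ⊠ ((z ⊞ -1#) ⊠ eval G z)) ⊞ 0# ≡⟨ cong₂ (λ a b → ι j ⊠ (z ⊠ a) ⊞ b) (eval-V -1# G z) (trans (cong (_⊠ eval (θ G) z) z+w) (zeroˡ _)) ⟨
            ι j ⊠ (z ⊠ eval (U G) z) ⊞ (z ⊞ w) ⊠ eval (θ G) z ≡⟨ cong₂ (λ a b → ι j ⊠ a ⊞ b) (eval-X (U G) z) (eval-V w (θ G) z) ⟨
            ι j ⊠ eval (X (U G)) z ⊞ eval (V w (θ G)) z ≡⟨ cong (_⊞ eval (V w (θ G)) z) (eval-· (ι j) (X (U G)) z) ⟨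
            eval (ι j · X (U G)) z ⊞ eval (V w (θ G)) z ≡⟨ eval-⊕ (ι j · X (U G)) (V w (θ G)) z ⟨
            eval (ι j · X (U G) ⊕ V w (θ G)) z ≡⟨ v ⟩
            0# ∎)
          vG : Θ.Vanish z M G
          vG = drop-factor M j G (ℕₚ.≤-trans (ℕₚ.+-monoʳ-≤ j (ℕₚ.n≤1+n M)) j+M≤p) 0<j (Θ.v-weaken M h)
          stuff : Pol
          stuff = ι j · (X (U (U G)) ⊕ X (X (U G)))
          v-stuff : Θ.Vanish z M stuff
          v-stuff = Θ.v-· M (ι j) (Θ.v-⊕ M (θv-X M (θv-V -1# M (θv-V -1# M vG))) (θv-X M (θv-X M (θv-V -1# M vG))))
          θXU : θ (X (U G)) ≋ X (U (θ G) ⊕ X (U G)) ⊕ X (U (U G))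
          θXU = ≋-trans (θ-X (U G)) (⊕-cong (X-cong (θ-V -1# G)) ≋-refl)
          expand : θ (ι j · X (U G) ⊕ V w (θ G)) ≋ stuff ⊕ (ι (suc j) · X (U (θ G)) ⊕ V w (θ (θ G)))
          expand = ≋-trans (θ-⊕ _ _) (≋-trans (⊕-cong (≋-trans (θ-· (ι j) (X (U G))) (·-cong (ι j) (≋-trans θXU (⊕-cong (X-⊕ (U (θ G)) (X (U G))) ≋-refl)))) (θ-V w (θ G)))
            ⟪ (λ k → trans
                (solve 5 (λ j a b c d → j :* ((a :+ b) :+ c) :+ (d :+ a) := j :* (c :+ b) :+ ((con 1 :+ j) :* a :+ d)) refl
                  (ι j) (at (X (U (θ G))) k) (at (X (X (U G))) k) (at (X (U (U G))) k) (at (V w (θ (θ G))) k))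
                (cong (λ i → ι j ⊠ (at (X (U (U G))) k ⊞ at (X (X (U G))) k) ⊞ (i ⊠ at (X (U (θ G))) k ⊞ at (V w (θ (θ G))) k)) (sym (ι-suc j)))) ⟫)
          tail : Θ.Vanish z M (ι (suc j) · X (U (θ G)) ⊕ V w (θ (θ G)))
          tail = Θ.v-cancel M (Θ.v-cong M expand vs) v-stuff

        -- A factor x - z accounts for one order of vanishing at z. The bound `suc M ≤ p` keeps the
        -- integers 1, ..., M produced by repeated differentiation invertible.
        remove-root : ∀ M G → suc M ≤ p → Θ.Vanish z (suc M) (V w G) → Θ.Vanish z M G
        remove-root M G M<p (_ , vs) = drop-factor M 1 G M<p (s≤s z≤n) (Θ.v-cong M
          (≋-trans (θ-V w G) ⟪ (λ k → trans (+-comm _ _) (cong (_⊞ at (V w (θ G)) k) (sym (trans (cong (_⊠ at (X (U G)) k) (trans (ι-suc 0) (trans (cong (1# ⊞_) ι-zero) (+-identityʳ 1#)))) (*-identityˡ _))))) ⟫) vs)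

      -- At u the factor u + w is invertible, and θ((x + w)G) = (x + w)θG + x(x - 1)G, where the
      -- last term already has the required order by induction.
      keep-other : ∀ {u} → u ⊞ w ≢ 0# → ∀ M G → Θ.Vanish u M (V w G) → Θ.Vanish u M G
      keep-other ne zero G _ = tt
      keep-other {u} ne (suc M) G h@(v , vs) =
        ⊠≡0 ne (trans (sym (eval-V w G u)) v) ,
        keep-other ne M (θ G) (Θ.v-cancel M (Θ.v-cong M (≋-trans (θ-V w G) ⟪ (λ k → +-comm _ _) ⟫) vs) (θv-X M (θv-V -1# M (keep-other ne M G (Θ.v-weaken M h)))))

-- The auxiliary polynomials of Stepanov's method.

module StepanovPolynomials where

  open import Data.Nat as ℕ using (ℕ; zero; suc; _≤_; _<_; z≤n; s≤s)
  import Data.Nat.Properties as ℕₚ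
  open import Data.List using ([]; _∷_; length)
  open import Data.List.Relation.Unary.All using (All; []; _∷_)
  import Data.List.Relation.Unary.All as All
  open import Data.List.Relation.Unary.AllPairs using (AllPairs; []; _∷_)
  open import Data.List.Membership.Propositional using (_∉_)
  open import Data.List.Relation.Unary.Any using (here; there)
  open import Data.Product using (∃; _×_; _,_; proj₁)
  open import Data.Unit using (tt)
  open import Data.Empty using (⊥-elim)
  open import Relation.Nullary using (Dec; yes; no)
  open import Relation.Binary.PropositionalEquality
  open PrimeFields
  open FieldArithmetic
  open PolynomialVanishing

  module Stepanov {p : ℕ} (𝔽 : PrimeField p) where
    open FieldLemmas 𝔽
    open Polynomials 𝔽

    Regular : F → Set
    Regular z = z ≢ 0# × z ⊞ -1# ≢ 0#

    -- Divides out one factor at a time: `k` is the multiplicity left at the current point z, while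
    -- every point of `W` still has the full `M`. `remove-root` lowers the order at z by one and
    -- `keep-other` preserves the orders elsewhere. `M ≤ p` comes from the characteristic, through
    -- `remove-root`.
    zero-count : ∀ d P M k z W → Deg≤ d P → k ≤ M → M ≤ p → Regular z → All Regular W →
      All (z ≢_) W → AllPairs _≢_ W → Θ.Vanish z k P → All (λ u → Θ.Vanish u M P) W →
      d ≤ k ℕ.+ M ℕ.* length W → P ≋ 𝟘
    zero-count zero P M k z W deg _ _ _ _ _ _ _ _ _ = ⟪ (λ k → above deg k z≤n) ⟫
    zero-count (suc d) P M zero z [] deg _ _ _ _ _ _ _ _ le = ⊥-elim (ℕₚ.1+n≰n (ℕₚ.≤-trans (s≤s z≤n) (subst (suc d ≤_) (ℕₚ.*-zeroʳ M) le)))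
    zero-count (suc d) P M zero z (u ∷ W) deg k≤M M≤p rz (ru ∷ rW) (_ ∷ zW) (uW ∷ dW) v (vu ∷ vW) le =
      zero-count (suc d) P M M u W deg ℕₚ.≤-refl M≤p ru rW uW dW vu vW (subst (suc d ≤_) (ℕₚ.*-suc M (length W)) le)
    zero-count (suc d) P M (suc k) z W deg k<M M≤p rz@(z≢0 , z-1≢0) rW zW dW v vW le =
      conclude (Root.divide z z≢0 d P deg (proj₁ v))
      where
      open Root z z≢0
      V0 : ∀ k → at (V (-1# ⊠ z) 𝟘) k ≡ 0#
      V0 zero = trans (+-identityˡ _) (zeroʳ _)
      V0 (suc k) = trans (+-identityˡ _) (zeroʳ _)
      conclude : (∃ λ Q → Deg≤ d Q × V (-1# ⊠ z) Q ≋ P) → P ≋ 𝟘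
      conclude (Q , degQ , eq) = ≋-trans (≋-sym eq) (≋-trans (V-cong (-1# ⊠ z) Q≋0) ⟪ V0 ⟫)
        where
        other : ∀ {u} → z ≢ u → Θ.Vanish u M P → Θ.Vanish u M Q
        other ne vu = keep-other (λ e → ne (sym (x-y≡0⇒x≡y e))) M Q (Θ.v-cong M (≋-sym eq) vu)
        Q≋0 : Q ≋ 𝟘
        Q≋0 = zero-count d Q M k z W degQ (ℕₚ.≤-trans (ℕₚ.n≤1+n k) k<M) M≤p rz rW zW dW
          (remove-root z-1≢0 k Q (ℕₚ.≤-trans k<M M≤p) (Θ.v-cong (suc k) (≋-sym eq) v))
          (All.zipWith (λ (ne , vu) → other ne vu) (zW , vW)) (ℕₚ.≤-pred le)

    ev-single : ∀ d e (f : Ser) z → (∀ k → k ≢ e → f k ≡ 0#) → e < d → ev d f z ≡ f e ⊠ z ↑ e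
    ev-single (suc d) zero f z h _ = trans (cong (λ b → f 0 ⊞ z ⊠ b) (ev-zero d z (λ k → h (suc k) (λ ()))))
      (solve 2 (λ a z → a :+ z :* con 0 := a :* con 1) refl (f 0) z)
    ev-single (suc d) (suc e) f z h (s≤s le) = trans (cong₂ (λ a b → a ⊞ z ⊠ b) (h 0 (λ ())) (ev-single d e (λ k → f (suc k)) z (λ k ne → h (suc k) (λ q → ne (ℕₚ.suc-injective q))) le))
      (solve 3 (λ a z y → con 0 :+ z :* (a :* y) := a :* (z :* y)) refl (f (suc e)) z (z ↑ e))

    -- δ P - e P has one exponent fewer and loses at most one order of vanishing at 1.
    sparse : ∀ S P → All (_< p) S → (∀ k → k ∉ S → at P k ≡ 0#) → Δ.Vanish 1# (length S) P → P ≋ 𝟘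
    sparse [] P _ supp _ = ⟪ (λ k → supp k (λ ())) ⟫
    sparse (e ∷ S) P (e<p ∷ S<p) supp v@(root , vs) = ⟪ at-zero ⟫
      where
      open ≡-Reasoning
      P′ = δ P ⊕ (-1# ⊠ ι e) · P
      factor : ∀ k → at P′ k ≡ (ι k ⊞ -1# ⊠ ι e) ⊠ at P k
      factor k = sym (distribʳ (at P k) (ι k) (-1# ⊠ ι e))
      supp′ : ∀ k → k ∉ S → at P′ k ≡ 0#
      supp′ k k∉S = go (k ℕ.≟ e)
        where
        go : Dec (k ≡ e) → at P′ k ≡ 0#
        go (yes k≡e) = trans (factor k) (trans (cong (λ j → (ι j ⊞ -1# ⊠ ι e) ⊠ at P k) k≡e) (trans (cong (_⊠ at P k) (x+-1x (ι e))) (zeroˡ _)))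
        go (no k≢e) = trans (factor k) (trans (cong ((ι k ⊞ -1# ⊠ ι e) ⊠_) (supp k λ { (here q) → k≢e q ; (there q) → k∉S q })) (zeroʳ _))
      P′≋0 : P′ ≋ 𝟘
      P′≋0 = sparse S P′ S<p supp′ (Δ.v-⊕ (length S) vs (Δ.v-· (length S) (-1# ⊠ ι e) (Δ.v-weaken (length S) v)))
      off-e : ∀ k → k ≢ e → at P k ≡ 0#
      off-e k k≢e = go (k ℕ.<? p)
        where
        go : Dec (k < p) → at P k ≡ 0#
        go (yes k<p) = ⊠≡0 (ι-injective k<p e<p k≢e) (trans (sym (factor k)) (at-≡ P′≋0 k))
        go (no k≮p) = supp k λ { (here q) → k≢e q ; (there q) → k≮p (All.lookup S<p q) }
      at-e : at P e ≡ 0#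
      at-e = begin
        at P e ≡⟨ *-identityʳ _ ⟨
        at P e ⊠ 1# ≡⟨ cong (at P e ⊠_) (1↑ e) ⟨
        at P e ⊠ 1# ↑ e ≡⟨ ev-single (bound P ℕ.+ suc e) e (at P) 1# off-e (ℕₚ.m≤n+m (suc e) (bound P)) ⟨
        ev (bound P ℕ.+ suc e) (at P) 1# ≡⟨ ev-stable 1# (vanish P) (ℕₚ.m≤m+n (bound P) (suc e)) ⟩
        ev (bound P) (at P) 1# ≡⟨ eval≡ev P 1# (Deg≤-bound P) ⟨
        eval P 1# ≡⟨ root ⟩
        0# ∎
      at-zero : ∀ k → at P k ≡ 0#
      at-zero k = go (k ℕ.≟ e)
        where
        go : Dec (k ≡ e) → at P k ≡ 0#
        go (yes k≡e) = trans (cong (at P) k≡e) at-e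
        go (no k≢e) = off-e k k≢e

    Xⁿ Uⁿ : ℕ → Pol → Pol
    Xⁿ zero P = P
    Xⁿ (suc k) P = X (Xⁿ k P)
    Uⁿ zero P = P
    Uⁿ (suc k) P = U (Uⁿ k P)

    ∑P : ℕ → (ℕ → Pol) → Pol
    ∑P zero f = 𝟘
    ∑P (suc k) f = f 0 ⊕ ∑P k (λ i → f (suc i))

    ∑P-cong : ∀ B {f g : ℕ → Pol} → (∀ i → f i ≋ g i) → ∑P B f ≋ ∑P B g
    ∑P-cong zero e = ≋-refl
    ∑P-cong (suc B) e = ⊕-cong (e 0) (∑P-cong B (λ i → e (suc i)))

    record Linear (L : Pol → Pol) : Set where
      field
        L-cong : ∀ {P Q} → P ≋ Q → L P ≋ L Q
        L-⊕ : ∀ P Q → L (P ⊕ Q) ≋ L P ⊕ L Q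
        L-· : ∀ c P → L (c · P) ≋ c · L P

      L-𝟘 : L 𝟘 ≋ 𝟘
      L-𝟘 = ≋-trans (L-cong {𝟘} {0# · 𝟘} ⟪ (λ k → sym (zeroˡ _)) ⟫) (≋-trans (L-· 0# 𝟘) ⟪ (λ k → zeroˡ _) ⟫)

      L-∑ : ∀ B f → L (∑P B f) ≋ ∑P B (λ i → L (f i))
      L-∑ zero f = L-𝟘
      L-∑ (suc B) f = ≋-trans (L-⊕ _ _) (⊕-cong ≋-refl (L-∑ B _))

    open Linear

    id-linear : Linear (λ P → P)
    id-linear = record { L-cong = λ e → e ; L-⊕ = λ _ _ → ≋-refl ; L-· = λ _ _ → ≋-refl }

    ∘-linear : ∀ {L K} → Linear L → Linear K → Linear (λ P → L (K P))
    ∘-linear l k = record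
      { L-cong = λ e → L-cong l (L-cong k e)
      ; L-⊕ = λ P Q → ≋-trans (L-cong l (L-⊕ k P Q)) (L-⊕ l _ _)
      ; L-· = λ c P → ≋-trans (L-cong l (L-· k c P)) (L-· l c _) }

    ⊞-interchange : ∀ a b c d → (a ⊞ b) ⊞ (c ⊞ d) ≡ (a ⊞ c) ⊞ (b ⊞ d)
    ⊞-interchange = solve 4 (λ a b c d → (a :+ b) :+ (c :+ d) := (a :+ c) :+ (b :+ d)) refl

    ⊕-linear : ∀ {L K} → Linear L → Linear K → Linear (λ P → L P ⊕ K P)
    ⊕-linear {L} {K} l k = record
      { L-cong = λ e → ⊕-cong (L-cong l e) (L-cong k e)
      ; L-⊕ = λ P Q → ≋-trans (⊕-cong (L-⊕ l P Q) (L-⊕ k P Q)) ⟪ (λ i → ⊞-interchange (at (L P) i) _ _ _) ⟫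
      ; L-· = λ c P → ≋-trans (⊕-cong (L-· l c P) (L-· k c P)) ⟪ (λ i → sym (distribˡ c _ _)) ⟫ }

    ·-linear : ∀ c → Linear (c ·_)
    ·-linear c = record
      { L-cong = ·-cong c
      ; L-⊕ = λ P Q → ⟪ (λ k → distribˡ c (at P k) (at Q k)) ⟫
      ; L-· = λ d P → ⟪ (λ k → solve 3 (λ c d a → c :* (d :* a) := d :* (c :* a)) refl c d (at P k)) ⟫ }

    X-linear : Linear X
    X-linear = record { L-cong = X-cong ; L-⊕ = X-⊕ ; L-· = X-· }

    V-linear : ∀ w → Linear (V w)
    V-linear w = record { L-cong = V-cong w ; L-⊕ = V-⊕ w ; L-· = V-· w }

    θ-linear : Linear θ
    θ-linear = record { L-cong = θ-cong ; L-⊕ = θ-⊕ ; L-· = θ-· }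

    Xⁿ-linear : ∀ k → Linear (Xⁿ k)
    Xⁿ-linear zero = id-linear
    Xⁿ-linear (suc k) = ∘-linear X-linear (Xⁿ-linear k)

    Uⁿ-linear : ∀ k → Linear (Uⁿ k)
    Uⁿ-linear zero = id-linear
    Uⁿ-linear (suc k) = ∘-linear (V-linear -1#) (Uⁿ-linear k)

    X-Uⁿ : ∀ k P → X (Uⁿ k P) ≋ Uⁿ k (X P)
    X-Uⁿ zero P = ≋-refl
    X-Uⁿ (suc k) P = ≋-trans (X-V -1# (Uⁿ k P)) (V-cong -1# (X-Uⁿ k P))

    U-Xⁿ : ∀ k P → U (Xⁿ k P) ≋ Xⁿ k (U P)
    U-Xⁿ zero P = ≋-refl
    U-Xⁿ (suc k) P = ≋-trans (≋-sym (X-V -1# (Xⁿ k P))) (X-cong (U-Xⁿ k P))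

    X-Xⁿ : ∀ k P → X (Xⁿ k P) ≋ Xⁿ k (X P)
    X-Xⁿ zero P = ≋-refl
    X-Xⁿ (suc k) P = X-cong (X-Xⁿ k P)

    private
      ι0· : ∀ P Q → P ≋ P ⊕ ι 0 · Q
      ι0· P Q = ⟪ (λ k → sym (trans (cong (λ i → at P k ⊞ i ⊠ at Q k) ι-zero) (trans (cong (at P k ⊞_) (zeroˡ _)) (+-identityʳ _)))) ⟫

      ιsuc· : ∀ j P Q → (P ⊕ ι j · Q) ⊕ Q ≋ P ⊕ ι (suc j) · Q
      ιsuc· j P Q = ⟪ (λ k → trans (solve 3 (λ a j b → (a :+ j :* b) :+ b := a :+ (con 1 :+ j) :* b) refl (at P k) (ι j) (at Q k))
        (cong (λ i → at P k ⊞ i ⊠ at Q k) (sym (ι-suc j)))) ⟫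

    θ-Uⁿ : ∀ j P → θ (Uⁿ j P) ≋ Uⁿ j (θ P ⊕ ι j · X P)
    θ-Uⁿ zero P = ι0· (θ P) (X P)
    θ-Uⁿ (suc j) P = ≋-trans (θ-V -1# (Uⁿ j P)) (≋-trans (⊕-cong (V-cong -1# (θ-Uⁿ j P)) (≋-trans (X-V -1# (Uⁿ j P)) (V-cong -1# (X-Uⁿ j P))))
      (≋-trans (≋-sym (V-⊕ -1# _ _)) (V-cong -1# (≋-trans (≋-sym (L-⊕ (Uⁿ-linear j) _ _)) (L-cong (Uⁿ-linear j) (ιsuc· j (θ P) (X P)))))))

    θ-Xⁿ : ∀ j P → θ (Xⁿ j P) ≋ Xⁿ j (θ P ⊕ ι j · U P)
    θ-Xⁿ zero P = ι0· (θ P) (U P)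
    θ-Xⁿ (suc j) P = ≋-trans (θ-X (Xⁿ j P)) (≋-trans (⊕-cong (X-cong (θ-Xⁿ j P)) (X-cong (U-Xⁿ j P)))
      (≋-trans (≋-sym (X-⊕ _ _)) (X-cong (≋-trans (≋-sym (L-⊕ (Xⁿ-linear j) _ _)) (L-cong (Xⁿ-linear j) (ιsuc· j (θ P) (U P)))))))

    module Auxiliary (n B : ℕ) where

      -- Stepanov's auxiliary polynomial Σ x^(nb) (x - 1)^(nc) g_bc(x) over b, c < B. Its degree is
      -- about 2nB, but on the points with prescribed z^n and (z - 1)^n it agrees with a polynomial
      -- of the degree of the g_bc.
      Ψ : (ℕ → ℕ → Pol) → Pol
      Ψ g = ∑P B (λ c → Uⁿ (n ℕ.* c) (∑P B (λ b → Xⁿ (n ℕ.* b) (g b c))))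

      -- θ sends x^(nb) (x - 1)^(nc) g to x^(nb) (x - 1)^(nc) times `stepOp b c g`. Hence all
      -- derivatives of `Ψ` keep its shape, and each raises the degrees of the inner polynomials by
      -- at most one.
      stepOp : ℕ → ℕ → Pol → Pol
      stepOp b c P = (θ P ⊕ ι (n ℕ.* b) · U P) ⊕ ι (n ℕ.* c) · X P

      stepOp-linear : ∀ b c → Linear (stepOp b c)
      stepOp-linear b c = ⊕-linear (⊕-linear θ-linear (∘-linear (·-linear _) (V-linear -1#))) (∘-linear (·-linear _) X-linear)

      iter : ℕ → ℕ → ℕ → Pol → Pol
      iter zero b c P = P
      iter (suc m) b c P = iter m b c (stepOp b c P)

      iter-linear : ∀ m b c → Linear (iter m b c)
      iter-linear zero b c = id-linear
      iter-linear (suc m) b c = ∘-linear (iter-linear m b c) (stepOp-linear b c)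

      ∑P-⊕ : ∀ B f g → ∑P B f ⊕ ∑P B g ≋ ∑P B (λ i → f i ⊕ g i)
      ∑P-⊕ zero f g = ⟪ (λ k → +-identityˡ 0#) ⟫
      ∑P-⊕ (suc B) f g = ≋-trans ⟪ (λ k → ⊞-interchange (at (f 0) k) _ _ _) ⟫ (⊕-cong ≋-refl (∑P-⊕ B _ _))

      θ-Ψ : ∀ g → θ (Ψ g) ≋ Ψ (λ b c → stepOp b c (g b c))
      θ-Ψ g = ≋-trans (L-∑ θ-linear B _) (∑P-cong B λ c → ≋-trans (θ-Uⁿ (n ℕ.* c) _) (L-cong (Uⁿ-linear (n ℕ.* c))
        (≋-trans (⊕-cong (≋-trans (L-∑ θ-linear B _) (∑P-cong B (λ b → θ-Xⁿ (n ℕ.* b) (g b c))))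
                         (L-∑ (∘-linear (·-linear (ι (n ℕ.* c))) X-linear) B _))
         (≋-trans (∑P-⊕ B _ _) (∑P-cong B λ b →
           ≋-trans (⊕-cong ≋-refl (≋-trans (·-cong _ (X-Xⁿ (n ℕ.* b) (g b c))) (≋-sym (L-· (Xⁿ-linear (n ℕ.* b)) _ _))))
                   (≋-sym (L-⊕ (Xⁿ-linear (n ℕ.* b)) _ _)))))))

      comb : F → F → (ℕ → ℕ → Pol) → Pol
      comb s t g = ∑P B (λ c → t ↑ c · ∑P B (λ b → s ↑ b · g b c))

      eval-Uⁿ : ∀ j P z → eval (Uⁿ j P) z ≡ (z ⊞ -1#) ↑ j ⊠ eval P z
      eval-Uⁿ zero P z = sym (*-identityˡ _)
      eval-Uⁿ (suc j) P z = trans (eval-V -1# (Uⁿ j P) z) (trans (cong ((z ⊞ -1#) ⊠_) (eval-Uⁿ j P z)) (sym (*-assoc _ _ _)))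

      eval-Xⁿ : ∀ j P z → eval (Xⁿ j P) z ≡ z ↑ j ⊠ eval P z
      eval-Xⁿ zero P z = sym (*-identityˡ _)
      eval-Xⁿ (suc j) P z = trans (eval-X (Xⁿ j P) z) (trans (cong (z ⊠_) (eval-Xⁿ j P z)) (sym (*-assoc _ _ _)))

      eval-∑ : ∀ B {f g : ℕ → Pol} z → (∀ i → eval (f i) z ≡ eval (g i) z) → eval (∑P B f) z ≡ eval (∑P B g) z
      eval-∑ zero z e = refl
      eval-∑ (suc B) {f} {g} z e = trans (eval-⊕ (f 0) (∑P B (λ i → f (suc i))) z) (trans (cong₂ _⊞_ (e 0) (eval-∑ B {λ i → f (suc i)} {λ i → g (suc i)} z (λ i → e (suc i)))) (sym (eval-⊕ (g 0) (∑P B (λ i → g (suc i))) z)))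

      eval-Ψ : ∀ g z → eval (Ψ g) z ≡ eval (comb (z ↑ n) ((z ⊞ -1#) ↑ n) g) z
      eval-Ψ g z = eval-∑ B z λ c → trans (eval-Uⁿ (n ℕ.* c) _ z) (trans
        (cong₂ _⊠_ (↑-* (z ⊞ -1#) n c) (eval-∑ B z λ b → trans (eval-Xⁿ (n ℕ.* b) (g b c) z) (trans (cong (_⊠ eval (g b c) z) (↑-* z n b)) (sym (eval-· _ (g b c) z)))))
        (sym (eval-· _ _ z)))

      -- The low-degree polynomials `comb` are required to vanish identically, not just at z. These
      -- conditions depend only on the pair (z^n, (z - 1)^n), so they cost the same however many
      -- points share that pair.
      Ψ-vanish : ∀ M z g → (∀ m → m < M → comb (z ↑ n) ((z ⊞ -1#) ↑ n) (λ b c → iter m b c (g b c)) ≋ 𝟘) → Θ.Vanish z M (Ψ g)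
      Ψ-vanish zero z g h = tt
      Ψ-vanish (suc M) z g h = trans (eval-Ψ g z) (trans (eval-cong z (h 0 (s≤s z≤n))) (eval-𝟘 z)) ,
        Θ.v-cong M (≋-sym (θ-Ψ g)) (Ψ-vanish M z (λ b c → stepOp b c (g b c)) (λ m m<M → h (suc m) (s≤s m<M)))

      comb-linear : ∀ s t (L : ℕ → ℕ → Pol → Pol) → (∀ b c → Linear (L b c)) → ∀ (g g′ : ℕ → ℕ → Pol) →
        comb s t (λ b c → L b c (g b c ⊕ -1# · g′ b c)) ≋ comb s t (λ b c → L b c (g b c)) ⊕ -1# · comb s t (λ b c → L b c (g′ b c))
      comb-linear s t L lin g g′ = ≋-trans
        (∑P-cong B λ c → ≋-trans (·-cong (t ↑ c) (≋-trans
            (∑P-cong B λ b → ≋-trans (·-cong (s ↑ b) (≋-trans (L-⊕ (lin b c) _ _) (⊕-cong ≋-refl (L-· (lin b c) _ _)))) (diff (·-linear (s ↑ b)) _ _))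
            (∑-diff B _ _))) (diff (·-linear (t ↑ c)) _ _))
        (∑-diff B _ _)
        where
        diff : ∀ {K} → Linear K → ∀ P Q → K (P ⊕ -1# · Q) ≋ K P ⊕ -1# · K Q
        diff k P Q = ≋-trans (L-⊕ k P _) (⊕-cong ≋-refl (L-· k -1# Q))
        ∑-diff : ∀ B f h → ∑P B (λ i → f i ⊕ -1# · h i) ≋ ∑P B f ⊕ -1# · ∑P B h
        ∑-diff B f h = ≋-trans (≋-sym (∑P-⊕ B f (λ i → -1# · h i))) (⊕-cong ≋-refl (≋-sym (L-∑ (·-linear -1#) B h)))

      deg-· : ∀ {d} c P → Deg≤ d P → Deg≤ d (c · P)
      deg-· c P h = deg≤ λ k le → trans (cong (c ⊠_) (above h k le)) (zeroʳ c)

      deg-⊕ : ∀ {d} P Q → Deg≤ d P → Deg≤ d Q → Deg≤ d (P ⊕ Q)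
      deg-⊕ P Q h h′ = deg≤ λ k le → trans (cong₂ _⊞_ (above h k le) (above h′ k le)) (+-identityˡ 0#)

      deg-∑ : ∀ B d f → (∀ i → i < B → Deg≤ d (f i)) → Deg≤ d (∑P B f)
      deg-∑ zero d f h = deg≤ λ k le → refl
      deg-∑ (suc B) d f h = deg-⊕ _ _ (h 0 (s≤s z≤n)) (deg-∑ B d _ (λ i i<B → h (suc i) (s≤s i<B)))

      deg-mono : ∀ {d e} P → d ≤ e → Deg≤ d P → Deg≤ e P
      deg-mono P d≤e h = deg≤ λ k le → above h k (ℕₚ.≤-trans d≤e le)

      deg-X : ∀ {d} P → Deg≤ d P → Deg≤ (suc d) (X P)
      deg-X P h = deg≤ λ { (suc k) (s≤s le) → above h k le }

      deg-V : ∀ {d} w P → Deg≤ d P → Deg≤ (suc d) (V w P)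
      deg-V {d} w P h = deg-⊕ (X P) (w · P) (deg-X P h) (deg-mono (w · P) (ℕₚ.n≤1+n d) (deg-· w P h))

      deg-δ : ∀ {d} P → Deg≤ d P → Deg≤ d (δ P)
      deg-δ P h = deg≤ λ k le → trans (cong (ι k ⊠_) (above h k le)) (zeroʳ _)

      deg-Xⁿ : ∀ {d} j P → Deg≤ d P → Deg≤ (j ℕ.+ d) (Xⁿ j P)
      deg-Xⁿ zero P h = h
      deg-Xⁿ (suc j) P h = deg-X (Xⁿ j P) (deg-Xⁿ j P h)

      deg-Uⁿ : ∀ {d} j P → Deg≤ d P → Deg≤ (j ℕ.+ d) (Uⁿ j P)
      deg-Uⁿ zero P h = h
      deg-Uⁿ (suc j) P h = deg-V -1# (Uⁿ j P) (deg-Uⁿ j P h)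

      deg-step : ∀ {d} b c P → Deg≤ d P → Deg≤ (suc d) (stepOp b c P)
      deg-step {d} b c P h = deg-⊕ _ _ (deg-⊕ _ _ (deg-V -1# (δ P) (deg-δ P h)) (deg-· _ _ (deg-V -1# P h))) (deg-· _ _ (deg-X P h))

      deg-iter : ∀ {d} m b c P → Deg≤ d P → Deg≤ (m ℕ.+ d) (iter m b c P)
      deg-iter zero b c P h = h
      deg-iter {d} (suc m) b c P h = subst (λ e → Deg≤ e (iter m b c (stepOp b c P))) (ℕₚ.+-suc m d) (deg-iter m b c (stepOp b c P) (deg-step b c P h))

      deg-comb : ∀ {d} s t g → (∀ b c → Deg≤ d (g b c)) → Deg≤ d (comb s t g)
      deg-comb {d} s t g h = deg-∑ B d _ λ c _ → deg-· _ _ (deg-∑ B d _ λ b _ → deg-· _ _ (h b c))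

      deg-Ψ : ∀ {A} g → (∀ b c → Deg≤ A (g b c)) → Deg≤ (n ℕ.* B ℕ.+ (n ℕ.* B ℕ.+ A)) (Ψ g)
      deg-Ψ {A} g h = deg-∑ B _ _ λ c c<B → deg-mono _ (ℕₚ.+-monoˡ-≤ _ (ℕₚ.*-monoʳ-≤ n (ℕₚ.<⇒≤ c<B))) (deg-Uⁿ (n ℕ.* c) _
        (deg-∑ B _ _ λ b b<B → deg-mono _ (ℕₚ.+-monoˡ-≤ A (ℕₚ.*-monoʳ-≤ n (ℕₚ.<⇒≤ b<B))) (deg-Xⁿ (n ℕ.* b) _ (h b c))))

-- Stepanov's method: a nonzero auxiliary polynomial and its zeros.

module StepanovMethod where

  open import Data.Nat as ℕ using (ℕ; zero; suc; _∸_; _≤_; _<_; s≤s)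
  import Data.Nat.Properties as ℕₚ
  open import Data.Fin using (Fin; toℕ; fromℕ<; combine; remQuot; funToFin; finToFun)
  import Data.Fin as Fin
  open import Data.Fin.Properties using (pigeonhole; funToFin-finToFin; finToFun-funToFin; combine-remQuot; remQuot-combine; fromℕ<-toℕ; toℕ<n)
  import Data.Fin.Properties as Finₚ
  open import Data.List using (List; []; _∷_; length; _++_; map; upTo)
  open import Data.List.Properties using (length-++; length-map; length-upTo)
  open import Data.List.Relation.Unary.All using (All; []; _∷_)
  import Data.List.Relation.Unary.All as All
  import Data.List.Relation.Unary.All.Properties as Allₚ
  open import Data.List.Relation.Unary.AllPairs using (AllPairs; []; _∷_)
  open import Data.List.Membership.Propositional using (_∈_; _∉_)
  open import Data.List.Membership.Propositional.Properties using (∈-++⁺ˡ; ∈-++⁺ʳ; ∈-map⁺; ∈-upTo⁺; ∈-upTo⁻)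
  open import Data.Product using (∃; _×_; _,_; proj₁; proj₂)
  open import Data.Unit using (tt)
  open import Data.Empty using (⊥; ⊥-elim)
  open import Relation.Nullary using (¬_; Dec; yes; no)
  open import Relation.Binary.PropositionalEquality
  open PrimeFields
  open FieldArithmetic
  open PolynomialVanishing
  open StepanovPolynomials

  module StepanovBound {p : ℕ} (𝔽 : PrimeField p) where
    open FieldLemmas 𝔽
    open Polynomials 𝔽
    open Stepanov 𝔽
    open Linear

    -1≢0 : -1# ≢ 0#
    -1≢0 e = 1≢0 (trans (sym -1*-1) (trans (cong (_⊠ -1#) e) (zeroˡ _)))

    U-injective : ∀ P → U P ≋ 𝟘 → P ≋ 𝟘
    U-injective P e = ⟪ go ⟫
      where
      go : ∀ k → at P k ≡ 0#
      go zero = ⊠≡0 -1≢0 (trans (sym (+-identityˡ _)) (at-≡ e 0))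
      go (suc k) = ⊠≡0 -1≢0 (trans (sym (+-identityˡ _)) (trans (cong (_⊞ -1# ⊠ at P (suc k)) (sym (go k))) (at-≡ e (suc k))))

    Uⁿ-injective : ∀ k P → Uⁿ k P ≋ 𝟘 → P ≋ 𝟘
    Uⁿ-injective zero P e = e
    Uⁿ-injective (suc k) P e = Uⁿ-injective k P (U-injective (Uⁿ k P) e)

    Uⁿ-+ : ∀ a b P → Uⁿ (a ℕ.+ b) P ≋ Uⁿ a (Uⁿ b P)
    Uⁿ-+ zero b P = ≋-refl
    Uⁿ-+ (suc a) b P = V-cong -1# (Uⁿ-+ a b P)

    Xⁿ-+ : ∀ a b P → Xⁿ (a ℕ.+ b) P ≋ Xⁿ a (Xⁿ b P)
    Xⁿ-+ zero b P = ≋-refl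
    Xⁿ-+ (suc a) b P = X-cong (Xⁿ-+ a b P)

    ≡⇒≋ : ∀ {P Q} → P ≡ Q → P ≋ Q
    ≡⇒≋ refl = ≋-refl

    δv-Uⁿ : ∀ n P → Δ.Vanish 1# n (Uⁿ n P)
    δv-Uⁿ zero P = tt
    δv-Uⁿ (suc n) P = δv-U n (δv-Uⁿ n P)

    δv-≤ : ∀ {z P} M N → N ≤ M → Δ.Vanish z M P → Δ.Vanish z N P
    δv-≤ M zero le v = tt
    δv-≤ (suc M) (suc N) (s≤s le) (v , vs) = v , δv-≤ M N le vs

    ⊕≋𝟘 : ∀ {P Q} → P ⊕ Q ≋ 𝟘 → P ≋ -1# · Q
    ⊕≋𝟘 {P} {Q} e = ⟪ (λ k → begin
      at P k ≡⟨ cancelʳ (at Q k) (at P k) ⟨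
      (at Q k ⊞ at P k) ⊞ -1# ⊠ at Q k ≡⟨ cong (_⊞ -1# ⊠ at Q k) (trans (+-comm _ _) (at-≡ e k)) ⟩
      0# ⊞ -1# ⊠ at Q k ≡⟨ +-identityˡ _ ⟩
      -1# ⊠ at Q k ∎) ⟫
      where open ≡-Reasoning

    cancel-𝟘ˡ : ∀ {P Q} → P ⊕ Q ≋ 𝟘 → P ≋ 𝟘 → Q ≋ 𝟘
    cancel-𝟘ˡ {P} {Q} e e′ = ⟪ (λ k → trans (sym (+-identityˡ _)) (trans (cong (_⊞ at Q k) (sym (at-≡ e′ k))) (at-≡ e k))) ⟫

    -- The lowest term P₀ equals a multiple of (x - 1)^n, so it vanishes to order n at 1 and is zero
    -- by hypothesis. Then (x - 1)^n is divided out of the remaining terms.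
    uncouple : ∀ n B (P : ℕ → Pol) → (∀ c → Δ.Vanish 1# n (P c) → P c ≋ 𝟘) →
      ∑P B (λ c → Uⁿ (n ℕ.* c) (P c)) ≋ 𝟘 → ∀ c → c < B → P c ≋ 𝟘
    uncouple n (suc B) P sp e = λ { zero _ → P0 ; (suc c) (s≤s c<B) → uncouple n B (λ i → P (suc i)) (λ i → sp (suc i)) Y≋0 c c<B }
      where
      Y = ∑P B (λ i → Uⁿ (n ℕ.* i) (P (suc i)))
      split : P 0 ⊕ Uⁿ n Y ≋ 𝟘
      split = ≋-trans (⊕-cong (≡⇒≋ (cong (λ j → Uⁿ j (P 0)) (sym (ℕₚ.*-zeroʳ n))))
        (≋-trans (L-∑ (Uⁿ-linear n) B _) (∑P-cong B λ i → ≋-trans (≋-sym (Uⁿ-+ n (n ℕ.* i) (P (suc i)))) (≡⇒≋ (cong (λ j → Uⁿ j (P (suc i))) (sym (ℕₚ.*-suc n i))))))) e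
      P0 : P 0 ≋ 𝟘
      P0 = sp 0 (Δ.v-cong n (≋-sym (⊕≋𝟘 split)) (Δ.v-· n -1# (δv-Uⁿ n Y)))
      Y≋0 : Y ≋ 𝟘
      Y≋0 = Uⁿ-injective n Y (cancel-𝟘ˡ split P0)

    -- Since A ≤ n, the blocks x^(nb) g_b do not overlap: their sum involves at most AB exponents
    -- and determines every g_b.
    module Blocks (n A : ℕ) (A≤n : A ≤ n) where

      blocks : ℕ → (ℕ → Pol) → Pol
      blocks zero g = 𝟘
      blocks (suc B) g = g 0 ⊕ Xⁿ n (blocks B (λ b → g (suc b)))

      ∑≋blocks : ∀ B g → ∑P B (λ b → Xⁿ (n ℕ.* b) (g b)) ≋ blocks B g
      ∑≋blocks zero g = ≋-refl
      ∑≋blocks (suc B) g = ⊕-cong (≡⇒≋ (cong (λ j → Xⁿ j (g 0)) (ℕₚ.*-zeroʳ n)))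
        (≋-trans (∑P-cong B λ i → ≋-trans (≡⇒≋ (cong (λ j → Xⁿ j (g (suc i))) (ℕₚ.*-suc n i))) (Xⁿ-+ n (n ℕ.* i) (g (suc i))))
         (≋-trans (≋-sym (L-∑ (Xⁿ-linear n) B _)) (L-cong (Xⁿ-linear n) (∑≋blocks B (λ b → g (suc b))))))

      exponents : ℕ → List ℕ
      exponents zero = []
      exponents (suc B) = upTo A ++ map (n ℕ.+_) (exponents B)

      length-exponents : ∀ B → length (exponents B) ≡ B ℕ.* A
      length-exponents zero = refl
      length-exponents (suc B) = trans (length-++ (upTo A)) (cong₂ ℕ._+_ (length-upTo A) (trans (length-map (n ℕ.+_) (exponents B)) (length-exponents B)))

      exponents-bounded : ∀ B → All (_< B ℕ.* n) (exponents B)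
      exponents-bounded zero = []
      exponents-bounded (suc B) = Allₚ.++⁺ (All.tabulate (λ k∈ → ℕₚ.<-≤-trans (∈-upTo⁻ k∈) (ℕₚ.≤-trans A≤n (ℕₚ.m≤m+n n (B ℕ.* n)))))
        (Allₚ.map⁺ (All.map (ℕₚ.+-monoʳ-< n) (exponents-bounded B)))

      at-Xⁿ-low : ∀ j P k → k < j → at (Xⁿ j P) k ≡ 0#
      at-Xⁿ-low (suc j) P zero _ = refl
      at-Xⁿ-low (suc j) P (suc k) (s≤s lt) = at-Xⁿ-low j P k lt

      at-Xⁿ-high : ∀ j P k → at (Xⁿ j P) (j ℕ.+ k) ≡ at P k
      at-Xⁿ-high zero P k = refl
      at-Xⁿ-high (suc j) P k = at-Xⁿ-high j P k

      support : ∀ B g → (∀ b → Deg≤ A (g b)) → ∀ k → k ∉ exponents B → at (blocks B g) k ≡ 0#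
      support zero g deg k k∉ = refl
      support (suc B) g deg k k∉ = trans (cong₂ _⊞_ (above (deg 0) k (ℕₚ.≮⇒≥ λ k<A → k∉ (∈-++⁺ˡ (∈-upTo⁺ k<A)))) (tail (k ℕ.<? n))) (+-identityˡ 0#)
        where
        rest = blocks B (λ b → g (suc b))
        tail : Dec (k < n) → at (Xⁿ n rest) k ≡ 0#
        tail (yes k<n) = at-Xⁿ-low n rest k k<n
        tail (no k≮n) = trans (cong (at (Xⁿ n rest)) (sym n+k′)) (trans (at-Xⁿ-high n rest (k ∸ n))
          (support B (λ b → g (suc b)) (λ b → deg (suc b)) (k ∸ n) λ k′∈ → k∉ (∈-++⁺ʳ (upTo A) (subst (_∈ map (n ℕ.+_) (exponents B)) n+k′ (∈-map⁺ (n ℕ.+_) k′∈)))))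
          where
          n+k′ : n ℕ.+ (k ∸ n) ≡ k
          n+k′ = ℕₚ.m+[n∸m]≡n (ℕₚ.≮⇒≥ k≮n)

      extract : ∀ B g → (∀ b → Deg≤ A (g b)) → blocks B g ≋ 𝟘 → ∀ b → b < B → g b ≋ 𝟘
      extract (suc B) g deg e = λ { zero _ → g0 ; (suc b) (s≤s b<B) → extract B (λ i → g (suc i)) (λ i → deg (suc i)) rest≋0 b b<B }
        where
        rest = blocks B (λ b → g (suc b))
        go : ∀ k → Dec (k < n) → at (g 0) k ≡ 0#
        go k (yes k<n) = trans (sym (+-identityʳ _)) (trans (cong (at (g 0) k ⊞_) (sym (at-Xⁿ-low n rest k k<n))) (at-≡ e k))
        go k (no k≮n) = above (deg 0) k (ℕₚ.≤-trans A≤n (ℕₚ.≮⇒≥ k≮n))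
        g0 : g 0 ≋ 𝟘
        g0 = ⟪ (λ k → go k (k ℕ.<? n)) ⟫
        rest≋0 : rest ≋ 𝟘
        rest≋0 = ⟪ (λ k → trans (sym (at-Xⁿ-high n rest k)) (at-≡ (cancel-𝟘ˡ e g0) (n ℕ.+ k))) ⟫

    -- AB ≤ n and nB ≤ p bring the inner sums within reach of `sparse`: at most n exponents, all
    -- below p. The inequality `few` says that the h · A · 2A scalar conditions are outnumbered by
    -- the AB² coefficients.
    module Construction (n A B : ℕ) (0<A : 0 < A) (AB≤n : A ℕ.* B ≤ n) (nB≤p : n ℕ.* B ≤ p) (A≤n : A ≤ n) (n<p : n < p)
      (h : ℕ) (few : h ℕ.* (A ℕ.* (A ℕ.+ A)) < A ℕ.* B ℕ.* B) (s t : Fin h → F) where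

      open Auxiliary n B
      open Blocks n A A≤n

      -- Rests on the fact that no nonzero Σ_b x^(nb) g_b, having at most n exponents, can be
      -- divisible by (x - 1)^n.
      Ψ-injective : ∀ g → (∀ b c → Deg≤ A (g b c)) → Ψ g ≋ 𝟘 → ∀ b c → b < B → c < B → g b c ≋ 𝟘
      Ψ-injective g deg e b c b<B c<B = extract B (λ b → g b c) (λ b → deg b c)
        (≋-trans (≋-sym (∑≋blocks B (λ b → g b c))) (uncouple n B _ sp e c c<B)) b b<B
        where
        len≤n : length (exponents B) ≤ n
        len≤n = subst (_≤ n) (trans (ℕₚ.*-comm A B) (sym (length-exponents B))) AB≤n
        sp : ∀ c → Δ.Vanish 1# n (∑P B (λ b → Xⁿ (n ℕ.* b) (g b c))) → ∑P B (λ b → Xⁿ (n ℕ.* b) (g b c)) ≋ 𝟘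
        sp c v = ≋-trans (∑≋blocks B _) (sparse (exponents B) _
          (All.map (λ lt → ℕₚ.<-≤-trans lt (subst (_≤ p) (ℕₚ.*-comm n B) nB≤p)) (exponents-bounded B))
          (support B (λ b → g b c) (λ b → deg b c)) (δv-≤ n _ len≤n (Δ.v-cong n (∑≋blocks B _) v)))

      Coefs : Set
      Coefs = Fin (A ℕ.* B ℕ.* B) → F

      pick : Coefs → ∀ {a b c} → Dec (a < A) → Dec (b < B) → Dec (c < B) → F
      pick f (yes a<) (yes b<) (yes c<) = f (combine (combine (fromℕ< a<) (fromℕ< b<)) (fromℕ< c<))
      pick f (no _) _ _ = 0#
      pick f (yes _) (no _) _ = 0#
      pick f (yes _) (yes _) (no _) = 0#

      coef : Coefs → ℕ → ℕ → ℕ → F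
      coef f a b c = pick f (a ℕ.<? A) (b ℕ.<? B) (c ℕ.<? B)

      pick-high : ∀ f {a b c} (da : Dec (a < A)) (db : Dec (b < B)) (dc : Dec (c < B)) → A ≤ a → pick f da db dc ≡ 0#
      pick-high f (yes a<) _ _ le = ⊥-elim (ℕₚ.<⇒≱ a< le)
      pick-high f (no _) _ _ le = refl

      pick-fin : ∀ f i j k (da : Dec (toℕ i < A)) (db : Dec (toℕ j < B)) (dc : Dec (toℕ k < B)) → pick f da db dc ≡ f (combine (combine i j) k)
      pick-fin f i j k (yes a<) (yes b<) (yes c<) = cong₂ (λ u v → f (combine u v)) (cong₂ combine (fromℕ<-toℕ i a<) (fromℕ<-toℕ j b<)) (fromℕ<-toℕ k c<)
      pick-fin f i j k (no a≮) _ _ = ⊥-elim (a≮ (toℕ<n i))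
      pick-fin f i j k (yes _) (no b≮) _ = ⊥-elim (b≮ (toℕ<n j))
      pick-fin f i j k (yes _) (yes _) (no c≮) = ⊥-elim (c≮ (toℕ<n k))

      g : Coefs → ℕ → ℕ → Pol
      at (g f b c) a = coef f a b c
      bound (g f b c) = A
      vanish (g f b c) a le = pick-high f (a ℕ.<? A) (b ℕ.<? B) (c ℕ.<? B) le

      condition : Coefs → Fin h → ℕ → ℕ → F
      condition f i m k = at (comb (s i) (t i) (λ b c → iter m b c (g f b c))) k

      -- For m < A the m-th derivative has inner degrees below 2A, so A + A coefficients for each of
      -- the h pairs and each order m < A determine everything that must vanish.
      conditions : Coefs → Fin (h ℕ.* (A ℕ.* (A ℕ.+ A))) → F
      conditions f idx = condition f (proj₁ r) (toℕ (proj₁ r′)) (toℕ (proj₂ r′))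
        where
        r = remQuot {h} (A ℕ.* (A ℕ.+ A)) idx
        r′ = remQuot {A} (A ℕ.+ A) (proj₂ r)

      conditions-combine : ∀ f (i : Fin h) (m : Fin A) (k : Fin (A ℕ.+ A)) → conditions f (combine i (combine m k)) ≡ condition f i (toℕ m) (toℕ k)
      conditions-combine f i m k = trans
        (cong (λ r → condition f (proj₁ r) (toℕ (proj₁ (remQuot {A} (A ℕ.+ A) (proj₂ r)))) (toℕ (proj₂ (remQuot {A} (A ℕ.+ A) (proj₂ r))))) (remQuot-combine {h} {A ℕ.* (A ℕ.+ A)} i (combine m k)))
        (cong (λ r′ → condition f i (toℕ (proj₁ r′)) (toℕ (proj₂ r′))) (remQuot-combine {A} {A ℕ.+ A} m k))

      1<p : 1 < p
      1<p = ℕₚ.≤-<-trans (ℕₚ.≤-trans 0<A A≤n) n<p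

      -- Pigeonhole in place of linear algebra: the coefficient vectors outnumber the possible
      -- condition vectors, so two of them satisfy the same conditions, and their difference is a
      -- nonzero solution of the homogeneous system.
      collision : ∃ λ f → ∃ λ f′ → (∀ idx → conditions f idx ≡ conditions f′ idx) × ¬ (∀ x → f x ≡ f′ x)
      collision with pigeonhole (ℕₚ.^-monoʳ-< p 1<p few) (λ v → funToFin (conditions (finToFun {p} {A ℕ.* B ℕ.* B} v)))
      ... | v , v′ , v<v′ , eq = finToFun v , finToFun v′ ,
        (λ idx → trans (sym (finToFun-funToFin (conditions (finToFun v)) idx)) (trans (cong (λ w → finToFun w idx) eq) (finToFun-funToFin (conditions (finToFun v′)) idx))) ,
        λ same → ℕₚ.<⇒≢ v<v′ (cong toℕ (trans (sym (funToFin-finToFin {A ℕ.* B ℕ.* B} {p} v)) (trans (funToFin-≗ (A ℕ.* B ℕ.* B) same) (funToFin-finToFin {A ℕ.* B ℕ.* B} {p} v′))))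
        where
        funToFin-≗ : ∀ m {k} {f f′ : Fin m → Fin k} → (∀ x → f x ≡ f′ x) → funToFin f ≡ funToFin f′
        funToFin-≗ zero e = refl
        funToFin-≗ (suc m) e = cong₂ combine (e Fin.zero) (funToFin-≗ m (λ x → e (Fin.suc x)))

      -- Otherwise `Ψ` of the difference, vanishing to order A at every point of W, has as many
      -- zeros as its degree bound and is zero by `zero-count`. By `Ψ-injective` the two colliding
      -- coefficient vectors would then agree.
      bound-zeros : ∀ W → AllPairs _≢_ W → All Regular W → All (λ z → ∃ λ i → z ↑ n ≡ s i × (z ⊞ -1#) ↑ n ≡ t i) W →
        A ℕ.* length W < n ℕ.* B ℕ.+ (n ℕ.* B ℕ.+ A)
      bound-zeros W distinct regular covered = ℕₚ.≰⇒> λ enough → main collision W distinct regular covered enough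
        where
        main : (∃ λ f → ∃ λ f′ → (∀ idx → conditions f idx ≡ conditions f′ idx) × ¬ (∀ x → f x ≡ f′ x)) →
          ∀ W → AllPairs _≢_ W → All Regular W → All (λ z → ∃ λ i → z ↑ n ≡ s i × (z ⊞ -1#) ↑ n ≡ t i) W →
          n ℕ.* B ℕ.+ (n ℕ.* B ℕ.+ A) ≤ A ℕ.* length W → ⊥
        main (f , f′ , same , differ) W distinct regular covered enough = differ λ x → subst (λ y → f y ≡ f′ y) (assemble x) (coefs-agree x)
          where
          G : ℕ → ℕ → Pol
          G b c = g f b c ⊕ -1# · g f′ b c
          degG : ∀ b c → Deg≤ A (G b c)
          degG b c = deg-⊕ (g f b c) (-1# · g f′ b c) (Deg≤-bound (g f b c)) (Deg≤-bound (-1# · g f′ b c))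
          degI : ∀ f m → m < A → ∀ i → Deg≤ (A ℕ.+ A) (comb (s i) (t i) (λ b c → iter m b c (g f b c)))
          degI f m m<A i = deg-mono _ (ℕₚ.+-monoˡ-≤ A (ℕₚ.<⇒≤ m<A)) (deg-comb (s i) (t i) _ (λ b c → deg-iter m b c (g f b c) (Deg≤-bound (g f b c))))
          agree : ∀ i m → m < A → ∀ k → Dec (k < A ℕ.+ A) → condition f i m k ≡ condition f′ i m k
          agree i m m<A k (yes k<) = trans (sym (idx f)) (trans (same (combine i (combine (fromℕ< m<A) (fromℕ< k<)))) (idx f′))
            where
            idx : ∀ f → conditions f (combine i (combine (fromℕ< m<A) (fromℕ< k<))) ≡ condition f i m k
            idx f = trans (conditions-combine f i (fromℕ< m<A) (fromℕ< k<)) (cong₂ (condition f i) (Finₚ.toℕ-fromℕ< m<A) (Finₚ.toℕ-fromℕ< k<))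
          agree i m m<A k (no k≮) = trans (above (degI f m m<A i) k (ℕₚ.≮⇒≥ k≮)) (sym (above (degI f′ m m<A i) k (ℕₚ.≮⇒≥ k≮)))
          comb≋0 : ∀ i m → m < A → comb (s i) (t i) (λ b c → iter m b c (G b c)) ≋ 𝟘
          comb≋0 i m m<A = ≋-trans (comb-linear (s i) (t i) (iter m) (iter-linear m) (g f) (g f′))
            ⟪ (λ k → trans (cong (λ a → a ⊞ -1# ⊠ condition f′ i m k) (agree i m m<A k (k ℕ.<? A ℕ.+ A))) (x+-1x _)) ⟫
          vanishes : ∀ {z} → (∃ λ i → z ↑ n ≡ s i × (z ⊞ -1#) ↑ n ≡ t i) → Θ.Vanish z A (Ψ G)
          vanishes {z} (i , es , et) = Ψ-vanish A z G λ m m<A →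
            ≋-trans (≡⇒≋ (cong₂ (λ u v → comb u v (λ b c → iter m b c (G b c))) es et)) (comb≋0 i m m<A)
          finish : ∀ W → AllPairs _≢_ W → All Regular W → All (λ z → ∃ λ i → z ↑ n ≡ s i × (z ⊞ -1#) ↑ n ≡ t i) W →
            n ℕ.* B ℕ.+ (n ℕ.* B ℕ.+ A) ≤ A ℕ.* length W → Ψ G ≋ 𝟘
          finish [] _ _ _ le = ⊥-elim (ℕₚ.<⇒≱ 0<A (ℕₚ.≤-trans (ℕₚ.m≤n+m A (n ℕ.* B)) (ℕₚ.≤-trans (ℕₚ.m≤n+m _ (n ℕ.* B)) (subst (n ℕ.* B ℕ.+ (n ℕ.* B ℕ.+ A) ≤_) (ℕₚ.*-zeroʳ A) le))))
          finish (z ∷ W) (zW ∷ dW) (rz ∷ rW) (cz ∷ cW) le = zero-count _ (Ψ G) A A z W (deg-Ψ G degG) ℕₚ.≤-refl (ℕₚ.<⇒≤ (ℕₚ.≤-<-trans A≤n n<p)) rz rW zW dW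
            (vanishes cz) (All.map vanishes cW) (subst (n ℕ.* B ℕ.+ (n ℕ.* B ℕ.+ A) ≤_) (ℕₚ.*-suc A (length W)) le)
          Ψ≋0 : Ψ G ≋ 𝟘
          Ψ≋0 = finish W distinct regular covered enough
          q : Fin (A ℕ.* B ℕ.* B) → Fin (A ℕ.* B) × Fin B
          q x = remQuot {A ℕ.* B} B x
          q′ : Fin (A ℕ.* B ℕ.* B) → Fin A × Fin B
          q′ x = remQuot {A} B (proj₁ (q x))
          re : Fin (A ℕ.* B ℕ.* B) → Fin (A ℕ.* B ℕ.* B)
          re x = combine (combine (proj₁ (q′ x)) (proj₂ (q′ x))) (proj₂ (q x))
          assemble : ∀ x → re x ≡ x
          assemble x = trans (cong (λ u → combine u (proj₂ (q x))) (combine-remQuot {A} B (proj₁ (q x)))) (combine-remQuot {A ℕ.* B} B x)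
          coefs-agree : ∀ x → f (re x) ≡ f′ (re x)
          coefs-agree x = trans (sym (pick-fin f i j k (toℕ i ℕ.<? A) (toℕ j ℕ.<? B) (toℕ k ℕ.<? B)))
            (trans (x-y≡0⇒x≡y (at-≡ (Ψ-injective G degG Ψ≋0 (toℕ j) (toℕ k) (toℕ<n j) (toℕ<n k)) (toℕ i)))
              (pick-fin f′ i j k (toℕ i ℕ.<? A) (toℕ j ℕ.<? B) (toℕ k ℕ.<? B)))
            where
            i = proj₁ (q′ x)
            j = proj₂ (q′ x)
            k = proj₂ (q x)

-- Finite sums, indicators and Cauchy-Schwarz inequalities.

module FiniteSums where

  open import Data.Nat using (ℕ; zero; suc; _+_; _*_; _∸_; _≤_; z≤n; _≤?_)
  open import Data.Nat.Properties
  open import Data.Nat.Solver using (module +-*-Solver)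
  open import Data.Fin as Fin using (Fin)
  import Data.Fin.Properties as Finₚ
  open import Data.Fin.Permutation using (permutation)
  open import Data.Nat.ListAction using (sum)
  open import Data.List as List using (List; []; _∷_; length; filter; allFin; concatMap; map; _++_)
  open import Data.Product using (∃; _×_; _,_; proj₁; proj₂)
  open import Data.Sum using (inj₁; inj₂)
  open import Data.Empty using (⊥-elim)
  open import Relation.Nullary using (¬_; Dec; yes; no)
  open import Relation.Binary.PropositionalEquality
  import Algebra.Properties.Semiring.Sum as Sum

  module ∑ℕ = Sum +-*-semiring

  abstract
    ∑ : ∀ {m} → (Fin m → ℕ) → ℕ
    ∑ f = ∑ℕ.sum f

    ∑-cong : ∀ {m} {f g : Fin m → ℕ} → (∀ i → f i ≡ g i) → ∑ f ≡ ∑ g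
    ∑-cong = ∑ℕ.sum-cong-≗

    ∑-mono : ∀ {m} {f g : Fin m → ℕ} → (∀ i → f i ≤ g i) → ∑ f ≤ ∑ g
    ∑-mono {zero} h = z≤n
    ∑-mono {suc m} h = +-mono-≤ (h Fin.zero) (∑-mono (λ i → h (Fin.suc i)))

    ∑-+ : ∀ {m} (f g : Fin m → ℕ) → ∑ (λ i → f i + g i) ≡ ∑ f + ∑ g
    ∑-+ = ∑ℕ.∑-distrib-+

    ∑-*ˡ : ∀ {m} c (f : Fin m → ℕ) → ∑ (λ i → c * f i) ≡ c * ∑ f
    ∑-*ˡ c f = sym (∑ℕ.*-distribˡ-sum c f)

    ∑-*ʳ : ∀ {m} c (f : Fin m → ℕ) → ∑ (λ i → f i * c) ≡ ∑ f * c
    ∑-*ʳ c f = sym (∑ℕ.*-distribʳ-sum c f)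

    ∑-swap : ∀ {m k} (f : Fin m → Fin k → ℕ) → ∑ (λ i → ∑ (λ j → f i j)) ≡ ∑ (λ j → ∑ (λ i → f i j))
    ∑-swap = ∑ℕ.∑-comm

    ∑-bij : ∀ {m k} (f : Fin k → ℕ) (φ : Fin m → Fin k) (ψ : Fin k → Fin m) →
      (∀ x → φ (ψ x) ≡ x) → (∀ x → ψ (φ x) ≡ x) → ∑ (λ i → f (φ i)) ≡ ∑ f
    ∑-bij f φ ψ r l = sym (∑ℕ.sum-permute f (permutation φ ψ r l))

    ∑-const : ∀ {m} c → ∑ {m} (λ _ → c) ≡ m * c
    ∑-const {zero} c = refl
    ∑-const {suc m} c = cong (c +_) (∑-const {m} c)

    ∑-nil : (f : Fin 0 → ℕ) → ∑ f ≡ 0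
    ∑-nil f = refl

    ∑-suc : ∀ {m} (f : Fin (suc m) → ℕ) → ∑ f ≡ f Fin.zero + ∑ (λ i → f (Fin.suc i))
    ∑-suc f = refl

    ∑-term : ∀ {m} (f : Fin m → ℕ) i → f i ≤ ∑ f
    ∑-term {suc m} f Fin.zero = m≤m+n (f Fin.zero) _
    ∑-term {suc m} f (Fin.suc i) = ≤-trans (∑-term (λ j → f (Fin.suc j)) i) (m≤n+m _ (f Fin.zero))


  ∑-zero : ∀ {m} {f : Fin m → ℕ} → (∀ i → f i ≡ 0) → ∑ f ≡ 0
  ∑-zero {m} {f} h = trans (∑-cong {f = f} h) (trans (∑-const {m} 0) (*-zeroʳ m))

  ∑-single : ∀ {m} (f : Fin m → ℕ) i → (∀ j → j ≢ i → f j ≡ 0) → ∑ f ≡ f i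
  ∑-single {suc m} f Fin.zero h = trans (∑-suc f) (trans (cong (f Fin.zero +_) (∑-zero (λ j → h (Fin.suc j) (λ ())))) (+-identityʳ _))
  ∑-single {suc m} f (Fin.suc i) h = trans (∑-suc f) (trans (cong (_+ ∑ (λ j → f (Fin.suc j))) (h Fin.zero (λ ())))
    (∑-single (λ j → f (Fin.suc j)) i (λ j ne → h (Fin.suc j) (λ e → ne (Finₚ.suc-injective e)))))

  -- Selects a dominating dyadic level, at the cost of a factor equal to the number of levels.
  ∑-max : ∀ {m} (f : Fin (suc m) → ℕ) → ∃ λ i → (∀ j → f j ≤ f i) × ∑ f ≤ suc m * f i
  ∑-max {m} f = i , big , ≤-trans (∑-mono big) (≤-reflexive (∑-const {suc m} (f i)))
    where
    go : ∀ {m} (f : Fin (suc m) → ℕ) → ∃ λ i → ∀ j → f j ≤ f i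
    go {zero} f = Fin.zero , λ { Fin.zero → ≤-refl }
    go {suc m} f with go (λ j → f (Fin.suc j))
    ... | i , h with f (Fin.suc i) ≤? f Fin.zero
    ... | yes le = Fin.zero , λ { Fin.zero → ≤-refl ; (Fin.suc j) → ≤-trans (h j) le }
    ... | no ≰ = Fin.suc i , λ { Fin.zero → <⇒≤ (≰⇒> ≰) ; (Fin.suc j) → h j }
    i = proj₁ (go f)
    big = proj₂ (go f)

  ⟦_⟧ : ∀ {a} {A : Set a} → Dec A → ℕ
  ⟦ yes _ ⟧ = 1
  ⟦ no _ ⟧ = 0

  ⟦⟧≤1 : ∀ {a} {A : Set a} (d : Dec A) → ⟦ d ⟧ ≤ 1
  ⟦⟧≤1 (yes _) = ≤-refl
  ⟦⟧≤1 (no _) = z≤n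

  ⟦⟧-yes : ∀ {a} {A : Set a} (d : Dec A) → A → ⟦ d ⟧ ≡ 1
  ⟦⟧-yes (yes _) a = refl
  ⟦⟧-yes (no ¬a) a = ⊥-elim (¬a a)

  ⟦⟧-no : ∀ {a} {A : Set a} (d : Dec A) → ¬ A → ⟦ d ⟧ ≡ 0
  ⟦⟧-no (yes a) ¬a = ⊥-elim (¬a a)
  ⟦⟧-no (no _) ¬a = refl

  ⟦⟧-mono : ∀ {a b} {A : Set a} {B : Set b} (d : Dec A) (e : Dec B) → (A → B) → ⟦ d ⟧ ≤ ⟦ e ⟧
  ⟦⟧-mono (yes a) e f = ≤-reflexive (sym (⟦⟧-yes e (f a)))
  ⟦⟧-mono (no _) e f = z≤n

  ⟦⟧-iff : ∀ {a b} {A : Set a} {B : Set b} (d : Dec A) (e : Dec B) → (A → B) → (B → A) → ⟦ d ⟧ ≡ ⟦ e ⟧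
  ⟦⟧-iff d e f g = ≤-antisym (⟦⟧-mono d e f) (⟦⟧-mono e d g)

  ∑-at-most-one : ∀ {m} {P : Fin m → Set} (d : ∀ i → Dec (P i)) (e : Dec (∃ P)) →
    (∀ i j → P i → P j → i ≡ j) → ∑ (λ i → ⟦ d i ⟧) ≤ ⟦ e ⟧
  ∑-at-most-one d (yes (i , pi)) uniq = ≤-trans (≤-reflexive (∑-single (λ j → ⟦ d j ⟧) i (λ j ne → ⟦⟧-no (d j) (λ pj → ne (uniq j i pj pi))))) (⟦⟧≤1 (d i))
  ∑-at-most-one d (no ¬e) uniq = ≤-reflexive (∑-zero (λ i → ⟦⟧-no (d i) (λ pi → ¬e (i , pi))))

  ∑ˡ : ∀ {A : Set} → List A → (A → ℕ) → ℕ
  ∑ˡ xs f = sum (map f xs)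

  length-filter : ∀ {A : Set} {P : A → Set} (d : ∀ x → Dec (P x)) xs → length (filter d xs) ≡ ∑ˡ xs (λ x → ⟦ d x ⟧)
  length-filter d [] = refl
  length-filter d (x ∷ xs) with d x
  ... | yes _ = cong suc (length-filter d xs)
  ... | no _ = length-filter d xs

  ∑ˡ-filter : ∀ {A : Set} {P : A → Set} (d : ∀ x → Dec (P x)) xs (f : A → ℕ) → ∑ˡ (filter d xs) f ≡ ∑ˡ xs (λ x → ⟦ d x ⟧ * f x)
  ∑ˡ-filter d [] f = refl
  ∑ˡ-filter d (x ∷ xs) f with d x
  ... | yes _ = cong₂ _+_ (sym (+-identityʳ (f x))) (∑ˡ-filter d xs f)
  ... | no _ = ∑ˡ-filter d xs f

  ∑ˡ-cong : ∀ {A : Set} (xs : List A) {f g : A → ℕ} → (∀ x → f x ≡ g x) → ∑ˡ xs f ≡ ∑ˡ xs g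
  ∑ˡ-cong [] h = refl
  ∑ˡ-cong (x ∷ xs) h = cong₂ _+_ (h x) (∑ˡ-cong xs h)

  ∑ˡ-++ : ∀ {A : Set} (xs ys : List A) f → ∑ˡ (xs ++ ys) f ≡ ∑ˡ xs f + ∑ˡ ys f
  ∑ˡ-++ [] ys f = refl
  ∑ˡ-++ (x ∷ xs) ys f = trans (cong (f x +_) (∑ˡ-++ xs ys f)) (sym (+-assoc (f x) _ _))

  ∑ˡ-map : ∀ {A B : Set} (g : A → B) xs f → ∑ˡ (map g xs) f ≡ ∑ˡ xs (λ x → f (g x))
  ∑ˡ-map g [] f = refl
  ∑ˡ-map g (x ∷ xs) f = cong (f (g x) +_) (∑ˡ-map g xs f)

  ∑ˡ-pairs : ∀ {A B : Set} (xs : List A) (ys : List B) (f : A × B → ℕ) →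
    ∑ˡ (concatMap (λ x → map (λ y → (x , y)) ys) xs) f ≡ ∑ˡ xs (λ x → ∑ˡ ys (λ y → f (x , y)))
  ∑ˡ-pairs [] ys f = refl
  ∑ˡ-pairs (x ∷ xs) ys f = trans (∑ˡ-++ (map (λ y → (x , y)) ys) _ f) (cong₂ _+_ (∑ˡ-map (λ y → (x , y)) ys f) (∑ˡ-pairs xs ys f))

  ∑ˡ-allFin : ∀ m (f : Fin m → ℕ) → ∑ˡ (allFin m) f ≡ ∑ f
  ∑ˡ-allFin m f = go m (λ i → i) f
    where
    go : ∀ k {A : Set} (g : Fin k → A) (f : A → ℕ) → ∑ˡ (List.tabulate g) f ≡ ∑ (λ i → f (g i))
    go zero g f = sym (∑-nil _)
    go (suc k) g f = trans (cong (f (g Fin.zero) +_) (go k (λ i → g (Fin.suc i)) f)) (sym (∑-suc _))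

  2xy≤x²+y² : ∀ x y → x * y + x * y ≤ x * x + y * y
  2xy≤x²+y² x y with ≤-total x y
  ... | inj₁ x≤y = subst (λ y → x * y + x * y ≤ x * x + y * y) (m+[n∸m]≡n x≤y) (ordered x (y ∸ x))
    where
    ordered : ∀ x d → x * (x + d) + x * (x + d) ≤ x * x + (x + d) * (x + d)
    ordered x d = ≤-trans (m≤m+n _ (d * d)) (≤-reflexive (solve 2 (λ x d → (x :* (x :+ d) :+ x :* (x :+ d)) :+ d :* d := x :* x :+ (x :+ d) :* (x :+ d)) refl x d))
      where open +-*-Solver
  ... | inj₂ y≤x = subst (λ x → x * y + x * y ≤ x * x + y * y) (m+[n∸m]≡n y≤x) (ordered y (x ∸ y))
    where
    ordered : ∀ y d → (y + d) * y + (y + d) * y ≤ (y + d) * (y + d) + y * y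
    ordered y d = ≤-trans (m≤m+n _ (d * d)) (≤-reflexive (solve 2 (λ y d → ((y :+ d) :* y :+ (y :+ d) :* y) :+ d :* d := (y :+ d) :* (y :+ d) :+ y :* y) refl y d))
      where open +-*-Solver

  ∑∑-* : ∀ {m k} (f : Fin m → ℕ) (g : Fin k → ℕ) → ∑ (λ i → ∑ (λ j → f i * g j)) ≡ ∑ f * ∑ g
  ∑∑-* f g = trans (∑-cong (λ i → ∑-*ˡ (f i) g)) (∑-*ʳ (∑ g) f)

  ∑∑-+ : ∀ {m k} (f g : Fin m → Fin k → ℕ) → ∑ (λ i → ∑ (λ j → f i j + g i j)) ≡ ∑ (λ i → ∑ (f i)) + ∑ (λ i → ∑ (g i))
  ∑∑-+ f g = trans (∑-cong (λ i → ∑-+ (f i) (g i))) (∑-+ (λ i → ∑ (f i)) (λ i → ∑ (g i)))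

  -- After doubling, both sides are double sums, and 2xy ≤ x² + y² with x = f_i g_j and y = g_i f_j
  -- compares them term by term. This avoids subtraction and square roots.
  cauchy-schwarz : ∀ {m} (f g : Fin m → ℕ) →
    ∑ (λ i → f i * g i) * ∑ (λ i → f i * g i) ≤ ∑ (λ i → f i * f i) * ∑ (λ i → g i * g i)
  cauchy-schwarz f g = *-cancelˡ-≤ 2 (begin
    2 * (S * S) ≡⟨ cong (S * S +_) (+-identityʳ _) ⟩
    S * S + S * S ≡⟨ cong₂ _+_ (∑∑-* fg fg) (∑∑-* fg fg) ⟨
    ∑ (λ i → ∑ (λ j → fg i * fg j)) + ∑ (λ i → ∑ (λ j → fg i * fg j)) ≡⟨ ∑∑-+ _ _ ⟨
    ∑ (λ i → ∑ (λ j → fg i * fg j + fg i * fg j)) ≤⟨ ∑-mono (λ i → ∑-mono (λ j → pointwise (f i) (g i) (f j) (g j))) ⟩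
    ∑ (λ i → ∑ (λ j → (f i * f i) * (g j * g j) + (g i * g i) * (f j * f j))) ≡⟨ ∑∑-+ _ _ ⟩
    ∑ (λ i → ∑ (λ j → (f i * f i) * (g j * g j))) + ∑ (λ i → ∑ (λ j → (g i * g i) * (f j * f j))) ≡⟨ cong₂ _+_ (∑∑-* ff gg) (trans (∑∑-* gg ff) (*-comm (∑ gg) (∑ ff))) ⟩
    ∑ ff * ∑ gg + ∑ ff * ∑ gg ≡⟨ cong (∑ ff * ∑ gg +_) (+-identityʳ _) ⟨
    2 * (∑ ff * ∑ gg) ∎)
    where
    open ≤-Reasoning
    fg ff gg : Fin _ → ℕ
    fg i = f i * g i
    ff i = f i * f i
    gg i = g i * g i
    S = ∑ fg
    pointwise : ∀ a b c d → (a * b) * (c * d) + (a * b) * (c * d) ≤ (a * a) * (d * d) + (b * b) * (c * c)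
    pointwise a b c d = subst₂ _≤_ (cong₂ _+_ e₁ e₁) (cong₂ _+_ e₂ e₃) (2xy≤x²+y² (a * d) (b * c))
      where
      open +-*-Solver
      e₁ : (a * d) * (b * c) ≡ (a * b) * (c * d)
      e₁ = solve 4 (λ a b c d → (a :* d) :* (b :* c) := (a :* b) :* (c :* d)) refl a b c d
      e₂ : (a * d) * (a * d) ≡ (a * a) * (d * d)
      e₂ = solve 2 (λ a d → (a :* d) :* (a :* d) := (a :* a) :* (d :* d)) refl a d
      e₃ : (b * c) * (b * c) ≡ (b * b) * (c * c)
      e₃ = solve 2 (λ a d → (a :* d) :* (a :* d) := (a :* a) :* (d :* d)) refl b c

  ∑∑-mono : ∀ {m k} {f g : Fin m → Fin k → ℕ} → (∀ i j → f i j ≤ g i j) → ∑ (λ i → ∑ (f i)) ≤ ∑ (λ i → ∑ (g i))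
  ∑∑-mono h = ∑-mono (λ i → ∑-mono (h i))

  ∑∑-cong : ∀ {m k} {f g : Fin m → Fin k → ℕ} → (∀ i j → f i j ≡ g i j) → ∑ (λ i → ∑ (f i)) ≡ ∑ (λ i → ∑ (g i))
  ∑∑-cong h = ∑-cong (λ i → ∑-cong (h i))

  -- Turns a double sum into a single one, so that the two-variable Cauchy-Schwarz inequalities are
  -- instances of the one-variable ones.
  ∑-product : ∀ m {k} (f : Fin m → Fin k → ℕ) → ∑ {m * k} (λ x → f (proj₁ (Fin.remQuot k x)) (proj₂ (Fin.remQuot {m} k x))) ≡ ∑ (λ i → ∑ (f i))
  ∑-product zero f = trans (∑-nil _) (sym (∑-nil _))
  ∑-product (suc m) {k} f = trans (split k (λ x → f (proj₁ (Fin.remQuot {suc m} k x)) (proj₂ (Fin.remQuot {suc m} k x))))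
    (trans (cong₂ _+_ (∑-cong (λ j → cong (λ r → f (proj₁ r) (proj₂ r)) (Finₚ.remQuot-combine {suc m} {k} Fin.zero j)))
      (trans (∑-cong (λ x → cong (λ r → f (proj₁ r) (proj₂ r)) (shifted x))) (∑-product m (λ i → f (Fin.suc i))))) (sym (∑-suc (λ i → ∑ (f i)))))
    where
    split : ∀ a {b} (g : Fin (a + b) → ℕ) → ∑ g ≡ ∑ (λ i → g (i Fin.↑ˡ b)) + ∑ (λ j → g (a Fin.↑ʳ j))
    split zero g = sym (cong (_+ ∑ g) (∑-nil _))
    split (suc a) {b} g = trans (∑-suc g) (trans (cong (g Fin.zero +_) (split a (λ i → g (Fin.suc i)))) (trans (sym (+-assoc (g Fin.zero) _ _)) (cong (_+ ∑ (λ j → g (suc a Fin.↑ʳ j))) (sym (∑-suc (λ i → g (i Fin.↑ˡ b)))))))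
    shifted : ∀ x → Fin.remQuot {suc m} k (k Fin.↑ʳ x) ≡ (Fin.suc (proj₁ (Fin.remQuot {m} k x)) , proj₂ (Fin.remQuot {m} k x))
    shifted x = trans (cong (λ y → Fin.remQuot {suc m} k (k Fin.↑ʳ y)) (sym (Finₚ.combine-remQuot {m} k x))) (Finₚ.remQuot-combine {suc m} {k} (Fin.suc (proj₁ (Fin.remQuot {m} k x))) (proj₂ (Fin.remQuot {m} k x)))

  cauchy-schwarz² : ∀ {m k} (f g : Fin m → Fin k → ℕ) →
    ∑ (λ i → ∑ (λ j → f i j * g i j)) * ∑ (λ i → ∑ (λ j → f i j * g i j)) ≤ ∑ (λ i → ∑ (λ j → f i j * f i j)) * ∑ (λ i → ∑ (λ j → g i j * g i j))
  cauchy-schwarz² {m} {k} f g = subst₂ _≤_ (cong₂ _*_ (∑-product m _) (∑-product m _)) (cong₂ _*_ (∑-product m _) (∑-product m _))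
    (cauchy-schwarz {m * k} (λ x → f (proj₁ (Fin.remQuot k x)) (proj₂ (Fin.remQuot {m} k x))) (λ x → g (proj₁ (Fin.remQuot k x)) (proj₂ (Fin.remQuot {m} k x))))

  -- Not an instance of `cauchy-schwarz`, since a weight w need not have a square root in ℕ; the
  -- doubling argument is repeated with w_i w_j in front.
  cs-weighted : ∀ {m} (w u : Fin m → ℕ) → ∑ (λ i → w i * u i) * ∑ (λ i → w i * u i) ≤ ∑ w * ∑ (λ i → w i * (u i * u i))
  cs-weighted w u = *-cancelˡ-≤ 2 (begin
    2 * (S * S) ≡⟨ cong (S * S +_) (+-identityʳ _) ⟩
    S * S + S * S ≡⟨ cong₂ _+_ (∑∑-* wu wu) (∑∑-* wu wu) ⟨
    ∑ (λ i → ∑ (λ j → wu i * wu j)) + ∑ (λ i → ∑ (λ j → wu i * wu j)) ≡⟨ ∑∑-+ _ _ ⟨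
    ∑ (λ i → ∑ (λ j → wu i * wu j + wu i * wu j)) ≤⟨ ∑∑-mono (λ i j → pointwise (w i) (u i) (w j) (u j)) ⟩
    ∑ (λ i → ∑ (λ j → w i * wuu j + wuu i * w j)) ≡⟨ ∑∑-+ _ _ ⟩
    ∑ (λ i → ∑ (λ j → w i * wuu j)) + ∑ (λ i → ∑ (λ j → wuu i * w j)) ≡⟨ cong₂ _+_ (∑∑-* w wuu) (trans (∑∑-* wuu w) (*-comm (∑ wuu) (∑ w))) ⟩
    ∑ w * ∑ wuu + ∑ w * ∑ wuu ≡⟨ cong (∑ w * ∑ wuu +_) (+-identityʳ _) ⟨
    2 * (∑ w * ∑ wuu) ∎)
    where
    open ≤-Reasoning
    wu wuu : Fin _ → ℕ
    wu i = w i * u i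
    wuu i = w i * (u i * u i)
    S = ∑ wu
    pointwise : ∀ a b c d → (a * b) * (c * d) + (a * b) * (c * d) ≤ a * (c * (d * d)) + a * (b * b) * c
    pointwise a b c d = begin
      (a * b) * (c * d) + (a * b) * (c * d) ≡⟨ solve 4 (λ a b c d → (a :* b) :* (c :* d) :+ (a :* b) :* (c :* d) := (a :* c) :* (b :* d :+ b :* d)) refl a b c d ⟩
      (a * c) * (b * d + b * d) ≤⟨ *-monoʳ-≤ (a * c) (2xy≤x²+y² b d) ⟩
      (a * c) * (b * b + d * d) ≡⟨ solve 4 (λ a b c d → (a :* c) :* (b :* b :+ d :* d) := a :* (c :* (d :* d)) :+ a :* (b :* b) :* c) refl a b c d ⟩
      a * (c * (d * d)) + a * (b * b) * c ∎
      where open +-*-Solver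

  cs-weighted² : ∀ {m k} (w u : Fin m → Fin k → ℕ) →
    ∑ (λ i → ∑ (λ j → w i j * u i j)) * ∑ (λ i → ∑ (λ j → w i j * u i j)) ≤ ∑ (λ i → ∑ (w i)) * ∑ (λ i → ∑ (λ j → w i j * (u i j * u i j)))
  cs-weighted² {m} {k} w u = subst₂ _≤_ (cong₂ _*_ (∑-product m _) (∑-product m _)) (cong₂ _*_ (∑-product m _) (∑-product m _))
    (cs-weighted {m * k} (λ x → w (proj₁ (Fin.remQuot k x)) (proj₂ (Fin.remQuot {m} k x))) (λ x → u (proj₁ (Fin.remQuot k x)) (proj₂ (Fin.remQuot {m} k x))))

  ∑-pull : ∀ {m k l} (h : Fin m → Fin k → Fin l → ℕ) → ∑ (λ x → ∑ (λ y → ∑ (λ z → h x y z))) ≡ ∑ (λ y → ∑ (λ z → ∑ (λ x → h x y z)))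
  ∑-pull h = trans (∑-swap _) (∑-cong (λ y → ∑-swap _))

-- Counting points with prescribed n-th powers.

module SubgroupCounting where

  open import Data.Nat using (ℕ; zero; suc; _+_; _*_; _≤_; _<_; z≤n; s≤s)
  open import Data.Nat.Properties as ℕₚ using (≤-refl; ≤-trans; ≤-reflexive; <⇒≤)
  open import Data.Fin as Fin using (Fin)
  import Data.Fin.Properties as Finₚ
  open import Data.List using (List; []; _∷_; length; filter; allFin)
  import Data.List.Relation.Unary.All as All
  open PrimeFields
  open FieldArithmetic
  open PolynomialVanishing
  open StepanovPolynomials
  open StepanovMethod
  open FiniteSums

  open All using (All; []; _∷_)
  open import Data.List.Relation.Unary.All.Properties using (all-filter)
  open import Data.List.Relation.Unary.AllPairs using (AllPairs; []; _∷_)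
  open import Data.List.Relation.Unary.Unique.Propositional.Properties using (allFin⁺; filter⁺)
  open import Data.Product using (∃; _×_; _,_; proj₁; proj₂)
  open import Data.Sum using (_⊎_; inj₁; inj₂)
  open import Data.Empty using (⊥; ⊥-elim)
  open import Relation.Nullary using (¬_; Dec; yes; no)
  open import Relation.Nullary.Decidable using (_×-dec_; ¬?)
  open import Relation.Binary.PropositionalEquality
  import Algebra.Properties.CommutativeMonoid.Sum as Product
  open import Algebra.Bundles using (CommutativeRing)

  -- Turns a lower bound for a count into an injective list of h witnesses, the form in which
  -- `stepanov` receives its pairs.
  choose : ∀ {m} {P : Fin m → Set} (d : ∀ i → Dec (P i)) h → h ≤ ∑ (λ i → ⟦ d i ⟧) →
    ∃ λ (e : Fin h → Fin m) → (∀ i j → e i ≡ e j → i ≡ j) × (∀ i → P (e i))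
  choose d zero _ = (λ ()) , (λ ()) , (λ ())
  choose {zero} d (suc h) le = ⊥-elim (ℕₚ.1+n≰n (≤-trans (s≤s z≤n) (≤-trans le (≤-reflexive (∑-nil _)))))
  choose {suc m} {P} d (suc h) le = go (d Fin.zero) (≤-trans le (≤-reflexive (∑-suc _)))
    where
    go : (d₀ : Dec (P Fin.zero)) → suc h ≤ ⟦ d₀ ⟧ + ∑ (λ i → ⟦ d (Fin.suc i) ⟧) →
      ∃ λ (e : Fin (suc h) → Fin (suc m)) → (∀ i j → e i ≡ e j → i ≡ j) × (∀ i → P (e i))
    go (yes p₀) (s≤s le) with choose (λ i → d (Fin.suc i)) h le
    ... | e , inj , hold = e′ , inj′ , hold′
      where
      e′ : Fin (suc h) → Fin (suc m)
      e′ Fin.zero = Fin.zero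
      e′ (Fin.suc i) = Fin.suc (e i)
      inj′ : ∀ i j → e′ i ≡ e′ j → i ≡ j
      inj′ Fin.zero Fin.zero _ = refl
      inj′ (Fin.suc i) (Fin.suc j) q = cong Fin.suc (inj i j (Finₚ.suc-injective q))
      hold′ : ∀ i → P (e′ i)
      hold′ Fin.zero = p₀
      hold′ (Fin.suc i) = hold i
    go (no _) le with choose (λ i → d (Fin.suc i)) (suc h) le
    ... | e , inj , hold = (λ i → Fin.suc (e i)) , (λ i j q → inj i j (Finₚ.suc-injective q)) , hold

  -- A subgroup as a 0/1-valued function, so that every count becomes a sum of products of values of
  -- G. Closure under inverses is contained in `G-invariant`, which is an equality and not only an
  -- implication.
  record IsSubgroupIndicator {p} (𝔽 : PrimeField p) (G : Fin p → ℕ) : Set where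
    open PrimeField 𝔽
    field
      zero-or-one : ∀ x → G x ≡ 0 ⊎ G x ≡ 1
      G-zero : G 0# ≡ 0
      G-one : G 1# ≡ 1
      G-invariant : ∀ γ x → G γ ≡ 1 → G (γ ⊠ x) ≡ G x

  module Subgroup {p : ℕ} (𝔽 : PrimeField p) {G : Fin p → ℕ} (isG : IsSubgroupIndicator 𝔽 G) where
    open FieldLemmas 𝔽
    open IsSubgroupIndicator isG

    n : ℕ
    n = ∑ G

    inv-involutive : ∀ x → inv (inv x) ≡ x
    inv-involutive x = go (x Fin.≟ 0#)
      where
      go : Dec (x ≡ 0#) → inv (inv x) ≡ x
      go (yes e) = subst (λ y → inv (inv y) ≡ y) (sym e) (trans (cong inv inv-zero) inv-zero)
      go (no ne) = ⊠-cancelˡ (inv≢0 ne) (trans (⊠-inverse (inv≢0 ne)) (sym (trans (*-comm _ _) (⊠-inverse ne))))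

    ∑-shift : ∀ (g : F → ℕ) a → ∑ (λ x → g (x ⊞ a)) ≡ ∑ g
    ∑-shift g a = ∑-bij g (_⊞ a) (_⊞ ⊟ a)
      (λ x → trans (+-assoc x (⊟ a) a) (trans (cong (x ⊞_) (-‿inverseˡ a)) (+-identityʳ x)))
      (λ x → trans (+-assoc x a (⊟ a)) (trans (cong (x ⊞_) (-‿inverseʳ a)) (+-identityʳ x)))

    ∑-scale : ∀ (g : F → ℕ) {a} → a ≢ 0# → ∑ (λ x → g (a ⊠ x)) ≡ ∑ g
    ∑-scale g {a} ne = ∑-bij g (a ⊠_) (inv a ⊠_)
      (λ x → trans (sym (*-assoc a (inv a) x)) (trans (cong (_⊠ x) (⊠-inverse ne)) (*-identityˡ x)))
      (λ x → trans (sym (*-assoc (inv a) a x)) (trans (cong (_⊠ x) (trans (*-comm (inv a) a) (⊠-inverse ne))) (*-identityˡ x)))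

    ∑-inv : ∀ (g : F → ℕ) → ∑ (λ x → g (inv x)) ≡ ∑ g
    ∑-inv g = ∑-bij g inv inv inv-involutive inv-involutive

    private
      module ∏ = Product (CommutativeRing.*-commutativeMonoid ring)
      ∏ = ∏.sum

      ∏-↑ : ∀ x {m} (g : Fin m → ℕ) → ∏ (λ i → x ↑ g i) ≡ x ↑ ∑ g
      ∏-↑ x {zero} g = sym (cong (x ↑_) (∑-nil g))
      ∏-↑ x {suc m} g = trans (cong (x ↑ g Fin.zero ⊠_) (∏-↑ x (λ i → g (Fin.suc i)))) (trans (sym (↑-+ x (g Fin.zero) (∑ (λ i → g (Fin.suc i))))) (cong (x ↑_) (sym (∑-suc g))))

      ∏≢0 : ∀ {m} (g : Fin m → F) → (∀ i → g i ≢ 0#) → ∏ g ≢ 0#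
      ∏≢0 {zero} g h = 1≢0
      ∏≢0 {suc m} g h = ⊠≢0 (h Fin.zero) (∏≢0 (λ i → g (Fin.suc i)) (λ i → h (Fin.suc i)))

    G≢0 : ∀ {x} → G x ≡ 1 → x ≢ 0#
    G≢0 e refl = ℕₚ.0≢1+n (trans (sym G-zero) e)

    open import Data.Fin.Permutation using (permutation)

    -- Multiplication by x permutes Γ, so multiplying each element of Γ by x leaves the product of
    -- all elements unchanged. Elements outside Γ contribute y^0 = 1 to that product.
    lagrange : ∀ {x} → G x ≡ 1 → x ↑ n ≡ 1#
    lagrange {x} Gx = ⊠-cancelˡ all≢0 (begin
      all ⊠ x ↑ n ≡⟨ *-comm _ _ ⟩
      x ↑ n ⊠ all ≡⟨ cong (_⊠ all) (∏-↑ x G) ⟨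
      ∏ (λ y → x ↑ G y) ⊠ ∏ (λ y → y ↑ G y) ≡⟨ ∏.∑-distrib-+ (λ y → x ↑ G y) (λ y → y ↑ G y) ⟨
      ∏ (λ y → x ↑ G y ⊠ y ↑ G y) ≡⟨ ∏.sum-cong-≗ (λ y → trans (sym (⊠-↑ x y (G y))) (cong ((x ⊠ y) ↑_) (sym (G-invariant x y Gx)))) ⟩
      ∏ (λ y → (x ⊠ y) ↑ G (x ⊠ y)) ≡⟨ ∏.sum-permute (λ y → y ↑ G y) (permutation (x ⊠_) (inv x ⊠_)
          (λ y → trans (sym (*-assoc x (inv x) y)) (trans (cong (_⊠ y) (⊠-inverse x≢0)) (*-identityˡ y)))
          (λ y → trans (sym (*-assoc (inv x) x y)) (trans (cong (_⊠ y) (trans (*-comm (inv x) x) (⊠-inverse x≢0))) (*-identityˡ y)))) ⟨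
      all ≡⟨ *-identityʳ _ ⟨
      all ⊠ 1# ∎)
      where
      open ≡-Reasoning
      x≢0 = G≢0 Gx
      all = ∏ (λ y → y ↑ G y)
      factor≢0 : ∀ y → G y ≡ 0 ⊎ G y ≡ 1 → y ↑ G y ≢ 0#
      factor≢0 y (inj₁ e) q = 1≢0 (trans (sym (cong (y ↑_) e)) q)
      factor≢0 y (inj₂ e) q = ↑≢0 (G≢0 e) (G y) q
      all≢0 : all ≢ 0#
      all≢0 = ∏≢0 _ (λ y → factor≢0 y (zero-or-one y))

    0<n : 0 < n
    0<n = ≤-trans (≤-reflexive (sym G-one)) (∑-term G 1#)

    nz : F → ℕ
    nz x = ⟦ ¬? (x Fin.≟ 0#) ⟧

    nz-yes : ∀ {x} → x ≢ 0# → nz x ≡ 1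
    nz-yes = ⟦⟧-yes (¬? (_ Fin.≟ 0#))

    nz-zero : nz 0# ≡ 0
    nz-zero = ⟦⟧-no (¬? (0# Fin.≟ 0#)) (λ ne → ne refl)

    G≤1 : ∀ x → G x ≤ 1
    G≤1 x with zero-or-one x
    ... | inj₁ e = ≤-trans (≤-reflexive e) z≤n
    ... | inj₂ e = ≤-reflexive e

    G≤nz : ∀ x → G x ≤ nz x
    G≤nz x with x Fin.≟ 0#
    ... | yes refl = ≤-reflexive G-zero
    ... | no _ = G≤1 x

    n<p : n < p
    n<p = ≤-trans (s≤s (∑-mono G≤nz)) (≤-reflexive (begin
      suc (∑ nz) ≡⟨ cong (_+ ∑ nz) (trans (sym zero-count≡1) refl) ⟩
      ∑ (λ x → ⟦ x Fin.≟ 0# ⟧) + ∑ nz ≡⟨ ∑-+ _ _ ⟨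
      ∑ (λ x → ⟦ x Fin.≟ 0# ⟧ + nz x) ≡⟨ ∑-cong complementary ⟩
      ∑ (λ _ → 1) ≡⟨ ∑-const 1 ⟩
      p * 1 ≡⟨ ℕₚ.*-identityʳ p ⟩
      p ∎))
      where
      open ≡-Reasoning
      zero-count≡1 : ∑ (λ x → ⟦ x Fin.≟ 0# ⟧) ≡ 1
      zero-count≡1 = trans (∑-single _ 0# (λ j ne → ⟦⟧-no (j Fin.≟ 0#) ne)) (⟦⟧-yes (0# Fin.≟ 0#) refl)
      complementary : ∀ x → ⟦ x Fin.≟ 0# ⟧ + nz x ≡ 1
      complementary x with x Fin.≟ 0#
      ... | yes _ = refl
      ... | no _ = refl

    module Counting where
      open Polynomials 𝔽
      open Stepanov 𝔽
      open StepanovBound 𝔽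

      regular? : ∀ z → Dec (Regular z)
      regular? z = ¬? (z Fin.≟ 0#) ×-dec ¬? (z ⊞ -1# Fin.≟ 0#)

      private
        𝟙 : Pol
        at 𝟙 zero = 1#
        at 𝟙 (suc k) = 0#
        bound 𝟙 = 1
        vanish 𝟙 (suc k) _ = refl

        eval-𝟙 : ∀ z → eval 𝟙 z ≡ 1#
        eval-𝟙 z = trans (eval≡ev 𝟙 z (Deg≤-bound 𝟙)) (trans (cong (1# ⊞_) (zeroʳ z)) (+-identityʳ 1#))

        pow-s : F → Pol
        pow-s s = Xⁿ n 𝟙 ⊕ (-1# ⊠ s) · 𝟙

        open Auxiliary n n

        pow-s-root : ∀ s z → z ↑ n ≡ s → eval (pow-s s) z ≡ 0#
        pow-s-root s z e = begin
          eval (pow-s s) z ≡⟨ eval-⊕ (Xⁿ n 𝟙) _ z ⟩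
          eval (Xⁿ n 𝟙) z ⊞ eval ((-1# ⊠ s) · 𝟙) z ≡⟨ cong₂ _⊞_ (trans (eval-Xⁿ n 𝟙 z) (cong (z ↑ n ⊠_) (eval-𝟙 z))) (trans (eval-· _ 𝟙 z) (cong ((-1# ⊠ s) ⊠_) (eval-𝟙 z))) ⟩
          z ↑ n ⊠ 1# ⊞ (-1# ⊠ s) ⊠ 1# ≡⟨ cong₂ _⊞_ (trans (*-identityʳ _) e) (*-identityʳ _) ⟩
          s ⊞ -1# ⊠ s ≡⟨ x+-1x s ⟩
          0# ∎
          where open ≡-Reasoning

        pow-s-deg : ∀ s → Deg≤ (n + 1) (pow-s s)
        pow-s-deg s = deg-⊕ _ _ (deg-Xⁿ n 𝟙 (Deg≤-bound 𝟙)) (deg-mono _ (ℕₚ.m≤n+m 1 n) (deg-· (-1# ⊠ s) 𝟙 (Deg≤-bound 𝟙)))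

        pow-s≢𝟘 : ∀ s → ¬ (pow-s s ≋ 𝟘)
        pow-s≢𝟘 s e = 1≢0 (begin
          1# ≡⟨ +-identityʳ 1# ⟨
          1# ⊞ 0# ≡⟨ cong₂ _⊞_ (trans (cong (at (Xⁿ n 𝟙)) (sym (ℕₚ.+-identityʳ n))) (Blocks.at-Xⁿ-high n n ≤-refl n 𝟙 0)) (trans (cong ((-1# ⊠ s) ⊠_) (𝟙-at 0<n)) (zeroʳ _)) ⟨
          at (pow-s s) n ≡⟨ at-≡ e n ⟩
          0# ∎)
          where
          open ≡-Reasoning
          𝟙-at : ∀ {k} → 0 < k → at 𝟙 k ≡ 0#
          𝟙-at (s≤s _) = refl

        -- x^n - s is nonzero with n + 1 coefficients, and `zero-count` with multiplicity 1 applies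
        -- to its roots.
        few-roots : ∀ s W → AllPairs _≢_ W → All (λ z → Regular z × z ↑ n ≡ s) W → length W ≤ n
        few-roots s [] _ _ = z≤n
        few-roots s (z ∷ W) (zW ∷ dW) ((rz , ez) ∷ aW) = ℕₚ.≮⇒≥ λ big → pow-s≢𝟘 s
          (zero-count (n + 1) (pow-s s) 1 1 z W (pow-s-deg s) ≤-refl (≤-trans 0<n (<⇒≤ n<p)) rz (All.map proj₁ aW) zW dW
            (pow-s-root s z ez , _) (All.map (λ (_ , e) → pow-s-root s _ e , _) aW)
            (≤-trans (≤-reflexive (ℕₚ.+-comm n 1)) (≤-trans big (s≤s (≤-reflexive (sym (ℕₚ.+-identityʳ (length W))))))))

      roots : F → ℕ
      roots s = ∑ (λ c → nz c * ⟦ c ↑ n Fin.≟ s ⟧)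

      -- The additional 1 allows for the root c = 1, which `zero-count` does not cover.
      roots≤ : ∀ s → roots s ≤ suc n
      roots≤ s = begin
        roots s ≤⟨ ∑-mono pointwise ⟩
        ∑ (λ c → ⟦ c Fin.≟ 1# ⟧ + ⟦ reg c ⟧) ≡⟨ ∑-+ _ _ ⟩
        ∑ (λ c → ⟦ c Fin.≟ 1# ⟧) + ∑ (λ c → ⟦ reg c ⟧) ≡⟨ cong₂ _+_ (trans (∑-single _ 1# (λ j ne → ⟦⟧-no (j Fin.≟ 1#) ne)) (⟦⟧-yes (1# Fin.≟ 1#) refl))
                                                         (trans (sym (∑ˡ-allFin p (λ c → ⟦ reg c ⟧))) (sym (length-filter reg (allFin p)))) ⟩
        1 + length (filter reg (allFin p)) ≤⟨ s≤s (few-roots s _ (filter⁺ reg (allFin⁺ p)) (all-filter reg (allFin p))) ⟩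
        suc n ∎
        where
        open ℕₚ.≤-Reasoning
        reg : ∀ c → Dec (Regular c × c ↑ n ≡ s)
        reg c = regular? c ×-dec (c ↑ n Fin.≟ s)
        cases : ∀ c (d₀ : Dec (c ≢ 0#)) (dₛ : Dec (c ↑ n ≡ s)) (d₁ : Dec (c ≡ 1#)) → ⟦ d₀ ⟧ * ⟦ dₛ ⟧ ≤ ⟦ d₁ ⟧ + ⟦ reg c ⟧
        cases c (no _) _ _ = z≤n
        cases c (yes _) (no _) _ = z≤n
        cases c (yes _) (yes _) (yes _) = s≤s z≤n
        cases c (yes ne) (yes e) (no c≢1) = ≤-reflexive (sym (⟦⟧-yes (reg c) ((ne , λ q → c≢1 (x-y≡0⇒x≡y (trans (cong (c ⊞_) (*-identityʳ _)) q))) , e)))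
        pointwise : ∀ c → nz c * ⟦ c ↑ n Fin.≟ s ⟧ ≤ ⟦ c Fin.≟ 1# ⟧ + ⟦ reg c ⟧
        pointwise c = cases c (¬? (c Fin.≟ 0#)) (c ↑ n Fin.≟ s) (c Fin.≟ 1#)

      at-pair? : ∀ s t z → Dec (Regular z × (z ↑ n ≡ s × (z ⊞ -1#) ↑ n ≡ t))
      at-pair? s t z = regular? z ×-dec ((z ↑ n Fin.≟ s) ×-dec ((z ⊞ -1#) ↑ n Fin.≟ t))

      -- Up to the excluded points 0 and 1, the intersection of a coset of Γ with a translated
      -- coset, either of which may be empty.
      cnt : F → F → ℕ
      cnt s t = ∑ (λ z → ⟦ at-pair? s t z ⟧)

      -- Distinct pairs (s_i, t_i) have disjoint point sets, so h heavy pairs together provide at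
      -- least hν zeros in the single list `W`.
      stepanov : ∀ A B → 0 < A → A * B ≤ n → n * B ≤ p → A ≤ n → ∀ h → h * (A * (A + A)) < A * B * B →
        ∀ ν (s t : Fin h → F) → (∀ i j → s i ≡ s j → t i ≡ t j → i ≡ j) → (∀ i → ν ≤ cnt (s i) (t i)) →
        A * (h * ν) < n * B + (n * B + A)
      stepanov A B 0<A AB≤n nB≤p A≤n h few ν s t inj heavy = ℕₚ.≤-<-trans (ℕₚ.*-monoʳ-≤ A count)
        (Construction.bound-zeros n A B 0<A AB≤n nB≤p A≤n n<p h few s t W (filter⁺ good? (allFin⁺ p)) (All.map proj₁ all-good) (All.map proj₂ all-good))
        where
        open ℕₚ.≤-Reasoning
        hit? : ∀ z → Dec (∃ λ i → z ↑ n ≡ s i × (z ⊞ -1#) ↑ n ≡ t i)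
        hit? z = Finₚ.any? (λ i → (z ↑ n Fin.≟ s i) ×-dec ((z ⊞ -1#) ↑ n Fin.≟ t i))
        good? : ∀ z → Dec (Regular z × ∃ λ i → z ↑ n ≡ s i × (z ⊞ -1#) ↑ n ≡ t i)
        good? z = regular? z ×-dec hit? z
        W = filter good? (allFin p)
        all-good = all-filter good? (allFin p)
        lift : ∀ z → Dec (∃ λ i → Regular z × (z ↑ n ≡ s i × (z ⊞ -1#) ↑ n ≡ t i))
        lift z = Finₚ.any? (λ i → at-pair? (s i) (t i) z)
        count : h * ν ≤ length W
        count = begin
          h * ν ≡⟨ ∑-const ν ⟨
          ∑ {h} (λ _ → ν) ≤⟨ ∑-mono heavy ⟩
          ∑ (λ i → ∑ (λ z → ⟦ at-pair? (s i) (t i) z ⟧)) ≡⟨ ∑-swap _ ⟩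
          ∑ (λ z → ∑ (λ i → ⟦ at-pair? (s i) (t i) z ⟧)) ≤⟨ ∑-mono (λ z → ∑-at-most-one (λ i → at-pair? (s i) (t i) z) (lift z)
              (λ { i j (_ , es , et) (_ , es′ , et′) → inj i j (trans (sym es) es′) (trans (sym et) et′) })) ⟩
          ∑ (λ z → ⟦ lift z ⟧) ≤⟨ ∑-mono (λ z → ⟦⟧-mono (lift z) (good? z) (λ { (i , r , es , et) → r , i , es , et })) ⟩
          ∑ (λ z → ⟦ good? z ⟧) ≡⟨ ∑ˡ-allFin p _ ⟨
          ∑ˡ (allFin p) (λ z → ⟦ good? z ⟧) ≡⟨ length-filter good? (allFin p) ⟨
          length W ∎

-- Optimising the parameters of Stepanov's method.

module LevelSetArithmetic where

  open import Data.Nat using (ℕ; zero; suc; _+_; _*_; _∸_; _≤_; _<_; z≤n; s≤s; _≤?_; NonZero; >-nonZero)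
  open import Data.Nat.Properties
  open import Data.Nat.DivMod using (_/_; _%_; m/n*n≤m; m≥n⇒m/n>0; m≡m%n+[m/n]*n; m%n<n)
  open import Data.Nat.Solver using (module +-*-Solver)
  open import Data.Product using (∃; _×_; _,_)
  open import Data.Empty using (⊥; ⊥-elim)
  open import Relation.Nullary using (¬_; Dec; yes; no)
  open import Relation.Binary.PropositionalEquality

  open +-*-Solver using (solve; _:+_; _:*_; _:=_; con)
  open ≤-Reasoning

  m<[1+m/n]*n : ∀ m n .{{_ : NonZero n}} → m < suc (m / n) * n
  m<[1+m/n]*n m n = begin-strict
    m                   ≡⟨ m≡m%n+[m/n]*n m n ⟩
    m % n + m / n * n   <⟨ +-monoˡ-< (m / n * n) (m%n<n m n) ⟩
    n + m / n * n       ∎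

  -- Any κ ≥ 384 would do; N₀ = 128² makes n³ ≤ p² imply 128 n⁴ ≤ p³.
  abstract
    κ N₀ : ℕ
    κ = 512
    N₀ = 128 * 128

    384≤κ : 384 ≤ κ
    384≤κ = m≤m+n 384 128

    N₀≡ : 128 * 128 ≡ N₀
    N₀≡ = refl

    4≤N₀ : 4 ≤ N₀
    4≤N₀ = m≤m+n 4 16380

  instance
    κ≢0 : NonZero κ
    κ≢0 = >-nonZero (≤-trans (s≤s z≤n) 384≤κ)

  last-below : ∀ {P : ℕ → Set} (d : ∀ k → Dec (P k)) a b → P a → ¬ P (a + b) → ∃ λ k → a ≤ k × P k × ¬ P (suc k)
  last-below {P} d a zero pa ¬pb = ⊥-elim (¬pb (subst P (sym (+-identityʳ a)) pa))
  last-below {P} d a (suc b) pa ¬pb with d (suc a)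
  ... | no ¬p = a , ≤-refl , pa , ¬p
  ... | yes p with last-below d (suc a) b p (λ q → ¬pb (subst P (sym (+-suc a b)) q))
  ... | k , le , pk , ¬pk = k , ≤-trans (n≤1+n a) le , pk , ¬pk

  -- `T` will be the number of pairs with at least ν points, and `zeros` is Stepanov's inequality
  -- for any h ≤ T of them. The aim is Tν³ ≪ n²: with B close to n/A the inequality reads hνA² <
  -- 3n², valid while 16hA³ ≤ n², and A is taken as a fixed fraction of ν.
  module LevelBound (n p ν T : ℕ)
    (zeros : ∀ h A B → h ≤ T → 0 < A → A * B ≤ n → n * B ≤ p → A ≤ n → h * (A * (A + A)) < A * B * B → A * (h * ν) < n * B + (n * B + A))
    where

    -- B = ⌊n/A⌋ is the largest choice with AB ≤ n. Then n < 2AB turns `small` into the comparison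
    -- of conditions with coefficients, and `cap` gives nB ≤ p.
    optimised : ∀ h A → 0 < h → h ≤ T → 0 < A → 16 * (h * (A * A * A)) ≤ n * n → n * n ≤ p * A → h * ν * (A * A) < 3 * (n * n)
    optimised h A@(suc a) 0<h h≤T 0<A small cap = begin-strict
      h * ν * (A * A) ≡⟨ solve 3 (λ h v A → h :* v :* (A :* A) := A :* (A :* (h :* v))) refl h ν A ⟩
      A * (A * (h * ν)) <⟨ *-monoʳ-< A (zeros h A B h≤T 0<A AB≤n nB≤p A≤n few) ⟩
      A * (n * B + (n * B + A)) ≤⟨ *-monoʳ-≤ A (+-monoʳ-≤ (n * B) (+-monoʳ-≤ (n * B) A≤nB)) ⟩
      A * (n * B + (n * B + n * B)) ≡⟨ solve 3 (λ A n B → A :* (n :* B :+ (n :* B :+ n :* B)) := con 3 :* (n :* (A :* B))) refl A n B ⟩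
      3 * (n * (A * B)) ≤⟨ *-monoʳ-≤ 3 (*-monoʳ-≤ n AB≤n) ⟩
      3 * (n * n) ∎
      where
      B = n / A
      AB≤n : A * B ≤ n
      AB≤n = ≤-trans (≤-reflexive (*-comm A B)) (m/n*n≤m n A)
      n<AB+A : n < A * suc B
      n<AB+A = <-≤-trans (m<[1+m/n]*n n A) (≤-reflexive (*-comm (suc B) A))
      A≤n : A ≤ n
      A≤n = ≮⇒≥ λ n<A → <⇒≱ (begin-strict
        n * n <⟨ *-mono-< n<A n<A ⟩
        A * A ≤⟨ m≤m*n (A * A) A ⟩
        A * A * A ≡⟨ *-identityˡ _ ⟨
        1 * (A * A * A) ≤⟨ *-monoˡ-≤ (A * A * A) 0<h ⟩
        h * (A * A * A) ≤⟨ m≤n*m _ 16 ⟩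
        16 * (h * (A * A * A)) ∎) small
      0<B : 0 < B
      0<B = m≥n⇒m/n>0 A≤n
      nB≤p : n * B ≤ p
      nB≤p = *-cancelʳ-≤ (n * B) p A (begin
        n * B * A ≡⟨ solve 3 (λ n B A → n :* B :* A := n :* (A :* B)) refl n B A ⟩
        n * (A * B) ≤⟨ *-monoʳ-≤ n AB≤n ⟩
        n * n ≤⟨ cap ⟩
        p * A ∎)
      A≤nB : A ≤ n * B
      A≤nB = ≤-trans A≤n (≤-trans (≤-reflexive (sym (*-identityʳ n))) (*-monoʳ-≤ n 0<B))
      n<2AB : n < A * (B + B)
      n<2AB = <-≤-trans n<AB+A (*-monoʳ-≤ A (+-monoˡ-≤ B 0<B))
      4hA<B² : 4 * (h * A) < B * B
      4hA<B² = *-cancelʳ-< (4 * (A * A)) (4 * (h * A)) (B * B) (begin-strict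
        4 * (h * A) * (4 * (A * A)) ≡⟨ solve 3 (λ k h A → k :* (h :* A) :* (k :* (A :* A)) := k :* k :* (h :* (A :* A :* A))) refl 4 h A ⟩
        16 * (h * (A * A * A)) ≤⟨ small ⟩
        n * n <⟨ *-mono-< n<2AB n<2AB ⟩
        A * (B + B) * (A * (B + B)) ≡⟨ solve 2 (λ A B → A :* (B :+ B) :* (A :* (B :+ B)) := B :* B :* (con 4 :* (A :* A))) refl A B ⟩
        B * B * (4 * (A * A)) ∎)
      few : h * (A * (A + A)) < A * B * B
      few = begin-strict
        h * (A * (A + A)) ≤⟨ m≤m+n _ (h * (A * (A + A))) ⟩
        h * (A * (A + A)) + h * (A * (A + A)) ≡⟨ solve 2 (λ h A → h :* (A :* (A :+ A)) :+ h :* (A :* (A :+ A)) := A :* (con 4 :* (h :* A))) refl h A ⟩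
        A * (4 * (h * A)) <⟨ *-monoʳ-< A 4hA<B² ⟩
        A * (B * B) ≡⟨ *-assoc A B B ⟨
        A * B * B ∎

    module _ (N₀≤n : N₀ ≤ n) (n³≤p² : n * n * n ≤ p * p) (high : (κ + κ) * (n * n) ≤ ν * p) (p≤n² : p ≤ n * n) where

      private
        1≤n : 1 ≤ n
        1≤n = ≤-trans (s≤s z≤n) (≤-trans 4≤N₀ N₀≤n)

        1≤p : 1 ≤ p
        1≤p = n≢0⇒n>0 λ { refl → <⇒≱ {0} {n * n * n} (*-mono-≤ (*-mono-≤ 1≤n 1≤n) 1≤n) n³≤p² }

        2κ≤ν : κ + κ ≤ ν
        2κ≤ν = *-cancelʳ-≤ (κ + κ) ν p {{>-nonZero 1≤p}} (≤-trans (*-monoʳ-≤ (κ + κ) p≤n²) high)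

      -- With this fraction of ν, `high` yields n² ≤ pA; this is where ν has to exceed a multiple of
      -- the mean value n²/p.
      A : ℕ
      A = ν / κ

      private
        0<A : 0 < A
        0<A = m≥n⇒m/n>0 (≤-trans (m≤m+n κ κ) 2κ≤ν)

        κA≤ν : κ * A ≤ ν
        κA≤ν = ≤-trans (≤-reflexive (*-comm κ A)) (m/n*n≤m ν κ)

        ν<2κA : ν < (κ + κ) * A
        ν<2κA = begin-strict
          ν <⟨ m<[1+m/n]*n ν κ ⟩
          suc A * κ ≤⟨ *-monoˡ-≤ κ (+-monoˡ-≤ A 0<A) ⟩
          (A + A) * κ ≡⟨ solve 2 (λ k A → (A :+ A) :* k := (k :+ k) :* A) refl κ A ⟩
          (κ + κ) * A ∎

        cap : n * n ≤ p * A
        cap = *-cancelˡ-≤ (κ + κ) {{>-nonZero (≤-trans (≤-trans (s≤s z≤n) 384≤κ) (m≤m+n κ κ))}} (begin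
          (κ + κ) * (n * n) ≤⟨ high ⟩
          ν * p ≤⟨ *-monoˡ-≤ p (<⇒≤ ν<2κA) ⟩
          (κ + κ) * A * p ≡⟨ solve 3 (λ k A p → k :* A :* p := k :* (p :* A)) refl (κ + κ) A p ⟩
          (κ + κ) * (p * A) ∎)

        sq : ℕ → ℕ
        sq x = x * x

        cb : ℕ → ℕ
        cb x = x * x * x

        cb-mono : ∀ {x y} → x ≤ y → cb x ≤ cb y
        cb-mono le = *-mono-≤ (*-mono-≤ le le) le

        -- For h = ⌊n²/(16A³)⌋ one has 0 < h ≤ T and n² < 2h · 16A³. Stepanov's bound 3n² for hνA²,
        -- which is at least κhA³, then contradicts κ ≥ 96.
        case₁ : n * n < 16 * (T * cb A) → 16 * cb A ≤ n * n → ⊥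
        case₁ many fits = <-irrefl refl (begin-strict
          96 * (h * cb A) ≤⟨ *-monoˡ-≤ (h * cb A) (≤-trans (m≤m+n 96 288) 384≤κ) ⟩
          κ * (h * cb A) ≡⟨ solve 3 (λ k h A → k :* (h :* (A :* A :* A)) := h :* (k :* A) :* (A :* A)) refl κ h A ⟩
          h * (κ * A) * sq A ≤⟨ *-monoˡ-≤ (sq A) (*-monoʳ-≤ h κA≤ν) ⟩
          h * ν * sq A <⟨ optimised h A 0<h h≤T 0<A (≤-trans (≤-reflexive 16hA) (m/n*n≤m (n * n) D)) cap ⟩
          3 * (n * n) ≤⟨ *-monoʳ-≤ 3 (<⇒≤ (m<[1+m/n]*n (n * n) D)) ⟩
          3 * (suc h * D) ≤⟨ *-monoʳ-≤ 3 (*-monoˡ-≤ D (+-monoˡ-≤ h 0<h)) ⟩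
          3 * ((h + h) * (16 * cb A)) ≡⟨ trans (solve 3 (λ k h A → con 3 :* ((h :+ h) :* (k :* A)) := con 6 :* k :* (h :* A)) refl 16 h (cb A)) refl ⟩
          96 * (h * cb A) ∎)
          where
          D = 16 * cb A
          instance
            D≢0 : NonZero D
            D≢0 = >-nonZero (*-mono-≤ (m≤n+m 1 15) (cb-mono 0<A))
          h = (n * n) / D
          0<h : 0 < h
          0<h = m≥n⇒m/n>0 fits
          16hA : 16 * (h * cb A) ≡ h * D
          16hA = solve 3 (λ k h A → k :* (h :* A) := h :* (k :* A)) refl 16 h (cb A)
          h≤T : h ≤ T
          h≤T = *-cancelʳ-≤ h T D (≤-trans (m/n*n≤m (n * n) D) (≤-trans (<⇒≤ many) (≤-reflexive (solve 3 (λ k h A → k :* (h :* A) := h :* (k :* A)) refl 16 T (cb A)))))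

        -- If 16A³ > n², a single heavy pair is already too much. The largest a with 16a³ ≤ n²
        -- satisfies a ≤ A and n² < 128a³, and h = 1 with this a contradicts κ ≥ 384. The condition
        -- n² ≤ pa now comes from n³ ≤ p² and n ≥ N₀ instead of `high`.
        case₂ : 0 < T → ¬ (16 * cb A ≤ n * n) → ⊥
        case₂ 0<T big = go (last-below (λ k → 16 * cb k ≤? n * n) 1 (A ∸ 1) 16≤n² (subst (λ k → ¬ (16 * cb k ≤ n * n)) (sym (m+[n∸m]≡n 0<A)) big))
          where
          16≤n² : 16 * cb 1 ≤ n * n
          16≤n² = ≤-trans (*-mono-≤ 4≤N₀ 4≤N₀) (*-mono-≤ N₀≤n N₀≤n)
          go : (∃ λ a → 1 ≤ a × 16 * cb a ≤ n * n × ¬ (16 * cb (suc a) ≤ n * n)) → ⊥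
          go (a , 1≤a , fits , tight) = <-irrefl refl (begin-strict
            384 * (sq a * a) ≤⟨ *-monoˡ-≤ (sq a * a) 384≤κ ⟩
            κ * (sq a * a) ≡⟨ solve 2 (λ k a → k :* (a :* a :* a) := k :* a :* (a :* a)) refl κ a ⟩
            κ * a * sq a ≤⟨ *-monoˡ-≤ (sq a) (≤-trans (*-monoʳ-≤ κ a≤A) κA≤ν) ⟩
            ν * sq a ≡⟨ cong (_* sq a) (*-identityˡ ν) ⟨
            1 * ν * sq a <⟨ optimised 1 a ≤-refl 0<T 1≤a (≤-trans (≤-reflexive (cong (16 *_) (*-identityˡ (cb a)))) fits) cap-a ⟩
            3 * (n * n) ≤⟨ *-monoʳ-≤ 3 (<⇒≤ n²<128a³) ⟩
            3 * (128 * cb a) ≡⟨ *-assoc 3 128 (cb a) ⟨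
            384 * cb a ∎)
            where
            a≤A : a ≤ A
            a≤A = ≮⇒≥ λ A<a → big (≤-trans (*-monoʳ-≤ 16 (cb-mono (<⇒≤ A<a))) fits)
            n²<128a³ : n * n < 128 * cb a
            n²<128a³ = begin-strict
              n * n <⟨ ≰⇒> tight ⟩
              16 * cb (suc a) ≤⟨ *-monoʳ-≤ 16 (cb-mono (+-monoˡ-≤ a 1≤a)) ⟩
              16 * cb (a + a) ≡⟨ solve 2 (λ k a → k :* ((a :+ a) :* (a :+ a) :* (a :+ a)) := con 8 :* k :* (a :* a :* a)) refl 16 a ⟩
              128 * cb a ∎
            cap-a : n * n ≤ p * a
            cap-a = ≮⇒≥ λ short → <⇒≱ (begin-strict
              cb p * (n * n) <⟨ *-monoʳ-< (cb p) {{>-nonZero (cb-mono 1≤p)}} n²<128a³ ⟩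
              cb p * (128 * cb a) ≡⟨ solve 3 (λ k p a → p :* p :* p :* (k :* (a :* a :* a)) := k :* ((p :* a) :* (p :* a) :* (p :* a))) refl 128 p a ⟩
              128 * cb (p * a) ≤⟨ *-monoʳ-≤ 128 (cb-mono (<⇒≤ short)) ⟩
              128 * cb (n * n) ≡⟨ solve 2 (λ k n → k :* ((n :* n) :* (n :* n) :* (n :* n)) := k :* ((n :* n) :* (n :* n)) :* (n :* n)) refl 128 n ⟩
              128 * (sq n * sq n) * (n * n) ∎) (*-monoˡ-≤ (n * n) p³≥)
              where
              p³≥ : 128 * (sq n * sq n) ≤ cb p
              p³≥ = ≮⇒≥ λ short′ → <⇒≱ (begin-strict
                cb p * cb p <⟨ *-mono-< short′ short′ ⟩
                128 * (sq n * sq n) * (128 * (sq n * sq n)) ≡⟨ solve 2 (λ k n → k :* (n :* n :* (n :* n)) :* (k :* (n :* n :* (n :* n))) := k :* k :* (n :* n :* n :* n :* (n :* n :* n :* n))) refl 128 n ⟩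
                128 * 128 * (n * n * n * n * (n * n * n * n)) ≡⟨ cong (_* (n * n * n * n * (n * n * n * n))) N₀≡ ⟩
                N₀ * (n * n * n * n * (n * n * n * n)) ≤⟨ *-monoˡ-≤ _ N₀≤n ⟩
                n * (n * n * n * n * (n * n * n * n)) ≡⟨ solve 1 (λ n → n :* (n :* n :* n :* n :* (n :* n :* n :* n)) := (n :* n :* n) :* (n :* n :* n) :* (n :* n :* n)) refl n ⟩
                cb (n * n * n) ∎) (≤-trans (cb-mono n³≤p²) (≤-reflexive (solve 1 (λ p → (p :* p) :* (p :* p) :* (p :* p) := p :* p :* p :* (p :* p :* p)) refl p)))

        fits : 16 * (T * cb A) ≤ n * n
        fits = ≮⇒≥ λ many → decide many (16 * cb A ≤? n * n)
          where
          T-positive : n * n < 16 * (T * cb A) → 0 < T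
          T-positive many = n≢0⇒n>0 λ { refl → <⇒≱ many z≤n }
          decide : n * n < 16 * (T * cb A) → Dec (16 * cb A ≤ n * n) → ⊥
          decide many (yes le) = case₁ many le
          decide many (no ¬le) = case₂ (T-positive many) ¬le

      level-bound : T * (ν * ν * ν) ≤ (κ + κ) * (κ + κ) * (κ + κ) * (n * n)
      level-bound = begin
        T * cb ν ≤⟨ *-monoʳ-≤ T (cb-mono (<⇒≤ ν<2κA)) ⟩
        T * cb ((κ + κ) * A) ≡⟨ solve 3 (λ k T A → T :* ((k :* A) :* (k :* A) :* (k :* A)) := k :* k :* k :* (T :* (A :* A :* A))) refl (κ + κ) T A ⟩
        cb (κ + κ) * (T * cb A) ≤⟨ *-monoʳ-≤ (cb (κ + κ)) (≤-trans (m≤n*m _ 16) fits) ⟩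
        cb (κ + κ) * (n * n) ∎

-- Level sets of the representation functions.

module LevelSets where

  open import Data.Nat using (ℕ; suc; _+_; _*_; _≤_; _<_; z≤n; s≤s; _≤?_; >-nonZero)
  open import Data.Nat.Properties as ℕₚ using (≤-trans; ≤-reflexive; <⇒≤; *-mono-≤)
  open import Data.Nat.Solver using (module +-*-Solver)
  open import Data.Fin as Fin using (Fin; remQuot)
  import Data.Fin.Properties as Finₚ
  open import Data.Product using (_,_; proj₁; proj₂)
  open import Data.Sum using (_⊎_; inj₁; inj₂)
  open import Relation.Nullary using (yes; no)
  open import Relation.Nullary.Decidable using (¬?)
  open import Relation.Binary.PropositionalEquality
  open PrimeFields
  open FieldArithmetic
  open FiniteSums
  open SubgroupCounting
  open LevelSetArithmetic

  C₀ : ℕ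
  C₀ = (κ + κ) * (κ + κ) * (κ + κ)

  module Representations {p : ℕ} (𝔽 : PrimeField p) {G : Fin p → ℕ} (isG : IsSubgroupIndicator 𝔽 G) where
    open FieldLemmas 𝔽
    open IsSubgroupIndicator isG
    open Subgroup 𝔽 isG
    open Counting

    abstract
      f : F → F → ℕ
      f λ′ c = ∑ (λ b → G b * G (c ⊞ λ′ ⊠ b))

      f-def : ∀ λ′ c → f λ′ c ≡ ∑ (λ b → G b * G (c ⊞ λ′ ⊠ b))
      f-def _ _ = refl

    G*G≤ : ∀ x y → G x * G y ≤ G x
    G*G≤ x y = ≤-trans (ℕₚ.*-monoʳ-≤ (G x) (G≤1 y)) (≤-reflexive (ℕₚ.*-identityʳ (G x)))

    f≤n : ∀ λ′ c → f λ′ c ≤ n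
    f≤n λ′ c = ≤-trans (≤-reflexive (f-def λ′ c)) (∑-mono (λ b → G*G≤ b _))

    -- Substituting b = (c/λ)(z - 1) gives a = cz. If a and b lie in Γ, their n-th powers are 1,
    -- hence z^n = c^-n and (z - 1)^n = (λ/c)^n.
    f≤cnt : ∀ {λ′ c} → λ′ ≢ 0# → c ≢ 0# → f λ′ c ≤ cnt (inv c ↑ n) ((λ′ ⊠ inv c) ↑ n)
    f≤cnt {l} {c} l≢0 c≢0 = begin
      f l c ≡⟨ f-def l c ⟩
      ∑ (λ b → G b * G (c ⊞ l ⊠ b)) ≡⟨ ∑-scale (λ b → G b * G (c ⊞ l ⊠ b)) k≢0 ⟨
      ∑ (λ z → G (k ⊠ z) * G (c ⊞ l ⊠ (k ⊠ z))) ≡⟨ ∑-shift (λ z → G (k ⊠ z) * G (c ⊞ l ⊠ (k ⊠ z))) -1# ⟨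
      ∑ (λ z → G (k ⊠ (z ⊞ -1#)) * G (c ⊞ l ⊠ (k ⊠ (z ⊞ -1#)))) ≤⟨ ∑-mono pointwise ⟩
      cnt (inv c ↑ n) ((l ⊠ inv c) ↑ n) ∎
      where
      open ℕₚ.≤-Reasoning
      k = c ⊠ inv l
      k≢0 : k ≢ 0#
      k≢0 = ⊠≢0 c≢0 (inv≢0 l≢0)
      k-inverse : (l ⊠ inv c) ⊠ k ≡ 1#
      k-inverse = trans (solve 4 (λ l ic c il → (l :* ic) :* (c :* il) := (l :* il) :* (c :* ic)) refl l (inv c) c (inv l))
        (trans (cong₂ _⊠_ (⊠-inverse l≢0) (⊠-inverse c≢0)) (*-identityˡ 1#))
      cz : ∀ z → c ⊞ l ⊠ (k ⊠ (z ⊞ -1#)) ≡ c ⊠ z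
      cz z = trans (cong (c ⊞_) (trans (solve 4 (λ l c il y → l :* ((c :* il) :* y) := (l :* il) :* (c :* y)) refl l c (inv l) (z ⊞ -1#))
        (trans (cong (_⊠ (c ⊠ (z ⊞ -1#))) (⊠-inverse l≢0)) (*-identityˡ _))))
        (trans (solve 3 (λ c z m → c :+ c :* (z :+ m) := (c :+ c :* z) :+ m :* c) refl c z -1#) (cancelʳ c (c ⊠ z)))
      power : ∀ {a z} w → w ⊠ a ≡ 1# → G (a ⊠ z) ≡ 1 → z ↑ n ≡ w ↑ n
      power {a} {z} w wa g = trans (cong (_↑ n) (sym wz)) (trans (⊠-↑ w (a ⊠ z) n) (trans (cong (w ↑ n ⊠_) (lagrange g)) (*-identityʳ _)))
        where
        wz : w ⊠ (a ⊠ z) ≡ z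
        wz = trans (sym (*-assoc w a z)) (trans (cong (_⊠ z) wa) (*-identityˡ z))
      factor≢0 : ∀ a z → G (a ⊠ z) ≡ 1 → z ≢ 0#
      factor≢0 a z g e = G≢0 g (trans (cong (a ⊠_) e) (zeroʳ a))
      cases : ∀ z → (G (k ⊠ (z ⊞ -1#)) ≡ 0 ⊎ G (k ⊠ (z ⊞ -1#)) ≡ 1) → (G (c ⊠ z) ≡ 0 ⊎ G (c ⊠ z) ≡ 1) →
        G (k ⊠ (z ⊞ -1#)) * G (c ⊠ z) ≤ ⟦ at-pair? (inv c ↑ n) ((l ⊠ inv c) ↑ n) z ⟧
      cases z (inj₁ e) _ = ≤-trans (≤-reflexive (cong (_* G (c ⊠ z)) e)) z≤n
      cases z (inj₂ e) (inj₁ e′) = ≤-trans (≤-reflexive (trans (cong (G (k ⊠ (z ⊞ -1#)) *_) e′) (ℕₚ.*-zeroʳ (G (k ⊠ (z ⊞ -1#)))))) z≤n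
      cases z (inj₂ e) (inj₂ e′) = ≤-trans (≤-reflexive (cong₂ _*_ e e′)) (≤-reflexive (sym (⟦⟧-yes (at-pair? (inv c ↑ n) ((l ⊠ inv c) ↑ n) z)
        ((factor≢0 c z e′ , factor≢0 k _ e) , power (inv c) (trans (*-comm _ _) (⊠-inverse c≢0)) e′ , power (l ⊠ inv c) k-inverse e))))
      pointwise : ∀ z → G (k ⊠ (z ⊞ -1#)) * G (c ⊞ l ⊠ (k ⊠ (z ⊞ -1#))) ≤ ⟦ at-pair? (inv c ↑ n) ((l ⊠ inv c) ↑ n) z ⟧
      pointwise z = ≤-trans (≤-reflexive (cong (λ y → G (k ⊠ (z ⊞ -1#)) * G y) (cz z))) (cases z (zero-or-one _) (zero-or-one _))

    -- By `roots≤`, at most n + 1 nonzero c share an n-th power.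
    fibre : ∀ (g : F → ℕ) → ∑ (λ c → nz c * g (c ↑ n)) ≤ suc n * ∑ g
    fibre g = begin
      ∑ (λ c → nz c * g (c ↑ n)) ≡⟨ ∑-cong (λ c → cong (nz c *_) (sym (select (c ↑ n)))) ⟩
      ∑ (λ c → nz c * ∑ (λ s → ⟦ c ↑ n Fin.≟ s ⟧ * g s)) ≡⟨ ∑-cong (λ c → trans (sym (∑-*ˡ (nz c) _)) (∑-cong (λ s → sym (ℕₚ.*-assoc (nz c) _ (g s))))) ⟩
      ∑ (λ c → ∑ (λ s → nz c * ⟦ c ↑ n Fin.≟ s ⟧ * g s)) ≡⟨ ∑-swap _ ⟩
      ∑ (λ s → ∑ (λ c → nz c * ⟦ c ↑ n Fin.≟ s ⟧ * g s)) ≡⟨ ∑-cong (λ s → ∑-*ʳ (g s) _) ⟩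
      ∑ (λ s → roots s * g s) ≤⟨ ∑-mono (λ s → ℕₚ.*-monoˡ-≤ (g s) (roots≤ s)) ⟩
      ∑ (λ s → suc n * g s) ≡⟨ ∑-*ˡ (suc n) g ⟩
      suc n * ∑ g ∎
      where
      open ℕₚ.≤-Reasoning
      select : ∀ x → ∑ (λ s → ⟦ x Fin.≟ s ⟧ * g s) ≡ g x
      select x = trans (∑-single _ x (λ j ne → cong (_* g j) (⟦⟧-no (x Fin.≟ j) (λ e → ne (sym e))))) (trans (cong (_* g x) (⟦⟧-yes (x Fin.≟ x) refl)) (ℕₚ.*-identityˡ _))

    nz-inv : ∀ c → nz (inv c) ≡ nz c
    nz-inv c = ⟦⟧-iff (¬? (inv c Fin.≟ 0#)) (¬? (c Fin.≟ 0#)) (λ ne e → ne (trans (cong inv e) inv-zero)) inv≢0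

    nz-⊠ : ∀ {a} x → a ≢ 0# → nz (a ⊠ x) ≡ nz x
    nz-⊠ {a} x a≢0 = ⟦⟧-iff (¬? (a ⊠ x Fin.≟ 0#)) (¬? (x Fin.≟ 0#)) (λ ne e → ne (trans (cong (a ⊠_) e) (zeroʳ a))) (⊠≢0 a≢0)

    nz-guard : ∀ x {a b : ℕ} → (x ≢ 0# → a ≤ b) → nz x * a ≤ nz x * b
    nz-guard x {a} {b} h with x Fin.≟ 0#
    ... | yes _ = z≤n
    ... | no ne = ℕₚ.*-monoʳ-≤ 1 (h ne)

    lev : ℕ → F → F → ℕ
    lev ν l c = nz l * (nz c * ⟦ ν ≤? f l c ⟧)

    rowlev : ℕ → F → F → ℕ
    rowlev ν l c = nz c * ⟦ ν ≤? f l c ⟧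

    heavy : ℕ → F → F → ℕ
    heavy ν s t = ⟦ ν ≤? cnt s t ⟧

    -- For fixed l the pair attached to c is (s, l^n s) with s = c^-n. A row therefore meets only a
    -- one-parameter family of pairs, and passing to them costs a single factor n + 1.
    row-count : ∀ ν {l} → l ≢ 0# → ∑ (rowlev ν l) ≤ suc n * ∑ (λ s → heavy ν s (l ↑ n ⊠ s))
    row-count ν {l} l≢0 = begin
      ∑ (rowlev ν l) ≤⟨ ∑-mono (λ c → nz-guard c (λ c≢0 → ⟦⟧-mono (ν ≤? f l c) (ν ≤? cnt (inv c ↑ n) (l ↑ n ⊠ inv c ↑ n)) (λ le → ≤-trans le (≤-trans (f≤cnt l≢0 c≢0) (≤-reflexive (cong (cnt (inv c ↑ n)) (⊠-↑ l (inv c) n))))))) ⟩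
      ∑ (λ c → nz c * h (inv c ↑ n)) ≡⟨ ∑-cong (λ c → cong (_* h (inv c ↑ n)) (sym (nz-inv c))) ⟩
      ∑ (λ c → nz (inv c) * h (inv c ↑ n)) ≡⟨ ∑-inv (λ c → nz c * h (c ↑ n)) ⟩
      ∑ (λ c → nz c * h (c ↑ n)) ≤⟨ fibre h ⟩
      suc n * ∑ h ∎
      where
      open ℕₚ.≤-Reasoning
      h : F → ℕ
      h s = heavy ν s (l ↑ n ⊠ s)

    -- On nonzero l and c the map to (c^-n, (l/c)^n) is at most (n + 1)²-to-one.
    pair-count : ∀ ν → ∑ (λ l → ∑ (lev ν l)) ≤ suc n * (suc n * ∑ (λ s → ∑ (heavy ν s)))
    pair-count ν = begin
      ∑ (λ l → ∑ (λ c → nz l * (nz c * ⟦ ν ≤? f l c ⟧))) ≤⟨ ∑∑-mono (λ l c → nz-guard l (λ l≢0 → nz-guard c (λ c≢0 → ⟦⟧-mono (ν ≤? f l c) (ν ≤? cnt (inv c ↑ n) ((l ⊠ inv c) ↑ n)) (λ le → ≤-trans le (f≤cnt l≢0 c≢0))))) ⟩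
      ∑ (λ l → ∑ (λ c → nz l * (nz c * heavy ν (inv c ↑ n) ((l ⊠ inv c) ↑ n)))) ≡⟨ ∑-swap _ ⟩
      ∑ (λ c → ∑ (λ l → nz l * (nz c * heavy ν (inv c ↑ n) ((l ⊠ inv c) ↑ n)))) ≡⟨ ∑-cong reorder ⟩
      ∑ (λ c → nz c * ∑ (λ m → nz m * heavy ν (inv c ↑ n) (m ↑ n))) ≡⟨ ∑-cong (λ c → cong (_* inner (inv c ↑ n)) (sym (nz-inv c))) ⟩
      ∑ (λ c → nz (inv c) * inner (inv c ↑ n)) ≡⟨ ∑-inv (λ c → nz c * inner (c ↑ n)) ⟩
      ∑ (λ c → nz c * inner (c ↑ n)) ≤⟨ fibre inner ⟩
      suc n * ∑ inner ≤⟨ ℕₚ.*-monoʳ-≤ (suc n) (∑-mono (λ s → fibre (heavy ν s))) ⟩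
      suc n * ∑ (λ s → suc n * ∑ (heavy ν s)) ≡⟨ cong (suc n *_) (∑-*ˡ (suc n) _) ⟩
      suc n * (suc n * ∑ (λ s → ∑ (heavy ν s))) ∎
      where
      open ℕₚ.≤-Reasoning
      inner : F → ℕ
      inner s = ∑ (λ m → nz m * heavy ν s (m ↑ n))
      rescale : ∀ c → c ≢ 0# → ∑ (λ l → nz l * heavy ν (inv c ↑ n) ((l ⊠ inv c) ↑ n)) ≡ inner (inv c ↑ n)
      rescale c c≢0 = trans (∑-cong (λ l → cong₂ (λ a b → a * heavy ν (inv c ↑ n) (b ↑ n)) (sym (nz-⊠ l (inv≢0 c≢0))) (*-comm l (inv c))))
        (∑-scale (λ m → nz m * heavy ν (inv c ↑ n) (m ↑ n)) (inv≢0 c≢0))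
      reorder : ∀ c → ∑ (λ l → nz l * (nz c * heavy ν (inv c ↑ n) ((l ⊠ inv c) ↑ n))) ≡ nz c * inner (inv c ↑ n)
      reorder c = trans (∑-cong (λ l → x*yz≡y*xz (nz l) (nz c) _)) (trans (∑-*ˡ (nz c) _) (ℕₚ.≤-antisym
        (nz-guard c (λ ne → ≤-reflexive (rescale c ne))) (nz-guard c (λ ne → ≤-reflexive (sym (rescale c ne))))))
        where
        x*yz≡y*xz : ∀ x y z → x * (y * z) ≡ y * (x * z)
        x*yz≡y*xz x y z = trans (sym (ℕₚ.*-assoc x y z)) (trans (cong (_* z) (ℕₚ.*-comm x y)) (ℕₚ.*-assoc y x z))

    module Levels (N₀≤n : N₀ ≤ n) (p≤n² : p ≤ n * n) (n³≤p² : n * n * n ≤ p * p) where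
      private
        open +-*-Solver using () renaming (solve to solveℕ; _:+_ to _⟨+⟩_; _:*_ to _⟨*⟩_; _:=_ to _⟨=⟩_)
        open ℕₚ.≤-Reasoning

        cube : ℕ → ℕ
        cube x = x * x * x

        cube-mono : ∀ {x y} → x ≤ y → cube x ≤ cube y
        cube-mono le = *-mono-≤ (*-mono-≤ le le) le

        1≤p : 1 ≤ p
        1≤p = ≤-trans (s≤s z≤n) n<p

        suc-n≤2n : suc n ≤ n + n
        suc-n≤2n = ℕₚ.+-monoˡ-≤ n 0<n

      heavy-pairs-bound : ∀ ν → (κ + κ) * (n * n) ≤ ν * p → ∑ (λ s → ∑ (heavy ν s)) * cube ν ≤ C₀ * (n * n)
      heavy-pairs-bound ν high = ≤-trans (≤-reflexive (cong (_* cube ν) (sym (∑-product p (heavy ν)))))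
        (LevelBound.level-bound n p ν T zeros N₀≤n n³≤p² high p≤n²)
        where
        s′ t′ : Fin (p * p) → F
        s′ x = proj₁ (remQuot {p} p x)
        t′ x = proj₂ (remQuot {p} p x)
        T = ∑ (λ x → ⟦ ν ≤? cnt (s′ x) (t′ x) ⟧)
        zeros : ∀ h A B → h ≤ T → 0 < A → A * B ≤ n → n * B ≤ p → A ≤ n → h * (A * (A + A)) < A * B * B → A * (h * ν) < n * B + (n * B + A)
        zeros h A B h≤T 0<A AB≤n nB≤p A≤n few with choose (λ x → ν ≤? cnt (s′ x) (t′ x)) h h≤T
        ... | e , inj , hold = stepanov A B 0<A AB≤n nB≤p A≤n h few ν (λ i → s′ (e i)) (λ i → t′ (e i))
          (λ i j es et → inj i j (trans (sym (Finₚ.combine-remQuot {p} p (e i))) (trans (cong₂ Fin.combine es et) (Finₚ.combine-remQuot {p} p (e j))))) hold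

      heavy-row-bound : ∀ ν u → (κ + κ) * (n * n) ≤ ν * p → ∑ (λ s → heavy ν s (u ⊠ s)) * cube ν ≤ C₀ * (n * n)
      heavy-row-bound ν u high = LevelBound.level-bound n p ν T zeros N₀≤n n³≤p² high p≤n²
        where
        T = ∑ (λ s → ⟦ ν ≤? cnt s (u ⊠ s) ⟧)
        zeros : ∀ h A B → h ≤ T → 0 < A → A * B ≤ n → n * B ≤ p → A ≤ n → h * (A * (A + A)) < A * B * B → A * (h * ν) < n * B + (n * B + A)
        zeros h A B h≤T 0<A AB≤n nB≤p A≤n few with choose (λ s → ν ≤? cnt s (u ⊠ s)) h h≤T
        ... | e , inj , hold = stepanov A B 0<A AB≤n nB≤p A≤n h few ν e (λ i → u ⊠ e i) (λ i j es _ → inj i j es) hold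

      C : ℕ
      C = 4 * C₀

      pairs-high : ∀ ν → (κ + κ) * (n * n) ≤ ν * p → ∑ (λ l → ∑ (lev ν l)) * cube ν ≤ C * (n * n * (n * n))
      pairs-high ν high = begin
        ∑ (λ l → ∑ (lev ν l)) * cube ν ≤⟨ ℕₚ.*-monoˡ-≤ (cube ν) (pair-count ν) ⟩
        suc n * (suc n * H) * cube ν ≤⟨ ℕₚ.*-monoˡ-≤ (cube ν) (*-mono-≤ suc-n≤2n (ℕₚ.*-monoˡ-≤ H suc-n≤2n)) ⟩
        (n + n) * ((n + n) * H) * cube ν ≡⟨ solveℕ 3 (λ n H v → (n ⟨+⟩ n) ⟨*⟩ ((n ⟨+⟩ n) ⟨*⟩ H) ⟨*⟩ v ⟨=⟩ +-*-Solver.con 4 ⟨*⟩ (n ⟨*⟩ n) ⟨*⟩ (H ⟨*⟩ v)) refl n H (cube ν) ⟩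
        4 * (n * n) * (H * cube ν) ≤⟨ ℕₚ.*-monoʳ-≤ (4 * (n * n)) (heavy-pairs-bound ν high) ⟩
        4 * (n * n) * (C₀ * (n * n)) ≡⟨ solveℕ 3 (λ k m c → k ⟨*⟩ m ⟨*⟩ (c ⟨*⟩ m) ⟨=⟩ (k ⟨*⟩ c) ⟨*⟩ (m ⟨*⟩ m)) refl 4 (n * n) C₀ ⟩
        C * (n * n * (n * n)) ∎
        where H = ∑ (λ s → ∑ (heavy ν s))

      private
        low-cube : ∀ ν → ν * p ≤ (κ + κ) * (n * n) → cube ν * cube p ≤ C₀ * cube (n * n)
        low-cube ν low = begin
          cube ν * cube p ≡⟨ solveℕ 2 (λ v p → v ⟨*⟩ v ⟨*⟩ v ⟨*⟩ (p ⟨*⟩ p ⟨*⟩ p) ⟨=⟩ (v ⟨*⟩ p) ⟨*⟩ (v ⟨*⟩ p) ⟨*⟩ (v ⟨*⟩ p)) refl ν p ⟩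
          cube (ν * p) ≤⟨ cube-mono low ⟩
          cube ((κ + κ) * (n * n)) ≡⟨ solveℕ 2 (λ v p → (v ⟨*⟩ p) ⟨*⟩ (v ⟨*⟩ p) ⟨*⟩ (v ⟨*⟩ p) ⟨=⟩ v ⟨*⟩ v ⟨*⟩ v ⟨*⟩ (p ⟨*⟩ p ⟨*⟩ p)) refl (κ + κ) (n * n) ⟩
          C₀ * cube (n * n) ∎

        lev≤1 : ∀ ν l c → lev ν l c ≤ 1
        lev≤1 ν l c = *-mono-≤ (⟦⟧≤1 (¬? (l Fin.≟ 0#))) (*-mono-≤ (⟦⟧≤1 (¬? (c Fin.≟ 0#))) (⟦⟧≤1 (ν ≤? f l c)))

      -- Below the threshold, ν is at most 2κn²/p and the trivial count p² suffices. The price for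
      -- covering all ν is a factor n²/p compared with `pairs-high`.
      pairs-all : ∀ ν → ∑ (λ l → ∑ (lev ν l)) * cube ν * p ≤ C * cube (n * n)
      pairs-all ν with (κ + κ) * (n * n) ≤? ν * p
      ... | yes high = begin
        ∑ (λ l → ∑ (lev ν l)) * cube ν * p ≤⟨ *-mono-≤ (pairs-high ν high) p≤n² ⟩
        C * (n * n * (n * n)) * (n * n) ≡⟨ ℕₚ.*-assoc C _ _ ⟩
        C * cube (n * n) ∎
      ... | no ¬high = begin
        ∑ (λ l → ∑ (lev ν l)) * cube ν * p ≤⟨ ℕₚ.*-monoˡ-≤ p (ℕₚ.*-monoˡ-≤ (cube ν) all≤p²) ⟩
        p * p * cube ν * p ≡⟨ solveℕ 2 (λ p v → p ⟨*⟩ p ⟨*⟩ v ⟨*⟩ p ⟨=⟩ v ⟨*⟩ (p ⟨*⟩ p ⟨*⟩ p)) refl p (cube ν) ⟩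
        cube ν * cube p ≤⟨ low-cube ν (<⇒≤ (ℕₚ.≰⇒> ¬high)) ⟩
        C₀ * cube (n * n) ≤⟨ ℕₚ.*-monoˡ-≤ (cube (n * n)) (ℕₚ.m≤n*m C₀ 4) ⟩
        C * cube (n * n) ∎
        where
        all≤p² : ∑ (λ l → ∑ (lev ν l)) ≤ p * p
        all≤p² = ≤-trans (∑∑-mono (lev≤1 ν)) (≤-reflexive (trans (∑-cong (λ _ → trans (∑-const 1) (ℕₚ.*-identityʳ p))) (∑-const p)))

      -- Below the threshold the trivial count p gives p(n²/p)³ = n⁶/p², which is at most n³ because
      -- n³ ≤ p². Thus rows, unlike pairs, lose nothing there.
      row-all : ∀ ν {l} → l ≢ 0# → ∑ (rowlev ν l) * cube ν ≤ C * cube n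
      row-all ν {l} l≢0 with (κ + κ) * (n * n) ≤? ν * p
      ... | yes high = begin
        ∑ (rowlev ν l) * cube ν ≤⟨ ℕₚ.*-monoˡ-≤ (cube ν) (row-count ν l≢0) ⟩
        suc n * H * cube ν ≤⟨ ℕₚ.*-monoˡ-≤ (cube ν) (ℕₚ.*-monoˡ-≤ H suc-n≤2n) ⟩
        (n + n) * H * cube ν ≡⟨ ℕₚ.*-assoc (n + n) H _ ⟩
        (n + n) * (H * cube ν) ≤⟨ ℕₚ.*-monoʳ-≤ (n + n) (heavy-row-bound ν (l ↑ n) high) ⟩
        (n + n) * (C₀ * (n * n)) ≡⟨ solveℕ 2 (λ n c → (n ⟨+⟩ n) ⟨*⟩ (c ⟨*⟩ (n ⟨*⟩ n)) ⟨=⟩ (c ⟨+⟩ c) ⟨*⟩ (n ⟨*⟩ n ⟨*⟩ n)) refl n C₀ ⟩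
        (C₀ + C₀) * cube n ≤⟨ ℕₚ.*-monoˡ-≤ (cube n) (ℕₚ.+-monoʳ-≤ C₀ (ℕₚ.m≤m+n C₀ _)) ⟩
        C * cube n ∎
        where H = ∑ (λ s → heavy ν s (l ↑ n ⊠ s))
      ... | no ¬high = ℕₚ.*-cancelʳ-≤ _ _ (p * p) {{>-nonZero (*-mono-≤ 1≤p 1≤p)}} (begin
        ∑ (rowlev ν l) * cube ν * (p * p) ≤⟨ ℕₚ.*-monoˡ-≤ (p * p) (ℕₚ.*-monoˡ-≤ (cube ν) row≤p) ⟩
        p * cube ν * (p * p) ≡⟨ solveℕ 2 (λ p v → p ⟨*⟩ v ⟨*⟩ (p ⟨*⟩ p) ⟨=⟩ v ⟨*⟩ (p ⟨*⟩ p ⟨*⟩ p)) refl p (cube ν) ⟩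
        cube ν * cube p ≤⟨ low-cube ν (<⇒≤ (ℕₚ.≰⇒> ¬high)) ⟩
        C₀ * cube (n * n) ≡⟨ solveℕ 2 (λ c n → c ⟨*⟩ ((n ⟨*⟩ n) ⟨*⟩ (n ⟨*⟩ n) ⟨*⟩ (n ⟨*⟩ n)) ⟨=⟩ c ⟨*⟩ (n ⟨*⟩ n ⟨*⟩ n) ⟨*⟩ (n ⟨*⟩ n ⟨*⟩ n)) refl C₀ n ⟩
        C₀ * cube n * cube n ≤⟨ ℕₚ.*-monoʳ-≤ (C₀ * cube n) n³≤p² ⟩
        C₀ * cube n * (p * p) ≤⟨ ℕₚ.*-monoˡ-≤ (p * p) (ℕₚ.*-monoˡ-≤ (cube n) (ℕₚ.m≤n*m C₀ 4)) ⟩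
        C * cube n * (p * p) ∎)
        where
        row≤p : ∑ (rowlev ν l) ≤ p
        row≤p = ≤-trans (∑-mono (λ c → *-mono-≤ (⟦⟧≤1 (¬? (c Fin.≟ 0#))) (⟦⟧≤1 (ν ≤? f l c)))) (≤-reflexive (trans (∑-const 1) (ℕₚ.*-identityʳ p)))

-- Energies and triangles in Γ.

module EnergyInequalities where

  open import Data.Nat using (ℕ; _+_; _*_; _≤_)
  open import Data.Nat.Properties as ℕₚ using (≤-trans; ≤-reflexive; *-mono-≤)
  open import Data.Nat.Solver using (module +-*-Solver)
  open import Data.Fin using (Fin)
  open import Data.Sum using (inj₁; inj₂)
  open import Relation.Binary.PropositionalEquality
  open PrimeFields
  open FieldArithmetic
  open FiniteSums
  open SubgroupCounting
  open LevelSets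

  module Energies {p : ℕ} (𝔽 : PrimeField p) {G : Fin p → ℕ} (isG : IsSubgroupIndicator 𝔽 G) where
    open FieldLemmas 𝔽
    open IsSubgroupIndicator isG
    open Subgroup 𝔽 isG
    open Representations 𝔽 isG
    open +-*-Solver using () renaming (solve to solveℕ; _:+_ to _⟨+⟩_; _:*_ to _⟨*⟩_; _:=_ to _⟨=⟩_)

    infixl 6 _⊖_
    _⊖_ : F → F → F
    x ⊖ y = x ⊞ -1# ⊠ y

    r : F → ℕ
    r = f 1#

    E T : F → ℕ
    E l = ∑ (λ c → f l c * f l c)
    T l = ∑ (λ c → f l c * f l c * f l c)

    ⊖-⊞ : ∀ x y → x ⊖ y ⊞ y ≡ x
    ⊖-⊞ x y = trans (solve 3 (λ x y m → (x :+ m :* y) :+ y := x :+ (y :+ m :* y)) refl x y -1#) (trans (cong (x ⊞_) (x+-1x y)) (+-identityʳ x))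

    ∑-minus : ∀ (g : F → ℕ) a → ∑ (λ x → g (x ⊖ a)) ≡ ∑ g
    ∑-minus g a = ∑-shift g (-1# ⊠ a)

    ∑-plusˡ : ∀ (g : F → ℕ) a → ∑ (λ x → g (a ⊞ x)) ≡ ∑ g
    ∑-plusˡ g a = trans (∑-cong (λ x → cong g (+-comm a x))) (∑-shift g a)

    G-guard : ∀ x {a b : ℕ} → (G x ≡ 1 → a ≡ b) → G x * a ≡ G x * b
    G-guard x {a} {b} h with zero-or-one x
    ... | inj₁ e = trans (cong (_* a) e) (sym (cong (_* b) e))
    ... | inj₂ e = cong (G x *_) (h e)

    ∑-G* : ∀ c → ∑ (λ x → G x * c) ≡ n * c
    ∑-G* c = ∑-*ʳ c G

    correlation : ∀ y z → ∑ (λ b → G (y ⊞ b) * G (z ⊞ b)) ≡ r (y ⊖ z)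
    correlation y z = begin
      ∑ (λ b → G (y ⊞ b) * G (z ⊞ b)) ≡⟨ ∑-cong (λ b → trans (ℕₚ.*-comm (G (y ⊞ b)) _) (cong (λ w → G (z ⊞ b) * G w) (rewrite-y b))) ⟩
      ∑ (λ b → G (z ⊞ b) * G ((y ⊖ z) ⊞ 1# ⊠ (z ⊞ b))) ≡⟨ ∑-plusˡ (λ b → G b * G ((y ⊖ z) ⊞ 1# ⊠ b)) z ⟩
      ∑ (λ b → G b * G ((y ⊖ z) ⊞ 1# ⊠ b)) ≡⟨ f-def 1# (y ⊖ z) ⟨
      r (y ⊖ z) ∎
      where
      open ≡-Reasoning
      rewrite-y : ∀ b → y ⊞ b ≡ (y ⊖ z) ⊞ 1# ⊠ (z ⊞ b)
      rewrite-y b = trans (cong (_⊞ b) (sym (⊖-⊞ y z))) (solve 3 (λ d z b → (d :+ z) :+ b := d :+ con 1 :* (z :+ b)) refl (y ⊖ z) z b)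

    ∑-differences : ∀ (k : F → ℕ) → ∑ (λ x → ∑ (λ y → G x * (G y * k (x ⊖ y)))) ≡ ∑ (λ δ → r δ * k δ)
    ∑-differences k = begin
      ∑ (λ x → ∑ (λ y → G x * (G y * k (x ⊖ y)))) ≡⟨ ∑-swap _ ⟩
      ∑ (λ y → ∑ (λ x → G x * (G y * k (x ⊖ y)))) ≡⟨ ∑-cong (λ y → trans (∑-cong (λ x → cong (λ w → G w * (G y * k (x ⊖ y))) (sym (⊖-⊞ x y)))) (∑-minus (λ δ → G (δ ⊞ y) * (G y * k δ)) y)) ⟩
      ∑ (λ y → ∑ (λ δ → G (δ ⊞ y) * (G y * k δ))) ≡⟨ ∑-swap _ ⟩
      ∑ (λ δ → ∑ (λ y → G (δ ⊞ y) * (G y * k δ))) ≡⟨ ∑-cong (λ δ → trans (∑-cong (λ y → trans (solveℕ 3 (λ a b c → a ⟨*⟩ (b ⟨*⟩ c) ⟨=⟩ b ⟨*⟩ a ⟨*⟩ c) refl (G (δ ⊞ y)) (G y) (k δ)) (cong (λ w → G y * G (δ ⊞ w) * k δ) (sym (*-identityˡ y))))) (trans (∑-*ʳ (k δ) _) (cong (_* k δ) (sym (f-def 1# δ))))) ⟩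
      ∑ (λ δ → r δ * k δ) ∎
      where open ≡-Reasoning

    ∑f : ∀ l → ∑ (f l) ≡ n * n
    ∑f l = begin
      ∑ (f l) ≡⟨ ∑-cong (f-def l) ⟩
      ∑ (λ c → ∑ (λ b → G b * G (c ⊞ l ⊠ b))) ≡⟨ ∑-swap _ ⟩
      ∑ (λ b → ∑ (λ c → G b * G (c ⊞ l ⊠ b))) ≡⟨ ∑-cong (λ b → trans (∑-*ˡ (G b) _) (cong (G b *_) (∑-shift G (l ⊠ b)))) ⟩
      ∑ (λ b → G b * n) ≡⟨ ∑-G* n ⟩
      n * n ∎
      where open ≡-Reasoning

    -- Cauchy-Schwarz with weight f_l, whose total mass is n².
    E²≤ : ∀ l → E l * E l ≤ n * n * T l
    E²≤ l = ≤-trans (cs-weighted (f l) (f l)) (≤-reflexive (cong₂ _*_ (∑f l) (∑-cong (λ c → sym (ℕₚ.*-assoc (f l c) (f l c) (f l c))))))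

    f-scale : ∀ l γ c → G γ ≡ 1 → f l (γ ⊠ c) ≡ f l c
    f-scale l γ c g = begin
      f l (γ ⊠ c) ≡⟨ f-def l (γ ⊠ c) ⟩
      ∑ (λ b → G b * G (γ ⊠ c ⊞ l ⊠ b)) ≡⟨ ∑-scale (λ b → G b * G (γ ⊠ c ⊞ l ⊠ b)) (G≢0 g) ⟨
      ∑ (λ b → G (γ ⊠ b) * G (γ ⊠ c ⊞ l ⊠ (γ ⊠ b))) ≡⟨ ∑-cong (λ b → cong₂ _*_ (G-invariant γ b g) (trans (cong G (solve 4 (λ γ c l b → γ :* c :+ l :* (γ :* b) := γ :* (c :+ l :* b)) refl γ c l b)) (G-invariant γ _ g))) ⟩
      ∑ (λ b → G b * G (c ⊞ l ⊠ b)) ≡⟨ f-def l c ⟨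
      f l c ∎
      where open ≡-Reasoning

    -- The left side counts the solutions of a' - k a = h (b' - k b) in Γ, so it equals Σ_y f_k(y) f_k(h y).
    cross-energy : ∀ h k → ∑ (λ x → f h x * f h (k ⊠ x)) ≤ E k + ∑ (λ y → f k (h ⊠ y) * f k (h ⊠ y))
    cross-energy h k = begin
      ∑ (λ x → f h x * f h (k ⊠ x)) ≡⟨ ∑-cong (λ x → trans (cong₂ _*_ (f-def h x) (f-def h (k ⊠ x))) (sym (∑∑-* _ _))) ⟩
      ∑ (λ x → ∑ (λ b → ∑ (λ b′ → G b * G (x ⊞ h ⊠ b) * (G b′ * G (k ⊠ x ⊞ h ⊠ b′))))) ≡⟨ ∑-pull _ ⟩
      ∑ (λ b → ∑ (λ b′ → ∑ (λ x → G b * G (x ⊞ h ⊠ b) * (G b′ * G (k ⊠ x ⊞ h ⊠ b′))))) ≡⟨ ∑∑-cong (λ b b′ → trans (sym (∑-minus (λ x → G b * G (x ⊞ h ⊠ b) * (G b′ * G (k ⊠ x ⊞ h ⊠ b′))) (h ⊠ b))) (∑-cong (λ a → term b b′ a))) ⟩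
      ∑ (λ b → ∑ (λ b′ → ∑ (λ a → quad b b′ a))) ≡⟨ ∑∑-cong (λ b b′ → ∑-cong (λ a → term′ b b′ a)) ⟩
      ∑ (λ b → ∑ (λ b′ → ∑ (λ a → G b * G ((b′ ⊖ k ⊠ b) ⊞ k ⊠ b) * (G a * G (h ⊠ (b′ ⊖ k ⊠ b) ⊞ k ⊠ a))))) ≡⟨ ∑-cong (λ b → ∑-minus (λ y → ∑ (λ a → G b * G (y ⊞ k ⊠ b) * (G a * G (h ⊠ y ⊞ k ⊠ a)))) (k ⊠ b)) ⟩
      ∑ (λ b → ∑ (λ y → ∑ (λ a → G b * G (y ⊞ k ⊠ b) * (G a * G (h ⊠ y ⊞ k ⊠ a))))) ≡⟨ ∑-swap _ ⟩
      ∑ (λ y → ∑ (λ b → ∑ (λ a → G b * G (y ⊞ k ⊠ b) * (G a * G (h ⊠ y ⊞ k ⊠ a))))) ≡⟨ ∑-cong (λ y → trans (∑∑-* _ _) (sym (cong₂ _*_ (f-def k y) (f-def k (h ⊠ y))))) ⟩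
      ∑ (λ y → f k y * f k (h ⊠ y)) ≤⟨ ∑-mono (λ y → xy≤ (f k y) (f k (h ⊠ y))) ⟩
      ∑ (λ y → f k y * f k y + f k (h ⊠ y) * f k (h ⊠ y)) ≡⟨ ∑-+ _ _ ⟩
      E k + ∑ (λ y → f k (h ⊠ y) * f k (h ⊠ y)) ∎
      where
      open ℕₚ.≤-Reasoning
      quad : F → F → F → ℕ
      quad b b′ a = G b * G a * (G b′ * G (k ⊠ (a ⊖ h ⊠ b) ⊞ h ⊠ b′))
      term : ∀ b b′ a → G b * G ((a ⊖ h ⊠ b) ⊞ h ⊠ b) * (G b′ * G (k ⊠ (a ⊖ h ⊠ b) ⊞ h ⊠ b′)) ≡ quad b b′ a
      term b b′ a = cong (λ w → G b * G w * (G b′ * G (k ⊠ (a ⊖ h ⊠ b) ⊞ h ⊠ b′))) (⊖-⊞ a (h ⊠ b))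
      term′ : ∀ b b′ a → quad b b′ a ≡ G b * G ((b′ ⊖ k ⊠ b) ⊞ k ⊠ b) * (G a * G (h ⊠ (b′ ⊖ k ⊠ b) ⊞ k ⊠ a))
      term′ b b′ a = trans (solveℕ 4 (λ b a c d → b ⟨*⟩ a ⟨*⟩ (c ⟨*⟩ d) ⟨=⟩ b ⟨*⟩ c ⟨*⟩ (a ⟨*⟩ d)) refl (G b) (G a) (G b′) _)
        (cong₂ (λ u v → G b * G u * (G a * G v)) (sym (⊖-⊞ b′ (k ⊠ b)))
          (solve 6 (λ k a m h b c → k :* (a :+ m :* (h :* b)) :+ h :* c := h :* (c :+ m :* (k :* b)) :+ k :* a) refl k a -1# h b b′))
      xy≤ : ∀ x y → x * y ≤ x * x + y * y
      xy≤ x y = ≤-trans (ℕₚ.m≤m+n (x * y) (x * y)) (2xy≤x²+y² x y)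

    -- Indicators of Γ-invariant sets. Avoiding 0 allows division by their elements when dilates are
    -- parametrised as ratios.
    record Ind (D : F → ℕ) : Set where
      field
        idem : ∀ x → D x * D x ≡ D x
        at-zero : D 0# ≡ 0
        scale : ∀ γ x → G γ ≡ 1 → D (γ ⊠ x) ≡ D x

    size : (F → ℕ) → ℕ
    size D = ∑ D

    ρ : (F → ℕ) → F → ℕ
    ρ D k = ∑ (λ x → D x * D (k ⊠ x))

    module Triangles (h : F) (h≢0 : h ≢ 0#) (D : F → ℕ) (ind : Ind D) where
      open Ind ind

      μ : F → ℕ
      μ y = ∑ (λ x → G x * D (y ⊖ h ⊠ x))

      -- For y in Γ, replacing x by yx turns y - hx into y(1 - hx), and D is Γ-invariant. So the
      -- graph joining x and y when y - hx lies in D is regular.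
      μ-constant : ∀ y → G y ≡ 1 → μ y ≡ μ 1#
      μ-constant y g = begin
        ∑ (λ x → G x * D (y ⊖ h ⊠ x)) ≡⟨ ∑-scale (λ x → G x * D (y ⊖ h ⊠ x)) (G≢0 g) ⟨
        ∑ (λ x → G (y ⊠ x) * D (y ⊖ h ⊠ (y ⊠ x))) ≡⟨ ∑-cong (λ x → cong₂ _*_ (G-invariant y x g) (trans (cong D (solve 4 (λ y m h x → y :+ m :* (h :* (y :* x)) := y :* (con 1 :+ m :* (h :* x))) refl y -1# h x)) (scale y _ g))) ⟩
        ∑ (λ x → G x * D (1# ⊖ h ⊠ x)) ∎
        where open ≡-Reasoning

      n*μ : n * μ 1# ≡ ∑ (λ c → D c * f h c)
      n*μ = begin
        n * μ 1# ≡⟨ ∑-G* (μ 1#) ⟨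
        ∑ (λ y → G y * μ 1#) ≡⟨ ∑-cong (λ y → G-guard y (λ g → sym (μ-constant y g))) ⟩
        ∑ (λ y → G y * μ y) ≡⟨ ∑-cong (λ y → sym (∑-*ˡ (G y) _)) ⟩
        ∑ (λ y → ∑ (λ x → G y * (G x * D (y ⊖ h ⊠ x)))) ≡⟨ ∑-swap _ ⟩
        ∑ (λ x → ∑ (λ y → G y * (G x * D (y ⊖ h ⊠ x)))) ≡⟨ ∑-cong (λ x → trans (∑-cong (λ y → cong (λ w → G w * (G x * D (y ⊖ h ⊠ x))) (sym (⊖-⊞ y (h ⊠ x))))) (∑-minus (λ c → G (c ⊞ h ⊠ x) * (G x * D c)) (h ⊠ x))) ⟩
        ∑ (λ x → ∑ (λ c → G (c ⊞ h ⊠ x) * (G x * D c))) ≡⟨ ∑-swap _ ⟩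
        ∑ (λ c → ∑ (λ x → G (c ⊞ h ⊠ x) * (G x * D c))) ≡⟨ ∑-cong (λ c → trans (∑-cong (λ x → solveℕ 3 (λ a b d → a ⟨*⟩ (b ⟨*⟩ d) ⟨=⟩ d ⟨*⟩ (b ⟨*⟩ a)) refl (G (c ⊞ h ⊠ x)) (G x) (D c))) (trans (∑-*ˡ (D c) _) (cong (D c *_) (sym (f-def h c))))) ⟩
        ∑ (λ c → D c * f h c) ∎
        where open ≡-Reasoning

      u : F → F → ℕ
      u x y = G y * D (y ⊖ h ⊠ x)

      -- Its second moment over x in Γ and all b is `S`, while its first moment over x is a multiple
      -- of r(b); comparing the two is the first Cauchy-Schwarz step.
      C′ : F → F → ℕ
      C′ x b = ∑ (λ y → u x y * G (y ⊞ b))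

      S : ℕ
      S = ∑ (λ x → G x * ∑ (λ y → ∑ (λ z → u x y * u x z * r (y ⊖ z))))

      ∑C′² : ∀ x → ∑ (λ b → C′ x b * C′ x b) ≡ ∑ (λ y → ∑ (λ z → u x y * u x z * r (y ⊖ z)))
      ∑C′² x = begin
        ∑ (λ b → C′ x b * C′ x b) ≡⟨ ∑-cong (λ b → sym (∑∑-* _ _)) ⟩
        ∑ (λ b → ∑ (λ y → ∑ (λ z → u x y * G (y ⊞ b) * (u x z * G (z ⊞ b))))) ≡⟨ ∑-pull _ ⟩
        ∑ (λ y → ∑ (λ z → ∑ (λ b → u x y * G (y ⊞ b) * (u x z * G (z ⊞ b))))) ≡⟨ ∑∑-cong (λ y z → trans (∑-cong (λ b → solveℕ 4 (λ a b c d → a ⟨*⟩ b ⟨*⟩ (c ⟨*⟩ d) ⟨=⟩ a ⟨*⟩ c ⟨*⟩ (b ⟨*⟩ d)) refl (u x y) (G (y ⊞ b)) (u x z) (G (z ⊞ b)))) (trans (∑-*ˡ (u x y * u x z) _) (cong (u x y * u x z *_) (correlation y z)))) ⟩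
        ∑ (λ y → ∑ (λ z → u x y * u x z * r (y ⊖ z))) ∎
        where open ≡-Reasoning

      -- There are r(b) elements y of Γ with y + b in Γ, and each of them has μ(1) neighbours x.
      ∑GC′ : ∀ b → ∑ (λ x → G x * C′ x b) ≡ μ 1# * r b
      ∑GC′ b = begin
        ∑ (λ x → G x * C′ x b) ≡⟨ ∑-cong (λ x → sym (∑-*ˡ (G x) _)) ⟩
        ∑ (λ x → ∑ (λ y → G x * (u x y * G (y ⊞ b)))) ≡⟨ ∑-swap _ ⟩
        ∑ (λ y → ∑ (λ x → G x * (u x y * G (y ⊞ b)))) ≡⟨ ∑-cong (λ y → trans (∑-cong (λ x → solveℕ 4 (λ a b c d → a ⟨*⟩ (b ⟨*⟩ c ⟨*⟩ d) ⟨=⟩ b ⟨*⟩ d ⟨*⟩ (a ⟨*⟩ c)) refl (G x) (G y) (D (y ⊖ h ⊠ x)) (G (y ⊞ b)))) (∑-*ˡ (G y * G (y ⊞ b)) _)) ⟩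
        ∑ (λ y → G y * G (y ⊞ b) * μ y) ≡⟨ ∑-cong (λ y → trans (ℕₚ.*-assoc (G y) _ _) (trans (G-guard y (λ g → trans (cong (G (y ⊞ b) *_) (μ-constant y g)) (ℕₚ.*-comm _ (μ 1#)))) (solveℕ 3 (λ a b c → a ⟨*⟩ (b ⟨*⟩ c) ⟨=⟩ b ⟨*⟩ (a ⟨*⟩ c)) refl (G y) (μ 1#) (G (y ⊞ b))))) ⟩
        ∑ (λ y → μ 1# * (G y * G (y ⊞ b))) ≡⟨ ∑-*ˡ (μ 1#) _ ⟩
        μ 1# * ∑ (λ y → G y * G (y ⊞ b)) ≡⟨ cong (μ 1# *_) (trans (∑-cong (λ y → cong (λ w → G y * G w) (trans (+-comm y b) (cong (b ⊞_) (sym (*-identityˡ y)))))) (sym (f-def 1# b))) ⟩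
        μ 1# * r b ∎
        where open ≡-Reasoning

      μ²E≤nS : μ 1# * μ 1# * E 1# ≤ n * S
      μ²E≤nS = begin
        μ 1# * μ 1# * E 1# ≡⟨ ∑-*ˡ (μ 1# * μ 1#) _ ⟨
        ∑ (λ b → μ 1# * μ 1# * (r b * r b)) ≡⟨ ∑-cong (λ b → solveℕ 2 (λ m r → m ⟨*⟩ m ⟨*⟩ (r ⟨*⟩ r) ⟨=⟩ m ⟨*⟩ r ⟨*⟩ (m ⟨*⟩ r)) refl (μ 1#) (r b)) ⟩
        ∑ (λ b → μ 1# * r b * (μ 1# * r b)) ≡⟨ ∑-cong (λ b → cong₂ _*_ (∑GC′ b) (∑GC′ b)) ⟨
        ∑ (λ b → ∑ (λ x → G x * C′ x b) * ∑ (λ x → G x * C′ x b)) ≤⟨ ∑-mono (λ b → cs-weighted G (λ x → C′ x b)) ⟩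
        ∑ (λ b → n * ∑ (λ x → G x * (C′ x b * C′ x b))) ≡⟨ ∑-*ˡ n _ ⟩
        n * ∑ (λ b → ∑ (λ x → G x * (C′ x b * C′ x b))) ≡⟨ cong (n *_) (trans (∑-swap _) (∑-cong (λ x → trans (∑-*ˡ (G x) _) (cong (G x *_) (∑C′² x))))) ⟩
        n * S ∎
        where open ℕₚ.≤-Reasoning

      C₃ : F → F → ℕ
      C₃ α β = ∑ (λ x → G x * (G (α ⊞ h ⊠ x) * G (β ⊞ h ⊠ x)))

      DDr : F → F → ℕ
      DDr α β = D α * D β * r (α ⊖ β)

      -- The variables α = y - hx and β = z - hx have the same difference as y and z. For given α
      -- and β, `C₃` counts the x that complete the triangle.
      S≡ : S ≡ ∑ (λ α → ∑ (λ β → DDr α β * C₃ α β))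
      S≡ = begin
        S ≡⟨ ∑-cong (λ x → cong (G x *_) (substitute x)) ⟩
        ∑ (λ x → G x * ∑ (λ α → ∑ (λ β → g x α * g x β * r (α ⊖ β)))) ≡⟨ ∑-cong (λ x → trans (sym (∑-*ˡ (G x) _)) (∑-cong (λ α → sym (∑-*ˡ (G x) _)))) ⟩
        ∑ (λ x → ∑ (λ α → ∑ (λ β → G x * (g x α * g x β * r (α ⊖ β))))) ≡⟨ ∑-pull _ ⟩
        ∑ (λ α → ∑ (λ β → ∑ (λ x → G x * (g x α * g x β * r (α ⊖ β))))) ≡⟨ ∑∑-cong (λ α β → trans (∑-cong (λ x → solveℕ 6 (λ a b c d e r → a ⟨*⟩ ((b ⟨*⟩ c) ⟨*⟩ (d ⟨*⟩ e) ⟨*⟩ r) ⟨=⟩ (c ⟨*⟩ e ⟨*⟩ r) ⟨*⟩ (a ⟨*⟩ (b ⟨*⟩ d))) refl (G x) (G (α ⊞ h ⊠ x)) (D α) (G (β ⊞ h ⊠ x)) (D β) (r (α ⊖ β)))) (∑-*ˡ (DDr α β) _)) ⟩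
        ∑ (λ α → ∑ (λ β → DDr α β * C₃ α β)) ∎
        where
        open ≡-Reasoning
        g : F → F → ℕ
        g x α = G (α ⊞ h ⊠ x) * D α
        u≡ : ∀ x y → u x y ≡ g x (y ⊖ h ⊠ x)
        u≡ x y = cong (λ w → G w * D (y ⊖ h ⊠ x)) (sym (⊖-⊞ y (h ⊠ x)))
        r≡ : ∀ x y z → r (y ⊖ z) ≡ r ((y ⊖ h ⊠ x) ⊖ (z ⊖ h ⊠ x))
        r≡ x y z = cong r (sym (trans (solve 4 (λ y z w m → (y :+ m :* w) :+ m :* (z :+ m :* w) := (y :+ m :* z) :+ (m :* w :+ m :* (m :* w))) refl y z (h ⊠ x) -1#) (trans (cong (y ⊖ z ⊞_) (x+-1x _)) (+-identityʳ _))))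
        substitute : ∀ x → ∑ (λ y → ∑ (λ z → u x y * u x z * r (y ⊖ z))) ≡ ∑ (λ α → ∑ (λ β → g x α * g x β * r (α ⊖ β)))
        substitute x = begin
          ∑ (λ y → ∑ (λ z → u x y * u x z * r (y ⊖ z))) ≡⟨ ∑∑-cong (λ y z → cong₂ _*_ (cong₂ _*_ (u≡ x y) (u≡ x z)) (r≡ x y z)) ⟩
          ∑ (λ y → ∑ (λ z → g x (y ⊖ h ⊠ x) * g x (z ⊖ h ⊠ x) * r ((y ⊖ h ⊠ x) ⊖ (z ⊖ h ⊠ x)))) ≡⟨ ∑-cong (λ y → ∑-minus (λ β → g x (y ⊖ h ⊠ x) * g x β * r ((y ⊖ h ⊠ x) ⊖ β)) (h ⊠ x)) ⟩
          ∑ (λ y → ∑ (λ β → g x (y ⊖ h ⊠ x) * g x β * r ((y ⊖ h ⊠ x) ⊖ β))) ≡⟨ ∑-minus (λ α → ∑ (λ β → g x α * g x β * r (α ⊖ β))) (h ⊠ x) ⟩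
          ∑ (λ α → ∑ (λ β → g x α * g x β * r (α ⊖ β))) ∎

      -- Expanding the square, two elements x, y of Γ with difference δ share r(hδ) values of α and
      -- as many of β, so the sum is Σ_δ r(δ) r(hδ)². Dilation by h does not change Σ r³.
      ∑C₃² : ∑ (λ α → ∑ (λ β → C₃ α β * C₃ α β)) ≤ T 1# + T 1#
      ∑C₃² = begin
        ∑ (λ α → ∑ (λ β → C₃ α β * C₃ α β)) ≡⟨ ∑∑-cong (λ α β → sym (∑∑-* _ _)) ⟩
        ∑ (λ α → ∑ (λ β → ∑ (λ x → ∑ (λ y → t α x β * t α y β)))) ≡⟨ ∑-cong (λ α → trans (∑-pull _) (∑∑-cong (λ x y → refl))) ⟩
        ∑ (λ α → ∑ (λ x → ∑ (λ y → ∑ (λ β → t α x β * t α y β)))) ≡⟨ ∑-pull _ ⟩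
        ∑ (λ x → ∑ (λ y → ∑ (λ α → ∑ (λ β → t α x β * t α y β)))) ≡⟨ ∑∑-cong (λ x y → inner x y) ⟩
        ∑ (λ x → ∑ (λ y → G x * (G y * k (x ⊖ y)))) ≡⟨ ∑-differences k ⟩
        ∑ (λ δ → r δ * (r (h ⊠ δ) * r (h ⊠ δ))) ≤⟨ ∑-mono (λ δ → xyy≤ (r δ) (r (h ⊠ δ))) ⟩
        ∑ (λ δ → r δ * r δ * r δ + r (h ⊠ δ) * r (h ⊠ δ) * r (h ⊠ δ)) ≡⟨ trans (∑-+ _ _) (cong (T 1# +_) (∑-scale (λ δ → r δ * r δ * r δ) h≢0)) ⟩
        T 1# + T 1# ∎
        where
        open ℕₚ.≤-Reasoning
        t : F → F → F → ℕ
        t α x β = G x * (G (α ⊞ h ⊠ x) * G (β ⊞ h ⊠ x))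
        k : F → ℕ
        k δ = r (h ⊠ δ) * r (h ⊠ δ)
        corr : ∀ x y → ∑ (λ α → G (α ⊞ h ⊠ x) * G (α ⊞ h ⊠ y)) ≡ r (h ⊠ (x ⊖ y))
        corr x y = trans (∑-cong (λ α → cong₂ (λ a b → G a * G b) (+-comm α _) (+-comm α _))) (trans (correlation (h ⊠ x) (h ⊠ y))
          (cong r (solve 4 (λ h x y m → h :* x :+ m :* (h :* y) := h :* (x :+ m :* y)) refl h x y -1#)))
        inner : ∀ x y → ∑ (λ α → ∑ (λ β → t α x β * t α y β)) ≡ G x * (G y * k (x ⊖ y))
        inner x y = begin-equality
          ∑ (λ α → ∑ (λ β → t α x β * t α y β)) ≡⟨ ∑∑-cong (λ α β → solveℕ 6 (λ a b c a′ b′ c′ → a ⟨*⟩ (b ⟨*⟩ c) ⟨*⟩ (a′ ⟨*⟩ (b′ ⟨*⟩ c′)) ⟨=⟩ a ⟨*⟩ a′ ⟨*⟩ (b ⟨*⟩ b′) ⟨*⟩ (c ⟨*⟩ c′)) refl (G x) (G (α ⊞ h ⊠ x)) (G (β ⊞ h ⊠ x)) (G y) (G (α ⊞ h ⊠ y)) (G (β ⊞ h ⊠ y))) ⟩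
          ∑ (λ α → ∑ (λ β → G x * G y * (G (α ⊞ h ⊠ x) * G (α ⊞ h ⊠ y)) * (G (β ⊞ h ⊠ x) * G (β ⊞ h ⊠ y)))) ≡⟨ ∑∑-* _ _ ⟩
          ∑ (λ α → G x * G y * (G (α ⊞ h ⊠ x) * G (α ⊞ h ⊠ y))) * ∑ (λ β → G (β ⊞ h ⊠ x) * G (β ⊞ h ⊠ y)) ≡⟨ cong₂ _*_ (trans (∑-*ˡ (G x * G y) _) (cong (G x * G y *_) (corr x y))) (corr x y) ⟩
          G x * G y * r (h ⊠ (x ⊖ y)) * r (h ⊠ (x ⊖ y)) ≡⟨ solveℕ 3 (λ a b c → a ⟨*⟩ b ⟨*⟩ c ⟨*⟩ c ⟨=⟩ a ⟨*⟩ (b ⟨*⟩ (c ⟨*⟩ c))) refl (G x) (G y) (r (h ⊠ (x ⊖ y))) ⟩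
          G x * (G y * k (x ⊖ y)) ∎
        xyy≤ : ∀ x y → x * (y * y) ≤ x * x * x + y * y * y
        xyy≤ x y with ℕₚ.≤-total x y
        ... | inj₁ le = ≤-trans (ℕₚ.*-monoˡ-≤ (y * y) le) (≤-trans (≤-reflexive (sym (ℕₚ.*-assoc y y y))) (ℕₚ.m≤n+m _ (x * x * x)))
        ... | inj₂ le = ≤-trans (ℕₚ.*-monoʳ-≤ x (*-mono-≤ le le)) (≤-trans (≤-reflexive (sym (ℕₚ.*-assoc x x x))) (ℕₚ.m≤m+n _ (y * y * y)))

      X : ℕ
      X = ∑ (λ α → ∑ (λ β → D α * D β * (r (α ⊖ β) * r (α ⊖ β))))

      -- The second Cauchy-Schwarz separates r(α - β) from `C₃`; of the two factors on the right
      -- only `X` still depends on D.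
      S²≤ : S * S ≤ (T 1# + T 1#) * X
      S²≤ = begin
        S * S ≡⟨ cong₂ _*_ S≡ S≡ ⟩
        ∑ (λ α → ∑ (λ β → DDr α β * C₃ α β)) * ∑ (λ α → ∑ (λ β → DDr α β * C₃ α β)) ≤⟨ cauchy-schwarz² DDr C₃ ⟩
        ∑ (λ α → ∑ (λ β → DDr α β * DDr α β)) * ∑ (λ α → ∑ (λ β → C₃ α β * C₃ α β)) ≤⟨ *-mono-≤ (≤-reflexive (∑∑-cong square)) ∑C₃² ⟩
        X * (T 1# + T 1#) ≡⟨ ℕₚ.*-comm X _ ⟩
        (T 1# + T 1#) * X ∎
        where
        open ℕₚ.≤-Reasoning
        square : ∀ α β → DDr α β * DDr α β ≡ D α * D β * (r (α ⊖ β) * r (α ⊖ β))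
        square α β = trans (solveℕ 3 (λ a b r → a ⟨*⟩ b ⟨*⟩ r ⟨*⟩ (a ⟨*⟩ b ⟨*⟩ r) ⟨=⟩ (a ⟨*⟩ a) ⟨*⟩ (b ⟨*⟩ b) ⟨*⟩ (r ⟨*⟩ r)) refl (D α) (D β) (r (α ⊖ β))) (cong₂ (λ a b → a * b * (r (α ⊖ β) * r (α ⊖ β))) (idem α) (idem β))

-- Dyadic levels and weighted incidence sums.

module IncidenceSums where

  open import Data.Nat using (ℕ; zero; suc; _*_; _^_; _≤_; _<_; z≤n; s≤s; _≤?_; _<?_)
  open import Data.Nat.Properties as ℕₚ using (≤-trans; ≤-reflexive)
  open import Data.Nat.Solver using (module +-*-Solver)
  open import Data.Fin as Fin using (Fin; toℕ)
  import Data.Fin.Properties as Finₚ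
  open import Data.Product using (∃; _×_; _,_)
  open import Data.Sum using (_⊎_; inj₁; inj₂)
  open import Data.Empty using (⊥-elim)
  open import Relation.Nullary using (Dec; yes; no)
  open import Relation.Binary.PropositionalEquality
  open PrimeFields
  open FieldArithmetic
  open FiniteSums
  open SubgroupCounting
  open LevelSetArithmetic
  open LevelSets
  open EnergyInequalities

  ∑-swap₂ : ∀ {a b c d} (h : Fin a → Fin b → Fin c → Fin d → ℕ) →
    ∑ (λ i → ∑ (λ j → ∑ (λ k → ∑ (λ l → h i j k l)))) ≡ ∑ (λ k → ∑ (λ l → ∑ (λ i → ∑ (λ j → h i j k l))))
  ∑-swap₂ h = trans (∑-cong (λ i → ∑-pull _)) (∑-pull _)

  lvl : ℕ → ℕ → ℕ
  lvl i x = ⟦ 2 ^ i ≤? x ⟧ * ⟦ x <? 2 ^ suc i ⟧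

  lvl-01 : ∀ i x → lvl i x ≡ 0 ⊎ lvl i x ≡ 1
  lvl-01 i x with 2 ^ i ≤? x | x <? 2 ^ suc i
  ... | yes _ | yes _ = inj₂ refl
  ... | yes _ | no _ = inj₁ refl
  ... | no _ | _ = inj₁ refl

  lvl-lower : ∀ i x → lvl i x * 2 ^ i ≤ x
  lvl-lower i x with 2 ^ i ≤? x | x <? 2 ^ suc i
  ... | yes le | yes _ = ≤-trans (≤-reflexive (ℕₚ.*-identityˡ _)) le
  ... | yes _ | no _ = z≤n
  ... | no _ | _ = z≤n

  lvl≤ : ∀ i x → lvl i x ≤ ⟦ 2 ^ i ≤? x ⟧
  lvl≤ i x = ≤-trans (ℕₚ.*-monoʳ-≤ ⟦ 2 ^ i ≤? x ⟧ (⟦⟧≤1 (x <? 2 ^ suc i))) (≤-reflexive (ℕₚ.*-identityʳ _))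

  01-idem : ∀ {x} → x ≡ 0 ⊎ x ≡ 1 → x * x ≡ x
  01-idem (inj₁ refl) = refl
  01-idem (inj₂ refl) = refl

  01-* : ∀ {x y} → x ≡ 0 ⊎ x ≡ 1 → y ≡ 0 ⊎ y ≡ 1 → x * y ≡ 0 ⊎ x * y ≡ 1
  01-* (inj₁ refl) _ = inj₁ refl
  01-* (inj₂ refl) (inj₁ refl) = inj₁ refl
  01-* (inj₂ refl) (inj₂ refl) = inj₂ refl

  ⟦⟧-01 : ∀ {a} {A : Set a} (d : Dec A) → ⟦ d ⟧ ≡ 0 ⊎ ⟦ d ⟧ ≡ 1
  ⟦⟧-01 (yes _) = inj₂ refl
  ⟦⟧-01 (no _) = inj₁ refl

  dyadic : ∀ L x → 0 < x → x < 2 ^ L → ∃ λ (i : Fin L) → 2 ^ toℕ i ≤ x × x < 2 ^ suc (toℕ i)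
  dyadic zero x 0<x x<1 = ⊥-elim (ℕₚ.<⇒≱ x<1 0<x)
  dyadic (suc L) x 0<x x<2^ with x <? 2 ^ L
  ... | yes x< with dyadic L x 0<x x<
  ... | i , lo , hi = Fin.inject₁ i , subst (λ k → 2 ^ k ≤ x × x < 2 ^ suc k) (sym (Finₚ.toℕ-inject₁ i)) (lo , hi)
  dyadic (suc L) x 0<x x<2^ | no x≮ = Fin.fromℕ L , subst (λ k → 2 ^ k ≤ x × x < 2 ^ suc k) (sym (Finₚ.toℕ-fromℕ L)) (ℕₚ.≮⇒≥ x≮ , x<2^)

  -- Zero lies in no dyadic level, hence the assumption on g 0. For any other x below 2^L the
  -- summand of its own level already suffices.
  dyadic-sum : ∀ L x (g b : ℕ → ℕ) → x < 2 ^ L → g 0 ≡ 0 → (∀ i → x < 2 ^ suc i → g x ≤ b i) → g x ≤ ∑ {L} (λ i → lvl (toℕ i) x * b (toℕ i))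
  dyadic-sum L zero g b x< g0 up = ≤-trans (≤-reflexive g0) z≤n
  dyadic-sum L x@(suc _) g b x< g0 up with dyadic L x (s≤s z≤n) x<
  ... | i , lo , hi = ≤-trans (up (toℕ i) hi) (≤-trans (≤-reflexive (sym (trans (cong (_* b (toℕ i)) (cong₂ _*_ (⟦⟧-yes (2 ^ toℕ i ≤? x) lo) (⟦⟧-yes (x <? 2 ^ suc (toℕ i)) hi))) (ℕₚ.*-identityˡ _))))
    (∑-term (λ i → lvl (toℕ i) x * b (toℕ i)) i))

  module Incidences {p : ℕ} (𝔽 : PrimeField p) {G : Fin p → ℕ} (isG : IsSubgroupIndicator 𝔽 G) where
    open FieldLemmas 𝔽
    open IsSubgroupIndicator isG
    open Subgroup 𝔽 isG
    open Representations 𝔽 isG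
    open Energies 𝔽 isG
    open +-*-Solver using () renaming (solve to solveℕ; _:+_ to _⟨+⟩_; _:*_ to _⟨*⟩_; _:=_ to _⟨=⟩_)

    guard : ∀ {D} → Ind D → ∀ x {a b : ℕ} → (x ≢ 0# → a ≡ b) → D x * a ≡ D x * b
    guard {D} ind x {a} {b} h = go (x Fin.≟ 0#)
      where
      D≡0 : x ≡ 0# → D x ≡ 0
      D≡0 e = trans (cong D e) (Ind.at-zero ind)
      go : Dec (x ≡ 0#) → D x * a ≡ D x * b
      go (yes e) = trans (cong (_* a) (D≡0 e)) (sym (cong (_* b) (D≡0 e)))
      go (no ne) = cong (D x *_) (h ne)

    ∑-scaleʳ : ∀ (g : F → ℕ) {a} → a ≢ 0# → ∑ (λ x → g (x ⊠ a)) ≡ ∑ g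
    ∑-scaleʳ g {a} ne = trans (∑-cong (λ x → cong g (*-comm x a))) (∑-scale g ne)

    ∑ρ : ∀ {Q} → Ind Q → ∑ (ρ Q) ≡ size Q * size Q
    ∑ρ {Q} ind = begin
      ∑ (λ k → ∑ (λ x → Q x * Q (k ⊠ x))) ≡⟨ ∑-swap _ ⟩
      ∑ (λ x → ∑ (λ k → Q x * Q (k ⊠ x))) ≡⟨ ∑-cong (λ x → trans (∑-*ˡ (Q x) _) (guard ind x (λ ne → ∑-scaleʳ Q ne))) ⟩
      ∑ (λ x → Q x * size Q) ≡⟨ ∑-*ʳ (size Q) Q ⟩
      size Q * size Q ∎
      where open ≡-Reasoning

    module Incidence (D Q : F → ℕ) (indD : Ind D) (indQ : Ind Q) where

      B : ℕ
      B = ∑ (λ α → ∑ (λ β → D α * D β * Q (α ⊖ β)))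

      w : F → F → ℕ
      w l c = ∑ (λ α → D α * (D (l ⊠ α) * Q (c ⊠ α)))

      Z : ℕ
      Z = ∑ (λ k → ρ D k * (ρ D k * ρ Q k))

      private
        K : F → F → ℕ
        K α β = ∑ (λ a → ∑ (λ b → G a * (G b * Q (a ⊠ α ⊖ b ⊠ β))))

        inner : ∀ l α → ∑ (λ c → Q (c ⊠ α) * f l c) ≡ K α (l ⊠ α)
        inner l α = begin
          ∑ (λ c → Q (c ⊠ α) * f l c) ≡⟨ ∑-cong (λ c → trans (cong (Q (c ⊠ α) *_) (f-def l c)) (sym (∑-*ˡ (Q (c ⊠ α)) _))) ⟩
          ∑ (λ c → ∑ (λ b → Q (c ⊠ α) * (G b * G (c ⊞ l ⊠ b)))) ≡⟨ ∑-swap _ ⟩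
          ∑ (λ b → ∑ (λ c → Q (c ⊠ α) * (G b * G (c ⊞ l ⊠ b)))) ≡⟨ ∑-cong (λ b → trans (sym (∑-minus (λ c → Q (c ⊠ α) * (G b * G (c ⊞ l ⊠ b))) (l ⊠ b))) (∑-cong (λ a → term a b))) ⟩
          ∑ (λ b → ∑ (λ a → G a * (G b * Q (a ⊠ α ⊖ b ⊠ (l ⊠ α))))) ≡⟨ ∑-swap _ ⟩
          K α (l ⊠ α) ∎
          where
          open ≡-Reasoning
          term : ∀ a b → Q ((a ⊖ l ⊠ b) ⊠ α) * (G b * G ((a ⊖ l ⊠ b) ⊞ l ⊠ b)) ≡ G a * (G b * Q (a ⊠ α ⊖ b ⊠ (l ⊠ α)))
          term a b = trans (cong₂ (λ x y → Q x * (G b * G y)) (solve 5 (λ a m l b α → (a :+ m :* (l :* b)) :* α := a :* α :+ m :* (b :* (l :* α))) refl a -1# l b α) (⊖-⊞ a (l ⊠ b)))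
            (solveℕ 3 (λ q b a → q ⟨*⟩ (b ⟨*⟩ a) ⟨=⟩ a ⟨*⟩ (b ⟨*⟩ q)) refl (Q (a ⊠ α ⊖ b ⊠ (l ⊠ α))) (G b) (G a))

        scaled : ∀ a b → G a ≡ 1 → G b ≡ 1 → ∑ (λ α → ∑ (λ β → D α * D β * Q (a ⊠ α ⊖ b ⊠ β))) ≡ B
        scaled a b ga gb = begin
          ∑ (λ α → ∑ (λ β → D α * D β * Q (a ⊠ α ⊖ b ⊠ β))) ≡⟨ ∑∑-cong (λ α β → cong₂ (λ x y → x * y * Q (a ⊠ α ⊖ b ⊠ β)) (sym (Ind.scale indD a α ga)) (sym (Ind.scale indD b β gb))) ⟩
          ∑ (λ α → ∑ (λ β → D (a ⊠ α) * D (b ⊠ β) * Q (a ⊠ α ⊖ b ⊠ β))) ≡⟨ ∑-cong (λ α → ∑-scale (λ β → D (a ⊠ α) * D β * Q (a ⊠ α ⊖ β)) (G≢0 gb)) ⟩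
          ∑ (λ α → ∑ (λ β → D (a ⊠ α) * D β * Q (a ⊠ α ⊖ β))) ≡⟨ ∑-scale (λ α → ∑ (λ β → D α * D β * Q (α ⊖ β))) (G≢0 ga) ⟩
          B ∎
          where open ≡-Reasoning

      -- By Γ-invariance of D, n²B counts the (a, b, α, β) with a, b in Γ, α, β in D and aα - bβ in
      -- Q. Put β = lα and c = a - lb; the condition becomes cα in Q, so (l, c) collects w(l, c)
      -- values of α and f_l(c) pairs (a, b).
      incidences : ∑ (λ l → ∑ (λ c → w l c * f l c)) ≡ n * (n * B)
      incidences = begin
        ∑ (λ l → ∑ (λ c → w l c * f l c)) ≡⟨ ∑∑-cong (λ l c → trans (sym (∑-*ʳ (f l c) _)) (∑-cong (λ α → solveℕ 4 (λ d e q f → d ⟨*⟩ (e ⟨*⟩ q) ⟨*⟩ f ⟨=⟩ d ⟨*⟩ (e ⟨*⟩ (q ⟨*⟩ f))) refl (D α) (D (l ⊠ α)) (Q (c ⊠ α)) (f l c)))) ⟩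
        ∑ (λ l → ∑ (λ c → ∑ (λ α → D α * (D (l ⊠ α) * (Q (c ⊠ α) * f l c))))) ≡⟨ ∑-pull (λ α l c → D α * (D (l ⊠ α) * (Q (c ⊠ α) * f l c))) ⟨
        ∑ (λ α → ∑ (λ l → ∑ (λ c → D α * (D (l ⊠ α) * (Q (c ⊠ α) * f l c))))) ≡⟨ ∑-cong (λ α → trans (∑-cong (λ l → trans (∑-*ˡ (D α) _) (cong (D α *_) (trans (∑-*ˡ (D (l ⊠ α)) _) (cong (D (l ⊠ α) *_) (inner l α)))))) (trans (∑-*ˡ (D α) _) (guard indD α (λ ne → ∑-scaleʳ (λ β → D β * K α β) ne)))) ⟩
        ∑ (λ α → D α * ∑ (λ β → D β * K α β)) ≡⟨ ∑-cong (λ α → trans (sym (∑-*ˡ (D α) _)) (∑-cong (λ β → trans (sym (ℕₚ.*-assoc (D α) (D β) _)) (trans (sym (∑-*ˡ (D α * D β) _)) (∑-cong (λ a → trans (sym (∑-*ˡ (D α * D β) _)) (∑-cong (λ b → solveℕ 4 (λ d a b q → d ⟨*⟩ (a ⟨*⟩ (b ⟨*⟩ q)) ⟨=⟩ a ⟨*⟩ (b ⟨*⟩ (d ⟨*⟩ q))) refl (D α * D β) (G a) (G b) (Q (a ⊠ α ⊖ b ⊠ β)))))))))) ⟩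
        ∑ (λ α → ∑ (λ β → ∑ (λ a → ∑ (λ b → G a * (G b * (D α * D β * Q (a ⊠ α ⊖ b ⊠ β))))))) ≡⟨ ∑-swap₂ _ ⟩
        ∑ (λ a → ∑ (λ b → ∑ (λ α → ∑ (λ β → G a * (G b * (D α * D β * Q (a ⊠ α ⊖ b ⊠ β))))))) ≡⟨ ∑∑-cong (λ a b → trans (∑-cong (λ α → trans (∑-*ˡ (G a) _) (cong (G a *_) (∑-*ˡ (G b) _)))) (trans (∑-*ˡ (G a) _) (cong (G a *_) (∑-*ˡ (G b) _)))) ⟩
        ∑ (λ a → ∑ (λ b → G a * (G b * ∑ (λ α → ∑ (λ β → D α * D β * Q (a ⊠ α ⊖ b ⊠ β)))))) ≡⟨ ∑∑-cong (λ a b → G-guard a (λ ga → G-guard b (λ gb → scaled a b ga gb))) ⟩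
        ∑ (λ a → ∑ (λ b → G a * (G b * B))) ≡⟨ ∑-cong (λ a → trans (∑-*ˡ (G a) _) (cong (G a *_) (∑-G* B))) ⟩
        ∑ (λ a → G a * (n * B)) ≡⟨ ∑-G* (n * B) ⟩
        n * (n * B) ∎
        where open ≡-Reasoning

      ∑w : ∑ (λ l → ∑ (w l)) ≡ size D * (size D * size Q)
      ∑w = begin
        ∑ (λ l → ∑ (λ c → ∑ (λ α → D α * (D (l ⊠ α) * Q (c ⊠ α))))) ≡⟨ ∑-pull (λ α l c → D α * (D (l ⊠ α) * Q (c ⊠ α))) ⟨
        ∑ (λ α → ∑ (λ l → ∑ (λ c → D α * (D (l ⊠ α) * Q (c ⊠ α))))) ≡⟨ ∑-cong (λ α → trans (∑-cong (λ l → ∑-*ˡ (D α) _)) (trans (∑-*ˡ (D α) _) (guard indD α (λ ne → trans (∑∑-* _ _) (cong₂ _*_ (∑-scaleʳ D ne) (∑-scaleʳ Q ne)))))) ⟩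
        ∑ (λ α → D α * (size D * size Q)) ≡⟨ ∑-*ʳ (size D * size Q) D ⟩
        size D * (size D * size Q) ∎
        where open ≡-Reasoning

      -- Write the second element as α′ = kα. There are ρ_D(k) such pairs, and the sums over l and
      -- over c contribute ρ_D(k) and ρ_Q(k).
      ∑w² : ∑ (λ l → ∑ (λ c → w l c * w l c)) ≡ Z
      ∑w² = begin
        ∑ (λ l → ∑ (λ c → w l c * w l c)) ≡⟨ ∑∑-cong (λ l c → sym (∑∑-* _ _)) ⟩
        ∑ (λ l → ∑ (λ c → ∑ (λ α → ∑ (λ α′ → D α * (D (l ⊠ α) * Q (c ⊠ α)) * (D α′ * (D (l ⊠ α′) * Q (c ⊠ α′))))))) ≡⟨ ∑-swap₂ _ ⟩
        ∑ (λ α → ∑ (λ α′ → ∑ (λ l → ∑ (λ c → D α * (D (l ⊠ α) * Q (c ⊠ α)) * (D α′ * (D (l ⊠ α′) * Q (c ⊠ α′))))))) ≡⟨ ∑∑-cong (λ α α′ → split α α′) ⟩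
        ∑ (λ α → ∑ (λ α′ → D α * (D α′ * (R D α α′ * R Q α α′)))) ≡⟨ ∑-cong (λ α → trans (∑-*ˡ (D α) _) (trans (guard indD α (λ ne → rescale α ne)) (sym (∑-*ˡ (D α) _)))) ⟩
        ∑ (λ α → ∑ (λ k → D α * (D (k ⊠ α) * (ρ D k * ρ Q k)))) ≡⟨ ∑-swap _ ⟩
        ∑ (λ k → ∑ (λ α → D α * (D (k ⊠ α) * (ρ D k * ρ Q k)))) ≡⟨ ∑-cong (λ k → trans (∑-cong (λ α → sym (ℕₚ.*-assoc (D α) _ _))) (∑-*ʳ (ρ D k * ρ Q k) _)) ⟩
        Z ∎
        where
        open ≡-Reasoning
        R : (F → ℕ) → F → F → ℕ
        R Y α α′ = ∑ (λ l → Y (l ⊠ α) * Y (l ⊠ α′))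
        split : ∀ α α′ → ∑ (λ l → ∑ (λ c → D α * (D (l ⊠ α) * Q (c ⊠ α)) * (D α′ * (D (l ⊠ α′) * Q (c ⊠ α′))))) ≡ D α * (D α′ * (R D α α′ * R Q α α′))
        split α α′ = begin
          ∑ (λ l → ∑ (λ c → D α * (D (l ⊠ α) * Q (c ⊠ α)) * (D α′ * (D (l ⊠ α′) * Q (c ⊠ α′))))) ≡⟨ ∑∑-cong (λ l c → solveℕ 6 (λ a b c d e f → a ⟨*⟩ (b ⟨*⟩ c) ⟨*⟩ (d ⟨*⟩ (e ⟨*⟩ f)) ⟨=⟩ a ⟨*⟩ d ⟨*⟩ (b ⟨*⟩ e ⟨*⟩ (c ⟨*⟩ f))) refl (D α) (D (l ⊠ α)) (Q (c ⊠ α)) (D α′) (D (l ⊠ α′)) (Q (c ⊠ α′))) ⟩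
          ∑ (λ l → ∑ (λ c → D α * D α′ * (D (l ⊠ α) * D (l ⊠ α′) * (Q (c ⊠ α) * Q (c ⊠ α′))))) ≡⟨ trans (∑-cong (λ l → ∑-*ˡ (D α * D α′) _)) (∑-*ˡ (D α * D α′) _) ⟩
          D α * D α′ * ∑ (λ l → ∑ (λ c → D (l ⊠ α) * D (l ⊠ α′) * (Q (c ⊠ α) * Q (c ⊠ α′)))) ≡⟨ trans (ℕₚ.*-assoc (D α) (D α′) _) (cong (λ x → D α * (D α′ * x)) (∑∑-* _ _)) ⟩
          D α * (D α′ * (R D α α′ * R Q α α′)) ∎
        R-ρ : ∀ Y α → α ≢ 0# → ∀ k → R Y α (k ⊠ α) ≡ ρ Y k
        R-ρ Y α ne k = trans (∑-cong (λ l → cong (λ x → Y (l ⊠ α) * Y x) (solve 3 (λ l k α → l :* (k :* α) := k :* (l :* α)) refl l k α))) (∑-scaleʳ (λ x → Y x * Y (k ⊠ x)) ne)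
        rescale : ∀ α → α ≢ 0# → ∑ (λ α′ → D α′ * (R D α α′ * R Q α α′)) ≡ ∑ (λ k → D (k ⊠ α) * (ρ D k * ρ Q k))
        rescale α ne = trans (sym (∑-scaleʳ (λ α′ → D α′ * (R D α α′ * R Q α α′)) ne)) (∑-cong (λ k → cong (D (k ⊠ α) *_) (cong₂ _*_ (R-ρ D α ne k) (R-ρ Q α ne k))))

      -- D and Q avoid 0, so w vanishes for l = 0 or c = 0, and the level bounds for nonzero l and c
      -- are enough.
      w-guard : ∀ l c {a b : ℕ} → (l ≢ 0# → c ≢ 0# → a ≤ b) → w l c * a ≤ w l c * b
      w-guard l c {a} {b} h = go (l Fin.≟ 0#) (c Fin.≟ 0#)
        where
        w≡0ˡ : l ≡ 0# → w l c ≡ 0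
        w≡0ˡ e = ∑-zero (λ α → trans (cong (λ y → D α * (y * Q (c ⊠ α))) (trans (cong D (trans (cong (_⊠ α) e) (zeroˡ α))) (Ind.at-zero indD))) (ℕₚ.*-zeroʳ (D α)))
        w≡0ʳ : c ≡ 0# → w l c ≡ 0
        w≡0ʳ e = ∑-zero (λ α → trans (cong (λ y → D α * (D (l ⊠ α) * y)) (trans (cong Q (trans (cong (_⊠ α) e) (zeroˡ α))) (Ind.at-zero indQ))) (trans (cong (D α *_) (ℕₚ.*-zeroʳ (D (l ⊠ α)))) (ℕₚ.*-zeroʳ (D α))))
        go : Dec (l ≡ 0#) → Dec (c ≡ 0#) → w l c * a ≤ w l c * b
        go (yes e) _ = ≤-trans (≤-reflexive (cong (_* a) (w≡0ˡ e))) z≤n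
        go (no _) (yes e) = ≤-trans (≤-reflexive (cong (_* a) (w≡0ʳ e))) z≤n
        go (no l≢0) (no c≢0) = ℕₚ.*-monoʳ-≤ (w l c) (h l≢0 c≢0)

-- Dyadic decomposition of energies and incidence sums.

module DyadicDecomposition where

  open import Data.Nat using (ℕ; suc; _+_; _*_; _^_; _≤_; _<_; z≤n)
  open import Data.Nat.Properties as ℕₚ using (≤-refl; ≤-trans; ≤-reflexive; <⇒≤; *-mono-≤; +-mono-≤)
  open import Data.Nat.Solver using (module +-*-Solver)
  open import Data.Fin as Fin using (Fin; toℕ)
  open import Data.Product using (∃; _×_; _,_)
  open import Data.Sum using (_⊎_; inj₁; inj₂)
  open import Relation.Nullary using (Dec; yes; no)
  open import Relation.Nullary.Decidable using (¬?)
  open import Relation.Binary.PropositionalEquality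
  open PrimeFields
  open FieldArithmetic
  open FiniteSums
  open SubgroupCounting
  open LevelSetArithmetic
  open LevelSets
  open EnergyInequalities
  open IncidenceSums

  a+b≤2max : ∀ {x} a b → x ≤ a + b → x ≤ 2 * a ⊎ x ≤ 2 * b
  a+b≤2max a b le with ℕₚ.≤-total a b
  ... | inj₁ a≤b = inj₂ (≤-trans le (≤-trans (ℕₚ.+-monoˡ-≤ b a≤b) (≤-reflexive (cong (b +_) (sym (ℕₚ.+-identityʳ b))))))
  ... | inj₂ b≤a = inj₁ (≤-trans le (≤-trans (ℕₚ.+-monoʳ-≤ a b≤a) (≤-reflexive (cong (a +_) (sym (ℕₚ.+-identityʳ a))))))

  module DyadicLevels {p : ℕ} (𝔽 : PrimeField p) {G : Fin p → ℕ} (isG : IsSubgroupIndicator 𝔽 G) (L-1 : ℕ)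
    (n<2^L : Subgroup.n 𝔽 isG < 2 ^ suc L-1) where
    open FieldLemmas 𝔽
    open IsSubgroupIndicator isG
    open Subgroup 𝔽 isG
    open Representations 𝔽 isG
    open Energies 𝔽 isG
    open Incidences 𝔽 isG
    open +-*-Solver using () renaming (solve to solveℕ; _:+_ to _⟨+⟩_; _:*_ to _⟨*⟩_; _:=_ to _⟨=⟩_)
    open ℕₚ.≤-Reasoning

    L : ℕ
    L = suc L-1

    f<2^L : ∀ l c → f l c < 2 ^ L
    f<2^L l c = ℕₚ.≤-<-trans (f≤n l c) n<2^L

    -- c = 0 is left out to satisfy `Ind`; its contribution appears as a separate term in
    -- `split-levels`.
    D : F → ℕ → F → ℕ
    D h i c = nz c * lvl i (f h c)

    D-ind : ∀ h i → Ind (D h i)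
    D-ind h i = record
      { idem = λ c → 01-idem (01-* (⟦⟧-01 (¬? (c Fin.≟ 0#))) (lvl-01 i (f h c)))
      ; at-zero = cong (_* lvl i (f h 0#)) nz-zero
      ; scale = λ γ c g → cong₂ _*_ (nz-⊠ c (G≢0 g)) (cong (lvl i) (f-scale h γ c g)) }

    d : F → ℕ → ℕ
    d h i = size (D h i)

    D-lower : ∀ h i c → D h i c * 2 ^ i ≤ f h c
    D-lower h i c = begin
      nz c * lvl i (f h c) * 2 ^ i ≤⟨ ℕₚ.*-monoˡ-≤ (2 ^ i) (ℕₚ.*-monoˡ-≤ (lvl i (f h c)) (⟦⟧≤1 (¬? (c Fin.≟ 0#)))) ⟩
      1 * lvl i (f h c) * 2 ^ i ≡⟨ cong (_* 2 ^ i) (ℕₚ.*-identityˡ (lvl i (f h c))) ⟩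
      lvl i (f h c) * 2 ^ i ≤⟨ lvl-lower i (f h c) ⟩
      f h c ∎

    dτ≤ : ∀ h i → d h i * 2 ^ i ≤ ∑ (λ c → D h i c * f h c)
    dτ≤ h i = ≤-trans (≤-reflexive (sym (∑-*ʳ (2 ^ i) (D h i)))) (∑-mono (λ c → begin
      D h i c * 2 ^ i ≡⟨ cong (_* 2 ^ i) (Ind.idem (D-ind h i) c) ⟨
      D h i c * D h i c * 2 ^ i ≡⟨ ℕₚ.*-assoc (D h i c) _ _ ⟩
      D h i c * (D h i c * 2 ^ i) ≤⟨ ℕₚ.*-monoʳ-≤ (D h i c) (D-lower h i c) ⟩
      D h i c * f h c ∎))

    dτ²≤E : ∀ h i → d h i * (2 ^ i * 2 ^ i) ≤ E h
    dτ²≤E h i = ≤-trans (≤-reflexive (sym (∑-*ʳ (2 ^ i * 2 ^ i) (D h i)))) (∑-mono (λ c → begin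
      D h i c * (2 ^ i * 2 ^ i) ≡⟨ cong (_* (2 ^ i * 2 ^ i)) (Ind.idem (D-ind h i) c) ⟨
      D h i c * D h i c * (2 ^ i * 2 ^ i) ≡⟨ solveℕ 2 (λ a b → a ⟨*⟩ a ⟨*⟩ (b ⟨*⟩ b) ⟨=⟩ a ⟨*⟩ b ⟨*⟩ (a ⟨*⟩ b)) refl (D h i c) (2 ^ i) ⟩
      D h i c * 2 ^ i * (D h i c * 2 ^ i) ≤⟨ *-mono-≤ (D-lower h i c) (D-lower h i c) ⟩
      f h c * f h c ∎))

    dτ³≤T : ∀ h i → d h i * (2 ^ i * 2 ^ i * 2 ^ i) ≤ T h
    dτ³≤T h i = ≤-trans (≤-reflexive (sym (∑-*ʳ (2 ^ i * 2 ^ i * 2 ^ i) (D h i)))) (∑-mono (λ c → begin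
      D h i c * (2 ^ i * 2 ^ i * 2 ^ i) ≡⟨ cong (_* (2 ^ i * 2 ^ i * 2 ^ i)) (trans (cong (_* D h i c) (Ind.idem (D-ind h i) c)) (Ind.idem (D-ind h i) c)) ⟨
      D h i c * D h i c * D h i c * (2 ^ i * 2 ^ i * 2 ^ i) ≡⟨ solveℕ 2 (λ a b → a ⟨*⟩ a ⟨*⟩ a ⟨*⟩ (b ⟨*⟩ b ⟨*⟩ b) ⟨=⟩ a ⟨*⟩ b ⟨*⟩ (a ⟨*⟩ b) ⟨*⟩ (a ⟨*⟩ b)) refl (D h i c) (2 ^ i) ⟩
      D h i c * 2 ^ i * (D h i c * 2 ^ i) * (D h i c * 2 ^ i) ≤⟨ *-mono-≤ (*-mono-≤ (D-lower h i c) (D-lower h i c)) (D-lower h i c) ⟩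
      f h c * f h c * f h c ∎))

    nz-split : ∀ c (g : ℕ) → g ≤ ⟦ c Fin.≟ 0# ⟧ * g + nz c * g
    nz-split c g with c Fin.≟ 0#
    ... | yes _ = ≤-reflexive (sym (trans (ℕₚ.+-identityʳ _) (ℕₚ.+-identityʳ g)))
    ... | no _ = ≤-reflexive (sym (ℕₚ.+-identityʳ g))

    ∑-at-zero : ∀ (g : F → ℕ) → ∑ (λ c → ⟦ c Fin.≟ 0# ⟧ * g c) ≡ g 0#
    ∑-at-zero g = trans (∑-single _ 0# (λ j ne → cong (_* g j) (⟦⟧-no (j Fin.≟ 0#) ne))) (trans (cong (_* g 0#) (⟦⟧-yes (0# Fin.≟ 0#) refl)) (ℕₚ.*-identityˡ _))

    split-levels : ∀ h (g b : ℕ → ℕ) → g 0 ≡ 0 → (∀ x i → x < 2 ^ suc i → g x ≤ b i) →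
      ∑ (λ c → g (f h c)) ≤ g (f h 0#) + ∑ {L} (λ i → d h (toℕ i) * b (toℕ i))
    split-levels h g b g0 up = begin
      ∑ (λ c → g (f h c)) ≤⟨ ∑-mono (λ c → nz-split c (g (f h c))) ⟩
      ∑ (λ c → ⟦ c Fin.≟ 0# ⟧ * g (f h c) + nz c * g (f h c)) ≡⟨ trans (∑-+ _ _) (cong (_+ ∑ (λ c → nz c * g (f h c))) (∑-at-zero (λ c → g (f h c)))) ⟩
      g (f h 0#) + ∑ (λ c → nz c * g (f h c)) ≤⟨ ℕₚ.+-monoʳ-≤ (g (f h 0#)) (∑-mono (λ c → ℕₚ.*-monoʳ-≤ (nz c) (dyadic-sum L (f h c) g b (f<2^L h c) g0 (up (f h c))))) ⟩
      g (f h 0#) + ∑ (λ c → nz c * ∑ {L} (λ i → lvl (toℕ i) (f h c) * b (toℕ i))) ≡⟨ cong (g (f h 0#) +_) (trans (∑-cong (λ c → trans (sym (∑-*ˡ (nz c) _)) (∑-cong (λ i → sym (ℕₚ.*-assoc (nz c) _ _))))) (trans (∑-swap _) (∑-cong (λ i → ∑-*ʳ (b (toℕ i)) (D h (toℕ i)))))) ⟩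
      g (f h 0#) + ∑ {L} (λ i → d h (toℕ i) * b (toℕ i)) ∎

    sq cb : ℕ → ℕ
    sq x = x * x
    cb x = x * x * x

    private
      sq-up : ∀ x i → x < 2 ^ suc i → sq x ≤ 4 * sq (2 ^ i)
      sq-up x i lt = ≤-trans (*-mono-≤ (<⇒≤ lt) (<⇒≤ lt)) (≤-reflexive (solveℕ 1 (λ t → (+-*-Solver.con 2 ⟨*⟩ t) ⟨*⟩ (+-*-Solver.con 2 ⟨*⟩ t) ⟨=⟩ +-*-Solver.con 4 ⟨*⟩ (t ⟨*⟩ t)) refl (2 ^ i)))

      cb-up : ∀ x i → x < 2 ^ suc i → cb x ≤ 8 * cb (2 ^ i)
      cb-up x i lt = ≤-trans (*-mono-≤ (*-mono-≤ (<⇒≤ lt) (<⇒≤ lt)) (<⇒≤ lt)) (≤-reflexive (solveℕ 1 (λ t → (+-*-Solver.con 2 ⟨*⟩ t) ⟨*⟩ (+-*-Solver.con 2 ⟨*⟩ t) ⟨*⟩ (+-*-Solver.con 2 ⟨*⟩ t) ⟨=⟩ +-*-Solver.con 8 ⟨*⟩ (t ⟨*⟩ t ⟨*⟩ t)) refl (2 ^ i)))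

    largest-level : ∀ {x a} {g : ℕ → ℕ} → x ≤ a + ∑ {L} (λ i → g (toℕ i)) → x ≤ 2 * a ⊎ ∃ λ i → x ≤ 2 * (L * g i)
    largest-level {x} {a} {g} le = go (a+b≤2max a _ le) (∑-max {L-1} (λ i → g (toℕ i)))
      where
      go : x ≤ 2 * a ⊎ x ≤ 2 * ∑ {L} (λ i → g (toℕ i)) → (∃ λ i → (∀ j → g (toℕ j) ≤ g (toℕ i)) × ∑ {L} (λ i → g (toℕ i)) ≤ L * g (toℕ i)) →
        x ≤ 2 * a ⊎ ∃ λ i → x ≤ 2 * (L * g i)
      go (inj₁ le) _ = inj₁ le
      go (inj₂ le) (i , _ , big) = inj₂ (toℕ i , ≤-trans le (ℕₚ.*-monoʳ-≤ 2 big))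

    E-levels : ∀ h → E h ≤ 2 * sq (f h 0#) ⊎ ∃ λ i → E h ≤ 2 * (L * (d h i * (4 * sq (2 ^ i))))
    E-levels h = largest-level {g = λ i → d h i * (4 * sq (2 ^ i))} (split-levels h sq (λ i → 4 * sq (2 ^ i)) refl sq-up)

    T-levels : ∀ h → T h ≤ cb (f h 0#) + ∑ {L} (λ i → d h (toℕ i) * (8 * cb (2 ^ toℕ i)))
    T-levels h = split-levels h cb (λ i → 8 * cb (2 ^ i)) refl cb-up

    d≤rowlev : ∀ h i → d h i ≤ ∑ (rowlev (2 ^ i) h)
    d≤rowlev h i = ∑-mono (λ c → ℕₚ.*-monoʳ-≤ (nz c) (lvl≤ i (f h c)))

    -- If x and kx both lie in the level set, f_h(x) and f_h(kx) are at least 2^i, so the left side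
    -- of `cross-energy` dominates. On its right side h only dilates a summation variable.
    ρ-bound : ∀ {h} i k → h ≢ 0# → ρ (D h i) k * (2 ^ i * 2 ^ i) ≤ E k + E k
    ρ-bound {h} i k h≢0 = begin
      ρ (D h i) k * (2 ^ i * 2 ^ i) ≡⟨ ∑-*ʳ (2 ^ i * 2 ^ i) _ ⟨
      ∑ (λ x → D h i x * D h i (k ⊠ x) * (2 ^ i * 2 ^ i)) ≤⟨ ∑-mono (λ x → ≤-trans (≤-reflexive (solveℕ 3 (λ a b t → a ⟨*⟩ b ⟨*⟩ (t ⟨*⟩ t) ⟨=⟩ a ⟨*⟩ t ⟨*⟩ (b ⟨*⟩ t)) refl (D h i x) (D h i (k ⊠ x)) (2 ^ i))) (*-mono-≤ (D-lower h i x) (D-lower h i (k ⊠ x)))) ⟩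
      ∑ (λ x → f h x * f h (k ⊠ x)) ≤⟨ cross-energy h k ⟩
      E k + ∑ (λ y → f k (h ⊠ y) * f k (h ⊠ y)) ≡⟨ cong (E k +_) (∑-scale (λ y → f k y * f k y) h≢0) ⟩
      E k + E k ∎

    ρ-zero : ∀ h i → ρ (D h i) 0# ≡ 0
    ρ-zero h i = ∑-zero (λ x → trans (cong (D h i x *_) (trans (cong (D h i) (zeroˡ x)) (Ind.at-zero (D-ind h i)))) (ℕₚ.*-zeroʳ (D h i x)))

    ρ≤d : ∀ h i k → ρ (D h i) k ≤ d h i
    ρ≤d h i k = ∑-mono (λ x → ≤-trans (ℕₚ.*-monoʳ-≤ (D h i x) (01≤1 (01-* (⟦⟧-01 (¬? (k ⊠ x Fin.≟ 0#))) (lvl-01 i (f h (k ⊠ x)))))) (≤-reflexive (ℕₚ.*-identityʳ _)))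
      where
      01≤1 : ∀ {y} → y ≡ 0 ⊎ y ≡ 1 → y ≤ 1
      01≤1 (inj₁ refl) = z≤n
      01≤1 (inj₂ refl) = ≤-refl

    nonzero-only : ∀ (g : F → ℕ) → g 0# ≡ 0 → ∑ g ≡ ∑ (λ k → nz k * g k)
    nonzero-only g g0 = ∑-cong (λ k → go k (k Fin.≟ 0#))
      where
      go : ∀ k → Dec (k ≡ 0#) → g k ≡ nz k * g k
      go k (yes refl) = trans g0 (sym (trans (cong (nz k *_) g0) (ℕₚ.*-zeroʳ (nz k))))
      go k (no ne) = sym (trans (cong (_* g k) (nz-yes ne)) (ℕₚ.*-identityˡ _))

    module XLevels (h : F) (h≢0 : h ≢ 0#) (i : ℕ) where
      open Triangles h h≢0 (D h i) (D-ind h i) using (X; μ; S; μ²E≤nS; S²≤; n*μ)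

      module Inc (j : ℕ) = Incidence (D h i) (D 1# j) (D-ind h i) (D-ind 1# j)

      -- With dτ ≤ nμ the left side is at most n⁴(μ²E)² ≤ n⁶S², where `μ²E≤nS` is used twice; `S²≤`
      -- finishes.
      triangle-bound : (d h i * 2 ^ i) ^ 4 * (E 1#) ^ 2 ≤ n ^ 6 * (2 * T 1#) * X
      triangle-bound = begin
        (d h i * 2 ^ i) ^ 4 * (E 1#) ^ 2 ≤⟨ ℕₚ.*-monoˡ-≤ ((E 1#) ^ 2) (ℕₚ.^-monoˡ-≤ 4 (≤-trans (dτ≤ h i) (≤-reflexive (sym n*μ)))) ⟩
        (n * m) ^ 4 * (E 1#) ^ 2 ≡⟨ solveℕ 3 (λ n m e → (n ⟨*⟩ m) ⟨^⟩ 4 ⟨*⟩ e ⟨^⟩ 2 ⟨=⟩ n ⟨^⟩ 4 ⟨*⟩ ((m ⟨*⟩ m ⟨*⟩ e) ⟨*⟩ (m ⟨*⟩ m ⟨*⟩ e))) refl n m (E 1#) ⟩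
        n ^ 4 * ((m * m * E 1#) * (m * m * E 1#)) ≤⟨ ℕₚ.*-monoʳ-≤ (n ^ 4) (*-mono-≤ μ²E≤nS μ²E≤nS) ⟩
        n ^ 4 * ((n * S) * (n * S)) ≡⟨ solveℕ 2 (λ n s → n ⟨^⟩ 4 ⟨*⟩ ((n ⟨*⟩ s) ⟨*⟩ (n ⟨*⟩ s)) ⟨=⟩ n ⟨^⟩ 6 ⟨*⟩ (s ⟨*⟩ s)) refl n S ⟩
        n ^ 6 * (S * S) ≤⟨ ℕₚ.*-monoʳ-≤ (n ^ 6) S²≤ ⟩
        n ^ 6 * ((T 1# + T 1#) * X) ≡⟨ solveℕ 3 (λ a t x → a ⟨*⟩ ((t ⟨+⟩ t) ⟨*⟩ x) ⟨=⟩ a ⟨*⟩ (+-*-Solver.con 2 ⟨*⟩ t) ⟨*⟩ x) refl (n ^ 6) (T 1#) X ⟩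
        n ^ 6 * (2 * T 1#) * X ∎
        where
        m = μ 1#
        open +-*-Solver using () renaming (_:^_ to _⟨^⟩_)

      -- The pairs α = β contribute at most dn². For the others r(α - β)² is replaced by the size of
      -- its dyadic level, and the level sets of r become the sets Q of the incidence sums.
      X-split : X ≤ d h i * (n * n) + ∑ {L} (λ j → 4 * sq (2 ^ toℕ j) * Inc.B (toℕ j))
      X-split = begin
        X ≤⟨ ∑∑-mono (λ α β → ℕₚ.*-monoʳ-≤ (D h i α * D h i β) (pointwise (α ⊖ β))) ⟩
        ∑ (λ α → ∑ (λ β → D h i α * D h i β * (⟦ α ⊖ β Fin.≟ 0# ⟧ * (n * n) + ∑ {L} (λ j → D 1# (toℕ j) (α ⊖ β) * b (toℕ j))))) ≡⟨ trans (∑∑-cong (λ α β → ℕₚ.*-distribˡ-+ (D h i α * D h i β) _ _)) (∑∑-+ _ _) ⟩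
        ∑ (λ α → ∑ (λ β → D h i α * D h i β * (⟦ α ⊖ β Fin.≟ 0# ⟧ * (n * n)))) + ∑ (λ α → ∑ (λ β → D h i α * D h i β * ∑ {L} (λ j → D 1# (toℕ j) (α ⊖ β) * b (toℕ j)))) ≡⟨ cong₂ _+_ diagonal off ⟩
        d h i * (n * n) + ∑ {L} (λ j → 4 * sq (2 ^ toℕ j) * Inc.B (toℕ j)) ∎
        where
        b : ℕ → ℕ
        b j = 4 * sq (2 ^ j)
        pointwise : ∀ x → r x * r x ≤ ⟦ x Fin.≟ 0# ⟧ * (n * n) + ∑ {L} (λ j → D 1# (toℕ j) x * b (toℕ j))
        pointwise x = ≤-trans (nz-split x (r x * r x)) (+-mono-≤ (ℕₚ.*-monoʳ-≤ ⟦ x Fin.≟ 0# ⟧ (*-mono-≤ (f≤n 1# x) (f≤n 1# x)))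
          (≤-trans (ℕₚ.*-monoʳ-≤ (nz x) (dyadic-sum L (r x) sq b (f<2^L 1# x) refl (sq-up (r x)))) (≤-reflexive (trans (sym (∑-*ˡ (nz x) _)) (∑-cong (λ j → sym (ℕₚ.*-assoc (nz x) _ _)))))))
        diagonal : ∑ (λ α → ∑ (λ β → D h i α * D h i β * (⟦ α ⊖ β Fin.≟ 0# ⟧ * (n * n)))) ≡ d h i * (n * n)
        diagonal = trans (∑-cong (λ α → trans (∑-single _ α (λ β ne → trans (cong (λ y → D h i α * D h i β * (y * (n * n))) (⟦⟧-no (α ⊖ β Fin.≟ 0#) (λ e → ne (sym (x-y≡0⇒x≡y e))))) (ℕₚ.*-zeroʳ (D h i α * D h i β))))
          (cong₂ _*_ (Ind.idem (D-ind h i) α) (trans (cong (_* (n * n)) (⟦⟧-yes (α ⊖ α Fin.≟ 0#) (x+-1x α))) (ℕₚ.*-identityˡ _))))) (∑-*ʳ (n * n) (D h i))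
        off : ∑ (λ α → ∑ (λ β → D h i α * D h i β * ∑ {L} (λ j → D 1# (toℕ j) (α ⊖ β) * b (toℕ j)))) ≡ ∑ {L} (λ j → b (toℕ j) * Inc.B (toℕ j))
        off = trans (∑∑-cong (λ α β → trans (sym (∑-*ˡ (D h i α * D h i β) _)) (∑-cong (λ j → solveℕ 3 (λ a q b → a ⟨*⟩ (q ⟨*⟩ b) ⟨=⟩ b ⟨*⟩ (a ⟨*⟩ q)) refl (D h i α * D h i β) (D 1# (toℕ j) (α ⊖ β)) (b (toℕ j))))))
          (trans (sym (∑-pull (λ j α β → b (toℕ j) * (D h i α * D h i β * D 1# (toℕ j) (α ⊖ β))))) (∑-cong (λ j → trans (∑-cong (λ α → ∑-*ˡ (b (toℕ j)) _)) (∑-*ˡ (b (toℕ j)) _))))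

      X-levels : X ≤ 2 * (d h i * (n * n)) ⊎ ∃ λ j → X ≤ 2 * (L * (4 * sq (2 ^ j) * Inc.B j))
      X-levels = largest-level {g = λ j → 4 * sq (2 ^ j) * Inc.B j} X-split

      Fl : ℕ → F → F → ℕ
      Fl s l c = nz l * (nz c * lvl s (f l c))

      Fl-idem : ∀ s l c → Fl s l c ≡ 0 ⊎ Fl s l c ≡ 1
      Fl-idem s l c = 01-* (⟦⟧-01 (¬? (l Fin.≟ 0#))) (01-* (⟦⟧-01 (¬? (c Fin.≟ 0#))) (lvl-01 s (f l c)))

      M : ℕ → ℕ → ℕ
      M j s = ∑ (λ l → ∑ (λ c → Fl s l c * Inc.w j l c))

      |Fl| : ℕ → ℕ
      |Fl| s = ∑ (λ l → ∑ (Fl s l))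

      |Fl|≤lev : ∀ s → |Fl| s ≤ ∑ (λ l → ∑ (lev (2 ^ s) l))
      |Fl|≤lev s = ∑∑-mono (λ l c → ℕₚ.*-monoʳ-≤ (nz l) (ℕₚ.*-monoʳ-≤ (nz c) (lvl≤ s (f l c))))

      private
        Fl≤1 : ∀ s l c → Fl s l c ≤ 1
        Fl≤1 s l c with Fl-idem s l c
        ... | inj₁ e = ≤-trans (≤-reflexive e) z≤n
        ... | inj₂ e = ≤-reflexive e

        1*x : ∀ {a} x → a ≤ 1 → a * x ≤ x
        1*x x le = ≤-trans (ℕₚ.*-monoˡ-≤ x le) (≤-reflexive (ℕₚ.*-identityˡ x))

      M≤ : ∀ j s → M j s ≤ d h i * (d h i * d 1# j)
      M≤ j s = ≤-trans (∑∑-mono (λ l c → 1*x (Inc.w j l c) (Fl≤1 s l c))) (≤-reflexive (Inc.∑w j))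

      -- Cauchy-Schwarz over the pairs (l, c) of level s. Multiplied by `M≤` it bounds M³ by the
      -- number of those pairs times |D|²|Q| Z, which is the Hölder step.
      M²≤ : ∀ j s → M j s * M j s ≤ |Fl| s * Inc.Z j
      M²≤ j s = ≤-trans (cs-weighted² (Fl s) (Inc.w j)) (ℕₚ.*-monoʳ-≤ (|Fl| s) (≤-trans (∑∑-mono (λ l c → 1*x (Inc.w j l c * Inc.w j l c) (Fl≤1 s l c))) (≤-reflexive (Inc.∑w² j))))

      B-levels : ∀ j → ∃ λ s → n * (n * Inc.B j) ≤ L * (2 * 2 ^ s * M j s)
      B-levels j with ∑-max {L-1} (λ s → 2 * 2 ^ toℕ s * M j (toℕ s))
      ... | s , _ , big = toℕ s , ≤-trans total big
        where
        total : n * (n * Inc.B j) ≤ ∑ {L} (λ s → 2 * 2 ^ toℕ s * M j (toℕ s))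
        total = begin
          n * (n * Inc.B j) ≡⟨ Inc.incidences j ⟨
          ∑ (λ l → ∑ (λ c → Inc.w j l c * f l c)) ≤⟨ ∑∑-mono (λ l c → Inc.w-guard j l c (pointwise l c)) ⟩
          ∑ (λ l → ∑ (λ c → Inc.w j l c * ∑ {L} (λ s → Fl (toℕ s) l c * (2 * 2 ^ toℕ s)))) ≡⟨ ∑∑-cong (λ l c → trans (sym (∑-*ˡ (Inc.w j l c) _)) (∑-cong (λ s → solveℕ 3 (λ w a t → w ⟨*⟩ (a ⟨*⟩ t) ⟨=⟩ t ⟨*⟩ (a ⟨*⟩ w)) refl (Inc.w j l c) (Fl (toℕ s) l c) (2 * 2 ^ toℕ s)))) ⟩
          ∑ (λ l → ∑ (λ c → ∑ {L} (λ s → 2 * 2 ^ toℕ s * (Fl (toℕ s) l c * Inc.w j l c)))) ≡⟨ ∑-pull (λ s l c → 2 * 2 ^ toℕ s * (Fl (toℕ s) l c * Inc.w j l c)) ⟨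
          ∑ {L} (λ s → ∑ (λ l → ∑ (λ c → 2 * 2 ^ toℕ s * (Fl (toℕ s) l c * Inc.w j l c)))) ≡⟨ ∑-cong (λ s → trans (∑-cong (λ l → ∑-*ˡ (2 * 2 ^ toℕ s) _)) (∑-*ˡ (2 * 2 ^ toℕ s) _)) ⟩
          ∑ {L} (λ s → 2 * 2 ^ toℕ s * M j (toℕ s)) ∎
          where
          pointwise : ∀ l c → l ≢ 0# → c ≢ 0# → f l c ≤ ∑ {L} (λ s → Fl (toℕ s) l c * (2 * 2 ^ toℕ s))
          pointwise l c l≢0 c≢0 = ≤-trans (dyadic-sum L (f l c) (λ x → x) (λ s → 2 * 2 ^ s) (f<2^L l c) refl (λ s lt → <⇒≤ lt))
            (≤-reflexive (∑-cong (λ s → cong (_* (2 * 2 ^ toℕ s)) (sym (trans (cong₂ (λ a b → a * (b * lvl (toℕ s) (f l c))) (nz-yes l≢0) (nz-yes c≢0)) (trans (ℕₚ.*-identityˡ _) (ℕₚ.*-identityˡ _)))))))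

-- Comparing monomials through their exponent vectors.

module Monomials where

  open import Data.Nat using (ℕ; zero; suc; _+_; _*_; _^_; _≤_; _<_; >-nonZero)
  open import Data.Nat.Properties
  open import Data.Fin using (Fin; zero; suc)
  open import Data.Vec as Vec using (Vec; []; _∷_; lookup; replicate; zipWith; tabulate)
  open import Data.Product using (_×_; _,_; proj₁; proj₂)
  open import Relation.Binary.PropositionalEquality

  infixl 7 _⊛_
  infixr 8 _↟_
  -- A syntax in which two monomials are identified by their exponent vectors, so that identities
  -- with exponents in the thousands are settled without expanding any power.
  data Mono (k : ℕ) : Set where
    var : Fin k → Mono k
    _⊛_ : Mono k → Mono k → Mono k
    _↟_ : Mono k → ℕ → Mono k

  ⟦_⟧ᵐ : ∀ {k} → Mono k → Vec ℕ k → ℕ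
  ⟦ var i ⟧ᵐ ρ = lookup ρ i
  ⟦ e ⊛ e′ ⟧ᵐ ρ = ⟦ e ⟧ᵐ ρ * ⟦ e′ ⟧ᵐ ρ
  ⟦ e ↟ a ⟧ᵐ ρ = ⟦ e ⟧ᵐ ρ ^ a

  exponentsᵐ : ∀ {k} → Mono k → Vec ℕ k
  exponentsᵐ (var zero) = 1 ∷ replicate _ 0
  exponentsᵐ (var (suc i)) = 0 ∷ exponentsᵐ (var i)
  exponentsᵐ (e ⊛ e′) = zipWith _+_ (exponentsᵐ e) (exponentsᵐ e′)
  exponentsᵐ (e ↟ a) = Vec.map (_* a) (exponentsᵐ e)

  power-product : ∀ {k} → Vec ℕ k → Vec ℕ k → ℕ
  power-product [] [] = 1
  power-product (a ∷ as) (x ∷ ρ) = x ^ a * power-product as ρ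

  *-interchange : ∀ a b c d → (a * b) * (c * d) ≡ (a * c) * (b * d)
  *-interchange a b c d = trans (*-assoc a b (c * d)) (trans (cong (a *_) (trans (sym (*-assoc b c d)) (trans (cong (_* d) (*-comm b c)) (*-assoc c b d)))) (sym (*-assoc a c (b * d))))

  ^-distribʳ-* : ∀ x y a → (x * y) ^ a ≡ x ^ a * y ^ a
  ^-distribʳ-* x y zero = refl
  ^-distribʳ-* x y (suc a) = trans (cong (x * y *_) (^-distribʳ-* x y a)) (*-interchange x y _ _)

  private
    pp-0 : ∀ {k} (ρ : Vec ℕ k) → power-product (replicate k 0) ρ ≡ 1
    pp-0 [] = refl
    pp-0 (x ∷ ρ) = trans (*-identityˡ _) (pp-0 ρ)

    pp-+ : ∀ {k} (as bs ρ : Vec ℕ k) → power-product (zipWith _+_ as bs) ρ ≡ power-product as ρ * power-product bs ρ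
    pp-+ [] [] [] = refl
    pp-+ (a ∷ as) (b ∷ bs) (x ∷ ρ) = trans (cong₂ _*_ (^-distribˡ-+-* x a b) (pp-+ as bs ρ)) (*-interchange (x ^ a) (x ^ b) _ _)

    pp-* : ∀ {k} (as ρ : Vec ℕ k) a → power-product (Vec.map (_* a) as) ρ ≡ power-product as ρ ^ a
    pp-* [] [] a = sym (^-zeroˡ a)
    pp-* (b ∷ as) (x ∷ ρ) a = trans (cong₂ _*_ (sym (^-*-assoc x b a)) (pp-* as ρ a)) (sym (^-distribʳ-* (x ^ b) _ a))

    correct : ∀ {k} (e : Mono k) ρ → power-product (exponentsᵐ e) ρ ≡ ⟦ e ⟧ᵐ ρ
    correct (var zero) (x ∷ ρ) = trans (cong₂ _*_ (*-identityʳ x) (pp-0 ρ)) (*-identityʳ x)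
    correct (var (suc i)) (x ∷ ρ) = trans (*-identityˡ _) (correct (var i) ρ)
    correct (e ⊛ e′) ρ = trans (pp-+ (exponentsᵐ e) (exponentsᵐ e′) ρ) (cong₂ _*_ (correct e ρ) (correct e′ ρ))
    correct (e ↟ a) ρ = trans (pp-* (exponentsᵐ e) ρ a) (cong (_^ a) (correct e ρ))

  monomial : ∀ {k} (ρ : Vec ℕ k) (q : Vec (Mono k) k → Mono k × Mono k) →
    exponentsᵐ (proj₁ (q (tabulate var))) ≡ exponentsᵐ (proj₂ (q (tabulate var))) →
    ⟦ proj₁ (q (tabulate var)) ⟧ᵐ ρ ≡ ⟦ proj₂ (q (tabulate var)) ⟧ᵐ ρ
  monomial ρ q eq = trans (sym (correct (proj₁ (q (tabulate var))) ρ)) (trans (cong (λ as → power-product as ρ) eq) (correct (proj₂ (q (tabulate var))) ρ))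

  -- An inequality a ≤ b is applied inside a monomial: A = a·r and b·r = B.
  step : ∀ {k} (ρ : Vec ℕ k) (q : Vec (Mono k) k → (Mono k × Mono k) × (Mono k × Mono k) × Mono k) →
    let A = proj₁ (proj₁ (q (tabulate var))) ; B = proj₂ (proj₁ (q (tabulate var)))
        a = proj₁ (proj₁ (proj₂ (q (tabulate var)))) ; b = proj₂ (proj₁ (proj₂ (q (tabulate var)))) ; r = proj₂ (proj₂ (q (tabulate var)))
    in exponentsᵐ A ≡ exponentsᵐ (a ⊛ r) → exponentsᵐ (b ⊛ r) ≡ exponentsᵐ B → ⟦ a ⟧ᵐ ρ ≤ ⟦ b ⟧ᵐ ρ → ⟦ A ⟧ᵐ ρ ≤ ⟦ B ⟧ᵐ ρ
  step ρ q e₁ e₂ h = ≤-trans (≤-reflexive (monomial ρ (λ vs → proj₁ (proj₁ (q vs)) , proj₁ (proj₁ (proj₂ (q vs))) ⊛ proj₂ (proj₂ (q vs))) e₁))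
    (≤-trans (*-monoˡ-≤ (⟦ proj₂ (proj₂ (q (tabulate var))) ⟧ᵐ ρ) h)
      (≤-reflexive (monomial ρ (λ vs → proj₂ (proj₁ (proj₂ (q vs))) ⊛ proj₂ (proj₂ (q vs)) , proj₂ (proj₁ (q vs))) e₂)))

  -- The converse use of `step`: A · r = a and b = B · r, and the positive monomial r is divided
  -- out.
  cancel : ∀ {k} (ρ : Vec ℕ k) (q : Vec (Mono k) k → (Mono k × Mono k) × (Mono k × Mono k) × Mono k) →
    let A = proj₁ (proj₁ (q (tabulate var))) ; B = proj₂ (proj₁ (q (tabulate var)))
        a = proj₁ (proj₁ (proj₂ (q (tabulate var)))) ; b = proj₂ (proj₁ (proj₂ (q (tabulate var)))) ; r = proj₂ (proj₂ (q (tabulate var)))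
    in exponentsᵐ (A ⊛ r) ≡ exponentsᵐ a → exponentsᵐ b ≡ exponentsᵐ (B ⊛ r) → 0 < ⟦ r ⟧ᵐ ρ → ⟦ a ⟧ᵐ ρ ≤ ⟦ b ⟧ᵐ ρ → ⟦ A ⟧ᵐ ρ ≤ ⟦ B ⟧ᵐ ρ
  cancel ρ q e₁ e₂ 0<r h = *-cancelʳ-≤ _ _ (⟦ proj₂ (proj₂ (q (tabulate var))) ⟧ᵐ ρ) {{>-nonZero 0<r}}
    (≤-trans (≤-reflexive (monomial ρ (λ vs → proj₁ (proj₁ (q vs)) ⊛ proj₂ (proj₂ (q vs)) , proj₁ (proj₁ (proj₂ (q vs)))) e₁))
      (≤-trans h (≤-reflexive (monomial ρ (λ vs → proj₂ (proj₁ (proj₂ (q vs))) , proj₂ (proj₁ (q vs)) ⊛ proj₂ (proj₂ (q vs))) e₂))))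

  pw : ∀ k {a b} → a ≤ b → a ^ k ≤ b ^ k
  pw k = ^-monoˡ-≤ k

  ^-pos : ∀ {x} k → 0 < x → 0 < x ^ k
  ^-pos {x} k 0<x = m^n>0 x {{>-nonZero 0<x}} k

-- The moment inequality for a dilate.

module MomentArithmetic where

  open import Data.Nat using (ℕ; zero; suc; _*_; _^_; _≤_; _<_; z≤n; s≤s; >-nonZero)
  open import Data.Nat.Properties
  open import Data.Vec using (Vec; []; _∷_)
  open import Data.Product using (_,_)
  open import Relation.Binary.PropositionalEquality
  open Monomials

  -- The cube is taken because the bound for M³ brings in `Fc`, and Fc · s³ is the quantity that the
  -- level bounds control, so the level s disappears. The factor t⁶ is carried along since B will
  -- enter through t²B.
  incidence-cubed : ∀ Λ n d t q B s M Fc Z Y → 0 < n → n ^ 2 * B ≤ Λ * s * M → M ^ 3 ≤ Fc * (d ^ 2 * q) * Z → Fc * s ^ 3 ≤ Y →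
    n ^ 6 * (t ^ 6 * B ^ 3) ≤ Λ ^ 3 * Y * (t ^ 6 * d ^ 2 * q * Z)
  incidence-cubed Λ n d t q B s M Fc Z Y 0<n h₁ h₂ h₃ =
    ≤-trans (step (Λ ∷ n ∷ d ∷ t ∷ q ∷ B ∷ s ∷ M ∷ Fc ∷ Z ∷ Y ∷ [])
      (λ { (Λ ∷ n ∷ d ∷ t ∷ q ∷ B ∷ s ∷ M ∷ Fc ∷ Z ∷ Y ∷ []) → (n ↟ 6 ⊛ (t ↟ 6 ⊛ B ↟ 3) , Λ ↟ 3 ⊛ s ↟ 3 ⊛ t ↟ 6 ⊛ M ↟ 3) , ((n ↟ 2 ⊛ B) ↟ 3 , (Λ ⊛ s ⊛ M) ↟ 3) , t ↟ 6 }) refl refl (pw 3 h₁))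
    (≤-trans (step (Λ ∷ n ∷ d ∷ t ∷ q ∷ B ∷ s ∷ M ∷ Fc ∷ Z ∷ Y ∷ [])
      (λ { (Λ ∷ n ∷ d ∷ t ∷ q ∷ B ∷ s ∷ M ∷ Fc ∷ Z ∷ Y ∷ []) → (Λ ↟ 3 ⊛ s ↟ 3 ⊛ t ↟ 6 ⊛ M ↟ 3 , Λ ↟ 3 ⊛ (Fc ⊛ s ↟ 3) ⊛ (t ↟ 6 ⊛ d ↟ 2 ⊛ q ⊛ Z)) , (M ↟ 3 , Fc ⊛ (d ↟ 2 ⊛ q) ⊛ Z) , Λ ↟ 3 ⊛ s ↟ 3 ⊛ t ↟ 6 }) refl refl h₂)
    (step (Λ ∷ n ∷ d ∷ t ∷ q ∷ B ∷ s ∷ M ∷ Fc ∷ Z ∷ Y ∷ [])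
      (λ { (Λ ∷ n ∷ d ∷ t ∷ q ∷ B ∷ s ∷ M ∷ Fc ∷ Z ∷ Y ∷ []) → (Λ ↟ 3 ⊛ (Fc ⊛ s ↟ 3) ⊛ (t ↟ 6 ⊛ d ↟ 2 ⊛ q ⊛ Z) , Λ ↟ 3 ⊛ Y ⊛ (t ↟ 6 ⊛ d ↟ 2 ⊛ q ⊛ Z)) , (Fc ⊛ s ↟ 3 , Y) , Λ ↟ 3 ⊛ (t ↟ 6 ⊛ d ↟ 2 ⊛ q ⊛ Z) }) refl refl h₃))

  -- Bookkeeping for one dilate h: its level set has d elements at level τ, while E is the energy of
  -- the dilate 1. Λ dominates all numerical constants and logarithms.
  module General (Λ n p d τ E X : ℕ) (0<n : 0 < n) (1≤Λ : 1 ≤ Λ)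
    (triangles : (d * τ) ^ 4 * E ^ 2 ≤ Λ ^ 2 * n ^ 9 * X) where

    Λ^-mono : ∀ {a b} → a ≤ b → Λ ^ a ≤ Λ ^ b
    Λ^-mono = ^-monoʳ-≤ Λ {{>-nonZero 1≤Λ}}

    -- The combination d^10 τ^16 is what remains of (dτ²)^14, the 14th power of E_h up to Λ, after
    -- four factors dτ³ ≤ T_h are split off.
    Bound : Set
    Bound = d ^ 10 * τ ^ 16 * E ^ 6 * p ^ 2 ≤ Λ ^ 17 * n ^ 41

    private
      cubed : d ^ 12 * τ ^ 16 * E ^ 6 * p ^ 2 ≤ Λ ^ 6 * n ^ 27 * (X ^ 3 * τ ^ 4 * p ^ 2)
      cubed = step (Λ ∷ n ∷ p ∷ d ∷ τ ∷ E ∷ X ∷ []) (λ { (Λ ∷ n ∷ p ∷ d ∷ τ ∷ E ∷ X ∷ []) →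
        (d ↟ 12 ⊛ τ ↟ 16 ⊛ E ↟ 6 ⊛ p ↟ 2 , Λ ↟ 6 ⊛ n ↟ 27 ⊛ (X ↟ 3 ⊛ τ ↟ 4 ⊛ p ↟ 2)) , (((d ⊛ τ) ↟ 4 ⊛ E ↟ 2) ↟ 3 , (Λ ↟ 2 ⊛ n ↟ 9 ⊛ X) ↟ 3) , τ ↟ 4 ⊛ p ↟ 2 }) refl refl (pw 3 triangles)

    conclude : X ^ 3 * τ ^ 4 * p ^ 2 ≤ Λ ^ 11 * n ^ 14 * d ^ 2 → Bound
    conclude h = go d refl
      where
      bounded : d ^ 12 * τ ^ 16 * E ^ 6 * p ^ 2 ≤ Λ ^ 17 * n ^ 41 * d ^ 2
      bounded = ≤-trans cubed (step (Λ ∷ n ∷ p ∷ d ∷ τ ∷ E ∷ X ∷ []) (λ { (Λ ∷ n ∷ p ∷ d ∷ τ ∷ E ∷ X ∷ []) →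
        (Λ ↟ 6 ⊛ n ↟ 27 ⊛ (X ↟ 3 ⊛ τ ↟ 4 ⊛ p ↟ 2) , Λ ↟ 17 ⊛ n ↟ 41 ⊛ d ↟ 2) , (X ↟ 3 ⊛ τ ↟ 4 ⊛ p ↟ 2 , Λ ↟ 11 ⊛ n ↟ 14 ⊛ d ↟ 2) , Λ ↟ 6 ⊛ n ↟ 27 }) refl refl h)
      go : ∀ d′ → d ≡ d′ → Bound
      go zero refl = z≤n
      go (suc d′) refl = cancel (Λ ∷ n ∷ p ∷ d ∷ τ ∷ E ∷ X ∷ []) (λ { (Λ ∷ n ∷ p ∷ d ∷ τ ∷ E ∷ X ∷ []) →
        (d ↟ 10 ⊛ τ ↟ 16 ⊛ E ↟ 6 ⊛ p ↟ 2 , Λ ↟ 17 ⊛ n ↟ 41) , (d ↟ 12 ⊛ τ ↟ 16 ⊛ E ↟ 6 ⊛ p ↟ 2 , Λ ↟ 17 ⊛ n ↟ 41 ⊛ d ↟ 2) , d ↟ 2 }) refl refl (^-pos {d} 2 (s≤s z≤n)) bounded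

    diagonal : X ≤ Λ * d * n ^ 2 → d * τ ^ 3 ≤ Λ * n ^ 3 → τ ≤ n → p ≤ n ^ 2 → Bound
    diagonal h₁ h₂ h₃ h₄ = conclude (≤-trans
      (step ρ (λ { (Λ ∷ n ∷ p ∷ d ∷ τ ∷ X ∷ []) → (X ↟ 3 ⊛ τ ↟ 4 ⊛ p ↟ 2 , Λ ↟ 3 ⊛ n ↟ 6 ⊛ d ↟ 3 ⊛ τ ↟ 4 ⊛ p ↟ 2) , (X ↟ 3 , (Λ ⊛ d ⊛ n ↟ 2) ↟ 3) , τ ↟ 4 ⊛ p ↟ 2 }) refl refl (pw 3 h₁))
      (≤-trans (step ρ (λ { (Λ ∷ n ∷ p ∷ d ∷ τ ∷ X ∷ []) → (Λ ↟ 3 ⊛ n ↟ 6 ⊛ d ↟ 3 ⊛ τ ↟ 4 ⊛ p ↟ 2 , Λ ↟ 4 ⊛ n ↟ 9 ⊛ d ↟ 2 ⊛ τ ⊛ p ↟ 2) , (d ⊛ τ ↟ 3 , Λ ⊛ n ↟ 3) , Λ ↟ 3 ⊛ n ↟ 6 ⊛ d ↟ 2 ⊛ τ ⊛ p ↟ 2 }) refl refl h₂)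
      (≤-trans (step ρ (λ { (Λ ∷ n ∷ p ∷ d ∷ τ ∷ X ∷ []) → (Λ ↟ 4 ⊛ n ↟ 9 ⊛ d ↟ 2 ⊛ τ ⊛ p ↟ 2 , Λ ↟ 4 ⊛ n ↟ 10 ⊛ d ↟ 2 ⊛ p ↟ 2) , (τ , n) , Λ ↟ 4 ⊛ n ↟ 9 ⊛ d ↟ 2 ⊛ p ↟ 2 }) refl refl h₃)
      (≤-trans (step ρ (λ { (Λ ∷ n ∷ p ∷ d ∷ τ ∷ X ∷ []) → (Λ ↟ 4 ⊛ n ↟ 10 ⊛ d ↟ 2 ⊛ p ↟ 2 , Λ ↟ 4 ⊛ (n ↟ 14 ⊛ d ↟ 2)) , (p ↟ 2 , (n ↟ 2) ↟ 2) , Λ ↟ 4 ⊛ n ↟ 10 ⊛ d ↟ 2 }) refl refl (pw 2 h₄))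
      (≤-trans (*-monoˡ-≤ (n ^ 14 * d ^ 2) (Λ^-mono {4} {11} (m≤m+n 4 7))) (≤-reflexive (sym (*-assoc (Λ ^ 11) (n ^ 14) (d ^ 2)))))))))
      where
      ρ : Vec ℕ 6
      ρ = Λ ∷ n ∷ p ∷ d ∷ τ ∷ X ∷ []

    -- Here ρ_Q is estimated trivially by q, which is the hypothesis Z ≤ qW. The variables of Q then
    -- occur only as q²t⁶ = (qt³)² and are eliminated by the row bound.
    off-diagonal : ∀ t q B s M Fc Z W U → X ≤ Λ * t ^ 2 * B → n ^ 2 * B ≤ Λ * s * M → M ^ 3 ≤ Fc * (d ^ 2 * q) * Z → Fc * s ^ 3 * p ≤ Λ * n ^ 6 →
      Z ≤ q * W → τ ^ 4 * W ≤ Λ * U → p * U ≤ Λ * n ^ 8 → q * t ^ 3 ≤ Λ * n ^ 3 → Bound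
    off-diagonal t q B s M Fc Z W U h₁ h₂ h₃ h₄ h₅ h₆ h₇ h₈ = conclude (cancel ρ (λ { (Λ ∷ n ∷ p ∷ d ∷ τ ∷ X ∷ t ∷ q ∷ B ∷ Fs ∷ Z ∷ W ∷ U ∷ []) →
        (X ↟ 3 ⊛ τ ↟ 4 ⊛ p ↟ 2 , Λ ↟ 11 ⊛ n ↟ 14 ⊛ d ↟ 2) , (X ↟ 3 ⊛ τ ↟ 4 ⊛ p ↟ 2 ⊛ n ↟ 6 , Λ ↟ 11 ⊛ n ↟ 20 ⊛ d ↟ 2) , n ↟ 6 }) refl refl (^-pos 6 0<n)
      (≤-trans (step ρ (λ { (Λ ∷ n ∷ p ∷ d ∷ τ ∷ X ∷ t ∷ q ∷ B ∷ Fs ∷ Z ∷ W ∷ U ∷ []) → (X ↟ 3 ⊛ τ ↟ 4 ⊛ p ↟ 2 ⊛ n ↟ 6 , Λ ↟ 3 ⊛ (n ↟ 6 ⊛ (t ↟ 6 ⊛ B ↟ 3)) ⊛ τ ↟ 4 ⊛ p ↟ 2) , (X ↟ 3 , (Λ ⊛ t ↟ 2 ⊛ B) ↟ 3) , τ ↟ 4 ⊛ p ↟ 2 ⊛ n ↟ 6 }) refl refl (pw 3 h₁))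
      (≤-trans (step ρ (λ { (Λ ∷ n ∷ p ∷ d ∷ τ ∷ X ∷ t ∷ q ∷ B ∷ Fs ∷ Z ∷ W ∷ U ∷ []) → (Λ ↟ 3 ⊛ (n ↟ 6 ⊛ (t ↟ 6 ⊛ B ↟ 3)) ⊛ τ ↟ 4 ⊛ p ↟ 2 , (Fs ⊛ p) ⊛ (Λ ↟ 6 ⊛ t ↟ 6 ⊛ d ↟ 2 ⊛ q ⊛ Z ⊛ τ ↟ 4 ⊛ p)) , (n ↟ 6 ⊛ (t ↟ 6 ⊛ B ↟ 3) , Λ ↟ 3 ⊛ Fs ⊛ (t ↟ 6 ⊛ d ↟ 2 ⊛ q ⊛ Z)) , Λ ↟ 3 ⊛ τ ↟ 4 ⊛ p ↟ 2 }) refl refl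
          (incidence-cubed Λ n d t q B s M Fc Z (Fc * s ^ 3) 0<n h₂ h₃ ≤-refl))
      (≤-trans (*-monoˡ-≤ _ h₄)
      (≤-trans (step ρ (λ { (Λ ∷ n ∷ p ∷ d ∷ τ ∷ X ∷ t ∷ q ∷ B ∷ Fs ∷ Z ∷ W ∷ U ∷ []) → (Λ ⊛ n ↟ 6 ⊛ (Λ ↟ 6 ⊛ t ↟ 6 ⊛ d ↟ 2 ⊛ q ⊛ Z ⊛ τ ↟ 4 ⊛ p) , Λ ↟ 7 ⊛ n ↟ 6 ⊛ t ↟ 6 ⊛ d ↟ 2 ⊛ q ↟ 2 ⊛ p ⊛ (τ ↟ 4 ⊛ W)) , (Z , q ⊛ W) , Λ ↟ 7 ⊛ n ↟ 6 ⊛ t ↟ 6 ⊛ d ↟ 2 ⊛ q ⊛ p ⊛ τ ↟ 4 }) refl refl h₅)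
      (≤-trans (step ρ (λ { (Λ ∷ n ∷ p ∷ d ∷ τ ∷ X ∷ t ∷ q ∷ B ∷ Fs ∷ Z ∷ W ∷ U ∷ []) → (Λ ↟ 7 ⊛ n ↟ 6 ⊛ t ↟ 6 ⊛ d ↟ 2 ⊛ q ↟ 2 ⊛ p ⊛ (τ ↟ 4 ⊛ W) , Λ ↟ 8 ⊛ n ↟ 6 ⊛ t ↟ 6 ⊛ d ↟ 2 ⊛ q ↟ 2 ⊛ (p ⊛ U)) , (τ ↟ 4 ⊛ W , Λ ⊛ U) , Λ ↟ 7 ⊛ n ↟ 6 ⊛ t ↟ 6 ⊛ d ↟ 2 ⊛ q ↟ 2 ⊛ p }) refl refl h₆)
      (≤-trans (step ρ (λ { (Λ ∷ n ∷ p ∷ d ∷ τ ∷ X ∷ t ∷ q ∷ B ∷ Fs ∷ Z ∷ W ∷ U ∷ []) → (Λ ↟ 8 ⊛ n ↟ 6 ⊛ t ↟ 6 ⊛ d ↟ 2 ⊛ q ↟ 2 ⊛ (p ⊛ U) , Λ ↟ 9 ⊛ n ↟ 14 ⊛ d ↟ 2 ⊛ (q ⊛ t ↟ 3) ↟ 2) , (p ⊛ U , Λ ⊛ n ↟ 8) , Λ ↟ 8 ⊛ n ↟ 6 ⊛ t ↟ 6 ⊛ d ↟ 2 ⊛ q ↟ 2 }) refl refl h₇)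
      (step ρ (λ { (Λ ∷ n ∷ p ∷ d ∷ τ ∷ X ∷ t ∷ q ∷ B ∷ Fs ∷ Z ∷ W ∷ U ∷ []) → (Λ ↟ 9 ⊛ n ↟ 14 ⊛ d ↟ 2 ⊛ (q ⊛ t ↟ 3) ↟ 2 , Λ ↟ 11 ⊛ n ↟ 20 ⊛ d ↟ 2) , ((q ⊛ t ↟ 3) ↟ 2 , (Λ ⊛ n ↟ 3) ↟ 2) , Λ ↟ 9 ⊛ n ↟ 14 ⊛ d ↟ 2 }) refl refl (pw 2 h₈)))))))))
      where
      ρ : Vec ℕ 13
      ρ = Λ ∷ n ∷ p ∷ d ∷ τ ∷ X ∷ t ∷ q ∷ B ∷ Fc * s ^ 3 ∷ Z ∷ W ∷ U ∷ []

    moment : ∀ Eₕ Tₕ → Bound → Eₕ ≤ Λ * d * τ ^ 2 → d * τ ^ 3 ≤ Tₕ → Eₕ ^ 14 * E ^ 6 * p ^ 2 ≤ Λ ^ 31 * n ^ 41 * Tₕ ^ 4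
    moment Eₕ Tₕ bound h₁ h₂ =
      ≤-trans (step ρ (λ { (Λ ∷ n ∷ p ∷ d ∷ τ ∷ E ∷ Eₕ ∷ Tₕ ∷ []) → (Eₕ ↟ 14 ⊛ E ↟ 6 ⊛ p ↟ 2 , (d ↟ 10 ⊛ τ ↟ 16 ⊛ E ↟ 6 ⊛ p ↟ 2) ⊛ (Λ ↟ 14 ⊛ (d ⊛ τ ↟ 3) ↟ 4)) , (Eₕ ↟ 14 , (Λ ⊛ d ⊛ τ ↟ 2) ↟ 14) , E ↟ 6 ⊛ p ↟ 2 }) refl refl (pw 14 h₁))
      (≤-trans (*-monoˡ-≤ _ bound)
      (step ρ (λ { (Λ ∷ n ∷ p ∷ d ∷ τ ∷ E ∷ Eₕ ∷ Tₕ ∷ []) → (Λ ↟ 17 ⊛ n ↟ 41 ⊛ (Λ ↟ 14 ⊛ (d ⊛ τ ↟ 3) ↟ 4) , Λ ↟ 31 ⊛ n ↟ 41 ⊛ Tₕ ↟ 4) , ((d ⊛ τ ↟ 3) ↟ 4 , Tₕ ↟ 4) , Λ ↟ 31 ⊛ n ↟ 41 }) refl refl (pw 4 h₂)))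
      where
      ρ : Vec ℕ 8
      ρ = Λ ∷ n ∷ p ∷ d ∷ τ ∷ E ∷ Eₕ ∷ Tₕ ∷ []

  -- The case where c = 0 dominates E_h, with φ = f_h(0): E_h^14 is essentially φ^28 = φ^16 (φ³)⁴,
  -- and for E⁶ the weaker bound n^15 is enough.
  moment-zero : ∀ Λ n p E Eₕ Tₕ φ → 1 ≤ Λ → 0 < n → Eₕ ≤ Λ * φ ^ 2 → φ ≤ n → φ ^ 3 ≤ Tₕ → E ^ 2 ≤ Λ * n ^ 5 → p ≤ n ^ 2 →
    Eₕ ^ 14 * E ^ 6 * p ^ 2 ≤ Λ ^ 31 * n ^ 41 * Tₕ ^ 4
  moment-zero Λ n p E Eₕ Tₕ φ 1≤Λ 0<n h₁ h₂ h₃ h₄ h₅ =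
    ≤-trans (step ρ (λ { (Λ ∷ n ∷ p ∷ E ∷ Eₕ ∷ Tₕ ∷ φ ∷ []) → (Eₕ ↟ 14 ⊛ E ↟ 6 ⊛ p ↟ 2 , Λ ↟ 14 ⊛ φ ↟ 28 ⊛ (E ↟ 2) ↟ 3 ⊛ p ↟ 2) , (Eₕ ↟ 14 , (Λ ⊛ φ ↟ 2) ↟ 14) , E ↟ 6 ⊛ p ↟ 2 }) refl refl (pw 14 h₁))
    (≤-trans (step ρ (λ { (Λ ∷ n ∷ p ∷ E ∷ Eₕ ∷ Tₕ ∷ φ ∷ []) → (Λ ↟ 14 ⊛ φ ↟ 28 ⊛ (E ↟ 2) ↟ 3 ⊛ p ↟ 2 , Λ ↟ 17 ⊛ n ↟ 15 ⊛ φ ↟ 28 ⊛ p ↟ 2) , ((E ↟ 2) ↟ 3 , (Λ ⊛ n ↟ 5) ↟ 3) , Λ ↟ 14 ⊛ φ ↟ 28 ⊛ p ↟ 2 }) refl refl (pw 3 h₄))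
    (≤-trans (step ρ (λ { (Λ ∷ n ∷ p ∷ E ∷ Eₕ ∷ Tₕ ∷ φ ∷ []) → (Λ ↟ 17 ⊛ n ↟ 15 ⊛ φ ↟ 28 ⊛ p ↟ 2 , Λ ↟ 17 ⊛ n ↟ 19 ⊛ φ ↟ 16 ⊛ (φ ↟ 3) ↟ 4) , (p ↟ 2 , (n ↟ 2) ↟ 2) , Λ ↟ 17 ⊛ n ↟ 15 ⊛ φ ↟ 28 }) refl refl (pw 2 h₅))
    (≤-trans (step ρ (λ { (Λ ∷ n ∷ p ∷ E ∷ Eₕ ∷ Tₕ ∷ φ ∷ []) → (Λ ↟ 17 ⊛ n ↟ 19 ⊛ φ ↟ 16 ⊛ (φ ↟ 3) ↟ 4 , Λ ↟ 17 ⊛ n ↟ 19 ⊛ φ ↟ 16 ⊛ Tₕ ↟ 4) , ((φ ↟ 3) ↟ 4 , Tₕ ↟ 4) , Λ ↟ 17 ⊛ n ↟ 19 ⊛ φ ↟ 16 }) refl refl (pw 4 h₃))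
    (≤-trans (step ρ (λ { (Λ ∷ n ∷ p ∷ E ∷ Eₕ ∷ Tₕ ∷ φ ∷ []) → (Λ ↟ 17 ⊛ n ↟ 19 ⊛ φ ↟ 16 ⊛ Tₕ ↟ 4 , Λ ↟ 17 ⊛ n ↟ 35 ⊛ Tₕ ↟ 4) , (φ ↟ 16 , n ↟ 16) , Λ ↟ 17 ⊛ n ↟ 19 ⊛ Tₕ ↟ 4 }) refl refl (pw 16 h₂))
    (*-monoˡ-≤ (Tₕ ^ 4) (*-mono-≤ (^-monoʳ-≤ Λ {{>-nonZero 1≤Λ}} (m≤m+n 17 14)) (^-monoʳ-≤ n {{>-nonZero 0<n}} (m≤m+n 35 6))))))))
    where
    ρ : Vec ℕ 7
    ρ = Λ ∷ n ∷ p ∷ E ∷ Eₕ ∷ Tₕ ∷ φ ∷ []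

-- The dilate 1 and the final exponents.

module ExponentArithmetic where

  open import Data.Nat using (ℕ; zero; suc; _+_; _*_; _^_; _≤_; _<_; z≤n; s≤s; >-nonZero; _⊔_)
  open import Data.Nat.Properties
  open import Data.Vec using (Vec; []; _∷_)
  open import Data.Product using (_,_)
  open import Data.Sum using (inj₁; inj₂)
  open import Data.Empty using (⊥-elim)
  open import Data.Fin using (Fin; zero; suc)
  open import Relation.Binary.PropositionalEquality
  open Monomials
  open MomentArithmetic
  open FiniteSums

  -- For h = 1 the energy in the triangle inequality is itself of size dτ². Large powers of dτ² can
  -- be split into the d and τ that this inequality controls and powers of dτ³, which is at most
  -- Λn³.
  module Extremal (Λ n p d τ E X : ℕ) (0<n : 0 < n) (0<d : 0 < d) (0<E : 0 < E)
    (triangles : (d * τ) ^ 4 * E ^ 2 ≤ Λ ^ 2 * n ^ 9 * X) (E≤ : E ≤ Λ * d * τ ^ 2) (d≤ : d * τ ^ 3 ≤ Λ * n ^ 3) where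

    diagonal′ : X ≤ Λ * d * n ^ 2 → E ^ 7 ≤ Λ ^ 10 * n ^ 17
    diagonal′ h =
      ≤-trans (step ρ (λ { (Λ ∷ n ∷ d ∷ τ ∷ E ∷ X ∷ []) → (E ↟ 7 , (d ↟ 3 ⊛ τ ↟ 4 ⊛ E ↟ 2) ⊛ (Λ ↟ 5 ⊛ (d ⊛ τ ↟ 3) ↟ 2)) , (E ↟ 5 , (Λ ⊛ d ⊛ τ ↟ 2) ↟ 5) , E ↟ 2 }) refl refl (pw 5 E≤))
      (≤-trans (*-monoˡ-≤ _ small)
      (step ρ (λ { (Λ ∷ n ∷ d ∷ τ ∷ E ∷ X ∷ []) → (Λ ↟ 3 ⊛ n ↟ 11 ⊛ (Λ ↟ 5 ⊛ (d ⊛ τ ↟ 3) ↟ 2) , Λ ↟ 10 ⊛ n ↟ 17) , ((d ⊛ τ ↟ 3) ↟ 2 , (Λ ⊛ n ↟ 3) ↟ 2) , Λ ↟ 8 ⊛ n ↟ 11 }) refl refl (pw 2 d≤)))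
      where
      ρ : Vec ℕ 6
      ρ = Λ ∷ n ∷ d ∷ τ ∷ E ∷ X ∷ []
      small : d ^ 3 * τ ^ 4 * E ^ 2 ≤ Λ ^ 3 * n ^ 11
      small = cancel ρ (λ { (Λ ∷ n ∷ d ∷ τ ∷ E ∷ X ∷ []) → (d ↟ 3 ⊛ τ ↟ 4 ⊛ E ↟ 2 , Λ ↟ 3 ⊛ n ↟ 11) , ((d ⊛ τ) ↟ 4 ⊛ E ↟ 2 , Λ ↟ 3 ⊛ n ↟ 11 ⊛ d) , d }) refl refl 0<d
        (≤-trans triangles (step ρ (λ { (Λ ∷ n ∷ d ∷ τ ∷ E ∷ X ∷ []) → (Λ ↟ 2 ⊛ n ↟ 9 ⊛ X , Λ ↟ 3 ⊛ n ↟ 11 ⊛ d) , (X , Λ ⊛ d ⊛ n ↟ 2) , Λ ↟ 2 ⊛ n ↟ 9 }) refl refl h))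

    module OffDiagonal (t q B s M : ℕ) (X≤ : X ≤ Λ * t ^ 2 * B) (B≤ : n ^ 2 * B ≤ Λ * s * M) where

      -- At levels s up to about n²/p only the trivial bound d²q for M is used. Then qt² ≤ E brings
      -- one factor E back to the right, where it is cancelled.
      low-level : s * p ≤ Λ * n ^ 2 → M ≤ d ^ 2 * q → q * t ^ 2 ≤ E → E ^ 3 * p ≤ Λ ^ 7 * n ^ 9
      low-level h₁ h₂ h₃ =
        ≤-trans (step ρ (λ { (Λ ∷ n ∷ p ∷ d ∷ τ ∷ E ∷ X ∷ t ∷ q ∷ B ∷ s ∷ M ∷ []) → (E ↟ 3 ⊛ p , Λ ↟ 2 ⊛ (d ↟ 2 ⊛ τ ↟ 4 ⊛ E ⊛ p)) , (E ↟ 2 , (Λ ⊛ d ⊛ τ ↟ 2) ↟ 2) , E ⊛ p }) refl refl (pw 2 E≤))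
        (step ρ (λ { (Λ ∷ n ∷ p ∷ d ∷ τ ∷ E ∷ X ∷ t ∷ q ∷ B ∷ s ∷ M ∷ []) → (Λ ↟ 2 ⊛ (d ↟ 2 ⊛ τ ↟ 4 ⊛ E ⊛ p) , Λ ↟ 7 ⊛ n ↟ 9) , (d ↟ 2 ⊛ τ ↟ 4 ⊛ E ⊛ p , Λ ↟ 5 ⊛ n ↟ 9) , Λ ↟ 2 }) refl refl small)
        where
        ρ : Vec ℕ 12
        ρ = Λ ∷ n ∷ p ∷ d ∷ τ ∷ E ∷ X ∷ t ∷ q ∷ B ∷ s ∷ M ∷ []
        pX : p * X ≤ Λ ^ 3 * d ^ 2 * E
        pX = cancel ρ (λ { (Λ ∷ n ∷ p ∷ d ∷ τ ∷ E ∷ X ∷ t ∷ q ∷ B ∷ s ∷ M ∷ []) → (p ⊛ X , Λ ↟ 3 ⊛ d ↟ 2 ⊛ E) , (n ↟ 2 ⊛ p ⊛ X , Λ ↟ 3 ⊛ n ↟ 2 ⊛ d ↟ 2 ⊛ E) , n ↟ 2 }) refl refl (^-pos 2 0<n)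
          (≤-trans (step ρ (λ { (Λ ∷ n ∷ p ∷ d ∷ τ ∷ E ∷ X ∷ t ∷ q ∷ B ∷ s ∷ M ∷ []) → (n ↟ 2 ⊛ p ⊛ X , Λ ⊛ t ↟ 2 ⊛ p ⊛ (n ↟ 2 ⊛ B)) , (X , Λ ⊛ t ↟ 2 ⊛ B) , n ↟ 2 ⊛ p }) refl refl X≤)
          (≤-trans (step ρ (λ { (Λ ∷ n ∷ p ∷ d ∷ τ ∷ E ∷ X ∷ t ∷ q ∷ B ∷ s ∷ M ∷ []) → (Λ ⊛ t ↟ 2 ⊛ p ⊛ (n ↟ 2 ⊛ B) , Λ ↟ 2 ⊛ t ↟ 2 ⊛ (s ⊛ p) ⊛ M) , (n ↟ 2 ⊛ B , Λ ⊛ s ⊛ M) , Λ ⊛ t ↟ 2 ⊛ p }) refl refl B≤)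
          (≤-trans (step ρ (λ { (Λ ∷ n ∷ p ∷ d ∷ τ ∷ E ∷ X ∷ t ∷ q ∷ B ∷ s ∷ M ∷ []) → (Λ ↟ 2 ⊛ t ↟ 2 ⊛ (s ⊛ p) ⊛ M , Λ ↟ 3 ⊛ t ↟ 2 ⊛ n ↟ 2 ⊛ M) , (s ⊛ p , Λ ⊛ n ↟ 2) , Λ ↟ 2 ⊛ t ↟ 2 ⊛ M }) refl refl h₁)
          (≤-trans (step ρ (λ { (Λ ∷ n ∷ p ∷ d ∷ τ ∷ E ∷ X ∷ t ∷ q ∷ B ∷ s ∷ M ∷ []) → (Λ ↟ 3 ⊛ t ↟ 2 ⊛ n ↟ 2 ⊛ M , Λ ↟ 3 ⊛ n ↟ 2 ⊛ d ↟ 2 ⊛ (q ⊛ t ↟ 2)) , (M , d ↟ 2 ⊛ q) , Λ ↟ 3 ⊛ t ↟ 2 ⊛ n ↟ 2 }) refl refl h₂)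
          (step ρ (λ { (Λ ∷ n ∷ p ∷ d ∷ τ ∷ E ∷ X ∷ t ∷ q ∷ B ∷ s ∷ M ∷ []) → (Λ ↟ 3 ⊛ n ↟ 2 ⊛ d ↟ 2 ⊛ (q ⊛ t ↟ 2) , Λ ↟ 3 ⊛ n ↟ 2 ⊛ d ↟ 2 ⊛ E) , (q ⊛ t ↟ 2 , E) , Λ ↟ 3 ⊛ n ↟ 2 ⊛ d ↟ 2 }) refl refl h₃)))))
        small : d ^ 2 * τ ^ 4 * E * p ≤ Λ ^ 5 * n ^ 9
        small = cancel ρ (λ { (Λ ∷ n ∷ p ∷ d ∷ τ ∷ E ∷ X ∷ t ∷ q ∷ B ∷ s ∷ M ∷ []) → (d ↟ 2 ⊛ τ ↟ 4 ⊛ E ⊛ p , Λ ↟ 5 ⊛ n ↟ 9) , ((d ⊛ τ) ↟ 4 ⊛ E ↟ 2 ⊛ p , Λ ↟ 5 ⊛ n ↟ 9 ⊛ d ↟ 2 ⊛ E) , d ↟ 2 ⊛ E }) refl refl (*-mono-≤ (^-pos 2 0<d) 0<E)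
          (≤-trans (*-monoˡ-≤ p triangles) (step ρ (λ { (Λ ∷ n ∷ p ∷ d ∷ τ ∷ E ∷ X ∷ t ∷ q ∷ B ∷ s ∷ M ∷ []) → (Λ ↟ 2 ⊛ n ↟ 9 ⊛ X ⊛ p , Λ ↟ 5 ⊛ n ↟ 9 ⊛ d ↟ 2 ⊛ E) , (p ⊛ X , Λ ↟ 3 ⊛ d ↟ 2 ⊛ E) , Λ ↟ 2 ⊛ n ↟ 9 }) refl refl pX))

      module HighLevel (Fc Z : ℕ) (M³≤ : M ^ 3 ≤ Fc * (d ^ 2 * q) * Z) (Fc≤ : Fc * s ^ 3 ≤ Λ * n ^ 4) (q≤ : q * t ^ 3 ≤ Λ * n ^ 3) where

        X³n² : X ^ 3 * n ^ 2 ≤ Λ ^ 7 * (t ^ 6 * d ^ 2 * q * Z)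
        X³n² = cancel ρ (λ { (Λ ∷ n ∷ d ∷ X ∷ t ∷ q ∷ B ∷ Z ∷ []) → (X ↟ 3 ⊛ n ↟ 2 , Λ ↟ 7 ⊛ (t ↟ 6 ⊛ d ↟ 2 ⊛ q ⊛ Z)) , (X ↟ 3 ⊛ n ↟ 6 , Λ ↟ 7 ⊛ n ↟ 4 ⊛ (t ↟ 6 ⊛ d ↟ 2 ⊛ q ⊛ Z)) , n ↟ 4 }) refl refl (^-pos 4 0<n)
          (≤-trans (step ρ (λ { (Λ ∷ n ∷ d ∷ X ∷ t ∷ q ∷ B ∷ Z ∷ []) → (X ↟ 3 ⊛ n ↟ 6 , Λ ↟ 3 ⊛ (n ↟ 6 ⊛ (t ↟ 6 ⊛ B ↟ 3))) , (X ↟ 3 , (Λ ⊛ t ↟ 2 ⊛ B) ↟ 3) , n ↟ 6 }) refl refl (pw 3 X≤))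
          (step ρ (λ { (Λ ∷ n ∷ d ∷ X ∷ t ∷ q ∷ B ∷ Z ∷ []) → (Λ ↟ 3 ⊛ (n ↟ 6 ⊛ (t ↟ 6 ⊛ B ↟ 3)) , Λ ↟ 7 ⊛ n ↟ 4 ⊛ (t ↟ 6 ⊛ d ↟ 2 ⊛ q ⊛ Z)) , (n ↟ 6 ⊛ (t ↟ 6 ⊛ B ↟ 3) , Λ ↟ 3 ⊛ (Λ ⊛ n ↟ 4) ⊛ (t ↟ 6 ⊛ d ↟ 2 ⊛ q ⊛ Z)) , Λ ↟ 3 }) refl refl
            (incidence-cubed Λ n d t q B s M Fc Z (Λ * n ^ 4) 0<n B≤ M³≤ Fc≤)))
          where
          ρ : Vec ℕ 8
          ρ = Λ ∷ n ∷ d ∷ X ∷ t ∷ q ∷ B ∷ Z ∷ []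

        -- U stands for the sum of E_k² over the dilates of large energy. As before, q²t⁶ = (qt³)²
        -- is eliminated by the row bound.
        large-energies : ∀ U → τ ^ 4 * Z ≤ Λ * q * U → E ^ 20 ≤ Λ ^ 34 * n ^ 43 * U
        large-energies U h =
          ≤-trans (step ρ (λ { (Λ ∷ n ∷ d ∷ τ ∷ E ∷ X ∷ t ∷ q ∷ Z ∷ U ∷ []) → (E ↟ 20 , (d ↟ 10 ⊛ τ ↟ 16 ⊛ E ↟ 6) ⊛ (Λ ↟ 14 ⊛ (d ⊛ τ ↟ 3) ↟ 4)) , (E ↟ 14 , (Λ ⊛ d ⊛ τ ↟ 2) ↟ 14) , E ↟ 6 }) refl refl (pw 14 E≤))
          (≤-trans (*-monoˡ-≤ _ small)
          (step ρ (λ { (Λ ∷ n ∷ d ∷ τ ∷ E ∷ X ∷ t ∷ q ∷ Z ∷ U ∷ []) → (Λ ↟ 16 ⊛ n ↟ 31 ⊛ U ⊛ (Λ ↟ 14 ⊛ (d ⊛ τ ↟ 3) ↟ 4) , Λ ↟ 34 ⊛ n ↟ 43 ⊛ U) , ((d ⊛ τ ↟ 3) ↟ 4 , (Λ ⊛ n ↟ 3) ↟ 4) , Λ ↟ 30 ⊛ n ↟ 31 ⊛ U }) refl refl (pw 4 d≤)))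
          where
          ρ : Vec ℕ 10
          ρ = Λ ∷ n ∷ d ∷ τ ∷ E ∷ X ∷ t ∷ q ∷ Z ∷ U ∷ []
          X³τ⁴ : X ^ 3 * τ ^ 4 ≤ Λ ^ 10 * n ^ 4 * d ^ 2 * U
          X³τ⁴ = cancel ρ (λ { (Λ ∷ n ∷ d ∷ τ ∷ E ∷ X ∷ t ∷ q ∷ Z ∷ U ∷ []) → (X ↟ 3 ⊛ τ ↟ 4 , Λ ↟ 10 ⊛ n ↟ 4 ⊛ d ↟ 2 ⊛ U) , (X ↟ 3 ⊛ n ↟ 2 ⊛ τ ↟ 4 , Λ ↟ 10 ⊛ n ↟ 6 ⊛ d ↟ 2 ⊛ U) , n ↟ 2 }) refl refl (^-pos 2 0<n)
            (≤-trans (*-monoˡ-≤ (τ ^ 4) X³n²)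
            (≤-trans (step ρ (λ { (Λ ∷ n ∷ d ∷ τ ∷ E ∷ X ∷ t ∷ q ∷ Z ∷ U ∷ []) → (Λ ↟ 7 ⊛ (t ↟ 6 ⊛ d ↟ 2 ⊛ q ⊛ Z) ⊛ τ ↟ 4 , Λ ↟ 8 ⊛ d ↟ 2 ⊛ U ⊛ (q ⊛ t ↟ 3) ↟ 2) , (τ ↟ 4 ⊛ Z , Λ ⊛ q ⊛ U) , Λ ↟ 7 ⊛ t ↟ 6 ⊛ d ↟ 2 ⊛ q }) refl refl h)
            (step ρ (λ { (Λ ∷ n ∷ d ∷ τ ∷ E ∷ X ∷ t ∷ q ∷ Z ∷ U ∷ []) → (Λ ↟ 8 ⊛ d ↟ 2 ⊛ U ⊛ (q ⊛ t ↟ 3) ↟ 2 , Λ ↟ 10 ⊛ n ↟ 6 ⊛ d ↟ 2 ⊛ U) , ((q ⊛ t ↟ 3) ↟ 2 , (Λ ⊛ n ↟ 3) ↟ 2) , Λ ↟ 8 ⊛ d ↟ 2 ⊛ U }) refl refl (pw 2 q≤))))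
          small : d ^ 10 * τ ^ 16 * E ^ 6 ≤ Λ ^ 16 * n ^ 31 * U
          small = cancel ρ (λ { (Λ ∷ n ∷ d ∷ τ ∷ E ∷ X ∷ t ∷ q ∷ Z ∷ U ∷ []) → (d ↟ 10 ⊛ τ ↟ 16 ⊛ E ↟ 6 , Λ ↟ 16 ⊛ n ↟ 31 ⊛ U) , (((d ⊛ τ) ↟ 4 ⊛ E ↟ 2) ↟ 3 ⊛ τ ↟ 4 , Λ ↟ 16 ⊛ n ↟ 31 ⊛ U ⊛ d ↟ 2) , d ↟ 2 }) refl refl (^-pos 2 0<d)
            (≤-trans (*-monoˡ-≤ (τ ^ 4) (pw 3 triangles))
            (step ρ (λ { (Λ ∷ n ∷ d ∷ τ ∷ E ∷ X ∷ t ∷ q ∷ Z ∷ U ∷ []) → ((Λ ↟ 2 ⊛ n ↟ 9 ⊛ X) ↟ 3 ⊛ τ ↟ 4 , Λ ↟ 16 ⊛ n ↟ 31 ⊛ U ⊛ d ↟ 2) , (X ↟ 3 ⊛ τ ↟ 4 , Λ ↟ 10 ⊛ n ↟ 4 ⊛ d ↟ 2 ⊛ U) , Λ ↟ 6 ⊛ n ↟ 27 }) refl refl X³τ⁴))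

        -- In the fourth power of t⁶qZ, Z⁴ is split as Z³ · Z. Three uses of the first bound and one
        -- of the second leave t^18 q⁶ = (qt³)⁶, so that t and q are eliminated together by `q≤`.
        small-energies : ∀ e → p * (t ^ 2 * (τ ^ 4 * Z)) ≤ Λ ^ 2 * e * n ^ 8 → τ ^ 4 * Z ≤ Λ * e ^ 2 * q ^ 2 → E ^ 80 * p ^ 3 ≤ Λ ^ 137 * n ^ 190 * e ^ 5
        small-energies e h₁ h₂ =
          ≤-trans (step ρ (λ { (Λ ∷ n ∷ p ∷ d ∷ τ ∷ E ∷ X ∷ t ∷ q ∷ Z ∷ e ∷ []) → (E ↟ 80 ⊛ p ↟ 3 , (d ↟ 40 ⊛ τ ↟ 64 ⊛ E ↟ 24 ⊛ p ↟ 3) ⊛ (Λ ↟ 56 ⊛ (d ⊛ τ ↟ 3) ↟ 16)) , (E ↟ 56 , (Λ ⊛ d ⊛ τ ↟ 2) ↟ 56) , E ↟ 24 ⊛ p ↟ 3 }) refl refl (pw 56 E≤))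
          (≤-trans (*-monoˡ-≤ _ small)
          (step ρ (λ { (Λ ∷ n ∷ p ∷ d ∷ τ ∷ E ∷ X ∷ t ∷ q ∷ Z ∷ e ∷ []) → (Λ ↟ 65 ⊛ n ↟ 142 ⊛ e ↟ 5 ⊛ (Λ ↟ 56 ⊛ (d ⊛ τ ↟ 3) ↟ 16) , Λ ↟ 137 ⊛ n ↟ 190 ⊛ e ↟ 5) , ((d ⊛ τ ↟ 3) ↟ 16 , (Λ ⊛ n ↟ 3) ↟ 16) , Λ ↟ 121 ⊛ n ↟ 142 ⊛ e ↟ 5 }) refl refl (pw 16 d≤)))
          where
          ρ : Vec ℕ 11
          ρ = Λ ∷ n ∷ p ∷ d ∷ τ ∷ E ∷ X ∷ t ∷ q ∷ Z ∷ e ∷ []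
          X¹² : X ^ 12 * p ^ 3 * τ ^ 16 ≤ Λ ^ 41 * d ^ 8 * n ^ 34 * e ^ 5
          X¹² = cancel ρ (λ { (Λ ∷ n ∷ p ∷ d ∷ τ ∷ E ∷ X ∷ t ∷ q ∷ Z ∷ e ∷ []) → (X ↟ 12 ⊛ p ↟ 3 ⊛ τ ↟ 16 , Λ ↟ 41 ⊛ d ↟ 8 ⊛ n ↟ 34 ⊛ e ↟ 5) , ((X ↟ 3 ⊛ n ↟ 2) ↟ 4 ⊛ (p ↟ 3 ⊛ τ ↟ 16) , Λ ↟ 41 ⊛ d ↟ 8 ⊛ n ↟ 42 ⊛ e ↟ 5) , n ↟ 8 }) refl refl (^-pos 8 0<n)
            (≤-trans (*-monoˡ-≤ (p ^ 3 * τ ^ 16) (pw 4 X³n²))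
            (≤-trans (step ρ (λ { (Λ ∷ n ∷ p ∷ d ∷ τ ∷ E ∷ X ∷ t ∷ q ∷ Z ∷ e ∷ []) → ((Λ ↟ 7 ⊛ (t ↟ 6 ⊛ d ↟ 2 ⊛ q ⊛ Z)) ↟ 4 ⊛ (p ↟ 3 ⊛ τ ↟ 16) , Λ ↟ 34 ⊛ d ↟ 8 ⊛ t ↟ 18 ⊛ q ↟ 4 ⊛ e ↟ 3 ⊛ n ↟ 24 ⊛ (τ ↟ 4 ⊛ Z)) , ((p ⊛ (t ↟ 2 ⊛ (τ ↟ 4 ⊛ Z))) ↟ 3 , (Λ ↟ 2 ⊛ e ⊛ n ↟ 8) ↟ 3) , Λ ↟ 28 ⊛ d ↟ 8 ⊛ t ↟ 18 ⊛ q ↟ 4 ⊛ (τ ↟ 4 ⊛ Z) }) refl refl (pw 3 h₁))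
            (≤-trans (step ρ (λ { (Λ ∷ n ∷ p ∷ d ∷ τ ∷ E ∷ X ∷ t ∷ q ∷ Z ∷ e ∷ []) → (Λ ↟ 34 ⊛ d ↟ 8 ⊛ t ↟ 18 ⊛ q ↟ 4 ⊛ e ↟ 3 ⊛ n ↟ 24 ⊛ (τ ↟ 4 ⊛ Z) , Λ ↟ 35 ⊛ d ↟ 8 ⊛ e ↟ 5 ⊛ n ↟ 24 ⊛ (q ⊛ t ↟ 3) ↟ 6) , (τ ↟ 4 ⊛ Z , Λ ⊛ e ↟ 2 ⊛ q ↟ 2) , Λ ↟ 34 ⊛ d ↟ 8 ⊛ t ↟ 18 ⊛ q ↟ 4 ⊛ e ↟ 3 ⊛ n ↟ 24 }) refl refl h₂)
            (step ρ (λ { (Λ ∷ n ∷ p ∷ d ∷ τ ∷ E ∷ X ∷ t ∷ q ∷ Z ∷ e ∷ []) → (Λ ↟ 35 ⊛ d ↟ 8 ⊛ e ↟ 5 ⊛ n ↟ 24 ⊛ (q ⊛ t ↟ 3) ↟ 6 , Λ ↟ 41 ⊛ d ↟ 8 ⊛ n ↟ 42 ⊛ e ↟ 5) , ((q ⊛ t ↟ 3) ↟ 6 , (Λ ⊛ n ↟ 3) ↟ 6) , Λ ↟ 35 ⊛ d ↟ 8 ⊛ e ↟ 5 ⊛ n ↟ 24 }) refl refl (pw 6 q≤)))))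
          small : d ^ 40 * τ ^ 64 * E ^ 24 * p ^ 3 ≤ Λ ^ 65 * n ^ 142 * e ^ 5
          small = cancel ρ (λ { (Λ ∷ n ∷ p ∷ d ∷ τ ∷ E ∷ X ∷ t ∷ q ∷ Z ∷ e ∷ []) → (d ↟ 40 ⊛ τ ↟ 64 ⊛ E ↟ 24 ⊛ p ↟ 3 , Λ ↟ 65 ⊛ n ↟ 142 ⊛ e ↟ 5) , (((d ⊛ τ) ↟ 4 ⊛ E ↟ 2) ↟ 12 ⊛ (p ↟ 3 ⊛ τ ↟ 16) , Λ ↟ 65 ⊛ n ↟ 142 ⊛ d ↟ 8 ⊛ e ↟ 5) , d ↟ 8 }) refl refl (^-pos 8 0<d)
            (≤-trans (*-monoˡ-≤ (p ^ 3 * τ ^ 16) (pw 12 triangles))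
            (step ρ (λ { (Λ ∷ n ∷ p ∷ d ∷ τ ∷ E ∷ X ∷ t ∷ q ∷ Z ∷ e ∷ []) → ((Λ ↟ 2 ⊛ n ↟ 9 ⊛ X) ↟ 12 ⊛ (p ↟ 3 ⊛ τ ↟ 16) , Λ ↟ 65 ⊛ n ↟ 142 ⊛ d ↟ 8 ⊛ e ↟ 5) , (X ↟ 12 ⊛ p ↟ 3 ⊛ τ ↟ 16 , Λ ↟ 41 ⊛ d ↟ 8 ⊛ n ↟ 34 ⊛ e ↟ 5) , Λ ↟ 24 ⊛ n ↟ 108 }) refl refl X¹²))

  private
    -- x^k A ≤ B y^k says x/y ≤ (B/A)^(1/k) without roots, and the mediant (x + x′)/(y + y′) does
    -- not exceed the larger ratio x′/y′. If y′ = 0, then x′ = 0 because A is positive.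
    ratio-add-ordered : ∀ m A B x y x′ y′ → 0 < A → x * y′ ≤ x′ * y → x ^ suc m * A ≤ B * y ^ suc m → x′ ^ suc m * A ≤ B * y′ ^ suc m →
      (x + x′) ^ suc m * A ≤ B * (y + y′) ^ suc m
    ratio-add-ordered m A B x y x′ y′ 0<A le h h′ = go y′ refl
      where
      open ≤-Reasoning
      k = suc m
      cross : (x + x′) * y′ ≤ x′ * (y + y′)
      cross = ≤-trans (≤-reflexive (*-distribʳ-+ y′ x x′)) (≤-trans (+-monoˡ-≤ (x′ * y′) le) (≤-reflexive (sym (*-distribˡ-+ x′ y y′))))
      vanishing : ∀ z → z ^ suc m * A ≤ B * 0 ^ suc m → z ≡ 0
      vanishing zero _ = refl
      vanishing z@(suc _) q = ⊥-elim (<⇒≱ (*-mono-≤ (^-pos {z} (suc m) (s≤s z≤n)) 0<A) (≤-trans q (≤-reflexive (*-zeroʳ B))))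
      go : ∀ w → y′ ≡ w → (x + x′) ^ suc m * A ≤ B * (y + y′) ^ suc m
      go zero refl = subst₂ (λ a b → a ^ suc m * A ≤ B * b ^ suc m) (sym (trans (cong (x +_) (vanishing x′ h′)) (+-identityʳ x))) (sym (+-identityʳ y)) h
      go (suc w) refl = *-cancelʳ-≤ _ _ (suc w ^ k) {{>-nonZero (^-pos {suc w} k (s≤s z≤n))}} (begin
        (x + x′) ^ k * A * y′ ^ k ≡⟨ trans (*-assoc ((x + x′) ^ k) A _) (trans (cong ((x + x′) ^ k *_) (*-comm A (y′ ^ k))) (sym (*-assoc ((x + x′) ^ k) _ A))) ⟩
        (x + x′) ^ k * y′ ^ k * A ≡⟨ cong (_* A) (^-distribʳ-* (x + x′) y′ k) ⟨
        ((x + x′) * y′) ^ k * A ≤⟨ *-monoˡ-≤ A (pw k cross) ⟩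
        (x′ * (y + y′)) ^ k * A ≡⟨ cong (_* A) (^-distribʳ-* x′ (y + y′) k) ⟩
        x′ ^ k * (y + y′) ^ k * A ≡⟨ trans (*-assoc (x′ ^ k) _ A) (trans (cong (x′ ^ k *_) (*-comm _ A)) (sym (*-assoc (x′ ^ k) A _))) ⟩
        x′ ^ k * A * (y + y′) ^ k ≤⟨ *-monoˡ-≤ ((y + y′) ^ k) h′ ⟩
        B * y′ ^ k * (y + y′) ^ k ≡⟨ trans (*-assoc B _ _) (trans (cong (B *_) (*-comm (y′ ^ k) _)) (sym (*-assoc B _ _))) ⟩
        B * (y + y′) ^ k * y′ ^ k ∎)

  ratio-add : ∀ m A B x y x′ y′ → 0 < A → x ^ suc m * A ≤ B * y ^ suc m → x′ ^ suc m * A ≤ B * y′ ^ suc m → (x + x′) ^ suc m * A ≤ B * (y + y′) ^ suc m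
  ratio-add m A B x y x′ y′ 0<A h h′ with ≤-total (x * y′) (x′ * y)
  ... | inj₁ le = ratio-add-ordered m A B x y x′ y′ 0<A le h h′
  ... | inj₂ ge = subst₂ (λ a b → a ^ suc m * A ≤ B * b ^ suc m) (+-comm x′ x) (+-comm y′ y) (ratio-add-ordered m A B x′ y′ x y 0<A ge h′ h)

  ratio-sum : ∀ m A B {k} (x y : Fin k → ℕ) → 0 < A → (∀ i → x i ^ suc m * A ≤ B * y i ^ suc m) → ∑ x ^ suc m * A ≤ B * ∑ y ^ suc m
  ratio-sum m A B {zero} x y 0<A h = subst₂ (λ a b → a ^ suc m * A ≤ B * b ^ suc m) (sym (∑-nil x)) (sym (∑-nil y)) z≤n
  ratio-sum m A B {suc k} x y 0<A h = subst₂ (λ a b → a ^ suc m * A ≤ B * b ^ suc m) (sym (∑-suc x)) (sym (∑-suc y))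
    (ratio-add m A B (x zero) (y zero) _ _ 0<A (h zero) (ratio-sum m A B (λ i → x (suc i)) (λ i → y (suc i)) 0<A (λ i → h (suc i))))

  -- The weights 5 and 6 leave e^70/e^30 = e^40 against T^20. So e² is at most a multiple of T, with
  -- a factor independent of the dilate, and `ratio-sum` can add this up over all dilates.
  large-energy-ratio : ∀ Λ n p E e T → 0 < e → E ^ 80 * p ^ 3 ≤ Λ ^ 137 * n ^ 190 * e ^ 5 → e ^ 14 * E ^ 6 * p ^ 2 ≤ Λ ^ 31 * n ^ 41 * T ^ 4 →
    (e ^ 2) ^ 20 * (E ^ 510 * p ^ 28) ≤ Λ ^ 977 * n ^ 1345 * T ^ 20
  large-energy-ratio Λ n p E e T 0<e h₁ h₂ = cancel ρ (λ { (Λ ∷ n ∷ p ∷ E ∷ e ∷ T ∷ []) →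
      ((e ↟ 2) ↟ 20 ⊛ (E ↟ 510 ⊛ p ↟ 28) , Λ ↟ 977 ⊛ n ↟ 1345 ⊛ T ↟ 20) , ((e ↟ 14 ⊛ E ↟ 6 ⊛ p ↟ 2) ↟ 5 ⊛ (E ↟ 80 ⊛ p ↟ 3) ↟ 6 , (Λ ↟ 31 ⊛ n ↟ 41 ⊛ T ↟ 4) ↟ 5 ⊛ (Λ ↟ 137 ⊛ n ↟ 190 ⊛ e ↟ 5) ↟ 6) , e ↟ 30 }) refl refl (^-pos 30 0<e)
    (*-mono-≤ (pw 5 h₂) (pw 6 h₁))
    where
    ρ : Vec ℕ 6
    ρ = Λ ∷ n ∷ p ∷ E ∷ e ∷ T ∷ []

  -- The first inequality is raised to the 20th power, and S stands for the sum of all T_k. The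
  -- exponents arise as 910 = 400 + 510, 48 = 28 + 20 and 2325 = 860 + 1345 + 120.
  combine-large : ∀ Λ n p E U S → E ^ 20 ≤ Λ ^ 34 * n ^ 43 * U → U ^ 20 * (E ^ 510 * p ^ 28) ≤ Λ ^ 977 * n ^ 1345 * S ^ 20 → p * S ≤ Λ * n ^ 6 →
    E ^ 910 * p ^ 48 ≤ Λ ^ 1677 * n ^ 2325
  combine-large Λ n p E U S h₁ h₂ h₃ =
    ≤-trans (step ρ (λ { (Λ ∷ n ∷ p ∷ E ∷ U ∷ S ∷ []) → (E ↟ 910 ⊛ p ↟ 48 , (U ↟ 20 ⊛ (E ↟ 510 ⊛ p ↟ 28)) ⊛ (Λ ↟ 680 ⊛ n ↟ 860 ⊛ p ↟ 20)) , ((E ↟ 20) ↟ 20 , (Λ ↟ 34 ⊛ n ↟ 43 ⊛ U) ↟ 20) , E ↟ 510 ⊛ p ↟ 48 }) refl refl (pw 20 h₁))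
    (≤-trans (*-monoˡ-≤ _ h₂)
    (step ρ (λ { (Λ ∷ n ∷ p ∷ E ∷ U ∷ S ∷ []) → (Λ ↟ 977 ⊛ n ↟ 1345 ⊛ S ↟ 20 ⊛ (Λ ↟ 680 ⊛ n ↟ 860 ⊛ p ↟ 20) , Λ ↟ 1677 ⊛ n ↟ 2325) , ((p ⊛ S) ↟ 20 , (Λ ⊛ n ↟ 6) ↟ 20) , Λ ↟ 1657 ⊛ n ↟ 2205 }) refl refl (pw 20 h₃)))
    where
    ρ : Vec ℕ 6
    ρ = Λ ∷ n ∷ p ∷ E ∷ U ∷ S ∷ []

  root-≤ : ∀ k {x y} → x ^ suc k ≤ y ^ suc k → x ≤ y
  root-≤ k {x} {y} h = ≮⇒≥ λ y<x → <⇒≱ (^-monoˡ-< (suc k) y<x) h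

  module Final (K Λ n p E : ℕ) (1≤K : 1 ≤ K) (1≤Λ : 1 ≤ Λ) (0<n : 0 < n) (p≤n² : p ≤ n ^ 2) (n³≤p² : n ^ 3 ≤ p ^ 2)
    (absorb : Λ ^ 20124 ≤ K * n) where

    -- The 120th power clears the exponents 1/40 and 1/24, and the factor p^25 clears the
    -- denominators p^9 and p^25.
    Target : Set
    Target = E ^ 120 * p ^ 25 ≤ K * ((n ^ 312 * p ^ 16) ⊔ n ^ 340)

    private
      firstly : E ^ 120 * p ^ 25 ≤ K * (n ^ 312 * p ^ 16) → Target
      firstly h = ≤-trans h (*-monoʳ-≤ K (m≤m⊔n _ _))

      Λ^≤ : ∀ a → a ≤ 20124 → Λ ^ a ≤ K * n
      Λ^≤ a le = ≤-trans (^-monoʳ-≤ Λ {{>-nonZero 1≤Λ}} le) absorb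

      K≤K^ : ∀ k → K ≤ K ^ suc k
      K≤K^ k = ≤-trans (≤-reflexive (sym (*-identityʳ K))) (*-monoʳ-≤ K (^-pos k 1≤K))

      n≤n^ : ∀ k → n ≤ n ^ suc k
      n≤n^ k = ≤-trans (≤-reflexive (sym (*-identityʳ n))) (*-monoʳ-≤ n (^-pos k 0<n))

      ρ : Vec ℕ 5
      ρ = K ∷ Λ ∷ n ∷ p ∷ E ∷ []

    -- 120 · 91 = 910 · 12. After p^243 ≤ n^486 the bound is n^28386 p^1456 against the permitted
    -- n^28392 p^1456, which leaves n⁶ to absorb Λ^20124.
    main-case : E ^ 910 * p ^ 48 ≤ Λ ^ 1677 * n ^ 2325 → Target
    main-case h = firstly (root-≤ 90 (
      ≤-trans (step ρ (λ { (K ∷ Λ ∷ n ∷ p ∷ E ∷ []) → ((E ↟ 120 ⊛ p ↟ 25) ↟ 91 , Λ ↟ 20124 ⊛ n ↟ 27900 ⊛ p ↟ 1699) , ((E ↟ 910 ⊛ p ↟ 48) ↟ 12 , (Λ ↟ 1677 ⊛ n ↟ 2325) ↟ 12) , p ↟ 1699 }) refl refl (pw 12 h))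
      (≤-trans (step ρ (λ { (K ∷ Λ ∷ n ∷ p ∷ E ∷ []) → (Λ ↟ 20124 ⊛ n ↟ 27900 ⊛ p ↟ 1699 , Λ ↟ 20124 ⊛ (n ↟ 28386 ⊛ p ↟ 1456)) , (p ↟ 243 , (n ↟ 2) ↟ 243) , Λ ↟ 20124 ⊛ n ↟ 27900 ⊛ p ↟ 1456 }) refl refl (pw 243 p≤n²))
      (≤-trans (*-monoˡ-≤ _ (≤-trans absorb (*-mono-≤ (K≤K^ 90) (n≤n^ 5))))
      (≤-reflexive (monomial ρ (λ { (K ∷ Λ ∷ n ∷ p ∷ E ∷ []) → K ↟ 91 ⊛ n ↟ 6 ⊛ (n ↟ 28386 ⊛ p ↟ 1456) , (K ⊛ (n ↟ 312 ⊛ p ↟ 16)) ↟ 91 }) refl))))))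

    diagonal-case : E ^ 7 ≤ Λ ^ 10 * n ^ 17 → Target
    diagonal-case h = firstly (root-≤ 6 (
      ≤-trans (step ρ (λ { (K ∷ Λ ∷ n ∷ p ∷ E ∷ []) → ((E ↟ 120 ⊛ p ↟ 25) ↟ 7 , Λ ↟ 1200 ⊛ n ↟ 2040 ⊛ p ↟ 175) , ((E ↟ 7) ↟ 120 , (Λ ↟ 10 ⊛ n ↟ 17) ↟ 120) , p ↟ 175 }) refl refl (pw 120 h))
      (≤-trans (step ρ (λ { (K ∷ Λ ∷ n ∷ p ∷ E ∷ []) → (Λ ↟ 1200 ⊛ n ↟ 2040 ⊛ p ↟ 175 , Λ ↟ 1200 ⊛ (n ↟ 2166 ⊛ p ↟ 112)) , (p ↟ 63 , (n ↟ 2) ↟ 63) , Λ ↟ 1200 ⊛ n ↟ 2040 ⊛ p ↟ 112 }) refl refl (pw 63 p≤n²))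
      (≤-trans (*-monoˡ-≤ _ (≤-trans (Λ^≤ 1200 (m≤m+n 1200 18924)) (*-mono-≤ (K≤K^ 6) (n≤n^ 17))))
      (≤-reflexive (monomial ρ (λ { (K ∷ Λ ∷ n ∷ p ∷ E ∷ []) → K ↟ 7 ⊛ n ↟ 18 ⊛ (n ↟ 2166 ⊛ p ↟ 112) , (K ⊛ (n ↟ 312 ⊛ p ↟ 16)) ↟ 7 }) refl))))))

    zero-case : E ≤ Λ * n ^ 2 → Target
    zero-case h = firstly (
      ≤-trans (step ρ (λ { (K ∷ Λ ∷ n ∷ p ∷ E ∷ []) → (E ↟ 120 ⊛ p ↟ 25 , Λ ↟ 120 ⊛ n ↟ 240 ⊛ p ↟ 25) , (E ↟ 120 , (Λ ⊛ n ↟ 2) ↟ 120) , p ↟ 25 }) refl refl (pw 120 h))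
      (≤-trans (step ρ (λ { (K ∷ Λ ∷ n ∷ p ∷ E ∷ []) → (Λ ↟ 120 ⊛ n ↟ 240 ⊛ p ↟ 25 , Λ ↟ 120 ⊛ (n ↟ 258 ⊛ p ↟ 16)) , (p ↟ 9 , (n ↟ 2) ↟ 9) , Λ ↟ 120 ⊛ n ↟ 240 ⊛ p ↟ 16 }) refl refl (pw 9 p≤n²))
      (≤-trans (*-monoˡ-≤ _ (≤-trans (Λ^≤ 120 (m≤m+n 120 20004)) (*-monoʳ-≤ K (n≤n^ 53))))
      (≤-reflexive (monomial ρ (λ { (K ∷ Λ ∷ n ∷ p ∷ E ∷ []) → K ⊛ n ↟ 54 ⊛ (n ↟ 258 ⊛ p ↟ 16) , K ⊛ (n ↟ 312 ⊛ p ↟ 16) }) refl)))))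

    -- The 40th power gives E^120 p^40 ≪ n^360. To reach n^340 after dropping p^15, with n² left
    -- over for Λ^280, one needs n^22 ≤ p^15; this follows from n³ ≤ p², which even gives n^45 ≤
    -- p^30.
    low-case : E ^ 3 * p ≤ Λ ^ 7 * n ^ 9 → Target
    low-case h = ≤-trans (cancel ρ (λ { (K ∷ Λ ∷ n ∷ p ∷ E ∷ []) → (E ↟ 120 ⊛ p ↟ 25 , K ⊛ n ↟ 340) , (n ↟ 22 ⊛ (E ↟ 120 ⊛ p ↟ 25) , K ⊛ n ↟ 2 ⊛ n ↟ 360) , n ↟ 22 }) refl refl (^-pos 22 0<n)
      (≤-trans (*-monoˡ-≤ (E ^ 120 * p ^ 25) n²²≤p¹⁵)
      -- No further factor is present; `K ↟ 0` stands for 1.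
      (≤-trans (step ρ (λ { (K ∷ Λ ∷ n ∷ p ∷ E ∷ []) → (p ↟ 15 ⊛ (E ↟ 120 ⊛ p ↟ 25) , Λ ↟ 280 ⊛ n ↟ 360) , ((E ↟ 3 ⊛ p) ↟ 40 , (Λ ↟ 7 ⊛ n ↟ 9) ↟ 40 ) , K ↟ 0 }) refl refl (pw 40 h))
      (*-monoˡ-≤ (n ^ 360) (≤-trans (Λ^≤ 280 (m≤m+n 280 19844)) (*-monoʳ-≤ K (n≤n^ 1)))))))
      (*-monoʳ-≤ K (m≤n⊔m (n ^ 312 * p ^ 16) (n ^ 340)))
      where
      n²²≤p¹⁵ : n ^ 22 ≤ p ^ 15
      n²²≤p¹⁵ = root-≤ 1 (≤-trans (≤-reflexive (^-*-assoc n 22 2)) (≤-trans (^-monoʳ-≤ n {{>-nonZero 0<n}} (n≤1+n 44)) (≤-trans (≤-reflexive (sym (^-*-assoc n 3 15))) (≤-trans (pw 15 n³≤p²) (≤-reflexive (trans (^-*-assoc p 2 15) (sym (^-*-assoc p 15 2))))))))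

-- Assembling the energy bound.

module EnergyBound where

  open import Data.Nat using (ℕ; zero; suc; _+_; _*_; _^_; _≤_; _<_; z≤n; s≤s; _≤?_; _<?_; >-nonZero; _⊔_)
  open import Data.Nat.Properties as ℕₚ using (≤-refl; ≤-trans; ≤-reflexive; <⇒≤; *-mono-≤; +-mono-≤)
  open import Data.Nat.Solver using (module +-*-Solver)
  open import Data.Fin as Fin using (Fin; toℕ)
  open import Data.Product using (∃; _,_; proj₁; proj₂)
  open import Data.Sum using (_⊎_; inj₁; inj₂)
  open import Data.Empty using (⊥; ⊥-elim)
  open import Relation.Nullary using (¬_; Dec; yes; no)
  open import Relation.Nullary.Decidable using (¬?)
  open import Relation.Binary.PropositionalEquality
  open PrimeFields
  open FieldArithmetic
  open FiniteSums
  open SubgroupCounting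
  open LevelSetArithmetic
  open LevelSets
  open EnergyInequalities
  open IncidenceSums
  open DyadicDecomposition
  open Monomials
  open MomentArithmetic
  open ExponentArithmetic

  argmax : ∀ {m} (g : Fin m → ℕ) → Fin m → ∃ λ i → ∀ j → g j ≤ g i
  argmax {suc m} g _ = proj₁ (∑-max g) , proj₁ (proj₂ (∑-max g))

  module Assembly {p : ℕ} (𝔽 : PrimeField p) {G : Fin p → ℕ} (isG : IsSubgroupIndicator 𝔽 G) (L-1 : ℕ)
    (n<2^L : Subgroup.n 𝔽 isG < 2 ^ suc L-1) (N₀≤n : N₀ ≤ Subgroup.n 𝔽 isG)
    (p≤nn : p ≤ Subgroup.n 𝔽 isG * Subgroup.n 𝔽 isG) (nnn≤pp : Subgroup.n 𝔽 isG * Subgroup.n 𝔽 isG * Subgroup.n 𝔽 isG ≤ p * p) where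
    open FieldLemmas 𝔽
    open IsSubgroupIndicator isG
    open Subgroup 𝔽 isG
    open Representations 𝔽 isG
    open Levels N₀≤n p≤nn nnn≤pp
    open Energies 𝔽 isG
    open Incidences 𝔽 isG
    open DyadicLevels 𝔽 isG L-1 n<2^L
    open +-*-Solver using () renaming (solve to solveℕ; _:+_ to _⟨+⟩_; _:*_ to _⟨*⟩_; _:=_ to _⟨=⟩_; _:^_ to _⟨^⟩_; con to ⟨con⟩)
    open ℕₚ.≤-Reasoning

    -- C is the constant of the level bounds and L, of order log n, the number of dyadic levels; 16
    -- covers the numerical factors in the estimates below.
    Λ : ℕ
    Λ = 16 * C * L

    private
      1≤2κ : 1 ≤ κ + κ
      1≤2κ = ≤-trans (≤-trans (s≤s z≤n) 384≤κ) (ℕₚ.m≤m+n κ κ)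

      1≤C₀ : 1 ≤ C₀
      1≤C₀ = *-mono-≤ (*-mono-≤ 1≤2κ 1≤2κ) 1≤2κ

      2κ≤C₀ : κ + κ ≤ C₀
      2κ≤C₀ = ≤-trans (≤-reflexive (sym (ℕₚ.*-identityˡ (κ + κ)))) (ℕₚ.*-monoˡ-≤ (κ + κ) (*-mono-≤ 1≤2κ 1≤2κ))

      C₀≤C : C₀ ≤ C
      C₀≤C = ℕₚ.m≤n*m C₀ 4

      1≤C : 1 ≤ C
      1≤C = ≤-trans 1≤C₀ C₀≤C

      16≤Λ : 16 ≤ Λ
      16≤Λ = *-mono-≤ (*-mono-≤ (≤-refl {16}) 1≤C) (s≤s (z≤n {L-1}))

      C≤Λ : C ≤ Λ
      C≤Λ = ≤-trans (ℕₚ.m≤n*m C 16) (ℕₚ.m≤m*n (16 * C) L)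

      16L≤Λ : 16 * L ≤ Λ
      16L≤Λ = ℕₚ.*-monoˡ-≤ L (≤-trans (≤-reflexive (sym (ℕₚ.*-identityʳ 16))) (ℕₚ.*-monoʳ-≤ 16 1≤C))

      ≤16⇒≤Λ : ∀ {k} → k ≤ 16 → k ≤ Λ
      ≤16⇒≤Λ le = ≤-trans le 16≤Λ

      1+8LC≤Λ : 1 + L * (8 * C) ≤ Λ
      1+8LC≤Λ = ≤-trans (ℕₚ.+-monoˡ-≤ (L * (8 * C)) (*-mono-≤ (s≤s (z≤n {L-1})) (*-mono-≤ (s≤s (z≤n {7})) 1≤C)))
        (≤-reflexive (solveℕ 2 (λ L c → L ⟨*⟩ (⟨con⟩ 8 ⟨*⟩ c) ⟨+⟩ L ⟨*⟩ (⟨con⟩ 8 ⟨*⟩ c) ⟨=⟩ ⟨con⟩ 16 ⟨*⟩ c ⟨*⟩ L) refl L C))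

    1≤Λ : 1 ≤ Λ
    1≤Λ = ≤16⇒≤Λ (s≤s z≤n)

    private
      0<p : 0 < p
      0<p = ≤-trans (s≤s z≤n) n<p

      x²≡ : ∀ x → x * x ≡ x ^ 2
      x²≡ x = cong (x *_) (sym (ℕₚ.*-identityʳ x))

      x³≡ : ∀ x → x * x * x ≡ x ^ 3
      x³≡ x = solveℕ 1 (λ x → x ⟨*⟩ x ⟨*⟩ x ⟨=⟩ x ⟨^⟩ 3) refl x

    p≤n² : p ≤ n ^ 2
    p≤n² = ≤-trans p≤nn (≤-reflexive (x²≡ n))

    n³≤p² : n ^ 3 ≤ p ^ 2
    n³≤p² = subst₂ _≤_ (x³≡ n) (x²≡ p) nnn≤pp

    private
      dτ³≤Cn³ : ∀ h i → h ≢ 0# → d h i * cb (2 ^ i) ≤ C * cb n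
      dτ³≤Cn³ h i h≢0 = ≤-trans (ℕₚ.*-monoˡ-≤ (cb (2 ^ i)) (d≤rowlev h i)) (row-all (2 ^ i) h≢0)

      d-bound : ∀ h i → h ≢ 0# → d h i * (2 ^ i) ^ 3 ≤ Λ * n ^ 3
      d-bound h i h≢0 = begin
        d h i * (2 ^ i) ^ 3 ≡⟨ cong (d h i *_) (x³≡ (2 ^ i)) ⟨
        d h i * cb (2 ^ i) ≤⟨ dτ³≤Cn³ h i h≢0 ⟩
        C * cb n ≤⟨ *-mono-≤ C≤Λ (≤-reflexive (x³≡ n)) ⟩
        Λ * n ^ 3 ∎

      T₁≤ : T 1# ≤ Λ * n ^ 3
      T₁≤ = begin
        T 1# ≤⟨ T-levels 1# ⟩
        cb (f 1# 0#) + ∑ {L} (λ i → d 1# (toℕ i) * (8 * cb (2 ^ toℕ i))) ≤⟨ +-mono-≤ (*-mono-≤ (*-mono-≤ (f≤n 1# 0#) (f≤n 1# 0#)) (f≤n 1# 0#)) (∑-mono (λ i → ≤-trans (≤-reflexive (solveℕ 2 (λ d c → d ⟨*⟩ (⟨con⟩ 8 ⟨*⟩ c) ⟨=⟩ ⟨con⟩ 8 ⟨*⟩ (d ⟨*⟩ c)) refl (d 1# (toℕ i)) (cb (2 ^ toℕ i)))) (ℕₚ.*-monoʳ-≤ 8 (dτ³≤Cn³ 1# (toℕ i) 1≢0)))) ⟩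
        cb n + ∑ {L} (λ _ → 8 * (C * cb n)) ≡⟨ cong (cb n +_) (∑-const {L} (8 * (C * cb n))) ⟩
        cb n + L * (8 * (C * cb n)) ≡⟨ solveℕ 3 (λ x L c → x ⟨+⟩ L ⟨*⟩ (⟨con⟩ 8 ⟨*⟩ (c ⟨*⟩ x)) ⟨=⟩ (⟨con⟩ 1 ⟨+⟩ L ⟨*⟩ (⟨con⟩ 8 ⟨*⟩ c)) ⟨*⟩ x) refl (cb n) L C ⟩
        (1 + L * (8 * C)) * cb n ≤⟨ *-mono-≤ 1+8LC≤Λ (≤-reflexive (x³≡ n)) ⟩
        Λ * n ^ 3 ∎

      -- a = kb with a and b in Γ forces k into Γ, and then every b in Γ occurs.
      f-at-zero : ∀ k → f k 0# ≡ n * G k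
      f-at-zero k = trans (f-def k 0#) (trans (∑-cong (λ b → G-guard b (λ g → trans (cong G (trans (+-identityˡ _) (*-comm k b))) (G-invariant b k g)))) (∑-G* (G k)))

      cb-at-zero : ∀ k → cb (f k 0#) ≡ cb n * G k
      cb-at-zero k = trans (cong cb (f-at-zero k)) (go (zero-or-one k))
        where
        go : G k ≡ 0 ⊎ G k ≡ 1 → cb (n * G k) ≡ cb n * G k
        go (inj₁ e) rewrite e = trans (cong (λ x → x * x * x) (ℕₚ.*-zeroʳ n)) (sym (ℕₚ.*-zeroʳ (cb n)))
        go (inj₂ e) rewrite e = trans (cong (λ x → x * x * x) (ℕₚ.*-identityʳ n)) (sym (ℕₚ.*-identityʳ (cb n)))

      nz*≤ : ∀ k x → nz k * x ≤ x
      nz*≤ k x = ≤-trans (ℕₚ.*-monoˡ-≤ x (⟦⟧≤1 (¬? (k Fin.≟ 0#)))) (≤-reflexive (ℕₚ.*-identityˡ x))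

    ΣT ΣE² : ℕ
    ΣT = ∑ (λ k → nz k * T k)
    ΣE² = ∑ (λ k → nz k * E k ^ 2)

    private
      -- The terms c = 0 are nonzero only for the n dilates in Γ and add up to at most n⁴, while p ≤
      -- n². Each dyadic level is covered by `pairs-all`.
      ΣT-bound : p * ΣT ≤ Λ * n ^ 6
      ΣT-bound = begin
        p * ΣT ≤⟨ ℕₚ.*-monoʳ-≤ p (∑-mono (λ k → ≤-trans (ℕₚ.*-monoʳ-≤ (nz k) (T-levels k)) (≤-reflexive (ℕₚ.*-distribˡ-+ (nz k) _ _)))) ⟩
        p * ∑ (λ k → nz k * cb (f k 0#) + nz k * levels k) ≡⟨ cong (p *_) (∑-+ _ _) ⟩
        p * (∑ (λ k → nz k * cb (f k 0#)) + ∑ (λ k → nz k * levels k)) ≤⟨ ℕₚ.*-monoʳ-≤ p (ℕₚ.+-monoˡ-≤ _ zero-part) ⟩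
        p * (cb n * n + ∑ (λ k → nz k * levels k)) ≡⟨ ℕₚ.*-distribˡ-+ p (cb n * n) _ ⟩
        p * (cb n * n) + p * ∑ (λ k → nz k * levels k) ≤⟨ +-mono-≤ (ℕₚ.*-monoˡ-≤ (cb n * n) p≤nn) level-part ⟩
        n * n * (cb n * n) + L * (8 * (C * cb (n * n))) ≡⟨ solveℕ 3 (λ n L c → n ⟨*⟩ n ⟨*⟩ (n ⟨*⟩ n ⟨*⟩ n ⟨*⟩ n) ⟨+⟩ L ⟨*⟩ (⟨con⟩ 8 ⟨*⟩ (c ⟨*⟩ (n ⟨*⟩ n ⟨*⟩ (n ⟨*⟩ n) ⟨*⟩ (n ⟨*⟩ n)))) ⟨=⟩ (⟨con⟩ 1 ⟨+⟩ L ⟨*⟩ (⟨con⟩ 8 ⟨*⟩ c)) ⟨*⟩ n ⟨^⟩ 6) refl n L C ⟩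
        (1 + L * (8 * C)) * n ^ 6 ≤⟨ ℕₚ.*-monoˡ-≤ (n ^ 6) 1+8LC≤Λ ⟩
        Λ * n ^ 6 ∎
        where
        levels : F → ℕ
        levels k = ∑ {L} (λ i → d k (toℕ i) * (8 * cb (2 ^ toℕ i)))
        zero-part : ∑ (λ k → nz k * cb (f k 0#)) ≤ cb n * n
        zero-part = ≤-trans (∑-mono (λ k → ≤-trans (nz*≤ k _) (≤-reflexive (cb-at-zero k)))) (≤-reflexive (∑-*ˡ (cb n) G))
        nz-d : ∀ i → ∑ (λ k → nz k * d k i) ≤ ∑ (λ k → ∑ (lev (2 ^ i) k))
        nz-d i = ∑-mono (λ k → ≤-trans (ℕₚ.*-monoʳ-≤ (nz k) (d≤rowlev k i)) (≤-reflexive (sym (∑-*ˡ (nz k) _))))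
        one-level : ∀ i → p * ∑ (λ k → nz k * (d k i * (8 * cb (2 ^ i)))) ≤ 8 * (C * cb (n * n))
        one-level i = begin
          p * ∑ (λ k → nz k * (d k i * (8 * cb (2 ^ i)))) ≡⟨ cong (p *_) (trans (∑-cong (λ k → sym (ℕₚ.*-assoc (nz k) (d k i) _))) (∑-*ʳ (8 * cb (2 ^ i)) _)) ⟩
          p * (∑ (λ k → nz k * d k i) * (8 * cb (2 ^ i))) ≤⟨ ℕₚ.*-monoʳ-≤ p (ℕₚ.*-monoˡ-≤ (8 * cb (2 ^ i)) (nz-d i)) ⟩
          p * (∑ (λ k → ∑ (lev (2 ^ i) k)) * (8 * cb (2 ^ i))) ≡⟨ solveℕ 3 (λ p a c → p ⟨*⟩ (a ⟨*⟩ (⟨con⟩ 8 ⟨*⟩ c)) ⟨=⟩ ⟨con⟩ 8 ⟨*⟩ (a ⟨*⟩ c ⟨*⟩ p)) refl p (∑ (λ k → ∑ (lev (2 ^ i) k))) (cb (2 ^ i)) ⟩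
          8 * (∑ (λ k → ∑ (lev (2 ^ i) k)) * cb (2 ^ i) * p) ≤⟨ ℕₚ.*-monoʳ-≤ 8 (pairs-all (2 ^ i)) ⟩
          8 * (C * cb (n * n)) ∎
        level-part : p * ∑ (λ k → nz k * levels k) ≤ L * (8 * (C * cb (n * n)))
        level-part = begin
          p * ∑ (λ k → nz k * levels k) ≡⟨ cong (p *_) (trans (∑-cong (λ k → sym (∑-*ˡ (nz k) _))) (∑-swap _)) ⟩
          p * ∑ {L} (λ i → ∑ (λ k → nz k * (d k (toℕ i) * (8 * cb (2 ^ toℕ i))))) ≡⟨ ∑-*ˡ p _ ⟨
          ∑ {L} (λ i → p * ∑ (λ k → nz k * (d k (toℕ i) * (8 * cb (2 ^ toℕ i))))) ≤⟨ ∑-mono (λ i → one-level (toℕ i)) ⟩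
          ∑ {L} (λ _ → 8 * (C * cb (n * n))) ≡⟨ ∑-const {L} _ ⟩
          L * (8 * (C * cb (n * n))) ∎

      ΣE²-bound : p * ΣE² ≤ Λ * n ^ 8
      ΣE²-bound = begin
        p * ΣE² ≤⟨ ℕₚ.*-monoʳ-≤ p (∑-mono (λ k → ℕₚ.*-monoʳ-≤ (nz k) (≤-trans (≤-reflexive (sym (x²≡ (E k)))) (E²≤ k)))) ⟩
        p * ∑ (λ k → nz k * (n * n * T k)) ≡⟨ cong (p *_) (trans (∑-cong (λ k → solveℕ 3 (λ a b c → a ⟨*⟩ (b ⟨*⟩ c) ⟨=⟩ b ⟨*⟩ (a ⟨*⟩ c)) refl (nz k) (n * n) (T k))) (∑-*ˡ (n * n) _)) ⟩
        p * (n * n * ΣT) ≡⟨ solveℕ 3 (λ p m t → p ⟨*⟩ (m ⟨*⟩ t) ⟨=⟩ m ⟨*⟩ (p ⟨*⟩ t)) refl p (n * n) ΣT ⟩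
        n * n * (p * ΣT) ≤⟨ ℕₚ.*-monoʳ-≤ (n * n) ΣT-bound ⟩
        n * n * (Λ * n ^ 6) ≡⟨ solveℕ 2 (λ n l → n ⟨*⟩ n ⟨*⟩ (l ⟨*⟩ n ⟨^⟩ 6) ⟨=⟩ l ⟨*⟩ n ⟨^⟩ 8) refl n Λ ⟩
        Λ * n ^ 8 ∎

      E₁²≤ : E 1# ^ 2 ≤ Λ * n ^ 5
      E₁²≤ = begin
        E 1# ^ 2 ≡⟨ x²≡ (E 1#) ⟨
        E 1# * E 1# ≤⟨ E²≤ 1# ⟩
        n * n * T 1# ≤⟨ ℕₚ.*-monoʳ-≤ (n * n) T₁≤ ⟩
        n * n * (Λ * n ^ 3) ≡⟨ solveℕ 2 (λ n l → n ⟨*⟩ n ⟨*⟩ (l ⟨*⟩ n ⟨^⟩ 3) ⟨=⟩ l ⟨*⟩ n ⟨^⟩ 5) refl n Λ ⟩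
        Λ * n ^ 5 ∎

      weaken : ∀ {x} k a y → k ≤ 16 → x ≤ k * (a * y) → a ≤ L → x ≤ Λ * y
      weaken {x} k a y k≤16 h a≤L = begin
        x ≤⟨ h ⟩
        k * (a * y) ≤⟨ *-mono-≤ k≤16 (ℕₚ.*-monoˡ-≤ y a≤L) ⟩
        16 * (L * y) ≡⟨ ℕₚ.*-assoc 16 L y ⟨
        16 * L * y ≤⟨ ℕₚ.*-monoˡ-≤ y 16L≤Λ ⟩
        Λ * y ∎

    module AtLevel (h : F) (h≢0 : h ≢ 0#) (i : ℕ) where
      open XLevels h h≢0 i
      open Triangles h h≢0 (D h i) (D-ind h i) using (X)

      τ = 2 ^ i

      triangles : (d h i * τ) ^ 4 * E 1# ^ 2 ≤ Λ ^ 2 * n ^ 9 * X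
      triangles = begin
        (d h i * τ) ^ 4 * E 1# ^ 2 ≤⟨ triangle-bound ⟩
        n ^ 6 * (2 * T 1#) * X ≤⟨ ℕₚ.*-monoˡ-≤ X (ℕₚ.*-monoʳ-≤ (n ^ 6) (*-mono-≤ (≤16⇒≤Λ (s≤s (s≤s z≤n))) T₁≤)) ⟩
        n ^ 6 * (Λ * (Λ * n ^ 3)) * X ≡⟨ cong (_* X) (solveℕ 2 (λ n l → n ⟨^⟩ 6 ⟨*⟩ (l ⟨*⟩ (l ⟨*⟩ n ⟨^⟩ 3)) ⟨=⟩ l ⟨^⟩ 2 ⟨*⟩ n ⟨^⟩ 9) refl n Λ) ⟩
        Λ ^ 2 * n ^ 9 * X ∎

      E≤level : E h ≤ 2 * (L * (d h i * (4 * sq τ))) → E h ≤ Λ * d h i * τ ^ 2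
      E≤level le = ≤-trans (weaken 8 L (d h i * τ ^ 2) (ℕₚ.m≤m+n 8 8) (≤-trans le (≤-reflexive (solveℕ 3 (λ L d t → ⟨con⟩ 2 ⟨*⟩ (L ⟨*⟩ (d ⟨*⟩ (⟨con⟩ 4 ⟨*⟩ (t ⟨*⟩ t)))) ⟨=⟩ ⟨con⟩ 8 ⟨*⟩ (L ⟨*⟩ (d ⟨*⟩ t ⟨^⟩ 2))) refl L (d h i) τ))) ≤-refl) (≤-reflexive (sym (ℕₚ.*-assoc Λ (d h i) (τ ^ 2))))

      X≤diagonal : X ≤ 2 * (d h i * (n * n)) → X ≤ Λ * d h i * n ^ 2
      X≤diagonal le = begin
        X ≤⟨ le ⟩
        2 * (d h i * (n * n)) ≤⟨ ℕₚ.*-monoˡ-≤ _ (≤16⇒≤Λ (s≤s (s≤s z≤n))) ⟩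
        Λ * (d h i * (n * n)) ≡⟨ trans (cong (λ x → Λ * (d h i * x)) (x²≡ n)) (sym (ℕₚ.*-assoc Λ (d h i) (n ^ 2))) ⟩
        Λ * d h i * n ^ 2 ∎

      τ≤n : 0 < d h i → τ ≤ n
      τ≤n 0<d = ℕₚ.*-cancelˡ-≤ (d h i) {{>-nonZero 0<d}} (begin
        d h i * τ ≤⟨ dτ≤ h i ⟩
        ∑ (λ c → D h i c * f h c) ≤⟨ ∑-mono (λ c → ℕₚ.*-monoʳ-≤ (D h i c) (f≤n h c)) ⟩
        ∑ (λ c → D h i c * n) ≡⟨ ∑-*ʳ n (D h i) ⟩
        d h i * n ∎)

      module AtX (j : ℕ) (X≤₀ : X ≤ 2 * (L * (4 * sq (2 ^ j) * Inc.B j))) where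
        t q B s M₁ Fc Z : ℕ
        t = 2 ^ j
        q = d 1# j
        B = Inc.B j
        s = 2 ^ proj₁ (B-levels j)
        M₁ = M j (proj₁ (B-levels j))
        Fc = |Fl| (proj₁ (B-levels j))
        Z = Inc.Z j

        X≤ : X ≤ Λ * t ^ 2 * B
        X≤ = ≤-trans (weaken 8 L (t ^ 2 * B) (ℕₚ.m≤m+n 8 8) (≤-trans X≤₀ (≤-reflexive (solveℕ 3 (λ L t b → ⟨con⟩ 2 ⟨*⟩ (L ⟨*⟩ (⟨con⟩ 4 ⟨*⟩ (t ⟨*⟩ t) ⟨*⟩ b)) ⟨=⟩ ⟨con⟩ 8 ⟨*⟩ (L ⟨*⟩ (t ⟨^⟩ 2 ⟨*⟩ b))) refl L t B))) ≤-refl) (≤-reflexive (sym (ℕₚ.*-assoc Λ (t ^ 2) B)))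

        B≤ : n ^ 2 * B ≤ Λ * s * M₁
        B≤ = ≤-trans (weaken 2 L (s * M₁) (ℕₚ.m≤m+n 2 14) (≤-trans (≤-reflexive (trans (cong (_* B) (sym (x²≡ n))) (ℕₚ.*-assoc n n B))) (≤-trans (proj₂ (B-levels j)) (≤-reflexive (solveℕ 3 (λ L s m → L ⟨*⟩ (⟨con⟩ 2 ⟨*⟩ s ⟨*⟩ m) ⟨=⟩ ⟨con⟩ 2 ⟨*⟩ (L ⟨*⟩ (s ⟨*⟩ m))) refl L s M₁)))) ≤-refl) (≤-reflexive (sym (ℕₚ.*-assoc Λ s M₁)))

        M₁≤ : M₁ ≤ d h i ^ 2 * q
        M₁≤ = ≤-trans (M≤ j (proj₁ (B-levels j))) (≤-reflexive (solveℕ 2 (λ d q → d ⟨*⟩ (d ⟨*⟩ q) ⟨=⟩ d ⟨^⟩ 2 ⟨*⟩ q) refl (d h i) q))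

        M₁³≤ : M₁ ^ 3 ≤ Fc * (d h i ^ 2 * q) * Z
        M₁³≤ = begin
          M₁ ^ 3 ≡⟨ x³≡ M₁ ⟨
          M₁ * M₁ * M₁ ≤⟨ *-mono-≤ (M²≤ j (proj₁ (B-levels j))) M₁≤ ⟩
          Fc * Z * (d h i ^ 2 * q) ≡⟨ solveℕ 3 (λ a b c → a ⟨*⟩ b ⟨*⟩ c ⟨=⟩ a ⟨*⟩ c ⟨*⟩ b) refl Fc Z (d h i ^ 2 * q) ⟩
          Fc * (d h i ^ 2 * q) * Z ∎

        q≤ : q * t ^ 3 ≤ Λ * n ^ 3
        q≤ = d-bound 1# j 1≢0

        Fc-all : Fc * s ^ 3 * p ≤ Λ * n ^ 6
        Fc-all = begin
          Fc * s ^ 3 * p ≡⟨ cong (λ x → Fc * x * p) (x³≡ s) ⟨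
          Fc * cb s * p ≤⟨ ℕₚ.*-monoˡ-≤ p (ℕₚ.*-monoˡ-≤ (cb s) (|Fl|≤lev (proj₁ (B-levels j)))) ⟩
          ∑ (λ l → ∑ (lev s l)) * cb s * p ≤⟨ pairs-all s ⟩
          C * cb (n * n) ≤⟨ *-mono-≤ C≤Λ (≤-reflexive (solveℕ 1 (λ n → n ⟨*⟩ n ⟨*⟩ (n ⟨*⟩ n) ⟨*⟩ (n ⟨*⟩ n) ⟨=⟩ n ⟨^⟩ 6) refl n)) ⟩
          Λ * n ^ 6 ∎

        Fc-high : (κ + κ) * (n * n) ≤ s * p → Fc * s ^ 3 ≤ Λ * n ^ 4
        Fc-high high = begin
          Fc * s ^ 3 ≡⟨ cong (Fc *_) (x³≡ s) ⟨
          Fc * cb s ≤⟨ ℕₚ.*-monoˡ-≤ (cb s) (|Fl|≤lev (proj₁ (B-levels j))) ⟩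
          ∑ (λ l → ∑ (lev s l)) * cb s ≤⟨ pairs-high s high ⟩
          C * (n * n * (n * n)) ≤⟨ *-mono-≤ C≤Λ (≤-reflexive (solveℕ 1 (λ n → n ⟨*⟩ n ⟨*⟩ (n ⟨*⟩ n) ⟨=⟩ n ⟨^⟩ 4) refl n)) ⟩
          Λ * n ^ 4 ∎

        W : ℕ
        W = ∑ (λ k → ρ (D h i) k ^ 2)

        Z≤qW : Z ≤ q * W
        Z≤qW = ≤-trans (∑-mono (λ k → ≤-trans (≤-reflexive (solveℕ 2 (λ a b → a ⟨*⟩ (a ⟨*⟩ b) ⟨=⟩ b ⟨*⟩ a ⟨^⟩ 2) refl (ρ (D h i) k) (ρ (D 1# j) k))) (ℕₚ.*-monoˡ-≤ (ρ (D h i) k ^ 2) (ρ≤d 1# j k)))) (≤-reflexive (∑-*ˡ q _))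

        ρ²-bound : ∀ k → τ ^ 4 * ρ (D h i) k ^ 2 ≤ 4 * E k ^ 2
        ρ²-bound k = begin
          τ ^ 4 * ρ (D h i) k ^ 2 ≡⟨ solveℕ 2 (λ t r → t ⟨^⟩ 4 ⟨*⟩ r ⟨^⟩ 2 ⟨=⟩ (r ⟨*⟩ (t ⟨*⟩ t)) ⟨*⟩ (r ⟨*⟩ (t ⟨*⟩ t))) refl τ (ρ (D h i) k) ⟩
          ρ (D h i) k * (τ * τ) * (ρ (D h i) k * (τ * τ)) ≤⟨ *-mono-≤ (ρ-bound i k h≢0) (ρ-bound i k h≢0) ⟩
          (E k + E k) * (E k + E k) ≡⟨ solveℕ 1 (λ e → (e ⟨+⟩ e) ⟨*⟩ (e ⟨+⟩ e) ⟨=⟩ ⟨con⟩ 4 ⟨*⟩ e ⟨^⟩ 2) refl (E k) ⟩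
          4 * E k ^ 2 ∎

        W-bound : τ ^ 4 * W ≤ Λ * ΣE²
        W-bound = begin
          τ ^ 4 * W ≡⟨ cong (τ ^ 4 *_) (nonzero-only (λ k → ρ (D h i) k ^ 2) (cong (_^ 2) (ρ-zero h i))) ⟩
          τ ^ 4 * ∑ (λ k → nz k * ρ (D h i) k ^ 2) ≡⟨ ∑-*ˡ (τ ^ 4) _ ⟨
          ∑ (λ k → τ ^ 4 * (nz k * ρ (D h i) k ^ 2)) ≤⟨ ∑-mono (λ k → ≤-trans (≤-reflexive (solveℕ 3 (λ a b c → a ⟨*⟩ (b ⟨*⟩ c) ⟨=⟩ b ⟨*⟩ (a ⟨*⟩ c)) refl (τ ^ 4) (nz k) (ρ (D h i) k ^ 2))) (≤-trans (ℕₚ.*-monoʳ-≤ (nz k) (ρ²-bound k)) (≤-reflexive (solveℕ 3 (λ a b c → a ⟨*⟩ (b ⟨*⟩ c) ⟨=⟩ b ⟨*⟩ (a ⟨*⟩ c)) refl (nz k) 4 (E k ^ 2))))) ⟩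
          ∑ (λ k → 4 * (nz k * E k ^ 2)) ≡⟨ ∑-*ˡ 4 _ ⟩
          4 * ΣE² ≤⟨ ℕₚ.*-monoˡ-≤ ΣE² (≤16⇒≤Λ (ℕₚ.m≤m+n 4 12)) ⟩
          Λ * ΣE² ∎

      open General Λ n p (d h i) τ (E 1#) X 0<n 1≤Λ triangles

      bound : Bound
      bound = go (d h i) refl X-levels
        where
        go : ∀ δ → d h i ≡ δ → X ≤ 2 * (d h i * (n * n)) ⊎ (∃ λ j → X ≤ 2 * (L * (4 * sq (2 ^ j) * Inc.B j))) → Bound
        -- An empty level is settled apart, since the proof of `τ≤n` divides by the size of the
        -- level.
        go zero e _ = ≤-trans (≤-reflexive (cong (λ x → x ^ 10 * τ ^ 16 * E 1# ^ 6 * p ^ 2) e)) z≤n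
        go (suc δ) e (inj₁ le) = diagonal (X≤diagonal le) (d-bound h i h≢0) (τ≤n (≤-trans (s≤s z≤n) (≤-reflexive (sym e)))) p≤n²
        go (suc δ) e (inj₂ (j , le)) = off-diagonal t q B s M₁ Fc Z W ΣE² X≤ B≤ M₁³≤ Fc-all Z≤qW W-bound ΣE²-bound q≤
          where open AtX j le

      level-moment : E h ≤ 2 * (L * (d h i * (4 * sq τ))) → E h ^ 14 * E 1# ^ 6 * p ^ 2 ≤ Λ ^ 31 * n ^ 41 * T h ^ 4
      level-moment le = moment (E h) (T h) bound (E≤level le) (≤-trans (≤-reflexive (cong (d h i *_) (sym (x³≡ τ)))) (dτ³≤T h i))

    -- The dominating dyadic level of f_h serves as the set D in the triangle argument; if instead c
    -- = 0 dominates, `moment-zero` applies.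
    energy-moment : ∀ h → h ≢ 0# → E h ^ 14 * E 1# ^ 6 * p ^ 2 ≤ Λ ^ 31 * n ^ 41 * T h ^ 4
    energy-moment h h≢0 = go (E-levels h)
      where
      go : E h ≤ 2 * sq (f h 0#) ⊎ (∃ λ i → E h ≤ 2 * (L * (d h i * (4 * sq (2 ^ i))))) → E h ^ 14 * E 1# ^ 6 * p ^ 2 ≤ Λ ^ 31 * n ^ 41 * T h ^ 4
      go (inj₁ le) = moment-zero Λ n p (E 1#) (E h) (T h) (f h 0#) 1≤Λ 0<n
        (≤-trans le (*-mono-≤ (≤16⇒≤Λ (s≤s (s≤s z≤n))) (≤-reflexive (x²≡ (f h 0#))))) (f≤n h 0#)
        (≤-trans (≤-reflexive (sym (x³≡ (f h 0#)))) (∑-term (λ c → f h c * f h c * f h c) 0#)) E₁²≤ p≤n²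
      go (inj₂ (i , le)) = AtLevel.level-moment h h≢0 i le

    private
      0<E₁ : 0 < E 1#
      0<E₁ = ≤-trans (*-mono-≤ 0<f 0<f) (∑-term (λ c → f 1# c * f 1# c) 0#)
        where
        0<f : 0 < f 1# 0#
        0<f = ≤-trans 0<n (≤-reflexive (sym (trans (f-at-zero 1#) (trans (cong (n *_) G-one) (ℕₚ.*-identityʳ n)))))

      move : ∀ a b c → a * (b * c) ≡ b * (a * c)
      move = solveℕ 3 (λ a b c → a ⟨*⟩ (b ⟨*⟩ c) ⟨=⟩ b ⟨*⟩ (a ⟨*⟩ c)) refl

    -- If the dilates k with E k below the threshold dominated Z, small-energies would contradict the threshold; above it, energy-moment applies.
    module Threshold (i : ℕ) (E≤₀ : E 1# ≤ 2 * (L * (d 1# i * (4 * sq (2 ^ i))))) where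
      open AtLevel 1# 1≢0 i
      open XLevels 1# 1≢0 i using (X-levels; module Inc)
      open Triangles 1# 1≢0 (D 1# i) (D-ind 1# i) using (X)

      -- The threshold is the exact negation of the conclusion of `small-energies` for e = E_k,
      -- which is what `low-impossible` exploits.
      low? : ∀ k → Dec (Λ ^ 137 * n ^ 190 * E k ^ 5 < E 1# ^ 80 * p ^ 3)
      low? k = Λ ^ 137 * n ^ 190 * E k ^ 5 <? E 1# ^ 80 * p ^ 3

      lo hi : F → ℕ
      lo k = nz k * ⟦ low? k ⟧
      hi k = nz k * ⟦ ¬? (low? k) ⟧

      lo+hi : ∀ k → nz k ≡ lo k + hi k
      lo+hi k = trans (sym (ℕₚ.*-identityʳ (nz k))) (trans (cong (nz k *_) (complementary (low? k))) (ℕₚ.*-distribˡ-+ (nz k) _ _))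
        where
        complementary : ∀ {A : Set} (a : Dec A) → 1 ≡ ⟦ a ⟧ + ⟦ ¬? a ⟧
        complementary (yes _) = refl
        complementary (no _) = refl

      ΣE²-high : ℕ
      ΣE²-high = ∑ (λ k → hi k * E k ^ 2)

      0<E^80p^3 : 0 < E 1# ^ 80 * p ^ 3
      0<E^80p^3 = *-mono-≤ (^-pos {E 1#} 80 0<E₁) (^-pos {p} 3 0<p)

      -- The dilates below the threshold contribute 0 on the left. For the others
      -- `large-energy-ratio` bounds E_k² by a multiple of T_k that is the same for all k.
      ratio-high : ΣE²-high ^ 20 * (E 1# ^ 510 * p ^ 28) ≤ Λ ^ 977 * n ^ 1345 * ΣT ^ 20
      ratio-high = ratio-sum 19 (E 1# ^ 510 * p ^ 28) (Λ ^ 977 * n ^ 1345) (λ k → hi k * E k ^ 2) (λ k → nz k * T k)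
        (*-mono-≤ (^-pos {E 1#} 510 0<E₁) (^-pos {p} 28 0<p)) (λ k → pointwise k (k Fin.≟ 0#) (low? k))
        where
        Ratio : F → ℕ → ℕ → Set
        Ratio k x y = x ^ 20 * (E 1# ^ 510 * p ^ 28) ≤ Λ ^ 977 * n ^ 1345 * y ^ 20
        trivially : ∀ k {x y} → x ≡ 0 → Ratio k x y
        trivially k {x} {y} e = subst (λ x → Ratio k x y) (sym e) z≤n
        -- Allows e^30 to be cancelled in `large-energy-ratio`: a dilate with E_k = 0 would be below
        -- the threshold.
        positive : ∀ k → ¬ (Λ ^ 137 * n ^ 190 * E k ^ 5 < E 1# ^ 80 * p ^ 3) → 0 < E k
        positive k ¬low = ℕₚ.n≢0⇒n>0 λ e → ¬low (ℕₚ.≤-<-trans (≤-reflexive (trans (cong (λ x → Λ ^ 137 * n ^ 190 * x ^ 5) e) (ℕₚ.*-zeroʳ (Λ ^ 137 * n ^ 190)))) 0<E^80p^3)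
        pointwise : ∀ k → Dec (k ≡ 0#) → Dec (Λ ^ 137 * n ^ 190 * E k ^ 5 < E 1# ^ 80 * p ^ 3) → Ratio k (hi k * E k ^ 2) (nz k * T k)
        pointwise k (yes k≡0) _ = trivially k {hi k * E k ^ 2} {nz k * T k} (cong (λ x → x * ⟦ ¬? (low? k) ⟧ * E k ^ 2) (trans (cong nz k≡0) nz-zero))
        pointwise k (no _) (yes low) = trivially k {hi k * E k ^ 2} {nz k * T k} (cong (_* E k ^ 2) (trans (cong (nz k *_) (⟦⟧-no (¬? (low? k)) (λ ¬low → ¬low low))) (ℕₚ.*-zeroʳ (nz k))))
        pointwise k (no k≢0) (no ¬low) = subst₂ (Ratio k) (sym x≡) (sym y≡)
          (large-energy-ratio Λ n p (E 1#) (E k) (T k) (positive k ¬low) (ℕₚ.≮⇒≥ ¬low) (energy-moment k k≢0))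
          where
          x≡ : hi k * E k ^ 2 ≡ E k ^ 2
          x≡ = trans (cong (_* E k ^ 2) (cong₂ _*_ (nz-yes k≢0) (⟦⟧-yes (¬? (low? k)) ¬low))) (ℕₚ.*-identityˡ (E k ^ 2))
          y≡ : nz k * T k ≡ T k
          y≡ = trans (cong (_* T k) (nz-yes k≢0)) (ℕₚ.*-identityˡ (T k))

      0<d : 0 < d 1# i
      0<d = ℕₚ.n≢0⇒n>0 λ e → ℕₚ.<⇒≱ 0<E₁ (≤-trans (E≤level E≤₀) (≤-reflexive (cong (_* τ ^ 2) (trans (cong (Λ *_) e) (ℕₚ.*-zeroʳ Λ)))))

      open Extremal Λ n p (d 1# i) τ (E 1#) X 0<n 0<d 0<E₁ triangles (E≤level E≤₀) (d-bound 1# i 1≢0)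

      module AtHigh (j : ℕ) (X≤₀ : X ≤ 2 * (L * (4 * sq (2 ^ j) * Inc.B j))) where
        open AtX j X≤₀
        open OffDiagonal t q B s M₁ X≤ B≤

        g : F → ℕ
        g k = ρ (D 1# i) k * (ρ (D 1# i) k * ρ (D 1# j) k)

        Zpart : (F → ℕ) → ℕ
        Zpart v = ∑ (λ k → v k * g k)

        Z-split : Z ≡ Zpart lo + Zpart hi
        Z-split = begin-equality
          Z ≡⟨ nonzero-only g (cong (λ x → x * (x * ρ (D 1# j) 0#)) (ρ-zero 1# i)) ⟩
          ∑ (λ k → nz k * g k) ≡⟨ ∑-cong (λ k → trans (cong (_* g k) (lo+hi k)) (ℕₚ.*-distribʳ-+ (g k) (lo k) (hi k))) ⟩
          ∑ (λ k → lo k * g k + hi k * g k) ≡⟨ ∑-+ _ _ ⟩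
          Zpart lo + Zpart hi ∎

        τ⁴g : ∀ k → τ ^ 4 * g k ≤ 4 * (E k ^ 2 * ρ (D 1# j) k)
        τ⁴g k = begin
          τ ^ 4 * g k ≡⟨ solveℕ 3 (λ t a b → t ⟨*⟩ (a ⟨*⟩ (a ⟨*⟩ b)) ⟨=⟩ t ⟨*⟩ a ⟨^⟩ 2 ⟨*⟩ b) refl (τ ^ 4) (ρ (D 1# i) k) (ρ (D 1# j) k) ⟩
          τ ^ 4 * ρ (D 1# i) k ^ 2 * ρ (D 1# j) k ≤⟨ ℕₚ.*-monoˡ-≤ (ρ (D 1# j) k) (ρ²-bound k) ⟩
          4 * E k ^ 2 * ρ (D 1# j) k ≡⟨ ℕₚ.*-assoc 4 (E k ^ 2) (ρ (D 1# j) k) ⟩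
          4 * (E k ^ 2 * ρ (D 1# j) k) ∎

        τ⁴Zpart : ∀ v → τ ^ 4 * Zpart v ≤ 4 * ∑ (λ k → v k * (E k ^ 2 * ρ (D 1# j) k))
        τ⁴Zpart v = begin
          τ ^ 4 * Zpart v ≡⟨ ∑-*ˡ (τ ^ 4) _ ⟨
          ∑ (λ k → τ ^ 4 * (v k * g k)) ≤⟨ ∑-mono (λ k → ≤-trans (≤-reflexive (move (τ ^ 4) (v k) (g k))) (≤-trans (ℕₚ.*-monoʳ-≤ (v k) (τ⁴g k)) (≤-reflexive (move (v k) 4 (E k ^ 2 * ρ (D 1# j) k))))) ⟩
          ∑ (λ k → 4 * (v k * (E k ^ 2 * ρ (D 1# j) k))) ≡⟨ ∑-*ˡ 4 _ ⟩
          4 * ∑ (λ k → v k * (E k ^ 2 * ρ (D 1# j) k)) ∎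

        high-part : Z ≤ 2 * Zpart hi → τ ^ 4 * Z ≤ Λ * q * ΣE²-high
        high-part le = begin
          τ ^ 4 * Z ≤⟨ ℕₚ.*-monoʳ-≤ (τ ^ 4) le ⟩
          τ ^ 4 * (2 * Zpart hi) ≡⟨ move (τ ^ 4) 2 (Zpart hi) ⟩
          2 * (τ ^ 4 * Zpart hi) ≤⟨ ℕₚ.*-monoʳ-≤ 2 (τ⁴Zpart hi) ⟩
          2 * (4 * ∑ (λ k → hi k * (E k ^ 2 * ρ (D 1# j) k))) ≤⟨ ℕₚ.*-monoʳ-≤ 2 (ℕₚ.*-monoʳ-≤ 4 (∑-mono (λ k → ≤-trans (ℕₚ.*-monoʳ-≤ (hi k) (ℕₚ.*-monoʳ-≤ (E k ^ 2) (ρ≤d 1# j k))) (≤-reflexive (sym (ℕₚ.*-assoc (hi k) (E k ^ 2) q)))))) ⟩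
          2 * (4 * ∑ (λ k → hi k * E k ^ 2 * q)) ≡⟨ cong (λ x → 2 * (4 * x)) (∑-*ʳ q _) ⟩
          2 * (4 * (ΣE²-high * q)) ≡⟨ solveℕ 2 (λ u q → ⟨con⟩ 2 ⟨*⟩ (⟨con⟩ 4 ⟨*⟩ (u ⟨*⟩ q)) ⟨=⟩ ⟨con⟩ 8 ⟨*⟩ (q ⟨*⟩ u)) refl ΣE²-high q ⟩
          8 * (q * ΣE²-high) ≤⟨ ℕₚ.*-monoˡ-≤ (q * ΣE²-high) (≤16⇒≤Λ (ℕₚ.m≤m+n 8 8)) ⟩
          Λ * (q * ΣE²-high) ≡⟨ ℕₚ.*-assoc Λ q ΣE²-high ⟨
          Λ * q * ΣE²-high ∎

        -- A dilate of largest energy below the threshold; `0#` only witnesses that the range is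
        -- nonempty. If no dilate is below the threshold, e becomes 0, and `low-impossible` covers
        -- this case as well.
        k₀ : F
        k₀ = proj₁ (argmax (λ k → lo k * E k) 0#)

        e : ℕ
        e = lo k₀ * E k₀

        lo-01 : ∀ k → lo k ≡ 0 ⊎ lo k ≡ 1
        lo-01 k = 01-* (⟦⟧-01 (¬? (k Fin.≟ 0#))) (⟦⟧-01 (low? k))

        lo-E : ∀ k {x y} → (E k ≤ e → x ≤ y) → lo k * x ≤ lo k * y
        lo-E k {x} {y} le = go (lo-01 k)
          where
          go : lo k ≡ 0 ⊎ lo k ≡ 1 → lo k * x ≤ lo k * y
          go (inj₁ z) = ≤-trans (≤-reflexive (cong (_* x) z)) z≤n
          go (inj₂ o) = ℕₚ.*-monoʳ-≤ (lo k) (le (≤-trans (≤-reflexive (sym (trans (cong (_* E k) o) (ℕₚ.*-identityˡ (E k))))) (proj₂ (argmax (λ k → lo k * E k) 0#) k)))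

        lo≤nz : ∀ k → lo k ≤ nz k
        lo≤nz k = ≤-trans (ℕₚ.m≤m+n (lo k) (hi k)) (≤-reflexive (sym (lo+hi k)))

        -- Both factors ρ_D are replaced by the maximal energy e, which leaves Σ_k ρ_Q(k) = q².
        low-second : Z ≤ 2 * Zpart lo → τ ^ 4 * Z ≤ Λ * e ^ 2 * q ^ 2
        low-second le = begin
          τ ^ 4 * Z ≤⟨ ℕₚ.*-monoʳ-≤ (τ ^ 4) le ⟩
          τ ^ 4 * (2 * Zpart lo) ≡⟨ move (τ ^ 4) 2 (Zpart lo) ⟩
          2 * (τ ^ 4 * Zpart lo) ≤⟨ ℕₚ.*-monoʳ-≤ 2 (τ⁴Zpart lo) ⟩
          2 * (4 * ∑ (λ k → lo k * (E k ^ 2 * ρ (D 1# j) k))) ≤⟨ ℕₚ.*-monoʳ-≤ 2 (ℕₚ.*-monoʳ-≤ 4 (∑-mono (λ k → ≤-trans (lo-E k (λ le → ℕₚ.*-monoˡ-≤ (ρ (D 1# j) k) (pw 2 le))) (≤-trans (ℕₚ.*-monoˡ-≤ (e ^ 2 * ρ (D 1# j) k) (≤-trans (lo≤nz k) (⟦⟧≤1 (¬? (k Fin.≟ 0#))))) (≤-reflexive (ℕₚ.*-identityˡ (e ^ 2 * ρ (D 1# j) k))))))) ⟩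
          2 * (4 * ∑ (λ k → e ^ 2 * ρ (D 1# j) k)) ≡⟨ cong (λ x → 2 * (4 * x)) (trans (∑-*ˡ (e ^ 2) _) (cong (e ^ 2 *_) (trans (∑ρ (D-ind 1# j)) (x²≡ q)))) ⟩
          2 * (4 * (e ^ 2 * q ^ 2)) ≡⟨ ℕₚ.*-assoc 2 4 (e ^ 2 * q ^ 2) ⟨
          8 * (e ^ 2 * q ^ 2) ≤⟨ ℕₚ.*-monoˡ-≤ (e ^ 2 * q ^ 2) (≤16⇒≤Λ (ℕₚ.m≤m+n 8 8)) ⟩
          Λ * (e ^ 2 * q ^ 2) ≡⟨ ℕₚ.*-assoc Λ (e ^ 2) (q ^ 2) ⟨
          Λ * e ^ 2 * q ^ 2 ∎

        -- Here ρ_Q is replaced by e at the cost of t², and the two factors ρ_D leave Σ_k E_k²,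
        -- which is at most about n⁸/p.
        low-first : Z ≤ 2 * Zpart lo → p * (t ^ 2 * (τ ^ 4 * Z)) ≤ Λ ^ 2 * e * n ^ 8
        low-first le = begin
          p * (t ^ 2 * (τ ^ 4 * Z)) ≤⟨ ℕₚ.*-monoʳ-≤ p (ℕₚ.*-monoʳ-≤ (t ^ 2) (≤-trans (ℕₚ.*-monoʳ-≤ (τ ^ 4) le) (≤-trans (≤-reflexive (move (τ ^ 4) 2 (Zpart lo))) (ℕₚ.*-monoʳ-≤ 2 (τ⁴Zpart lo))))) ⟩
          p * (t ^ 2 * (2 * (4 * ∑ (λ k → lo k * (E k ^ 2 * ρ (D 1# j) k))))) ≡⟨ solveℕ 3 (λ p t u → p ⟨*⟩ (t ⟨*⟩ (⟨con⟩ 2 ⟨*⟩ (⟨con⟩ 4 ⟨*⟩ u))) ⟨=⟩ p ⟨*⟩ (⟨con⟩ 8 ⟨*⟩ (t ⟨*⟩ u))) refl p (t ^ 2) (∑ (λ k → lo k * (E k ^ 2 * ρ (D 1# j) k))) ⟩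
          p * (8 * (t ^ 2 * ∑ (λ k → lo k * (E k ^ 2 * ρ (D 1# j) k)))) ≡⟨ cong (λ x → p * (8 * x)) (∑-*ˡ (t ^ 2) _) ⟨
          p * (8 * ∑ (λ k → t ^ 2 * (lo k * (E k ^ 2 * ρ (D 1# j) k)))) ≤⟨ ℕₚ.*-monoʳ-≤ p (ℕₚ.*-monoʳ-≤ 8 (∑-mono term)) ⟩
          p * (8 * ∑ (λ k → 2 * e * (nz k * E k ^ 2))) ≡⟨ cong (λ x → p * (8 * x)) (∑-*ˡ (2 * e) _) ⟩
          p * (8 * (2 * e * ΣE²)) ≡⟨ solveℕ 3 (λ p e u → p ⟨*⟩ (⟨con⟩ 8 ⟨*⟩ (⟨con⟩ 2 ⟨*⟩ e ⟨*⟩ u)) ⟨=⟩ ⟨con⟩ 16 ⟨*⟩ e ⟨*⟩ (p ⟨*⟩ u)) refl p e ΣE² ⟩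
          16 * e * (p * ΣE²) ≤⟨ *-mono-≤ (ℕₚ.*-monoˡ-≤ e 16≤Λ) ΣE²-bound ⟩
          Λ * e * (Λ * n ^ 8) ≡⟨ solveℕ 3 (λ l e m → l ⟨*⟩ e ⟨*⟩ (l ⟨*⟩ m) ⟨=⟩ l ⟨^⟩ 2 ⟨*⟩ e ⟨*⟩ m) refl Λ e (n ^ 8) ⟩
          Λ ^ 2 * e * n ^ 8 ∎
          where
          ρQ : ∀ k → t ^ 2 * ρ (D 1# j) k ≤ 2 * E k
          ρQ k = begin
            t ^ 2 * ρ (D 1# j) k ≡⟨ trans (cong (_* ρ (D 1# j) k) (sym (x²≡ t))) (ℕₚ.*-comm (t * t) _) ⟩
            ρ (D 1# j) k * (t * t) ≤⟨ ρ-bound j k 1≢0 ⟩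
            E k + E k ≡⟨ cong (E k +_) (ℕₚ.+-identityʳ (E k)) ⟨
            2 * E k ∎
          term : ∀ k → t ^ 2 * (lo k * (E k ^ 2 * ρ (D 1# j) k)) ≤ 2 * e * (nz k * E k ^ 2)
          term k = begin
            t ^ 2 * (lo k * (E k ^ 2 * ρ (D 1# j) k)) ≡⟨ solveℕ 4 (λ t l e r → t ⟨*⟩ (l ⟨*⟩ (e ⟨*⟩ r)) ⟨=⟩ l ⟨*⟩ (t ⟨*⟩ r ⟨*⟩ e)) refl (t ^ 2) (lo k) (E k ^ 2) (ρ (D 1# j) k) ⟩
            lo k * (t ^ 2 * ρ (D 1# j) k * E k ^ 2) ≤⟨ lo-E k (λ le → ℕₚ.*-monoˡ-≤ (E k ^ 2) (≤-trans (ρQ k) (ℕₚ.*-monoʳ-≤ 2 le))) ⟩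
            lo k * (2 * e * E k ^ 2) ≤⟨ ℕₚ.*-monoˡ-≤ (2 * e * E k ^ 2) (lo≤nz k) ⟩
            nz k * (2 * e * E k ^ 2) ≡⟨ move (nz k) (2 * e) (E k ^ 2) ⟩
            2 * e * (nz k * E k ^ 2) ∎

        low-impossible : ¬ (E 1# ^ 80 * p ^ 3 ≤ Λ ^ 137 * n ^ 190 * e ^ 5)
        low-impossible le = go (k₀ Fin.≟ 0#) (low? k₀)
          where
          vanishing : e ≡ 0 → ⊥
          vanishing z = ℕₚ.<⇒≱ 0<E^80p^3 (≤-trans le (≤-reflexive (trans (cong (λ x → Λ ^ 137 * n ^ 190 * x ^ 5) z) (ℕₚ.*-zeroʳ (Λ ^ 137 * n ^ 190)))))
          go : Dec (k₀ ≡ 0#) → Dec (Λ ^ 137 * n ^ 190 * E k₀ ^ 5 < E 1# ^ 80 * p ^ 3) → ⊥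
          go (yes z) _ = vanishing (cong (λ x → x * ⟦ low? k₀ ⟧ * E k₀) (trans (cong nz z) nz-zero))
          go (no _) (no ¬low) = vanishing (cong (_* E k₀) (trans (cong (nz k₀ *_) (⟦⟧-no (low? k₀) ¬low)) (ℕₚ.*-zeroʳ (nz k₀))))
          go (no k≢0) (yes low) = ℕₚ.<⇒≱ low (≤-trans le (≤-reflexive (cong (λ x → Λ ^ 137 * n ^ 190 * x ^ 5) (trans (cong (_* E k₀) (cong₂ _*_ (nz-yes k≢0) (⟦⟧-yes (low? k₀) low))) (ℕₚ.*-identityˡ (E k₀))))))

        high-bound : (κ + κ) * (n * n) ≤ s * p → E 1# ^ 910 * p ^ 48 ≤ Λ ^ 1677 * n ^ 2325
        high-bound high = go (a+b≤2max (Zpart lo) (Zpart hi) (≤-reflexive Z-split))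
          where
          open HighLevel Fc Z M₁³≤ (Fc-high high) q≤
          go : Z ≤ 2 * Zpart lo ⊎ Z ≤ 2 * Zpart hi → E 1# ^ 910 * p ^ 48 ≤ Λ ^ 1677 * n ^ 2325
          go (inj₁ le) = ⊥-elim (low-impossible (small-energies e (low-first le) (low-second le)))
          go (inj₂ le) = combine-large Λ n p (E 1#) ΣE²-high ΣT (large-energies ΣE²-high (high-part le)) ratio-high ΣT-bound

        low-bound : ¬ ((κ + κ) * (n * n) ≤ s * p) → E 1# ^ 3 * p ≤ Λ ^ 7 * n ^ 9
        low-bound ¬high = low-level (≤-trans (<⇒≤ (ℕₚ.≰⇒> ¬high)) (*-mono-≤ (≤-trans 2κ≤C₀ (≤-trans C₀≤C C≤Λ)) (≤-reflexive (x²≡ n)))) M₁≤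
          (≤-trans (≤-reflexive (cong (q *_) (sym (x²≡ t)))) (dτ²≤E 1# j))

      module _ (K : ℕ) (1≤K : 1 ≤ K) (absorb : Λ ^ 20124 ≤ K * n) where
        open Final K Λ n p (E 1#) 1≤K 1≤Λ 0<n p≤n² n³≤p² absorb

        level-target : Target
        level-target = go X-levels
          where
          at-high : ∀ j (X≤₀ : X ≤ 2 * (L * (4 * sq (2 ^ j) * Inc.B j))) → Dec ((κ + κ) * (n * n) ≤ AtX.s j X≤₀ * p) → Target
          at-high j X≤₀ (yes high) = main-case (AtHigh.high-bound j X≤₀ high)
          at-high j X≤₀ (no ¬high) = low-case (AtHigh.low-bound j X≤₀ ¬high)
          go : X ≤ 2 * (d 1# i * (n * n)) ⊎ (∃ λ j → X ≤ 2 * (L * (4 * sq (2 ^ j) * Inc.B j))) → Target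
          go (inj₁ le) = diagonal-case (diagonal′ (X≤diagonal le))
          go (inj₂ (j , le)) = at-high j le ((κ + κ) * (n * n) ≤? AtX.s j le * p)

    energy-bound : ∀ K → 1 ≤ K → Λ ^ 20124 ≤ K * n → E 1# ^ 120 * p ^ 25 ≤ K * ((n ^ 312 * p ^ 16) ⊔ n ^ 340)
    energy-bound K 1≤K absorb = go (E-levels 1#)
      where
      go : E 1# ≤ 2 * sq (f 1# 0#) ⊎ (∃ λ i → E 1# ≤ 2 * (L * (d 1# i * (4 * sq (2 ^ i))))) → E 1# ^ 120 * p ^ 25 ≤ K * ((n ^ 312 * p ^ 16) ⊔ n ^ 340)
      go (inj₁ le) = Final.zero-case K Λ n p (E 1#) 1≤K 1≤Λ 0<n p≤n² n³≤p² absorb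
        (≤-trans le (*-mono-≤ (≤16⇒≤Λ (s≤s (s≤s z≤n))) (≤-trans (*-mono-≤ (f≤n 1# 0#) (f≤n 1# 0#)) (≤-reflexive (x²≡ n)))))
      go (inj₂ (i , le)) = Threshold.level-target i le K 1≤K absorb

-- Absorbing logarithms, and the passage to subsets of `Fin p`.

module PrimeFieldSubgroups where

  open import Data.Nat using (ℕ; zero; suc; _+_; _*_; _^_; _≤_; _<_; z≤n; s≤s; _≤?_; NonZero; >-nonZero⁻¹; _⊔_)
  open import Data.Nat.Properties as ℕₚ using (≤-refl; ≤-trans; ≤-reflexive; <⇒≤; *-mono-≤; +-mono-≤)
  open import Data.Nat.DivMod using (_/_; m/n*n≤m; m<n⇒m%n≡m)
  open import Data.Nat.Primality using (Prime)
  open import Data.Fin using (toℕ)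
  import Data.Fin.Properties as Finₚ
  open import Data.Fin.Subset using (Subset; _∈_)
  open import Data.Fin.Subset.Properties using (_∈?_)
  open import Data.List using (List; concatMap; map; allFin)
  open import Data.Product using (_×_; _,_; proj₁; proj₂)
  open import Relation.Nullary using (Dec; yes; no)
  open import Relation.Binary.PropositionalEquality
  open PrimeFields
  open FieldArithmetic
  open FiniteSums
  open SubgroupCounting
  open LevelSetArithmetic
  open LevelSets
  open EnergyInequalities
  open IncidenceSums
  open Monomials
  open EnergyBound

  suc-n≤2^n : ∀ n → suc n ≤ 2 ^ n
  suc-n≤2^n zero = ≤-refl
  suc-n≤2^n (suc n) = ≤-trans (+-mono-≤ (≤-trans (s≤s z≤n) (suc-n≤2^n n)) (suc-n≤2^n n)) (≤-reflexive (cong (2 ^ n +_) (sym (ℕₚ.+-identityʳ (2 ^ n)))))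

  -- With q = ⌊l/J⌋ one has l + 1 ≤ (q + 1)J ≤ 2^q J, and the J-th power of 2^q is at most 2^l.
  log-power : ∀ J .{{_ : NonZero J}} l → suc l ^ J ≤ J ^ J * 2 ^ l
  log-power J l = begin
    suc l ^ J ≤⟨ ℕₚ.^-monoˡ-≤ J (≤-trans (m<[1+m/n]*n l J) (ℕₚ.*-monoˡ-≤ J (suc-n≤2^n q))) ⟩
    (2 ^ q * J) ^ J ≡⟨ ^-distribʳ-* (2 ^ q) J J ⟩
    (2 ^ q) ^ J * J ^ J ≡⟨ trans (cong (_* J ^ J) (ℕₚ.^-*-assoc 2 q J)) (ℕₚ.*-comm (2 ^ (q * J)) (J ^ J)) ⟩
    J ^ J * 2 ^ (q * J) ≤⟨ ℕₚ.*-monoʳ-≤ (J ^ J) (ℕₚ.^-monoʳ-≤ 2 (m/n*n≤m l J)) ⟩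
    J ^ J * 2 ^ l ∎
    where
    open ℕₚ.≤-Reasoning
    q = l / J

  absorb-logs : ∀ J .{{_ : NonZero J}} c l {n} → 2 ^ l ≤ n → (c * suc l) ^ J ≤ c ^ J * J ^ J * n
  absorb-logs J c l {n} le = begin
    (c * suc l) ^ J ≡⟨ ^-distribʳ-* c (suc l) J ⟩
    c ^ J * suc l ^ J ≤⟨ ℕₚ.*-monoʳ-≤ (c ^ J) (≤-trans (log-power J l) (ℕₚ.*-monoʳ-≤ (J ^ J) le)) ⟩
    c ^ J * (J ^ J * n) ≡⟨ ℕₚ.*-assoc (c ^ J) (J ^ J) n ⟨
    c ^ J * J ^ J * n ∎
    where open ℕₚ.≤-Reasoning

  -- 20124 = 12 · 1677 is the power of Λ that arises in main-case.
  abstract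
    K : ℕ
    K = (16 * (4 * C₀)) ^ 20124 * 20124 ^ 20124 + N₀ ^ 410

    K-absorbs : ∀ l {n} → 2 ^ l ≤ n → (16 * (4 * C₀) * suc l) ^ 20124 ≤ K * n
    K-absorbs l {n} le = ≤-trans (absorb-logs 20124 (16 * (4 * C₀)) l le) (ℕₚ.*-monoˡ-≤ n (ℕₚ.m≤m+n ((16 * (4 * C₀)) ^ 20124 * 20124 ^ 20124) (N₀ ^ 410)))

    N₀^410≤K : N₀ ^ 410 ≤ K
    N₀^410≤K = ℕₚ.m≤n+m (N₀ ^ 410) _

  1≤K : 1 ≤ K
  1≤K = ≤-trans (^-pos 410 (≤-trans (s≤s z≤n) 4≤N₀)) N₀^410≤K

  module SubgroupOfZp (p : ℕ) .{{_ : NonZero p}} (prime-p : Prime p) (Γ : Subset p) (isΓ : IsMulSubgroup p Γ) where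
    open IntegersMod p prime-p using (field-mod-p; 1<p; toℕ-ι; ι-toℕ)
    open IsMulSubgroup isΓ
    open FieldLemmas field-mod-p

    G : F → ℕ
    G x = ⟦ x ∈? Γ ⟧

    private
      member : ∀ {x} → G x ≡ 1 → x ∈ Γ
      member {x} e with x ∈? Γ
      ... | yes x∈ = x∈
      ... | no _ with () ← e

      toℕ-0# : toℕ 0# ≡ 0
      toℕ-0# = trans (toℕ-ι 0) (m<n⇒m%n≡m (>-nonZero⁻¹ p))

      toℕ-1# : toℕ 1# ≡ 1
      toℕ-1# = trans (toℕ-ι 1) (m<n⇒m%n≡m 1<p)

      toℕ≡1⇒≡1# : ∀ {x} → toℕ x ≡ 1 → x ≡ 1#
      toℕ≡1⇒≡1# e = Finₚ.toℕ-injective (trans e (sym toℕ-1#))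

      divide : ∀ γ x → γ ∈ Γ → (γ ⊠ x) ∈ Γ → x ∈ Γ
      divide γ x γ∈ γx∈ with inv∈ γ γ∈
      ... | y , y∈ , e = subst (_∈ Γ) y⊠γx (mul∈ y (γ ⊠ x) y∈ γx∈)
        where
        y⊠γx : y ⊠ (γ ⊠ x) ≡ x
        y⊠γx = trans (sym (*-assoc y γ x)) (trans (cong (_⊠ x) (trans (*-comm y γ) (toℕ≡1⇒≡1# e))) (*-identityˡ x))

    isG : IsSubgroupIndicator field-mod-p G
    isG = record
      { zero-or-one = λ x → ⟦⟧-01 (x ∈? Γ)
      ; G-zero = ⟦⟧-no (0# ∈? Γ) (λ 0∈ → zero∉ 0# 0∈ toℕ-0#)
      ; G-one = ⟦⟧-yes (1# ∈? Γ) (subst (_∈ Γ) (toℕ≡1⇒≡1# (proj₂ (proj₂ one∈))) (proj₁ (proj₂ one∈)))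
      ; G-invariant = λ γ x g → ⟦⟧-iff (γ ⊠ x ∈? Γ) (x ∈? Γ) (divide γ x (member g)) (mul∈ γ x (member g)) }

    open Subgroup field-mod-p isG
    open Representations field-mod-p isG
    open Energies field-mod-p isG

    card≡n : card Γ ≡ n
    card≡n = trans (length-filter (_∈? Γ) (allFin p)) (∑ˡ-allFin p G)

    private
      ∑-elems : ∀ g → ∑ˡ (elems Γ) g ≡ ∑ (λ x → G x * g x)
      ∑-elems g = trans (∑ˡ-filter (_∈? Γ) (allFin p) g) (∑ˡ-allFin p _)

      pairs : List (F × F)
      pairs = concatMap (λ x → map (λ y → (x , y)) (elems Γ)) (elems Γ)

      ∑-pairs : ∀ g → ∑ˡ pairs g ≡ ∑ (λ x → G x * ∑ (λ y → G y * g (x , y)))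
      ∑-pairs g = trans (∑ˡ-pairs (elems Γ) (elems Γ) g) (trans (∑-elems _) (∑-cong (λ x → cong (G x *_) (∑-elems _))))

      same? : ∀ x y z w → Dec (x ⊞ y ≡ z ⊞ w)
      same? x y z w = x ⊞ y Finₚ.≟ z ⊞ w

      last-determined : ∀ x y z → ∑ (λ w → G w * ⟦ same? x y z w ⟧) ≡ G ((x ⊖ z) ⊞ y)
      last-determined x y z = trans (∑-single _ w₀ (λ w ne → trans (cong (G w *_) (⟦⟧-no (same? x y z w) (λ e → ne (unique w e)))) (ℕₚ.*-zeroʳ (G w))))
        (trans (cong (G w₀ *_) (⟦⟧-yes (same? x y z w₀) (sym solution))) (ℕₚ.*-identityʳ (G w₀)))
        where
        w₀ = (x ⊖ z) ⊞ y
        solution : z ⊞ w₀ ≡ x ⊞ y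
        solution = trans (solve 3 (λ z d y → z :+ (d :+ y) := (d :+ z) :+ y) refl z (x ⊖ z) y) (cong (_⊞ y) (⊖-⊞ x z))
        unique : ∀ w → x ⊞ y ≡ z ⊞ w → w ≡ w₀
        unique w e = trans (sym (cancelʳ z w)) (trans (cong (_⊖ z) (sym e)) (solve 4 (λ x y z m → (x :+ y) :+ m :* z := (x :+ m :* z) :+ y) refl x y z -1#))

    -- x + y = z + w is read as x - z = w - y: for given x and z, the pairs (y, w) with this
    -- difference are counted by r(x - z), and grouping by the difference gives Σ r².
    energy≡E : energy Γ ≡ E 1#
    energy≡E = begin
      energy Γ ≡⟨ length-filter (λ q → same? (proj₁ (proj₁ q)) (proj₂ (proj₁ q)) (proj₁ (proj₂ q)) (proj₂ (proj₂ q))) (concatMap (λ a → map (λ b → (a , b)) pairs) pairs) ⟩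
      ∑ˡ (concatMap (λ a → map (λ b → (a , b)) pairs) pairs) (λ q → ⟦ same? (proj₁ (proj₁ q)) (proj₂ (proj₁ q)) (proj₁ (proj₂ q)) (proj₂ (proj₂ q)) ⟧) ≡⟨ ∑ˡ-pairs pairs pairs _ ⟩
      ∑ˡ pairs (λ a → ∑ˡ pairs (λ b → ⟦ same? (proj₁ a) (proj₂ a) (proj₁ b) (proj₂ b) ⟧)) ≡⟨ trans (∑-pairs _) (∑-cong (λ x → cong (G x *_) (∑-cong (λ y → cong (G y *_) (∑-pairs _))))) ⟩
      ∑ (λ x → G x * ∑ (λ y → G y * ∑ (λ z → G z * ∑ (λ w → G w * ⟦ same? x y z w ⟧)))) ≡⟨ ∑-cong (λ x → cong (G x *_) (∑-cong (λ y → cong (G y *_) (∑-cong (λ z → cong (G z *_) (last-determined x y z)))))) ⟩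
      ∑ (λ x → G x * ∑ (λ y → G y * ∑ (λ z → G z * G ((x ⊖ z) ⊞ y)))) ≡⟨ ∑-cong (λ x → trans (cong (G x *_) (trans (∑-cong (λ y → sym (∑-*ˡ (G y) _))) (∑-swap _))) (trans (sym (∑-*ˡ (G x) _)) (∑-cong (λ z → trans (cong (G x *_) (trans (∑-cong (λ y → swap (G y) (G z) _)) (∑-*ˡ (G z) _))) (cong (λ s → G x * (G z * s)) (trans (∑-cong (λ y → cong (λ v → G y * G ((x ⊖ z) ⊞ v)) (sym (*-identityˡ y)))) (sym (f-def 1# (x ⊖ z))))))))) ⟩
      ∑ (λ x → ∑ (λ z → G x * (G z * r (x ⊖ z)))) ≡⟨ ∑-differences r ⟩
      E 1# ∎
      where
      open ≡-Reasoning
      swap : ∀ a b c → a * (b * c) ≡ b * (a * c)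
      swap a b c = trans (sym (ℕₚ.*-assoc a b c)) (trans (cong (_* c) (ℕₚ.*-comm a b)) (ℕₚ.*-assoc b a c))

    private
      E≤n³ : E 1# ≤ n * (n * n)
      E≤n³ = ≤-trans (∑-mono (λ c → ℕₚ.*-monoˡ-≤ (r c) (f≤n 1# c))) (≤-reflexive (trans (∑-*ˡ n r) (cong (n *_) (∑f 1#))))

      x²≡ : ∀ x → x ^ 2 ≡ x * x
      x²≡ x = cong (x *_) (ℕₚ.*-identityʳ x)

      x³≡ : ∀ x → x ^ 3 ≡ x * x * x
      x³≡ x = trans (cong (λ y → x * (x * y)) (ℕₚ.*-identityʳ x)) (sym (ℕₚ.*-assoc x x x))

      -- The trivial bounds E ≤ n³ and p ≤ n² give n^410 on the left, which is the origin of the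
      -- summand N₀^410 in `K`.
      small : n < N₀ → p ≤ n ^ 2 → E 1# ^ 120 * p ^ 25 ≤ K * ((n ^ 312 * p ^ 16) ⊔ n ^ 340)
      small n<N₀ p≤n² = begin
        E 1# ^ 120 * p ^ 25 ≤⟨ *-mono-≤ (pw 120 (≤-trans E≤n³ (≤-reflexive (sym (trans (x³≡ n) (ℕₚ.*-assoc n n n)))))) (pw 25 p≤n²) ⟩
        (n ^ 3) ^ 120 * (n ^ 2) ^ 25 ≡⟨ trans (cong₂ _*_ (ℕₚ.^-*-assoc n 3 120) (ℕₚ.^-*-assoc n 2 25)) (sym (ℕₚ.^-distribˡ-+-* n 360 50)) ⟩
        n ^ 410 ≤⟨ pw 410 (<⇒≤ n<N₀) ⟩
        N₀ ^ 410 ≤⟨ N₀^410≤K ⟩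
        K ≡⟨ ℕₚ.*-identityʳ K ⟨
        K * 1 ≤⟨ ℕₚ.*-monoʳ-≤ K (≤-trans (^-pos 340 0<n) (ℕₚ.m≤n⊔m (n ^ 312 * p ^ 16) (n ^ 340))) ⟩
        K * ((n ^ 312 * p ^ 16) ⊔ n ^ 340) ∎
        where open ℕₚ.≤-Reasoning

    energy-power-bound : p ≤ card Γ ^ 2 → card Γ ^ 3 ≤ p ^ 2 → energy Γ ^ 120 * p ^ 25 ≤ K * ((card Γ ^ 312 * p ^ 16) ⊔ card Γ ^ 340)
    energy-power-bound p≤ ≤p² = subst₂ (λ e m → e ^ 120 * p ^ 25 ≤ K * ((m ^ 312 * p ^ 16) ⊔ m ^ 340)) (sym energy≡E) (sym card≡n) (go (N₀ ≤? n))
      where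
      p≤n² : p ≤ n ^ 2
      p≤n² = subst (λ m → p ≤ m ^ 2) card≡n p≤
      n³≤p² : n ^ 3 ≤ p ^ 2
      n³≤p² = subst (λ m → m ^ 3 ≤ p ^ 2) card≡n ≤p²
      go : Dec (N₀ ≤ n) → E 1# ^ 120 * p ^ 25 ≤ K * ((n ^ 312 * p ^ 16) ⊔ n ^ 340)
      go (no N₀≰n) = small (ℕₚ.≰⇒> N₀≰n) p≤n²
      go (yes N₀≤n) with dyadic n n 0<n (suc-n≤2^n n)
      -- i = ⌊log₂ n⌋, so i + 1 dyadic levels cover all values up to n.
      ... | i , 2^i≤n , n<2^ = Assembly.energy-bound field-mod-p isG (toℕ i) n<2^ N₀≤n (subst (p ≤_) (x²≡ n) p≤n²) (subst₂ _≤_ (x³≡ n) (x²≡ p) n³≤p²) K 1≤K (K-absorbs (toℕ i) 2^i≤n)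

    2≤card : p ≤ card Γ ^ 2 → 2 ≤ card Γ
    2≤card p≤ = ℕₚ.≰⇒> λ c≤1 → ℕₚ.<⇒≱ 1<p (≤-trans p≤ (pw 2 c≤1))

open import Data.Product using (_,_)
open import Data.Nat.Properties as ℕₚ using (≤-trans; ≤-reflexive; <⇒≤; *-mono-≤)
open Monomials using (pw)
open PrimeFieldSubgroups

-- The inequality is raised to the 120th power and multiplied by p^25, which turns log^(1/4) into
-- log^30. The real number log₂|Γ| is described by rationals: any a/b for which (a/b)^30 in its
-- place leaves the right side too small satisfies a/b ≤ log₂|Γ|, that is, 2^a ≤ |Γ|^b.
theorem19 : ∃ λ (K : ℕ) →
    ∀ (p : ℕ) .{{_ : NonZero p}} → Prime p →
    ∀ (Γ : Subset p) → IsMulSubgroup p Γ →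
    p ≤ card Γ ^ 2 → card Γ ^ 3 ≤ p ^ 2 →
    ∀ (a b : ℕ) → 0 < b →
    a ^ 30 * (K * ((card Γ ^ 312 * p ^ 16) ⊔ card Γ ^ 340)) < energy Γ ^ 120 * p ^ 25 * b ^ 30 →
    2 ^ a ≤ card Γ ^ b
theorem19 = K , λ p prime-p Γ isΓ p≤ ≤p² a b 0<b hyp → conclude p prime-p Γ isΓ p≤ ≤p² a b hyp
  where
  conclude : ∀ (p : ℕ) .{{_ : NonZero p}} → Prime p → ∀ (Γ : Subset p) → IsMulSubgroup p Γ → p ≤ card Γ ^ 2 → card Γ ^ 3 ≤ p ^ 2 →
    ∀ a b → a ^ 30 * (K * ((card Γ ^ 312 * p ^ 16) ⊔ card Γ ^ 340)) < energy Γ ^ 120 * p ^ 25 * b ^ 30 → 2 ^ a ≤ card Γ ^ b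
  conclude p prime-p Γ isΓ p≤ ≤p² a b hyp = ≤-trans (ℕₚ.^-monoʳ-≤ 2 (<⇒≤ a<b)) (pw b (2≤card p≤))
    where
    open SubgroupOfZp p prime-p Γ isΓ
    M = K * ((card Γ ^ 312 * p ^ 16) ⊔ card Γ ^ 340)
    -- If b ≤ a, the bound `energy-power-bound`, from which the logarithm has disappeared,
    -- contradicts `hyp`. Hence a/b < 1 ≤ log₂|Γ|.
    a<b : a < b
    a<b = ℕₚ.≰⇒> λ b≤a → ℕₚ.<⇒≱ hyp (≤-trans (*-mono-≤ (energy-power-bound p≤ ≤p²) (pw 30 b≤a)) (≤-reflexive (ℕₚ.*-comm M (a ^ 30))))
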